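{- Let $g$ be a positive integer. Then $\alpha_g(n)=(1+o_g(1))\sqrt{gn}$, i.e. $\lim_{n\to\infty}\frac{\alpha_g(n)}{\sqrt{gn}}=1$.
   Context: For a positive integer $n$ write $[n]=\{1,\dots,n\}$. For a set $A$ of integers and an integer $d$, let $r_{A-A}(d)=|\{(a,a')\in A\times A: d=a-a'\}|$. Define $\alpha_g(n)$ to be the largest cardinality of a set $A\subseteq[n]$ such that $r_{A-A}(x)\le g$ for every nonzero integer $x$. The notation $o_g(1)$ denotes a quantity tending to $0$ as $n\to\infty$, with rate possibly depending on $g$. -}

module Defs where

open import Data.Nat using (ℕ; _≤_; _*_)
open import Data.Integer as ℤ using (ℤ; +_; _-_)
open import Data.List using (List; length; filter; cartesianProduct)
open import Data.List.Relation.Unary.All using (All)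
open import Data.List.Relation.Unary.Unique.Propositional using (Unique)
open import Data.Product using (_×_; _,_; proj₁; proj₂; Σ)
open import Relation.Binary.PropositionalEquality using (_≡_)
open import Relation.Nullary using (¬_)

-- A finite set of integers is represented as a duplicate-free list of naturals
-- (all elements of [n] are positive naturals).

_⊆[_] : List ℕ → ℕ → Set
A ⊆[ n ] = All (λ a → 1 ≤ a × a ≤ n) A

r : List ℕ → ℤ → ℕ
r A d = length (filter (λ p → d ℤ.≟ ((+ proj₁ p) - (+ proj₂ p))) (cartesianProduct A A))

Admissible : ℕ → ℕ → List ℕ → Set
Admissible g n A = Unique A × A ⊆[ n ] × (∀ (x : ℤ) → ¬ (x ≡ + 0) → r A x ≤ g)

IsAlpha : ℕ → ℕ → ℕ → Set
IsAlpha g n m =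
  Σ (List ℕ) (λ A → Admissible g n A × length A ≡ m)
  × (∀ A → Admissible g n A → length A ≤ m)

{-# OPTIONS --safe #-}
module Submission where

-- Upper bound (Erdős–Turán): if A ⊆ [n] has m elements, comparing the first and second moments of the number of
-- elements of A in a window of length u gives m² u ≤ (n + u)(m + g u); take u to be a small multiple of n.
--
-- Lower bound (Ruzsa): for a prime p = 1 + g v with primitive root γ, the p − 1 residues z mod p v with z ≡ γ^i (mod p)
-- and z ≡ i (mod v) represent every nonzero difference at most g times, because i − j is only determined up to one of
-- the g residues mod p − 1 lying over a given residue mod v.  This set has size about √(g · p v).
--
-- It remains to find primes p ≡ 1 (mod g) in (q h, (q + 1) h] for every q and every large h.  Selberg's symmetry
-- formula for the residue classes shows, following Erdős, that if one class has almost no primes in such a window, then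
-- on some long lower range every class is either empty or has density twice the expected one, uniformly in short cells.
-- Half of the classes are then empty.  Applying this again to a window in that range, in which all the classes of B are
-- empty, forces B to be a coset of a subgroup of index two, i.e. of the kernel of a real character χ, and χ to be
-- constant on the dense classes; this contradicts Σ χ(k) Λ(k) / k = O(1), which follows from L(1, χ) ≠ 0.
--
-- Logarithms are replaced by rational-valued completely additive functions that approximate log on [1, X] with errors
-- independent of X.

-- The contradiction argument asks for less than the prime number theorem: a single window without
-- primes has to be refuted, so neither asymptotics nor complex analysis is needed. The only
-- character it can produce belongs to a subgroup of index two; hence nonvanishing at 1 matters for
-- real χ alone, where nonnegativity of the divisor sums of χ suffices. The argument runs twice
-- because full classes are only known to be closed under quotients of sparse ones, which is no
-- information while 1 is the only sparse class; the first run serves to make half of the classes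
-- sparse. How sparse they must be depends on the second run, so the constants are fixed backwards,
-- those of the second run first. An approximate logarithm exists only after `X` is fixed, so the
-- analytic part is parameterised by `X` and `L`, and no threshold may depend on them; `X` is chosen
-- last, when the window is already given.

open import Data.Empty using (⊥; ⊥-elim)
open import Data.List using (length)
open import Data.Nat as ℕ using (ℕ; zero; suc; z≤n; s≤s; NonZero)
import Data.Nat.Properties as ℕ
open import Data.Nat.Primality using (Prime)
open import Data.Product using (_×_; _,_; proj₁; proj₂; Σ)
open import Data.Sum using (_⊎_; inj₁; inj₂)
open import Relation.Binary.PropositionalEquality hiding (J)
open import Relation.Nullary using (yes; no; ¬_; Dec; contradiction)

-- Rational arithmetic, a ring normaliser and two-sided bounds.

module Field where
  open import Data.Bool using (Bool; true; false; T; _∧_; if_then_else_)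
  open import Data.Bool.Properties using (T-∧)
  open import Data.Fin using (Fin; zero; suc; toℕ)
  import Data.Fin.Properties as Fin
  open import Data.Integer as ℤ using (ℤ; +_; -[1+_])
  import Data.Integer.Properties as ℤ
  open import Data.List using (List; []; _∷_)
  import Data.List.Properties as List
  open import Data.Nat.Coprimality using (1-coprimeTo) renaming (sym to coprime-sym)
  open import Data.Rational as ℚ using (ℚ; mkℚ) public
  import Data.Rational.Properties as ℚ
  open import Data.Vec using (Vec; []; _∷_; lookup)
  open import Data.Vec.N-ary using (N-ary)
  open import Function using (Equivalence)

  open ≡-Reasoning

  infixl 6 _+_ _-_
  infixl 7 _*_
  infix 8 -_
  infix 4 _≤_ _≤?_

  -- The operations are abstract so that unification never unfolds them.
  abstract
    _+_ _*_ _-_ : ℚ → ℚ → ℚ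
    _+_ = ℚ._+_
    _*_ = ℚ._*_
    _-_ = ℚ._-_

    -_ : ℚ → ℚ
    -_ = ℚ.-_

    _≤_ : ℚ → ℚ → Set
    _≤_ = ℚ._≤_

    ιᶻ : ℤ → ℚ
    ιᶻ z = mkℚ z 0 (coprime-sym (1-coprimeTo _))

    ι : ℕ → ℚ
    ι n = ιᶻ (+ n)

    -- inv 0 = 0
    inv : ℕ → ℚ
    inv zero = ι 0
    inv (suc n) = ℚ.1/ (ι (suc n))

    +-assoc : ∀ a b c → a + b + c ≡ a + (b + c)
    +-assoc = ℚ.+-assoc

    +-comm : ∀ a b → a + b ≡ b + a
    +-comm = ℚ.+-comm

    +-identityˡ : ∀ a → ι 0 + a ≡ a
    +-identityˡ = ℚ.+-identityˡ

    +-identityʳ : ∀ a → a + ι 0 ≡ a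
    +-identityʳ = ℚ.+-identityʳ

    +-inverseˡ : ∀ a → - a + a ≡ ι 0
    +-inverseˡ = ℚ.+-inverseˡ

    *-assoc : ∀ a b c → a * b * c ≡ a * (b * c)
    *-assoc = ℚ.*-assoc

    *-comm : ∀ a b → a * b ≡ b * a
    *-comm = ℚ.*-comm

    *-identityˡ : ∀ a → ι 1 * a ≡ a
    *-identityˡ = ℚ.*-identityˡ

    *-identityʳ : ∀ a → a * ι 1 ≡ a
    *-identityʳ = ℚ.*-identityʳ

    *-zeroˡ : ∀ a → ι 0 * a ≡ ι 0
    *-zeroˡ = ℚ.*-zeroˡ

    *-zeroʳ : ∀ a → a * ι 0 ≡ ι 0
    *-zeroʳ = ℚ.*-zeroʳ

    *-distribˡ-+ : ∀ a b c → a * (b + c) ≡ a * b + a * c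
    *-distribˡ-+ = ℚ.*-distribˡ-+

    *-distribʳ-+ : ∀ a b c → (b + c) * a ≡ b * a + c * a
    *-distribʳ-+ = ℚ.*-distribʳ-+

    neg-distribˡ-* : ∀ a b → - (a * b) ≡ - a * b
    neg-distribˡ-* = ℚ.neg-distribˡ-*

    neg-distrib-+ : ∀ a b → - (a + b) ≡ - a + - b
    neg-distrib-+ = ℚ.neg-distrib-+

    neg-zero : - ι 0 ≡ ι 0
    neg-zero = refl

    minus-def : ∀ a b → a - b ≡ a + - b
    minus-def a b = refl

    ιᶻ-+ : ∀ m n → ιᶻ (m ℤ.+ n) ≡ ιᶻ m + ιᶻ n
    ιᶻ-+ m n = sym (trans (cong (ℚ._/ 1) (cong₂ ℤ._+_ (ℤ.*-identityʳ m) (ℤ.*-identityʳ n))) (ℚ.↥p/↧p≡p (ιᶻ (m ℤ.+ n))))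

    ιᶻ-* : ∀ m n → ιᶻ (m ℤ.* n) ≡ ιᶻ m * ιᶻ n
    ιᶻ-* m n = sym (ℚ.↥p/↧p≡p (ιᶻ (m ℤ.* n)))

    ιᶻ-neg : ∀ m → ιᶻ (ℤ.- m) ≡ - ιᶻ m
    ιᶻ-neg (+ zero) = refl
    ιᶻ-neg (+ suc n) = refl
    ιᶻ-neg -[1+ n ] = refl

    ι-ιᶻ : ∀ n → ι n ≡ ιᶻ (+ n)
    ι-ιᶻ n = refl

    ι-+ : ∀ m n → ι (m ℕ.+ n) ≡ ι m + ι n
    ι-+ m n = ιᶻ-+ (+ m) (+ n)

    ι-* : ∀ m n → ι (m ℕ.* n) ≡ ι m * ι n
    ι-* m n = trans (cong ιᶻ (ℤ.pos-* m n)) (ιᶻ-* (+ m) (+ n))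

    ι-mono : ∀ {m n} → m ℕ.≤ n → ι m ≤ ι n
    ι-mono m≤n = ℚ.*≤* (ℤ.*-monoʳ-≤-nonNeg (+ 1) (ℤ.+≤+ m≤n))

    ι-cancel : ∀ {m n} → ι m ≤ ι n → m ℕ.≤ n
    ι-cancel (ℚ.*≤* p) = ℤ.drop‿+≤+ (ℤ.*-cancelʳ-≤-pos _ _ (+ 1) p)

    ι*inv : ∀ n → ι (suc n) * inv (suc n) ≡ ι 1
    ι*inv n = ℚ.*-inverseʳ (ι (suc n))

    inv0 : inv 0 ≡ ι 0
    inv0 = refl

    ≤-refl : ∀ {a} → a ≤ a
    ≤-refl = ℚ.≤-refl

    ≤-reflexive : ∀ {a b} → a ≡ b → a ≤ b
    ≤-reflexive = ℚ.≤-reflexive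

    ≤-trans : ∀ {a b c} → a ≤ b → b ≤ c → a ≤ c
    ≤-trans = ℚ.≤-trans

    ≤-antisym : ∀ {a b} → a ≤ b → b ≤ a → a ≡ b
    ≤-antisym = ℚ.≤-antisym

    ≤-total : ∀ a b → a ≤ b ⊎ b ≤ a
    ≤-total = ℚ.≤-total

    _≤?_ : ∀ a b → Dec (a ≤ b)
    _≤?_ = ℚ._≤?_

    infixr 5 _⊞_
    _⊞_ : ∀ {a b c d} → a ≤ b → c ≤ d → a + c ≤ b + d
    _⊞_ = ℚ.+-mono-≤

    infixr 6 _⊛_
    _⊛_ : ∀ {k a b} → ι 0 ≤ k → a ≤ b → k * a ≤ k * b
    _⊛_ {k} p q = ℚ.*-monoˡ-≤-nonNeg k {{ℚ.nonNegative p}} q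

    inv≥0 : ∀ n → ι 0 ≤ inv n
    inv≥0 zero = ≤-refl
    inv≥0 (suc n) = ℚ.<⇒≤ (ℚ.positive⁻¹ (inv (suc n)))

  ≰⇒≥ : ∀ {a b} → ¬ (a ≤ b) → b ≤ a
  ≰⇒≥ {a} {b} h with ≤-total a b
  ... | inj₁ p = ⊥-elim (h p)
  ... | inj₂ p = p

  ι≥0 : ∀ n → ι 0 ≤ ι n
  ι≥0 n = ι-mono ℕ.z≤n

  data Expr (n : ℕ) : Set where
    var : Fin n → Expr n
    con : ℕ → Expr n
    _:+_ _:*_ _:-_ : Expr n → Expr n → Expr n
    :-_ : Expr n → Expr n

  infixl 6 _:+_ _:-_
  infixl 7 _:*_
  infix 8 :-_
  infix 4 _:=_

  data Equation (n : ℕ) : Set where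
    _:=_ : Expr n → Expr n → Equation n

  ⟦_⟧ : ∀ {n} → Expr n → Vec ℚ n → ℚ
  ⟦ var i ⟧ ρ = lookup ρ i
  ⟦ con c ⟧ ρ = ι c
  ⟦ a :+ b ⟧ ρ = ⟦ a ⟧ ρ + ⟦ b ⟧ ρ
  ⟦ a :* b ⟧ ρ = ⟦ a ⟧ ρ * ⟦ b ⟧ ρ
  ⟦ a :- b ⟧ ρ = ⟦ a ⟧ ρ - ⟦ b ⟧ ρ
  ⟦ :- a ⟧ ρ = - ⟦ a ⟧ ρ

  module Normaliser (n : ℕ) where
    Mono Poly : Set
    Mono = List (Fin n)
    Poly = List (ℤ × Mono)

    insertVar : Fin n → Mono → Mono
    insertVar i [] = i ∷ []
    insertVar i (j ∷ m) = if toℕ i ℕ.≤ᵇ toℕ j then i ∷ j ∷ m else j ∷ insertVar i m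

    mulMono : Mono → Mono → Mono
    mulMono [] m′ = m′
    mulMono (i ∷ m) m′ = insertVar i (mulMono m m′)

    addTerm : ℤ × Mono → Poly → Poly
    addTerm t [] = t ∷ []
    addTerm (c , m) ((d , m′) ∷ p) with List.≡-dec Fin._≟_ m m′
    ... | yes _ = (c ℤ.+ d , m′) ∷ p
    ... | no _ = (d , m′) ∷ addTerm (c , m) p

    add : Poly → Poly → Poly
    add [] q = q
    add (t ∷ p) q = addTerm t (add p q)

    mulTerm : ℤ × Mono → Poly → Poly
    mulTerm t [] = []
    mulTerm (c , m) ((d , m′) ∷ p) = addTerm (c ℤ.* d , mulMono m m′) (mulTerm (c , m) p)

    mul : Poly → Poly → Poly
    mul [] q = []
    mul (t ∷ p) q = add (mulTerm t q) (mul p q)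

    neg : Poly → Poly
    neg [] = []
    neg ((c , m) ∷ p) = (ℤ.- c , m) ∷ neg p

    norm : Expr n → Poly
    norm (var i) = (+ 1 , i ∷ []) ∷ []
    norm (con c) = (+ c , []) ∷ []
    norm (a :+ b) = add (norm a) (norm b)
    norm (a :* b) = mul (norm a) (norm b)
    norm (a :- b) = add (norm a) (neg (norm b))
    norm (:- a) = neg (norm a)

    isZeroℤ : ℤ → Bool
    isZeroℤ (+ zero) = true
    isZeroℤ _ = false

    isZero : Poly → Bool
    isZero [] = true
    isZero ((c , m) ∷ p) = isZeroℤ c ∧ isZero p

    -- Terms are not sorted and coefficients that cancel stay in the list as zeros, so normal forms
    -- cannot be compared directly; instead all coefficients of the difference of the two sides are
    -- tested for zero.
    valid : Equation n → Bool
    valid (a := b) = isZero (norm (a :- b))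

    module _ (ρ : Vec ℚ n) where
      evalM : Mono → ℚ
      evalM [] = ι 1
      evalM (i ∷ m) = lookup ρ i * evalM m

      eval : Poly → ℚ
      eval [] = ι 0
      eval ((c , m) ∷ p) = ιᶻ c * evalM m + eval p

      insertVar-eval : ∀ i m → evalM (insertVar i m) ≡ lookup ρ i * evalM m
      insertVar-eval i [] = refl
      insertVar-eval i (j ∷ m) with toℕ i ℕ.≤ᵇ toℕ j
      ... | true = refl
      ... | false = begin
        lookup ρ j * evalM (insertVar i m)       ≡⟨ cong (lookup ρ j *_) (insertVar-eval i m) ⟩
        lookup ρ j * (lookup ρ i * evalM m)      ≡⟨ *-assoc (lookup ρ j) _ _ ⟨
        lookup ρ j * lookup ρ i * evalM m        ≡⟨ cong (_* evalM m) (*-comm (lookup ρ j) _) ⟩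
        lookup ρ i * lookup ρ j * evalM m        ≡⟨ *-assoc (lookup ρ i) _ _ ⟩
        lookup ρ i * (lookup ρ j * evalM m)      ∎

      mulMono-eval : ∀ m m′ → evalM (mulMono m m′) ≡ evalM m * evalM m′
      mulMono-eval [] m′ = sym (*-identityˡ _)
      mulMono-eval (i ∷ m) m′ = begin
        evalM (insertVar i (mulMono m m′))       ≡⟨ insertVar-eval i (mulMono m m′) ⟩
        lookup ρ i * evalM (mulMono m m′)        ≡⟨ cong (lookup ρ i *_) (mulMono-eval m m′) ⟩
        lookup ρ i * (evalM m * evalM m′)        ≡⟨ *-assoc (lookup ρ i) _ _ ⟨
        lookup ρ i * evalM m * evalM m′          ∎

      addTerm-eval : ∀ c m p → eval (addTerm (c , m) p) ≡ ιᶻ c * evalM m + eval p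
      addTerm-eval c m [] = refl
      addTerm-eval c m ((d , m′) ∷ p) with List.≡-dec Fin._≟_ m m′
      ... | yes refl = begin
        ιᶻ (c ℤ.+ d) * evalM m + eval p              ≡⟨ cong (λ z → z * evalM m + eval p) (ιᶻ-+ c d) ⟩
        (ιᶻ c + ιᶻ d) * evalM m + eval p             ≡⟨ cong (_+ eval p) (*-distribʳ-+ (evalM m) (ιᶻ c) (ιᶻ d)) ⟩
        ιᶻ c * evalM m + ιᶻ d * evalM m + eval p     ≡⟨ +-assoc (ιᶻ c * evalM m) _ _ ⟩
        ιᶻ c * evalM m + (ιᶻ d * evalM m + eval p)   ∎
      ... | no _ = begin
        ιᶻ d * evalM m′ + eval (addTerm (c , m) p)      ≡⟨ cong (λ z → ιᶻ d * evalM m′ + z) (addTerm-eval c m p) ⟩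
        ιᶻ d * evalM m′ + (ιᶻ c * evalM m + eval p)     ≡⟨ +-assoc (ιᶻ d * evalM m′) _ _ ⟨
        ιᶻ d * evalM m′ + ιᶻ c * evalM m + eval p       ≡⟨ cong (_+ eval p) (+-comm (ιᶻ d * evalM m′) _) ⟩
        ιᶻ c * evalM m + ιᶻ d * evalM m′ + eval p       ≡⟨ +-assoc (ιᶻ c * evalM m) _ _ ⟩
        ιᶻ c * evalM m + (ιᶻ d * evalM m′ + eval p)     ∎

      add-eval : ∀ p q → eval (add p q) ≡ eval p + eval q
      add-eval [] q = sym (+-identityˡ _)
      add-eval ((c , m) ∷ p) q = begin
        eval (addTerm (c , m) (add p q))          ≡⟨ addTerm-eval c m (add p q) ⟩
        ιᶻ c * evalM m + eval (add p q)           ≡⟨ cong (λ z → ιᶻ c * evalM m + z) (add-eval p q) ⟩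
        ιᶻ c * evalM m + (eval p + eval q)        ≡⟨ +-assoc (ιᶻ c * evalM m) _ _ ⟨
        ιᶻ c * evalM m + eval p + eval q          ∎

      interchange : ∀ a b c d → (a * b) * (c * d) ≡ (a * c) * (b * d)
      interchange a b c d = begin
        (a * b) * (c * d)   ≡⟨ *-assoc a b (c * d) ⟩
        a * (b * (c * d))   ≡⟨ cong (a *_) (*-assoc b c d) ⟨
        a * (b * c * d)     ≡⟨ cong (λ z → a * (z * d)) (*-comm b c) ⟩
        a * (c * b * d)     ≡⟨ cong (a *_) (*-assoc c b d) ⟩
        a * (c * (b * d))   ≡⟨ *-assoc a c (b * d) ⟨
        (a * c) * (b * d)   ∎

      mulTerm-eval : ∀ c m p → eval (mulTerm (c , m) p) ≡ ιᶻ c * evalM m * eval p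
      mulTerm-eval c m [] = sym (*-zeroʳ (ιᶻ c * evalM m))
      mulTerm-eval c m ((d , m′) ∷ p) = begin
        eval (addTerm (c ℤ.* d , mulMono m m′) (mulTerm (c , m) p))
          ≡⟨ addTerm-eval (c ℤ.* d) (mulMono m m′) (mulTerm (c , m) p) ⟩
        ιᶻ (c ℤ.* d) * evalM (mulMono m m′) + eval (mulTerm (c , m) p)
          ≡⟨ cong₂ _+_ (cong₂ _*_ (ιᶻ-* c d) (mulMono-eval m m′)) (mulTerm-eval c m p) ⟩
        (ιᶻ c * ιᶻ d) * (evalM m * evalM m′) + ιᶻ c * evalM m * eval p
          ≡⟨ cong (λ z → z + ιᶻ c * evalM m * eval p) (interchange (ιᶻ c) (ιᶻ d) (evalM m) (evalM m′)) ⟩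
        (ιᶻ c * evalM m) * (ιᶻ d * evalM m′) + ιᶻ c * evalM m * eval p
          ≡⟨ *-distribˡ-+ (ιᶻ c * evalM m) (ιᶻ d * evalM m′) (eval p) ⟨
        ιᶻ c * evalM m * (ιᶻ d * evalM m′ + eval p) ∎

      mul-eval : ∀ p q → eval (mul p q) ≡ eval p * eval q
      mul-eval [] q = sym (*-zeroˡ (eval q))
      mul-eval ((c , m) ∷ p) q = begin
        eval (add (mulTerm (c , m) q) (mul p q))        ≡⟨ add-eval (mulTerm (c , m) q) (mul p q) ⟩
        eval (mulTerm (c , m) q) + eval (mul p q)       ≡⟨ cong₂ _+_ (mulTerm-eval c m q) (mul-eval p q) ⟩
        ιᶻ c * evalM m * eval q + eval p * eval q       ≡⟨ *-distribʳ-+ (eval q) (ιᶻ c * evalM m) (eval p) ⟨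
        (ιᶻ c * evalM m + eval p) * eval q              ∎

      neg-eval : ∀ p → eval (neg p) ≡ - eval p
      neg-eval [] = sym neg-zero
      neg-eval ((c , m) ∷ p) = begin
        ιᶻ (ℤ.- c) * evalM m + eval (neg p)    ≡⟨ cong₂ _+_ (cong (_* evalM m) (ιᶻ-neg c)) (neg-eval p) ⟩
        - ιᶻ c * evalM m + - eval p            ≡⟨ cong (_+ - eval p) (neg-distribˡ-* (ιᶻ c) (evalM m)) ⟨
        - (ιᶻ c * evalM m) + - eval p          ≡⟨ neg-distrib-+ (ιᶻ c * evalM m) (eval p) ⟨
        - (ιᶻ c * evalM m + eval p)            ∎

      norm-eval : ∀ e → eval (norm e) ≡ ⟦ e ⟧ ρ
      norm-eval (var i) = begin
        ιᶻ (+ 1) * (lookup ρ i * ι 1) + ι 0   ≡⟨ +-identityʳ _ ⟩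
        ιᶻ (+ 1) * (lookup ρ i * ι 1)          ≡⟨ cong (λ z → z * (lookup ρ i * ι 1)) (ι-ιᶻ 1) ⟨
        ι 1 * (lookup ρ i * ι 1)               ≡⟨ *-identityˡ _ ⟩
        lookup ρ i * ι 1                       ≡⟨ *-identityʳ _ ⟩
        lookup ρ i                              ∎
      norm-eval (con c) = begin
        ιᶻ (+ c) * ι 1 + ι 0   ≡⟨ +-identityʳ _ ⟩
        ιᶻ (+ c) * ι 1          ≡⟨ *-identityʳ _ ⟩
        ιᶻ (+ c)                 ≡⟨ ι-ιᶻ c ⟨
        ι c                      ∎
      norm-eval (a :+ b) = trans (add-eval (norm a) (norm b)) (cong₂ _+_ (norm-eval a) (norm-eval b))
      norm-eval (a :* b) = trans (mul-eval (norm a) (norm b)) (cong₂ _*_ (norm-eval a) (norm-eval b))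
      norm-eval (a :- b) = trans (add-eval (norm a) (neg (norm b)))
        (trans (cong₂ _+_ (norm-eval a) (trans (neg-eval (norm b)) (cong -_ (norm-eval b)))) (sym (minus-def (⟦ a ⟧ ρ) (⟦ b ⟧ ρ))))
      norm-eval (:- a) = trans (neg-eval (norm a)) (cong -_ (norm-eval a))

      isZeroℤ-sound : ∀ c → T (isZeroℤ c) → c ≡ + 0
      isZeroℤ-sound (+ zero) _ = refl

      isZero-sound : ∀ p → T (isZero p) → eval p ≡ ι 0
      isZero-sound [] _ = refl
      isZero-sound ((c , m) ∷ p) h with Equivalence.to T-∧ h
      ... | hc , hp rewrite isZeroℤ-sound c hc = begin
        ιᶻ (+ 0) * evalM m + eval p   ≡⟨ cong (_+ eval p) (trans (cong (_* evalM m) (sym (ι-ιᶻ 0))) (*-zeroˡ (evalM m))) ⟩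
        ι 0 + eval p                 ≡⟨ +-identityˡ (eval p) ⟩
        eval p                        ≡⟨ isZero-sound p hp ⟩
        ι 0                          ∎

      Holds : Equation n → Set
      Holds (a := b) = ⟦ a ⟧ ρ ≡ ⟦ b ⟧ ρ

      sound : ∀ e → T (valid e) → Holds e
      sound (a := b) h = begin
        ⟦ a ⟧ ρ                       ≡⟨ +-identityʳ _ ⟨
        ⟦ a ⟧ ρ + ι 0                ≡⟨ cong (λ z → ⟦ a ⟧ ρ + z) (+-inverseˡ (⟦ b ⟧ ρ)) ⟨
        ⟦ a ⟧ ρ + (- ⟦ b ⟧ ρ + ⟦ b ⟧ ρ) ≡⟨ +-assoc (⟦ a ⟧ ρ) _ _ ⟨
        ⟦ a ⟧ ρ + - ⟦ b ⟧ ρ + ⟦ b ⟧ ρ ≡⟨ cong (_+ ⟦ b ⟧ ρ) (minus-def (⟦ a ⟧ ρ) (⟦ b ⟧ ρ)) ⟨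
        ⟦ a ⟧ ρ - ⟦ b ⟧ ρ + ⟦ b ⟧ ρ   ≡⟨ cong (_+ ⟦ b ⟧ ρ) (trans (sym (norm-eval (a :- b))) (isZero-sound (norm (a :- b)) h)) ⟩
        ι 0 + ⟦ b ⟧ ρ                ≡⟨ +-identityˡ _ ⟩
        ⟦ b ⟧ ρ                       ∎

  -- The variables are implicit, so that an identity is used without naming them and unification
  -- with the goal supplies their values.
  Πʰ : ∀ n → (Vec ℚ n → Set) → Set
  Πʰ zero P = P []
  Πʰ (suc n) P = {x : ℚ} → Πʰ n (λ xs → P (x ∷ xs))

  introʰ : ∀ n {P : Vec ℚ n → Set} → (∀ ρ → P ρ) → Πʰ n P
  introʰ zero f = f []
  introʰ (suc n) f {x} = introʰ n (λ xs → f (x ∷ xs))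

  applyVars : ∀ {A B : Set} {n} → Vec A n → N-ary n A B → B
  applyVars [] f = f
  applyVars (x ∷ xs) f = applyVars xs (f x)

  vars : ∀ {n m} → (Fin n → Fin m) → Vec (Expr m) n
  vars {zero} f = []
  vars {suc n} f = var (f zero) ∷ vars (λ i → f (suc i))

  ring : ∀ n (f : N-ary n (Expr n) (Equation n)) {_ : T (Normaliser.valid n (applyVars (vars {n} (λ i → i)) f))} →
         Πʰ n (λ ρ → Normaliser.Holds n ρ (applyVars (vars {n} (λ i → i)) f))
  ring n f {h} = introʰ n (λ ρ → Normaliser.sound n ρ (applyVars (vars (λ i → i)) f) h)

  -- Inequalities are proved by exhibiting a combination of known ones and letting the normaliser check that the two differ by a ring identity.
  lin : ∀ {a b c d} → c ≤ d → b + c ≡ a + d → a ≤ b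
  lin {a} {b} {c} {d} p eq = subst₂ _≤_ (e a c) (e b c) (≤-trans (≤-refl {a} ⊞ p) (≤-reflexive (sym eq)) ⊞ ≤-refl { - c})
    where
    e : ∀ x y → x + y + - y ≡ x
    e x y = ring 2 (λ x y → x :+ y :+ :- y := x)

  *≥0 : ∀ {a b} → ι 0 ≤ a → ι 0 ≤ b → ι 0 ≤ a * b
  *≥0 p q = lin (p ⊛ q) (ring 2 λ a b → a :* b :+ a :* con 0 := con 0 :+ a :* b)

  +≥0 : ∀ {a b} → ι 0 ≤ a → ι 0 ≤ b → ι 0 ≤ a + b
  +≥0 p q = lin (p ⊞ q) (ring 2 λ a b → a :+ b :+ (con 0 :+ con 0) := con 0 :+ (a :+ b))

  *-mono : ∀ {a b c d} → ι 0 ≤ a → ι 0 ≤ d → a ≤ b → c ≤ d → a * c ≤ b * d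
  *-mono pa pd p q = lin (pa ⊛ q ⊞ pd ⊛ p) (ring 4 λ a b c d → b :* d :+ (a :* c :+ d :* a) := a :* c :+ (a :* d :+ d :* b))

  sq≥0 : ∀ a → ι 0 ≤ a * a
  sq≥0 a with ≤-total (ι 0) a
  ... | inj₁ p = *≥0 p p
  ... | inj₂ p = lin (neg ⊛ neg) (ring 1 λ a → a :* a :+ (:- a) :* con 0 := con 0 :+ (:- a) :* (:- a))
    where
    neg : ι 0 ≤ - a
    neg = lin p (ring 1 λ a → :- a :+ a := con 0 :+ con 0)

  ι-suc : ∀ n → ι (suc n) ≡ ι n + ι 1
  ι-suc n = trans (ι-+ 1 n) (+-comm (ι 1) (ι n))

  0≤1 : ι 0 ≤ ι 1
  0≤1 = ι≥0 1

  sub≥0 : ∀ {a b} → a ≤ b → ι 0 ≤ b - a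
  sub≥0 p = lin p (ring 2 λ a b → b :- a :+ a := con 0 :+ b)

  inv*ι : ∀ n .{{_ : ℕ.NonZero n}} → inv n * ι n ≡ ι 1
  inv*ι (suc n) = trans (*-comm _ _) (ι*inv n)

  ι-cancelˡ : ∀ n .{{_ : ℕ.NonZero n}} {a b} → ι n * a ≤ ι n * b → a ≤ b
  ι-cancelˡ n {a} {b} p = subst₂ _≤_ (e a) (e b) (inv≥0 n ⊛ p)
    where
    e : ∀ x → inv n * (ι n * x) ≡ x
    e x = trans (sym (*-assoc _ _ _)) (trans (cong (_* x) (inv*ι n)) (*-identityˡ x))

  inv-anti : ∀ {m n} .{{_ : ℕ.NonZero m}} → m ℕ.≤ n → inv n ≤ inv m
  inv-anti {m} {n@(suc _)} p = ι-cancelˡ m (ι-cancelˡ n (subst₂ _≤_ l r (ι-mono p)))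
    where
    l : ι m ≡ ι n * (ι m * inv n)
    l = trans (sym (*-identityʳ _)) (trans (cong (ι m *_) (sym (inv*ι n))) (ring 3 λ m i n → m :* (i :* n) := n :* (m :* i)))
    r : ι n ≡ ι n * (ι m * inv m)
    r = trans (sym (*-identityʳ _)) (cong (ι n *_) (trans (sym (inv*ι m)) (*-comm _ _)))
  inv-anti {suc m} {zero} ()

  inv-* : ∀ m n → inv (m ℕ.* n) ≡ inv m * inv n
  inv-* zero n = trans inv0 (trans (sym (*-zeroˡ (inv n))) (cong (_* inv n) (sym inv0)))
  inv-* (suc m) zero = trans (cong inv (ℕ.*-zeroʳ m)) (trans inv0 (trans (sym (*-zeroʳ (inv (suc m)))) (cong (inv (suc m) *_) (sym inv0))))
  inv-* m@(suc _) n@(suc _) = begin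
    inv (m ℕ.* n)                                          ≡⟨ *-identityʳ _ ⟨
    inv (m ℕ.* n) * ι 1                                    ≡⟨ cong (inv (m ℕ.* n) *_) (trans (cong₂ _*_ (inv*ι m) (inv*ι n)) (*-identityʳ _)) ⟨
    inv (m ℕ.* n) * (inv m * ι m * (inv n * ι n))          ≡⟨ ring 5 (λ k a m b n → k :* (a :* m :* (b :* n)) := k :* (m :* n) :* (a :* b)) ⟩
    inv (m ℕ.* n) * (ι m * ι n) * (inv m * inv n)          ≡⟨ cong (λ z → inv (m ℕ.* n) * z * (inv m * inv n)) (ι-* m n) ⟨
    inv (m ℕ.* n) * ι (m ℕ.* n) * (inv m * inv n)          ≡⟨ cong (_* (inv m * inv n)) (inv*ι (m ℕ.* n)) ⟩
    ι 1 * (inv m * inv n)                                  ≡⟨ *-identityˡ _ ⟩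
    inv m * inv n                                          ∎

  inv1 : inv 1 ≡ ι 1
  inv1 = trans (sym (*-identityʳ _)) (inv*ι 1)

  inv≤1 : ∀ n → inv n ≤ ι 1
  inv≤1 zero = subst (_≤ ι 1) (sym inv0) 0≤1
  inv≤1 (suc n) = subst (inv (suc n) ≤_) inv1 (inv-anti (ℕ.s≤s ℕ.z≤n))

  1≰0 : ¬ (ι 1 ≤ ι 0)
  1≰0 h with ι-cancel h
  ... | ()

  -- Stands for |x| ≤ e. Every error term of the analytic part is carried in this form with an
  -- explicit bound, which keeps the estimates uniform in `X`.
  Bd : ℚ → ℚ → Set
  Bd x e = (- e ≤ x) × (x ≤ e)

  Bd-≡ : ∀ {x y e} → x ≡ y → Bd x e → Bd y e
  Bd-≡ refl b = b

  Bd-≤ : ∀ {x e f} → e ≤ f → Bd x e → Bd x f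
  Bd-≤ {e = e} {f} p (l , u) = ≤-trans (lin p (ring 2 λ e f → :- e :+ e := :- f :+ f)) l , ≤-trans u p

  Bd-+ : ∀ {x y e f} → Bd x e → Bd y f → Bd (x + y) (e + f)
  Bd-+ (l , u) (l′ , u′) = lin (l ⊞ l′) (ring 4 λ x y e f → x :+ y :+ (:- e :+ :- f) := :- (e :+ f) :+ (x :+ y)) , u ⊞ u′

  Bd-neg : ∀ {x e} → Bd x e → Bd (- x) e
  Bd-neg (l , u) = lin u (ring 2 λ x e → :- x :+ x := :- e :+ e) , lin l (ring 2 λ x e → e :+ :- e := :- x :+ x)

  Bd-- : ∀ {x y e f} → Bd x e → Bd y f → Bd (x - y) (e + f)
  Bd-- {x} {y} b b′ = Bd-≡ (sym (minus-def x y)) (Bd-+ b (Bd-neg b′))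

  Bd-*ˡ : ∀ {k x e} → ι 0 ≤ k → Bd x e → Bd (k * x) (k * e)
  Bd-*ˡ p (l , u) = lin (p ⊛ l) (ring 3 λ k x e → k :* x :+ k :* :- e := :- (k :* e) :+ k :* x) , p ⊛ u

  Bd≥0 : ∀ {x e} → Bd x e → ι 0 ≤ e
  Bd≥0 (l , u) = ι-cancelˡ 2 (lin (≤-trans l u) (ring 1 λ e → con 2 :* e :+ :- e := con 2 :* con 0 :+ e))

  -- Half the sum of (e - x)(f - y) ≥ 0 and (x + e)(y + f) ≥ 0 is the lower bound; the mixed
  -- products give the upper one.
  Bd-* : ∀ {x y e f} → Bd x e → Bd y f → Bd (x * y) (e * f)
  Bd-* (l , u) (l′ , u′) =
      ι-cancelˡ 2 (lin (*≥0 (sub≥0 u) (sub≥0 u′) ⊞ *≥0 (sub≥0 l) (sub≥0 l′))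
        (ring 4 λ x y e f → con 2 :* (x :* y) :+ (con 0 :+ con 0) := con 2 :* :- (e :* f) :+ ((e :- x) :* (f :- y) :+ (x :- :- e) :* (y :- :- f))))
    , ι-cancelˡ 2 (lin (*≥0 (sub≥0 u) (sub≥0 l′) ⊞ *≥0 (sub≥0 l) (sub≥0 u′))
        (ring 4 λ x y e f → con 2 :* (e :* f) :+ (con 0 :+ con 0) := con 2 :* (x :* y) :+ ((e :- x) :* (y :- :- f) :+ (x :- :- e) :* (f :- y))))

  Bd-self : ∀ {x} → ι 0 ≤ x → Bd x x
  Bd-self p = lin (p ⊞ p) (ring 1 λ x → x :+ (con 0 :+ con 0) := :- x :+ (x :+ x)) , ≤-refl

  Bd-0 : ∀ {e} → ι 0 ≤ e → Bd (ι 0) e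
  Bd-0 p = lin p (ring 1 λ e → con 0 :+ con 0 := :- e :+ e) , p

  Bd-cancel : ∀ n .{{_ : ℕ.NonZero n}} {x e} → Bd (ι n * x) (ι n * e) → Bd x e
  Bd-cancel n {x} {e} (l , u) = ι-cancelˡ n (≤-trans (≤-reflexive (ring 2 λ n e → n :* :- e := :- (n :* e))) l) , ι-cancelˡ n u

-- Finite sums, indicators, floor division and partial summation.

module Sums where
  import Data.Nat.DivMod as ℕ
  open import Data.Nat.Divisibility using (_∣?_; divides)
  open import Data.Nat.Induction using (<-rec)
  open import Function using (_∘_)
  open Field

  open ≡-Reasoning

  -- ∑ n f is the sum of f over 1, …, n.
  ∑ : ℕ → (ℕ → ℚ) → ℚ
  ∑ zero f = ι 0
  ∑ (suc n) f = ∑ n f + f (suc n)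

  ∑-cong : ∀ n {f g : ℕ → ℚ} → (∀ i → 1 ℕ.≤ i → i ℕ.≤ n → f i ≡ g i) → ∑ n f ≡ ∑ n g
  ∑-cong zero h = refl
  ∑-cong (suc n) h = cong₂ _+_ (∑-cong n (λ i p q → h i p (ℕ.m≤n⇒m≤1+n q))) (h (suc n) (s≤s z≤n) ℕ.≤-refl)

  ∑-cong′ : ∀ n {f g : ℕ → ℚ} → (∀ i → f i ≡ g i) → ∑ n f ≡ ∑ n g
  ∑-cong′ n h = ∑-cong n (λ i _ _ → h i)

  ∑-mono : ∀ n {f g : ℕ → ℚ} → (∀ i → 1 ℕ.≤ i → i ℕ.≤ n → f i ≤ g i) → ∑ n f ≤ ∑ n g
  ∑-mono zero h = ≤-refl
  ∑-mono (suc n) h = ∑-mono n (λ i p q → h i p (ℕ.m≤n⇒m≤1+n q)) ⊞ h (suc n) (s≤s z≤n) ℕ.≤-refl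

  ∑-0 : ∀ n → ∑ n (λ _ → ι 0) ≡ ι 0
  ∑-0 zero = refl
  ∑-0 (suc n) = trans (cong (_+ ι 0) (∑-0 n)) (+-identityʳ _)

  ∑-zero : ∀ n {f : ℕ → ℚ} → (∀ i → 1 ℕ.≤ i → i ℕ.≤ n → f i ≡ ι 0) → ∑ n f ≡ ι 0
  ∑-zero n h = trans (∑-cong n h) (∑-0 n)

  ∑≥0 : ∀ n {f : ℕ → ℚ} → (∀ i → 1 ℕ.≤ i → i ℕ.≤ n → ι 0 ≤ f i) → ι 0 ≤ ∑ n f
  ∑≥0 n {f} h = subst (_≤ ∑ n f) (∑-0 n) (∑-mono n h)

  ∑-+ : ∀ n (f g : ℕ → ℚ) → ∑ n (λ i → f i + g i) ≡ ∑ n f + ∑ n g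
  ∑-+ zero f g = sym (+-identityʳ _)
  ∑-+ (suc n) f g = trans (cong (_+ (f (suc n) + g (suc n))) (∑-+ n f g)) (ring 4 λ a b c d → a :+ b :+ (c :+ d) := a :+ c :+ (b :+ d))

  ∑-*ˡ : ∀ n k (f : ℕ → ℚ) → ∑ n (λ i → k * f i) ≡ k * ∑ n f
  ∑-*ˡ zero k f = sym (*-zeroʳ k)
  ∑-*ˡ (suc n) k f = trans (cong (_+ k * f (suc n)) (∑-*ˡ n k f)) (ring 3 λ k a b → k :* a :+ k :* b := k :* (a :+ b))

  ∑-*ʳ : ∀ n k (f : ℕ → ℚ) → ∑ n (λ i → f i * k) ≡ ∑ n f * k
  ∑-*ʳ n k f = trans (∑-cong′ n (λ i → *-comm (f i) k)) (trans (∑-*ˡ n k f) (*-comm k _))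

  ∑-neg : ∀ n (f : ℕ → ℚ) → ∑ n (λ i → - f i) ≡ - ∑ n f
  ∑-neg zero f = ring 0 (con 0 := :- con 0)
  ∑-neg (suc n) f = trans (cong (_+ - f (suc n)) (∑-neg n f)) (ring 2 λ a b → :- a :+ :- b := :- (a :+ b))

  ∑-- : ∀ n (f g : ℕ → ℚ) → ∑ n (λ i → f i - g i) ≡ ∑ n f - ∑ n g
  ∑-- zero f g = ring 0 (con 0 := con 0 :- con 0)
  ∑-- (suc n) f g = trans (cong (_+ (f (suc n) - g (suc n))) (∑-- n f g)) (ring 4 λ a b c d → a :- b :+ (c :- d) := a :+ c :- (b :+ d))

  ∑-const : ∀ n k → ∑ n (λ _ → k) ≡ ι n * k
  ∑-const zero k = sym (*-zeroˡ k)
  ∑-const (suc n) k = trans (cong (_+ k) (∑-const n k)) (trans (ring 2 λ n k → n :* k :+ k := (n :+ con 1) :* k) (cong (_* k) (sym (ι-suc n))))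

  ∑-swap : ∀ n m (f : ℕ → ℕ → ℚ) → ∑ n (λ i → ∑ m (f i)) ≡ ∑ m (λ j → ∑ n (λ i → f i j))
  ∑-swap zero m f = sym (∑-0 m)
  ∑-swap (suc n) m f = trans (cong (_+ ∑ m (f (suc n))) (∑-swap n m f)) (sym (∑-+ m _ _))

  ∑-split : ∀ m n (f : ℕ → ℚ) → ∑ (m ℕ.+ n) f ≡ ∑ m f + ∑ n (λ i → f (m ℕ.+ i))
  ∑-split m zero f = trans (cong (λ k → ∑ k f) (ℕ.+-identityʳ m)) (sym (+-identityʳ _))
  ∑-split m (suc n) f = trans (cong (λ k → ∑ k f) (ℕ.+-suc m n))
    (trans (cong₂ _+_ (∑-split m n f) (cong f (sym (ℕ.+-suc m n)))) (+-assoc _ _ _))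

  ∑-extend : ∀ {m n} {f : ℕ → ℚ} → m ℕ.≤ n → (∀ i → m ℕ.< i → i ℕ.≤ n → f i ≡ ι 0) → ∑ n f ≡ ∑ m f
  ∑-extend {m} {n} {f} m≤n h = begin
    ∑ n f                                      ≡⟨ cong (λ k → ∑ k f) (ℕ.m+[n∸m]≡n m≤n) ⟨
    ∑ (m ℕ.+ (n ℕ.∸ m)) f                      ≡⟨ ∑-split m (n ℕ.∸ m) f ⟩
    ∑ m f + ∑ (n ℕ.∸ m) (λ i → f (m ℕ.+ i))    ≡⟨ cong (λ z → ∑ m f + z) (∑-zero (n ℕ.∸ m) λ i p q → h (m ℕ.+ i) (ℕ.m<m+n m p) (subst (m ℕ.+ i ℕ.≤_) (ℕ.m+[n∸m]≡n m≤n) (ℕ.+-monoʳ-≤ m q))) ⟩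
    ∑ m f + ι 0                                ≡⟨ +-identityʳ _ ⟩
    ∑ m f                                      ∎

  ∑-mono-range : ∀ {m n} {f : ℕ → ℚ} → m ℕ.≤ n → (∀ i → m ℕ.< i → i ℕ.≤ n → ι 0 ≤ f i) → ∑ m f ≤ ∑ n f
  ∑-mono-range {m} {n} {f} m≤n h = subst (∑ m f ≤_) eq (lin (∑≥0 (n ℕ.∸ m) {λ i → f (m ℕ.+ i)} λ i p q → h (m ℕ.+ i) (ℕ.m<m+n m p) (subst (m ℕ.+ i ℕ.≤_) (ℕ.m+[n∸m]≡n m≤n) (ℕ.+-monoʳ-≤ m q)))
     (ring 2 λ a b → a :+ b :+ con 0 := a :+ b))
    where
    eq : ∑ m f + ∑ (n ℕ.∸ m) (λ i → f (m ℕ.+ i)) ≡ ∑ n f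
    eq = trans (sym (∑-split m (n ℕ.∸ m) f)) (cong (λ k → ∑ k f) (ℕ.m+[n∸m]≡n m≤n))

  ∑-diff-mono : ∀ {m n} {f f′ : ℕ → ℚ} → m ℕ.≤ n → (∀ i → m ℕ.< i → i ℕ.≤ n → f i ≤ f′ i) → ∑ n f - ∑ m f ≤ ∑ n f′ - ∑ m f′
  ∑-diff-mono {m} {n} {f} {f′} m≤n h = subst₂ _≤_ (eq f) (eq f′) (∑-mono (n ℕ.∸ m) λ i p q → h (m ℕ.+ i) (ℕ.m<m+n m p) (subst (m ℕ.+ i ℕ.≤_) (ℕ.m+[n∸m]≡n m≤n) (ℕ.+-monoʳ-≤ m q)))
    where
    eq : ∀ f → ∑ (n ℕ.∸ m) (λ i → f (m ℕ.+ i)) ≡ ∑ n f - ∑ m f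
    eq f = trans (ring 2 λ a b → b := a :+ b :- a) (cong (_- ∑ m f) (trans (sym (∑-split m (n ℕ.∸ m) f)) (cong (λ k → ∑ k f) (ℕ.m+[n∸m]≡n m≤n))))

  ∑-Bd : ∀ n {f e : ℕ → ℚ} → (∀ i → 1 ℕ.≤ i → i ℕ.≤ n → Bd (f i) (e i)) → Bd (∑ n f) (∑ n e)
  ∑-Bd zero h = Bd-0 ≤-refl
  ∑-Bd (suc n) h = Bd-+ (∑-Bd n (λ i p q → h i p (ℕ.m≤n⇒m≤1+n q))) (h (suc n) (s≤s z≤n) ℕ.≤-refl)

  ∑-≥ : ∀ n {f : ℕ → ℚ} k → 1 ℕ.≤ k → k ℕ.≤ n → (∀ i → 1 ℕ.≤ i → i ℕ.≤ n → ι 0 ≤ f i) → f k ≤ ∑ n f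
  ∑-≥ zero (suc k) _ () _
  ∑-≥ (suc n) {f} k 1≤k k≤n h with ℕ.m≤n⇒m<n∨m≡n k≤n
  ... | inj₂ refl = lin (∑≥0 n {f} (λ i p q → h i p (ℕ.m≤n⇒m≤1+n q))) (ring 2 λ a b → a :+ b :+ con 0 := b :+ a)
  ... | inj₁ (s≤s k<n) = lin (∑-≥ n k 1≤k k<n (λ i p q → h i p (ℕ.m≤n⇒m≤1+n q)) ⊞ h (suc n) (s≤s z≤n) ℕ.≤-refl) (ring 3 λ a b c → a :+ b :+ (c :+ con 0) := c :+ (a :+ b))

  -- If the last term exceeds `t`, removing it leaves the average of the others at most `t`.
  pigeonhole : ∀ n {f : ℕ → ℚ} t → ∑ (suc n) f ≤ ι (suc n) * t → Σ ℕ λ i → 1 ℕ.≤ i × i ℕ.≤ suc n × f i ≤ t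
  pigeonhole zero {f} t h = 1 , ℕ.≤-refl , ℕ.≤-refl , lin h (ring 2 λ t f → t :+ (con 0 :+ f) := f :+ con 1 :* t)
  pigeonhole (suc n) {f} t h with f (suc (suc n)) ≤? t
  ... | yes q = suc (suc n) , s≤s z≤n , ℕ.≤-refl , q
  ... | no q with pigeonhole n {f} t (lin (h ⊞ ≰⇒≥ q ⊞ ≤-reflexive (cong (_* t) (ι-suc (suc n))))
         (ring 5 λ n n′ s t f → n :* t :+ (s :+ f :+ (t :+ n′ :* t)) := s :+ (n′ :* t :+ (f :+ (n :+ con 1) :* t))))
  ... | i , a , b , c = i , a , ℕ.m≤n⇒m≤1+n b , c

  𝟙 : ∀ {P : Set} → Dec P → ℚ
  𝟙 (yes _) = ι 1
  𝟙 (no _) = ι 0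

  𝟙-yes : ∀ {P : Set} (d : Dec P) → P → 𝟙 d ≡ ι 1
  𝟙-yes (yes _) _ = refl
  𝟙-yes (no ¬p) p = contradiction p ¬p

  𝟙-no : ∀ {P : Set} (d : Dec P) → ¬ P → 𝟙 d ≡ ι 0
  𝟙-no (yes p) ¬p = contradiction p ¬p
  𝟙-no (no _) _ = refl

  𝟙-⇔ : ∀ {P Q : Set} (d : Dec P) (d′ : Dec Q) → (P → Q) → (Q → P) → 𝟙 d ≡ 𝟙 d′
  𝟙-⇔ (yes p) d′ f g = sym (𝟙-yes d′ (f p))
  𝟙-⇔ (no ¬p) d′ f g = sym (𝟙-no d′ (¬p ∘ g))

  𝟙≥0 : ∀ {P : Set} (d : Dec P) → ι 0 ≤ 𝟙 d
  𝟙≥0 (yes _) = 0≤1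
  𝟙≥0 (no _) = ≤-refl

  𝟙≤1 : ∀ {P : Set} (d : Dec P) → 𝟙 d ≤ ι 1
  𝟙≤1 (yes _) = ≤-refl
  𝟙≤1 (no _) = 0≤1

  𝟙-mono : ∀ {P Q : Set} (d : Dec P) (d′ : Dec Q) → (P → Q) → 𝟙 d ≤ 𝟙 d′
  𝟙-mono (yes p) d′ f = ≤-reflexive (sym (𝟙-yes d′ (f p)))
  𝟙-mono (no _) d′ f = 𝟙≥0 d′

  𝟙*-cong : ∀ {P : Set} (d : Dec P) {a b : ℚ} → (P → a ≡ b) → 𝟙 d * a ≡ 𝟙 d * b
  𝟙*-cong (yes p) h = cong (ι 1 *_) (h p)
  𝟙*-cong (no _) {a} {b} h = trans (*-zeroˡ a) (sym (*-zeroˡ b))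

  𝟙*-≤ : ∀ {P : Set} (d : Dec P) {a} → ι 0 ≤ a → 𝟙 d * a ≤ a
  𝟙*-≤ (yes p) {a} h = ≤-reflexive (*-identityˡ a)
  𝟙*-≤ (no _) {a} h = subst (_≤ a) (sym (*-zeroˡ a)) h

  ∑-single : ∀ n k {f : ℕ → ℚ} → 1 ℕ.≤ k → k ℕ.≤ n → ∑ n (λ i → 𝟙 (i ℕ.≟ k) * f i) ≡ f k
  ∑-single zero (suc k) _ ()
  ∑-single (suc n) k {f} 1≤k k≤n with ℕ.m≤n⇒m<n∨m≡n k≤n
  ... | inj₂ refl = trans (cong₂ _+_ (∑-zero n λ i _ q → trans (cong (_* f i) (𝟙-no (i ℕ.≟ k) (λ e → ℕ.<⇒≢ (s≤s q) e))) (*-zeroˡ _))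
                                     (cong (_* f k) (𝟙-yes (k ℕ.≟ k) refl))) (ring 1 λ a → con 0 :+ con 1 :* a := a)
  ... | inj₁ (s≤s k<n) = trans (cong₂ _+_ (∑-single n k 1≤k k<n) (cong (_* f (suc n)) (𝟙-no (suc n ℕ.≟ k) (λ e → ℕ.<⇒≢ (s≤s k<n) (sym e)))))
      (ring 2 λ a b → a :+ con 0 :* b := a)

  ∑-restrict : ∀ {m n} (f : ℕ → ℚ) → m ℕ.≤ n → ∑ n (λ i → 𝟙 (i ℕ.≤? m) * f i) ≡ ∑ m f
  ∑-restrict {m} {n} f m≤n = trans (∑-extend m≤n (λ i p _ → trans (cong (_* f i) (𝟙-no (i ℕ.≤? m) (ℕ.<⇒≱ p))) (*-zeroˡ _)))
    (∑-cong m (λ i _ q → trans (cong (_* f i) (𝟙-yes (i ℕ.≤? m) q)) (*-identityˡ _)))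

  -- Division with x ÷ 0 = 0.
  infixl 7 _÷_
  _÷_ : ℕ → ℕ → ℕ
  x ÷ zero = 0
  x ÷ suc k = x ℕ./ suc k

  ÷-≤ : ∀ {x k j} → 1 ℕ.≤ k → k ℕ.* j ℕ.≤ x → j ℕ.≤ x ÷ k
  ÷-≤ {x} {suc k} {j} _ p = subst (ℕ._≤ x ℕ./ suc k) (trans (cong (ℕ._/ suc k) (ℕ.*-comm (suc k) j)) (ℕ.m*n/n≡m j (suc k))) (ℕ./-monoˡ-≤ (suc k) p)

  ÷-* : ∀ x k → k ℕ.* (x ÷ k) ℕ.≤ x
  ÷-* x zero = z≤n
  ÷-* x (suc k) = subst (ℕ._≤ x) (ℕ.*-comm (x ℕ./ suc k) (suc k)) (ℕ.m/n*n≤m x (suc k))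

  ≤-÷ : ∀ {x k j} → j ℕ.≤ x ÷ k → k ℕ.* j ℕ.≤ x
  ≤-÷ {x} {k} p = ℕ.≤-trans (ℕ.*-monoʳ-≤ k p) (÷-* x k)

  ÷-< : ∀ x k → 1 ℕ.≤ k → x ℕ.< k ℕ.* suc (x ÷ k)
  ÷-< x k 1≤k = ℕ.≰⇒> (λ p → ℕ.<-irrefl refl (÷-≤ 1≤k p))

  ÷≤ : ∀ x k → x ÷ k ℕ.≤ x
  ÷≤ x zero = z≤n
  ÷≤ x (suc k) = ℕ.m/n≤m x (suc k)

  ÷-÷ : ∀ x d m → 1 ℕ.≤ d → 1 ℕ.≤ m → x ÷ d ÷ m ≡ x ÷ (d ℕ.* m)
  ÷-÷ x d m 1≤d 1≤m = ℕ.≤-antisym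
    (÷-≤ (ℕ.*-mono-≤ 1≤d 1≤m) (ℕ.≤-trans (ℕ.≤-reflexive (ℕ.*-assoc d m _)) (≤-÷ {x} {d} (÷-* (x ÷ d) m))))
    (÷-≤ 1≤m (÷-≤ 1≤d (ℕ.≤-trans (ℕ.≤-reflexive (sym (ℕ.*-assoc d m _))) (÷-* x (d ℕ.* m)))))

  ÷-mono : ∀ {x y} k → x ℕ.≤ y → x ÷ k ℕ.≤ y ÷ k
  ÷-mono zero p = z≤n
  ÷-mono (suc k) p = ℕ./-monoˡ-≤ (suc k) p

  ÷-anti : ∀ x {d d′} → 1 ℕ.≤ d → d ℕ.≤ d′ → x ÷ d′ ℕ.≤ x ÷ d
  ÷-anti x {d} {d′} 1≤d d≤d′ = ÷-≤ 1≤d (ℕ.≤-trans (ℕ.*-monoˡ-≤ (x ÷ d′) d≤d′) (÷-* x d′))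

  1≤÷ : ∀ {x d} → 1 ℕ.≤ d → d ℕ.≤ x → 1 ℕ.≤ x ÷ d
  1≤÷ {x} {d} p q = ÷-≤ p (subst (ℕ._≤ x) (sym (ℕ.*-identityʳ d)) q)

  ∑-÷ : ∀ x k (f : ℕ → ℚ) → 1 ℕ.≤ k → ∑ x (λ j → 𝟙 (k ℕ.* j ℕ.≤? x) * f j) ≡ ∑ (x ÷ k) f
  ∑-÷ x k f 1≤k = trans (∑-cong′ x (λ j → cong (_* f j) (𝟙-⇔ (k ℕ.* j ℕ.≤? x) (j ℕ.≤? x ÷ k) (÷-≤ 1≤k) (≤-÷ {x} {k})))) (∑-restrict f (÷≤ x k))

  -- Both sides run over the pairs with i j ≤ x. Written as an indicator on a square, this condition
  -- allows the sums to be exchanged.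
  hyperbola-swap : ∀ x (f : ℕ → ℕ → ℚ) → ∑ x (λ i → ∑ (x ÷ i) (λ j → f i j)) ≡ ∑ x (λ j → ∑ (x ÷ j) (λ i → f i j))
  hyperbola-swap x f = begin
    ∑ x (λ i → ∑ (x ÷ i) (λ j → f i j))                          ≡⟨ ∑-cong x (λ i p _ → sym (∑-÷ x i (f i) p)) ⟩
    ∑ x (λ i → ∑ x (λ j → 𝟙 (i ℕ.* j ℕ.≤? x) * f i j))           ≡⟨ ∑-swap x x _ ⟩
    ∑ x (λ j → ∑ x (λ i → 𝟙 (i ℕ.* j ℕ.≤? x) * f i j))           ≡⟨ ∑-cong′ x (λ j → ∑-cong′ x (λ i → cong (λ k → 𝟙 (k ℕ.≤? x) * f i j) (ℕ.*-comm i j))) ⟩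
    ∑ x (λ j → ∑ x (λ i → 𝟙 (j ℕ.* i ℕ.≤? x) * f i j))           ≡⟨ ∑-cong x (λ j p _ → ∑-÷ x j (λ i → f i j) p) ⟩
    ∑ x (λ j → ∑ (x ÷ j) (λ i → f i j))                          ∎

  ∑-multiples : ∀ x d (f : ℕ → ℚ) → 1 ℕ.≤ d → ∑ x (λ n → 𝟙 (d ∣? n) * f n) ≡ ∑ (x ÷ d) (λ m → f (d ℕ.* m))
  ∑-multiples x d f 1≤d = begin
    ∑ x (λ n → 𝟙 (d ∣? n) * f n)                                             ≡⟨ ∑-cong x step ⟩
    ∑ x (λ n → ∑ x (λ m → 𝟙 (d ℕ.* m ℕ.≤? x) * (𝟙 (n ℕ.≟ d ℕ.* m) * f n)))   ≡⟨ ∑-swap x x _ ⟩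
    ∑ x (λ m → ∑ x (λ n → 𝟙 (d ℕ.* m ℕ.≤? x) * (𝟙 (n ℕ.≟ d ℕ.* m) * f n)))   ≡⟨ ∑-cong x (λ m 1≤m _ → trans (∑-*ˡ x (𝟙 (d ℕ.* m ℕ.≤? x)) _)
                                                                                  (𝟙*-cong (d ℕ.* m ℕ.≤? x) (∑-single x (d ℕ.* m) (ℕ.*-mono-≤ 1≤d 1≤m)))) ⟩
    ∑ x (λ m → 𝟙 (d ℕ.* m ℕ.≤? x) * f (d ℕ.* m))                             ≡⟨ ∑-÷ x d (λ m → f (d ℕ.* m)) 1≤d ⟩
    ∑ (x ÷ d) (λ m → f (d ℕ.* m))                                            ∎
    where
    step : ∀ n → 1 ℕ.≤ n → n ℕ.≤ x → 𝟙 (d ∣? n) * f n ≡ ∑ x (λ m → 𝟙 (d ℕ.* m ℕ.≤? x) * (𝟙 (n ℕ.≟ d ℕ.* m) * f n))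
    step n 1≤n n≤x with d ∣? n
    ... | no d∤n = trans (*-zeroˡ _) (sym (∑-zero x λ m _ _ → trans (cong (λ z → 𝟙 (d ℕ.* m ℕ.≤? x) * (z * f n))
              (𝟙-no (n ℕ.≟ d ℕ.* m) (λ e → d∤n (divides m (trans e (ℕ.*-comm d m)))))) (ring 2 λ a b → a :* (con 0 :* b) := con 0)))
    ... | yes (divides q refl) = sym (trans (∑-cong x λ m _ _ → eqs m) (trans (∑-single x q (ℕ.n≢0⇒n>0 λ { refl → ℕ.<⇒≢ 1≤n refl }) q≤x) (sym (*-identityˡ _))))
      where
      instance
        d≢0 : ℕ.NonZero d
        d≢0 = ℕ.>-nonZero 1≤d
      q≤x : q ℕ.≤ x
      q≤x = ℕ.≤-trans (ℕ.m≤m*n q d) n≤x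
      eqs : ∀ m → 𝟙 (d ℕ.* m ℕ.≤? x) * (𝟙 (q ℕ.* d ℕ.≟ d ℕ.* m) * f (q ℕ.* d)) ≡ 𝟙 (m ℕ.≟ q) * f (q ℕ.* d)
      eqs m with m ℕ.≟ q
      ... | yes refl = trans (cong₂ (λ a b → a * (b * f (q ℕ.* d))) (𝟙-yes (d ℕ.* q ℕ.≤? x) (subst (ℕ._≤ x) (ℕ.*-comm q d) n≤x)) (𝟙-yes (q ℕ.* d ℕ.≟ d ℕ.* q) (ℕ.*-comm q d))) (ring 1 λ a → con 1 :* (con 1 :* a) := con 1 :* a)
      ... | no m≢q = trans (cong (λ z → 𝟙 (d ℕ.* m ℕ.≤? x) * (z * f (q ℕ.* d))) (𝟙-no (q ℕ.* d ℕ.≟ d ℕ.* m) (λ e → m≢q (ℕ.*-cancelˡ-≡ m q d (trans (sym e) (ℕ.*-comm q d))))))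
            (ring 2 λ a b → a :* (con 0 :* b) := con 0 :* b)

  ∑-divisors : ∀ x (h : ℕ → ℕ → ℚ) → ∑ x (λ n → ∑ x (λ d → 𝟙 (d ∣? n) * h d n)) ≡ ∑ x (λ d → ∑ (x ÷ d) (λ m → h d (d ℕ.* m)))
  ∑-divisors x h = trans (∑-swap x x _) (∑-cong x (λ d p _ → ∑-multiples x d (h d) p))

  module _ (c : ℕ → ℚ) {B : ℚ} (C≤B : ∀ n → Bd (∑ n c) B) where
    private
      S : (ℕ → ℚ) → ℕ → ℚ
      S f n = ∑ n (λ i → c i * f i)

      step : ∀ (f : ℕ → ℚ) y n → S f (suc n) - S f y - (∑ (suc n) c - ∑ y c) * f (suc n)
           ≡ (S f n - S f y - (∑ n c - ∑ y c) * f n) + (∑ n c - ∑ y c) * (f n - f (suc n))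
      step f y n = ring 7 λ s t a b k u v → s :+ k :* v :- t :- (a :+ k :- b) :* v := (s :- t :- (a :- b) :* u) :+ (a :- b) :* (u :- v)

    -- `go` controls the sum minus its boundary term: a step changes it by a difference of partial
    -- sums of `c`, at most 2 B, times the decrease of `f`, and the decreases telescope. The
    -- boundary term costs 2 B times the last value of `f`.
    abel-decreasing : ∀ (f : ℕ → ℚ) y k → (∀ i → y ℕ.< i → i ℕ.< y ℕ.+ suc k → f (suc i) ≤ f i) → ι 0 ≤ f (y ℕ.+ suc k) →
                      Bd (S f (y ℕ.+ suc k) - S f y) ((B + B) * f (suc y))
    abel-decreasing f y k mono pos = Bd-≡ eq (Bd-≤ le (Bd-+ (go k mono) (Bd-≡ (*-comm _ _) (Bd-*ˡ pos (Bd-- (C≤B (y ℕ.+ suc k)) (C≤B y))))))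
      where
      go : ∀ k → (∀ i → y ℕ.< i → i ℕ.< y ℕ.+ suc k → f (suc i) ≤ f i) →
           Bd (S f (y ℕ.+ suc k) - S f y - (∑ (y ℕ.+ suc k) c - ∑ y c) * f (y ℕ.+ suc k)) ((B + B) * (f (suc y) - f (y ℕ.+ suc k)))
      go zero _ rewrite ℕ.+-comm y 1 = Bd-≡ (sym (trans (step f y y) (ring 4 λ s a u v → (s :- s :- (a :- a) :* u) :+ (a :- a) :* (u :- v) := con 0)))
        (Bd-0 (≤-reflexive (ring 2 λ b v → con 0 := (b :+ b) :* (v :- v))))
      go (suc k) m rewrite ℕ.+-suc y (suc k) = Bd-≡ (sym (step f y (y ℕ.+ suc k)))
        (Bd-≤ (≤-reflexive (ring 4 λ b u v w → (b :+ b) :* (u :- v) :+ (v :- w) :* (b :+ b) := (b :+ b) :* (u :- w)))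
          (Bd-+ (go k (λ i p q → m i p (ℕ.m≤n⇒m≤1+n q)))
             (Bd-≡ (*-comm _ _) (Bd-*ˡ (sub≥0 (m (y ℕ.+ suc k) (ℕ.m<m+n y (s≤s z≤n)) ℕ.≤-refl)) (Bd-- (C≤B (y ℕ.+ suc k)) (C≤B y))))))
      n = y ℕ.+ suc k
      eq : S f n - S f y - (∑ n c - ∑ y c) * f n + (∑ n c - ∑ y c) * f n ≡ S f n - S f y
      eq = ring 5 λ s t a b v → s :- t :- (a :- b) :* v :+ (a :- b) :* v := s :- t
      le : (B + B) * (f (suc y) - f n) + f n * (B + B) ≤ (B + B) * f (suc y)
      le = ≤-reflexive (ring 3 λ b u v → (b :+ b) :* (u :- v) :+ v :* (b :+ b) := (b :+ b) :* u)

    abel-increasing : ∀ (f : ℕ → ℚ) n → (∀ i → 1 ℕ.≤ i → i ℕ.≤ n → f i ≤ f (suc i)) → ι 0 ≤ f 1 → Bd (S f (suc n)) ((B + B) * f (suc n))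
    abel-increasing f n mono pos = Bd-≡ eq (Bd-≤ le (Bd-+ (go n mono) (Bd-≡ (*-comm _ _) (Bd-*ˡ (≤-trans pos (f1≤ n mono)) (C≤B (suc n))))))
      where
      f1≤ : ∀ n → (∀ i → 1 ℕ.≤ i → i ℕ.≤ n → f i ≤ f (suc i)) → f 1 ≤ f (suc n)
      f1≤ zero _ = ≤-refl
      f1≤ (suc n) m = ≤-trans (f1≤ n (λ i p q → m i p (ℕ.m≤n⇒m≤1+n q))) (m (suc n) (s≤s z≤n) ℕ.≤-refl)
      go : ∀ n → (∀ i → 1 ℕ.≤ i → i ℕ.≤ n → f i ≤ f (suc i)) → Bd (S f (suc n) - ∑ (suc n) c * f (suc n)) (B * (f (suc n) - f 1))
      go zero _ = Bd-≡ (ring 2 λ c v → con 0 := con 0 :+ c :* v :- (con 0 :+ c) :* v) (Bd-0 (≤-reflexive (ring 2 λ b v → con 0 := b :* (v :- v))))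
      go (suc n) m = Bd-≡ (ring 5 λ s a k u v → s :- a :* u :+ (v :- u) :* :- a := s :+ k :* v :- (a :+ k) :* v)
        (Bd-≤ (≤-reflexive (ring 4 λ b u v w → b :* (u :- w) :+ (v :- u) :* b := b :* (v :- w)))
          (Bd-+ (go n (λ i p q → m i p (ℕ.m≤n⇒m≤1+n q))) (Bd-*ˡ (sub≥0 (m (suc n) (s≤s z≤n) ℕ.≤-refl)) (Bd-neg (C≤B (suc n))))))
      eq : S f (suc n) - ∑ (suc n) c * f (suc n) + ∑ (suc n) c * f (suc n) ≡ S f (suc n)
      eq = ring 3 λ s a v → s :- a :* v :+ a :* v := s
      le : B * (f (suc n) - f 1) + f (suc n) * B ≤ (B + B) * f (suc n)
      le = lin (*≥0 (Bd≥0 (C≤B 0)) pos) (ring 3 λ b v u → (b :+ b) :* v :+ con 0 := b :* (v :- u) :+ v :* b :+ b :* u)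

  -- Whole periods sum to zero and are removed one at a time; fewer than `g` terms remain.
  periodic-Bd : ∀ g (c : ℕ → ℚ) {M} .{{_ : ℕ.NonZero g}} → (∀ i → c (g ℕ.+ i) ≡ c i) → (∀ i → Bd (c i) M) → ∑ g c ≡ ι 0 → ∀ n → Bd (∑ n c) (ι g * M)
  periodic-Bd g c {M} per bd sum0 = <-rec _ go
    where
    go : ∀ n → (∀ {m} → m ℕ.< n → Bd (∑ m c) (ι g * M)) → Bd (∑ n c) (ι g * M)
    go n rec with ℕ.<-≤-connex n g
    ... | inj₁ n<g = Bd-≤ le (∑-Bd n {c} {λ _ → M} (λ i _ _ → bd i))
      where
      M≥0 = Bd≥0 (bd 0)
      le : ∑ n (λ _ → M) ≤ ι g * M
      le = subst (_≤ ι g * M) (sym (∑-const n M)) (subst₂ _≤_ (*-comm M (ι n)) (*-comm M (ι g)) (M≥0 ⊛ ι-mono (ℕ.<⇒≤ n<g)))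
    ... | inj₂ g≤n = Bd-≡ (sym eq) (rec (ℕ.∸-monoʳ-< (ℕ.>-nonZero⁻¹ g) g≤n))
      where
      eq : ∑ n c ≡ ∑ (n ℕ.∸ g) c
      eq = begin
        ∑ n c                                              ≡⟨ cong (λ k → ∑ k c) (ℕ.m+[n∸m]≡n g≤n) ⟨
        ∑ (g ℕ.+ (n ℕ.∸ g)) c                              ≡⟨ ∑-split g (n ℕ.∸ g) c ⟩
        ∑ g c + ∑ (n ℕ.∸ g) (λ i → c (g ℕ.+ i))            ≡⟨ cong₂ _+_ sum0 (∑-cong′ (n ℕ.∸ g) per) ⟩
        ι 0 + ∑ (n ℕ.∸ g) c                                ≡⟨ +-identityˡ _ ⟩
        ∑ (n ℕ.∸ g) c                                      ∎

-- Prime factorisation as lists.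

module Factors where
  open import Data.List using (List; []; _∷_; _++_)
  open import Data.List.Membership.Propositional using (_∈_)
  open import Data.List.Relation.Binary.Permutation.Propositional using (_↭_)
  open import Data.List.Relation.Binary.Permutation.Propositional.Properties using (↭-length; ↭-singleton-inv)
  open import Data.List.Relation.Unary.All as All using (All; []; _∷_)
  open import Data.List.Relation.Unary.All.Properties using (++⁺; ¬All⇒Any¬)
  open import Data.List.Relation.Unary.Any using (here)
  import Data.List.Membership.Propositional as Mem
  open import Data.Nat using (_*_; _^_; _≤_; _<_; >-nonZero⁻¹; nonTrivial⇒n>1)
  open import Data.Nat.Properties
  open import Data.Nat.Divisibility using (_∣_)
  open import Data.Nat.ListAction using (product)
  open import Data.Nat.ListAction.Properties using (product-++; ∈⇒∣product)
  open import Data.Nat.Primality using (prime⇒nonTrivial; prime⇒nonZero; prime⇒irreducible)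
  open import Data.Nat.Primality.Factorisation

  abstract
    facs : ℕ → List ℕ
    facs zero = []
    facs (suc n) = factors (factorise (suc n))

    facs-product : ∀ {n} → 1 ≤ n → product (facs n) ≡ n
    facs-product {suc n} _ = sym (PrimeFactorisation.isFactorisation (factorise (suc n)))

    facs-prime : ∀ n → All Prime (facs n)
    facs-prime zero = []
    facs-prime (suc n) = PrimeFactorisation.factorsPrime (factorise (suc n))

    facs-unique : ∀ {n ps} → 1 ≤ n → n ≡ product ps → All Prime ps → facs n ↭ ps
    facs-unique {suc n} _ e h = factorisationUnique (factorise (suc n)) (record { factors = _ ; isFactorisation = e ; factorsPrime = h })

  facs-* : ∀ {m n} → 1 ≤ m → 1 ≤ n → facs (m * n) ↭ facs m ++ facs n
  facs-* {m} {n} p q = facs-unique (*-mono-≤ p q)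
    (sym (trans (product-++ (facs m) (facs n)) (cong₂ _*_ (facs-product p) (facs-product q)))) (++⁺ (facs-prime m) (facs-prime n))

  prime>0 : ∀ {p} → Prime p → 1 ≤ p
  prime>0 {p} pr = >-nonZero⁻¹ p {{prime⇒nonZero pr}}

  prime>1 : ∀ {p} → Prime p → 1 < p
  prime>1 {p} pr = nonTrivial⇒n>1 p {{prime⇒nonTrivial pr}}

  facs-1 : facs 1 ≡ []
  facs-1 with facs 1 | facs-unique {1} {[]} ≤-refl refl []
  ... | [] | _ = refl
  ... | x ∷ xs | h with ↭-length h
  ... | ()

  facs-p : ∀ {p} → Prime p → facs p ≡ p ∷ []
  facs-p {p} pr = ↭-singleton-inv (facs-unique (prime>0 pr) (sym (*-identityʳ p)) (pr ∷ []))

  facs-p* : ∀ {p n} → Prime p → 1 ≤ n → facs (p * n) ↭ p ∷ facs n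
  facs-p* {p} {n} pr q = subst (λ l → facs (p * n) ↭ l ++ facs n) (facs-p pr) (facs-* (prime>0 pr) q)

  ∈facs⇒∣ : ∀ {p n} → 1 ≤ n → p ∈ facs n → p ∣ n
  ∈facs⇒∣ q h = subst (_ ∣_) (facs-product q) (∈⇒∣product h)

  ∣⇒∈facs : ∀ {p n} → Prime p → 1 ≤ n → p ∣ n → p ∈ facs n
  ∣⇒∈facs {p} {n} pr q h = factorisationHasAllPrimeFactors pr (subst (p ∣_) (sym (facs-product q)) h) (facs-prime n)

  prime-divisor : ∀ {n} → 2 ≤ n → Σ ℕ λ p → Prime p × p ∣ n
  prime-divisor {n} q = go (facs n) refl
    where
    1≤n = ≤-trans (s≤s z≤n) q
    go : ∀ l → facs n ≡ l → Σ ℕ λ p → Prime p × p ∣ n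
    go [] e = ⊥-elim (<-irrefl (trans (cong product (sym e)) (facs-product 1≤n)) q)
    go (p ∷ l) e = p , All.head (subst (All Prime) e (facs-prime n)) , ∈facs⇒∣ 1≤n (subst (p ∈_) (sym e) (here refl))

  prime∣prime : ∀ {p q} → Prime p → Prime q → p ∣ q → p ≡ q
  prime∣prime {p} pp pq h with prime⇒irreducible pq h
  ... | inj₁ refl = ⊥-elim (<-irrefl refl (prime>1 pp))
  ... | inj₂ e = e

  -- This dichotomy decides whether the von Mangoldt function vanishes at `n`.
  power-or-other-prime : ∀ {p n} → 1 ≤ n → Prime p → (Σ ℕ λ k → n ≡ p ^ k) ⊎ (Σ ℕ λ q → Prime q × q ∣ n × q ≢ p)
  power-or-other-prime {p} {n} 1≤n pr with All.all? (_≟ p) (facs n)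
  ... | yes all = inj₁ (length (facs n) , trans (sym (facs-product 1≤n)) (go (facs n) all))
    where
    go : ∀ l → All (_≡ p) l → product l ≡ p ^ length l
    go [] [] = refl
    go (x ∷ l) (refl ∷ a) = cong (p *_) (go l a)
  ... | no ¬all with Mem.find (¬All⇒Any¬ (_≟ p) (facs n) ¬all)
  ... | q , q∈ , q≢p = inj₂ (q , All.lookup (facs-prime n) q∈ , ∈facs⇒∣ 1≤n q∈ , q≢p)

-- The Möbius function, completely additive functions and the von Mangoldt function.

module Mobius where
  open import Data.List using (List; []; _∷_; _++_)
  open import Data.List.Relation.Binary.Permutation.Propositional as Perm using (_↭_; ↭-sym; ↭⇒↭ₛ; prep; swap)
  open import Data.List.Relation.Binary.Permutation.Propositional.Properties using (↭-length)
  open import Data.List.Relation.Unary.All using ([]; _∷_)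
  open import Data.List.Relation.Unary.All.Properties using (¬Any⇒All¬; All¬⇒¬Any)
  open import Data.List.Relation.Unary.AllPairs using ([]; _∷_)
  open import Data.List.Relation.Unary.Unique.Propositional using (Unique)
  open import Data.List.Relation.Unary.Unique.DecPropositional ℕ._≟_ using (unique?)
  open import Data.List.Relation.Binary.Permutation.Setoid.Properties (setoid ℕ) using (Unique-resp-↭)
  open import Data.Nat.Divisibility using (_∣_; _∣?_; divides; ∣⇒≤; n∣m*n; ∣-trans; ∣1⇒≡1; *-cancelʳ-∣; 1∣_)
  open import Data.Nat.Primality using (euclidsLemma)
  open Field
  open Sums
  open Factors

  open ≡-Reasoning

  sign : ℕ → ℚ
  sign zero = ι 1
  sign (suc n) = - sign n

  μ : ℕ → ℚ
  μ n = 𝟙 (unique? (facs n)) * sign (length (facs n))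

  sign-Bd : ∀ n → Bd (sign n) (ι 1)
  sign-Bd zero = Bd-self 0≤1
  sign-Bd (suc n) = Bd-neg (sign-Bd n)

  μ-Bd : ∀ n → Bd (μ n) (ι 1)
  μ-Bd n = Bd-≤ (≤-reflexive (*-identityʳ (ι 1))) (Bd-* (Bd-≤ (𝟙≤1 (unique? (facs n))) (Bd-self (𝟙≥0 (unique? (facs n))))) (sign-Bd (length (facs n))))

  μ-1 : μ 1 ≡ ι 1
  μ-1 rewrite facs-1 = *-identityʳ (ι 1)

  module _ {p d : ℕ} (pr : Prime p) (1≤d : 1 ℕ.≤ d) where
    private
      perm = facs-p* pr 1≤d
      sgn : sign (length (facs (p ℕ.* d))) ≡ - sign (length (facs d))
      sgn = cong sign (↭-length perm)

    μ-∤ : ¬ (p ∣ d) → μ (p ℕ.* d) ≡ - μ d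
    μ-∤ p∤d = begin
      μ (p ℕ.* d)                                                        ≡⟨ cong₂ _*_ (𝟙-⇔ (unique? (facs (p ℕ.* d))) (unique? (facs d)) to from) sgn ⟩
      𝟙 (unique? (facs d)) * - sign (length (facs d))                    ≡⟨ ring 2 (λ a b → a :* :- b := :- (a :* b)) ⟩
      - μ d                                                              ∎
      where
      to : Unique (facs (p ℕ.* d)) → Unique (facs d)
      to u with Unique-resp-↭ (↭⇒↭ₛ perm) u
      ... | _ ∷ u′ = u′
      from : Unique (facs d) → Unique (facs (p ℕ.* d))
      from u = Unique-resp-↭ (↭⇒↭ₛ (↭-sym perm)) (¬Any⇒All¬ (facs d) (λ h → p∤d (∈facs⇒∣ 1≤d h)) ∷ u)

    μ-∣ : p ∣ d → μ (p ℕ.* d) ≡ ι 0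
    μ-∣ p∣d = trans (cong (_* sign (length (facs (p ℕ.* d)))) (𝟙-no (unique? (facs (p ℕ.* d))) no-unique)) (*-zeroˡ _)
      where
      no-unique : ¬ Unique (facs (p ℕ.* d))
      no-unique u with Unique-resp-↭ (↭⇒↭ₛ perm) u
      ... | a ∷ _ = All¬⇒¬Any a (∣⇒∈facs pr 1≤d p∣d)

  prime-*∣ : ∀ {p d n} → Prime p → ¬ (p ∣ d) → p ∣ n → d ∣ n → p ℕ.* d ∣ n
  prime-*∣ {p} {d} pr p∤d p∣n (divides q refl) with euclidsLemma q d pr p∣n
  ... | inj₂ h = contradiction h p∤d
  ... | inj₁ (divides r refl) = divides r (ℕ.*-assoc r p d)

  -- Divisors prime to `p` are paired with their `p`-multiples: μ(p d) = - μ(d), and multiples of p²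
  -- drop out. As the weight `g` is arbitrary, the same pairing yields the sum of μ, the value of
  -- `Λ` and its support.
  μ-pairing : ∀ {p} x n (g : ℕ → ℚ) → Prime p → 1 ℕ.≤ n → n ℕ.≤ x → p ∣ n →
    ∑ x (λ d → 𝟙 (d ∣? n) * (μ d * g d)) ≡ ∑ x (λ d → 𝟙 (d ∣? n) * (μ d * ((ι 1 - 𝟙 (p ∣? d)) * (g d - g (p ℕ.* d)))))
  μ-pairing {p} x n g pr 1≤n n≤x p∣n = begin
    ∑ x (λ d → h d)                                                       ≡⟨ ∑-cong′ x (λ d → ring 2 λ a t → t := a :* t :+ (con 1 :- a) :* t) ⟩
    ∑ x (λ d → 𝟙 (p ∣? d) * h d + (ι 1 - 𝟙 (p ∣? d)) * h d)               ≡⟨ ∑-+ x _ _ ⟩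
    ∑ x (λ d → 𝟙 (p ∣? d) * h d) + ∑ x (λ d → (ι 1 - 𝟙 (p ∣? d)) * h d)   ≡⟨ cong (_+ ∑ x (λ d → (ι 1 - 𝟙 (p ∣? d)) * h d)) (trans (∑-multiples x p h (prime>0 pr)) multiples) ⟩
    ∑ x k + ∑ x (λ d → (ι 1 - 𝟙 (p ∣? d)) * h d)                          ≡⟨ ∑-+ x _ _ ⟨
    ∑ x (λ d → k d + (ι 1 - 𝟙 (p ∣? d)) * h d)                            ≡⟨ ∑-cong′ x (λ d → ring 5 λ a b m u v → a :* (:- m :* (b :* v)) :+ b :* (a :* (m :* u)) := a :* (m :* (b :* (u :- v)))) ⟩
    ∑ x (λ d → 𝟙 (d ∣? n) * (μ d * ((ι 1 - 𝟙 (p ∣? d)) * (g d - g (p ℕ.* d))))) ∎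
    where
    h k : ℕ → ℚ
    h d = 𝟙 (d ∣? n) * (μ d * g d)
    k d = 𝟙 (d ∣? n) * (- μ d * ((ι 1 - 𝟙 (p ∣? d)) * g (p ℕ.* d)))
    instance
      n≢0 : ℕ.NonZero n
      n≢0 = ℕ.>-nonZero 1≤n
    term : ∀ m → 1 ℕ.≤ m → h (p ℕ.* m) ≡ k m
    term m 1≤m with p ∣? m
    ... | yes p∣m = trans (cong (λ z → 𝟙 (p ℕ.* m ∣? n) * (z * g (p ℕ.* m))) (μ-∣ pr 1≤m p∣m))
                      (ring 4 λ a b c d → a :* (con 0 :* b) := c :* (d :* ((con 1 :- con 1) :* b)))
    ... | no p∤m = trans (cong₂ (λ a z → a * (z * g (p ℕ.* m))) (𝟙-⇔ (p ℕ.* m ∣? n) (m ∣? n) (∣-trans (n∣m*n p)) (prime-*∣ pr p∤m p∣n)) (μ-∤ pr 1≤m p∤m))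
                      (ring 3 λ a b c → a :* (b :* c) := a :* (b :* ((con 1 :- con 0) :* c)))
    -- The sum over multiples of `p` stops at x ÷ p, but it may be extended to `x`: a divisor m of n
    -- prime to `p` has p m ∣ n ≤ x, so larger m contribute nothing.
    vanish : ∀ m → x ÷ p ℕ.< m → m ℕ.≤ x → k m ≡ ι 0
    vanish m p<m m≤x with p ∣? m | m ∣? n
    ... | yes _ | _ = ring 3 λ a b c → a :* (b :* ((con 1 :- con 1) :* c)) := con 0
    ... | no _ | no _ = *-zeroˡ _
    ... | no p∤m | yes m∣n = ⊥-elim (ℕ.<⇒≱ p<m (÷-≤ (prime>0 pr) (ℕ.≤-trans (∣⇒≤ (prime-*∣ pr p∤m p∣n m∣n)) n≤x)))
    multiples : ∑ (x ÷ p) (λ m → h (p ℕ.* m)) ≡ ∑ x k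
    multiples = trans (∑-cong (x ÷ p) (λ m q _ → term m q)) (sym (∑-extend (÷≤ x p) vanish))

  ∑-μ : ∀ x n → 1 ℕ.≤ n → n ℕ.≤ x → ∑ x (λ d → 𝟙 (d ∣? n) * μ d) ≡ 𝟙 (n ℕ.≟ 1)
  ∑-μ x 1 _ 1≤x = trans (∑-cong x (λ d _ _ → cong (_* μ d) (𝟙-⇔ (d ∣? 1) (d ℕ.≟ 1) ∣1⇒≡1 (λ { refl → 1∣ 1 })))) (trans (∑-single x 1 ℕ.≤-refl 1≤x) μ-1)
  ∑-μ x n@(suc (suc _)) 1≤n n≤x with prime-divisor {n} (s≤s (s≤s z≤n))
  ... | p , pr , p∣n = begin
    ∑ x (λ d → 𝟙 (d ∣? n) * μ d)              ≡⟨ ∑-cong′ x (λ d → ring 2 λ a m → a :* m := a :* (m :* con 1)) ⟩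
    ∑ x (λ d → 𝟙 (d ∣? n) * (μ d * ι 1))      ≡⟨ μ-pairing x n (λ _ → ι 1) pr 1≤n n≤x p∣n ⟩
    _                                         ≡⟨ ∑-zero x (λ d _ _ → ring 3 λ a m b → a :* (m :* (b :* (con 1 :- con 1))) := con 0) ⟩
    ι 0                                       ≡⟨ 𝟙-no (n ℕ.≟ 1) (λ ()) ⟨
    𝟙 (n ℕ.≟ 1)                               ∎

  -- The completely additive extension ℓ of a function on the primes, and its von Mangoldt function.
  module Additive (L : ℕ → ℚ) where

    sumL : List ℕ → ℚ
    sumL [] = ι 0
    sumL (p ∷ ps) = L p + sumL ps

    sumL-++ : ∀ ps qs → sumL (ps ++ qs) ≡ sumL ps + sumL qs
    sumL-++ [] qs = sym (+-identityˡ _)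
    sumL-++ (p ∷ ps) qs = trans (cong (L p +_) (sumL-++ ps qs)) (sym (+-assoc _ _ _))

    sumL-↭ : ∀ {ps qs} → ps ↭ qs → sumL ps ≡ sumL qs
    sumL-↭ Perm.refl = refl
    sumL-↭ (prep p h) = cong (L p +_) (sumL-↭ h)
    sumL-↭ (swap p q h) = trans (cong (λ z → L p + (L q + z)) (sumL-↭ h)) (ring 3 λ a b c → a :+ (b :+ c) := b :+ (a :+ c))
    sumL-↭ (Perm.trans h h′) = trans (sumL-↭ h) (sumL-↭ h′)

    ℓ : ℕ → ℚ
    ℓ n = sumL (facs n)

    ℓ-* : ∀ {m n} → 1 ℕ.≤ m → 1 ℕ.≤ n → ℓ (m ℕ.* n) ≡ ℓ m + ℓ n
    ℓ-* {m} {n} p q = trans (sumL-↭ (facs-* p q)) (sumL-++ (facs m) (facs n))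

    ℓ-1 : ℓ 1 ≡ ι 0
    ℓ-1 = cong sumL facs-1

    abstract
      -- The Dirichlet convolution of μ and `ℓ`: in the sum of μ(d) ℓ(n / d) the part ℓ(n) ∑ μ(d)
      -- vanishes, for n = 1 because ℓ 1 = 0.
      Λ : ℕ → ℚ
      Λ n = - ∑ n (λ d → 𝟙 (d ∣? n) * (μ d * ℓ d))

      Λ-def : ∀ x n → 1 ℕ.≤ n → n ℕ.≤ x → Λ n ≡ - ∑ x (λ d → 𝟙 (d ∣? n) * (μ d * ℓ d))
      Λ-def x n 1≤n n≤x = cong -_ (sym (∑-extend n≤x (λ d n<d _ → trans (cong (_* (μ d * ℓ d)) (𝟙-no (d ∣? n) (λ h → ℕ.<⇒≱ n<d (∣⇒≤ {{ℕ.>-nonZero 1≤n}} h)))) (*-zeroˡ _))))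

    Λ-1 : Λ 1 ≡ ι 0
    Λ-1 = trans (Λ-def 1 1 ℕ.≤-refl ℕ.≤-refl) (trans (cong (λ z → - (ι 0 + 𝟙 (1 ∣? 1) * (μ 1 * z))) ℓ-1) (ring 2 λ a b → :- (con 0 :+ a :* (b :* con 0)) := con 0))

    -- Pairing `d` with p d replaces ℓ(d) by ℓ(d) - ℓ(p d) = - ℓ(p), a constant that can be taken
    -- out of the sum.
    Λ-at : ∀ {p} n → 1 ℕ.≤ n → Prime p → p ∣ n → Λ n ≡ ℓ p * ∑ n (λ d → 𝟙 (d ∣? n) * (μ d * (ι 1 - 𝟙 (p ∣? d))))
    Λ-at {p} n 1≤n pr p∣n = begin
      Λ n                                                      ≡⟨ Λ-def n n 1≤n ℕ.≤-refl ⟩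
      - ∑ n (λ d → 𝟙 (d ∣? n) * (μ d * ℓ d))                   ≡⟨ cong -_ (μ-pairing n n ℓ pr 1≤n ℕ.≤-refl p∣n) ⟩
      - ∑ n _                                                  ≡⟨ ∑-neg n _ ⟨
      _                                                        ≡⟨ ∑-cong n (λ d 1≤d _ → trans (cong (λ z → - (𝟙 (d ∣? n) * (μ d * ((ι 1 - 𝟙 (p ∣? d)) * (ℓ d - z))))) (ℓ-* (prime>0 pr) 1≤d))
                                                                     (ring 5 λ a m b u v → :- (a :* (m :* (b :* (u :- (v :+ u))))) := v :* (a :* (m :* b)))) ⟩
      ∑ n (λ d → ℓ p * (𝟙 (d ∣? n) * (μ d * (ι 1 - 𝟙 (p ∣? d))))) ≡⟨ ∑-*ˡ n (ℓ p) _ ⟩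
      ℓ p * ∑ n (λ d → 𝟙 (d ∣? n) * (μ d * (ι 1 - 𝟙 (p ∣? d)))) ∎

    -- A second prime `q` of `n` permits another pairing, and since a factor `q` does not affect
    -- divisibility by `p`, the sum in `Λ-at` cancels. For a power of `p`, only d = 1 is prime to
    -- `p`.
    Λ-cases : ∀ n → 1 ℕ.≤ n → (Λ n ≡ ι 0) ⊎ (Σ ℕ λ p → Σ ℕ λ k → Prime p × n ≡ p ℕ.^ suc k × Λ n ≡ ℓ p)
    Λ-cases 1 _ = inj₁ Λ-1
    Λ-cases n@(suc (suc _)) 1≤n with prime-divisor {n} (s≤s (s≤s z≤n))
    ... | p , pr , p∣n with power-or-other-prime 1≤n pr
    ...   | inj₂ (q , qr , q∣n , q≢p) = inj₁ (trans (Λ-at n 1≤n pr p∣n) (trans (cong (ℓ p *_) E≡0) (*-zeroʳ _)))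
      where
      E : ℚ
      E = ∑ n (λ d → 𝟙 (d ∣? n) * (μ d * (ι 1 - 𝟙 (p ∣? d))))
      E≡0 : E ≡ ι 0
      E≡0 = trans (μ-pairing n n (λ d → ι 1 - 𝟙 (p ∣? d)) qr 1≤n ℕ.≤-refl q∣n) (∑-zero n λ d 1≤d _ →
        trans (cong (λ z → 𝟙 (d ∣? n) * (μ d * ((ι 1 - 𝟙 (q ∣? d)) * (ι 1 - 𝟙 (p ∣? d) - (ι 1 - z))))) (𝟙-⇔ (p ∣? (q ℕ.* d)) (p ∣? d) (f d) (λ h → ∣-trans h (n∣m*n q))))
          (ring 4 λ a b c e → a :* (b :* (c :* (con 1 :- e :- (con 1 :- e)))) := con 0))
        where
        f : ∀ d → p ∣ q ℕ.* d → p ∣ d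
        f d h with euclidsLemma q d pr h
        ... | inj₁ p∣q = contradiction (sym (prime∣prime pr qr p∣q)) q≢p
        ... | inj₂ p∣d = p∣d
    ...   | inj₁ (zero , ())
    ...   | inj₁ (suc k , n≡) = inj₂ (p , k , pr , n≡ , trans (Λ-at n 1≤n pr p∣n) (trans (cong (ℓ p *_) E≡1) (*-identityʳ _)))
      where
      E : ℚ
      E = ∑ n (λ d → 𝟙 (d ∣? n) * (μ d * (ι 1 - 𝟙 (p ∣? d))))
      only1 : ∀ d → 1 ℕ.≤ d → d ∣ n → ¬ (p ∣ d) → d ≡ 1
      only1 1 _ _ _ = refl
      only1 d@(suc (suc _)) _ d∣n p∤d with prime-divisor {d} (s≤s (s≤s z≤n))
      ... | q , qr , q∣d = ⊥-elim (p∤d (subst (_∣ d) (prime∣prime^ (suc k) (subst (q ∣_) n≡ (∣-trans q∣d d∣n))) q∣d))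
        where
        prime∣prime^ : ∀ j → q ∣ p ℕ.^ j → q ≡ p
        prime∣prime^ zero h = ⊥-elim (ℕ.<-irrefl (sym (∣1⇒≡1 h)) (prime>1 qr))
        prime∣prime^ (suc j) h with euclidsLemma p (p ℕ.^ j) qr h
        ... | inj₁ h′ = prime∣prime qr pr h′
        ... | inj₂ h′ = prime∣prime^ j h′
      E≡1 : E ≡ ι 1
      E≡1 = trans (∑-cong n term) (trans (∑-single n 1 {μ} ℕ.≤-refl 1≤n) μ-1)
        where
        term : ∀ d → 1 ℕ.≤ d → d ℕ.≤ n → 𝟙 (d ∣? n) * (μ d * (ι 1 - 𝟙 (p ∣? d))) ≡ 𝟙 (d ℕ.≟ 1) * μ d
        term d 1≤d _ with d ℕ.≟ 1
        ... | yes refl = trans (cong₂ (λ a b → a * (μ 1 * (ι 1 - b))) (𝟙-yes (1 ∣? n) (1∣ n)) (𝟙-no (p ∣? 1) (λ h → ℕ.<-irrefl (sym (∣1⇒≡1 h)) (prime>1 pr)))) (ring 1 λ m → con 1 :* (m :* (con 1 :- con 0)) := con 1 :* m)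
        ... | no d≢1 with d ∣? n | p ∣? d
        ...   | no _ | _ = ring 2 λ a b → con 0 :* (a :* b) := con 0 :* a
        ...   | yes _ | yes _ = ring 1 λ a → con 1 :* (a :* (con 1 :- con 1)) := con 0 :* a
        ...   | yes d∣n | no p∤d = contradiction (only1 d 1≤d d∣n p∤d) d≢1

    -- Möbius inversion. With k = d m, additivity gives ℓ(d m) - ℓ(d) = ℓ(m), free of `d`; the sum
    -- of μ(d) over d m ∣ n is nonzero only for m = n.
    ∑-Λ : ∀ x n → 1 ℕ.≤ n → n ℕ.≤ x → ∑ x (λ k → 𝟙 (k ∣? n) * Λ k) ≡ ℓ n
    ∑-Λ x n 1≤n n≤x = begin
      ∑ x (λ k → 𝟙 (k ∣? n) * Λ k)                                                     ≡⟨ ∑-cong x (λ k p q → trans (cong (𝟙 (k ∣? n) *_) (Λ-conv k p q)) (sym (∑-*ˡ x _ _))) ⟩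
      ∑ x (λ k → ∑ x (λ d → 𝟙 (k ∣? n) * (𝟙 (d ∣? k) * (μ d * (ℓ k - ℓ d)))))           ≡⟨ ∑-cong′ x (λ k → ∑-cong′ x (λ d → ring 3 λ a b c → a :* (b :* c) := b :* (a :* c))) ⟩
      ∑ x (λ k → ∑ x (λ d → 𝟙 (d ∣? k) * (𝟙 (k ∣? n) * (μ d * (ℓ k - ℓ d)))))           ≡⟨ ∑-divisors x (λ d k → 𝟙 (k ∣? n) * (μ d * (ℓ k - ℓ d))) ⟩
      ∑ x (λ d → ∑ (x ÷ d) (λ m → 𝟙 (d ℕ.* m ∣? n) * (μ d * (ℓ (d ℕ.* m) - ℓ d))))       ≡⟨ hyperbola-swap x _ ⟩
      ∑ x (λ m → ∑ (x ÷ m) (λ d → 𝟙 (d ℕ.* m ∣? n) * (μ d * (ℓ (d ℕ.* m) - ℓ d))))       ≡⟨ ∑-cong x inner ⟩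
      ∑ x (λ m → 𝟙 (m ℕ.≟ n) * ℓ m)                                                    ≡⟨ ∑-single x n 1≤n n≤x ⟩
      ℓ n                                                                              ∎
      where
      Λ-conv : ∀ k → 1 ℕ.≤ k → k ℕ.≤ x → Λ k ≡ ∑ x (λ d → 𝟙 (d ∣? k) * (μ d * (ℓ k - ℓ d)))
      Λ-conv k p q = sym (begin
        ∑ x (λ d → 𝟙 (d ∣? k) * (μ d * (ℓ k - ℓ d)))                                   ≡⟨ ∑-cong′ x (λ d → ring 4 λ a m u v → a :* (m :* (u :- v)) := a :* m :* u :- a :* (m :* v)) ⟩
        ∑ x (λ d → 𝟙 (d ∣? k) * μ d * ℓ k - 𝟙 (d ∣? k) * (μ d * ℓ d))                   ≡⟨ ∑-- x _ _ ⟩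
        ∑ x (λ d → 𝟙 (d ∣? k) * μ d * ℓ k) - ∑ x (λ d → 𝟙 (d ∣? k) * (μ d * ℓ d))       ≡⟨ cong (_- ∑ x (λ d → 𝟙 (d ∣? k) * (μ d * ℓ d))) (trans (∑-*ʳ x (ℓ k) _) (trans (cong (_* ℓ k) (∑-μ x k p q)) zero′)) ⟩
        ι 0 - ∑ x (λ d → 𝟙 (d ∣? k) * (μ d * ℓ d))                                     ≡⟨ ring 1 (λ a → con 0 :- a := :- a) ⟩
        - ∑ x (λ d → 𝟙 (d ∣? k) * (μ d * ℓ d))                                         ≡⟨ Λ-def x k p q ⟨
        Λ k                                                                            ∎)
        where
        zero′ : 𝟙 (k ℕ.≟ 1) * ℓ k ≡ ι 0
        zero′ with k ℕ.≟ 1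
        ... | yes refl = trans (*-identityˡ _) ℓ-1
        ... | no _ = *-zeroˡ _
      inner : ∀ m → 1 ℕ.≤ m → m ℕ.≤ x → ∑ (x ÷ m) (λ d → 𝟙 (d ℕ.* m ∣? n) * (μ d * (ℓ (d ℕ.* m) - ℓ d))) ≡ 𝟙 (m ℕ.≟ n) * ℓ m
      inner m 1≤m m≤x with m ∣? n
      ... | no m∤n = trans (∑-zero (x ÷ m) (λ d _ _ → trans (cong (_* (μ d * (ℓ (d ℕ.* m) - ℓ d))) (𝟙-no (d ℕ.* m ∣? n) (λ h → m∤n (∣-trans (n∣m*n d) h)))) (*-zeroˡ _)))
                       (sym (trans (cong (_* ℓ m) (𝟙-no (m ℕ.≟ n) (λ { refl → m∤n (divides 1 (sym (ℕ.*-identityˡ _))) }))) (*-zeroˡ _)))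
      ... | yes (divides N refl) = begin
        ∑ (x ÷ m) (λ d → 𝟙 (d ℕ.* m ∣? (N ℕ.* m)) * (μ d * (ℓ (d ℕ.* m) - ℓ d)))   ≡⟨ ∑-cong (x ÷ m) (λ d 1≤d _ → trans (cong₂ (λ a b → a * (μ d * (b - ℓ d))) (𝟙-⇔ (d ℕ.* m ∣? (N ℕ.* m)) (d ∣? N) (*-cancelʳ-∣ m) (λ { (divides q refl) → divides q (ℕ.*-assoc q d m) })) (ℓ-* 1≤d 1≤m))
                                                                                      (ring 4 λ a b u v → a :* (b :* (u :+ v :- u)) := a :* b :* v)) ⟩
        ∑ (x ÷ m) (λ d → 𝟙 (d ∣? N) * μ d * ℓ m)                                    ≡⟨ ∑-*ʳ (x ÷ m) (ℓ m) _ ⟩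
        ∑ (x ÷ m) (λ d → 𝟙 (d ∣? N) * μ d) * ℓ m                                    ≡⟨ cong (_* ℓ m) (∑-μ (x ÷ m) N 1≤N (÷-≤ 1≤m (subst (ℕ._≤ x) (ℕ.*-comm N m) n≤x))) ⟩
        𝟙 (N ℕ.≟ 1) * ℓ m                                                           ≡⟨ cong (_* ℓ m) (𝟙-⇔ (N ℕ.≟ 1) (m ℕ.≟ N ℕ.* m) (λ { refl → sym (ℕ.*-identityˡ m) }) (λ e → ℕ.*-cancelʳ-≡ N 1 m (trans (sym e) (sym (ℕ.*-identityˡ m))))) ⟩
        𝟙 (m ℕ.≟ N ℕ.* m) * ℓ m                                                     ∎
        where
        instance
          m≢0 : ℕ.NonZero m
          m≢0 = ℕ.>-nonZero 1≤m
        1≤N : 1 ℕ.≤ N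
        1≤N = ℕ.n≢0⇒n>0 λ { refl → ℕ.<⇒≢ 1≤n refl }

-- Approximate logarithms and their elementary sums.

module Log where
  open import Data.List using ([]; _∷_)
  open import Data.List.Relation.Unary.All using (All; []; _∷_)
  open import Data.Nat.ListAction using (product)
  open import Data.Nat.Primality using (productOfPrimes≥1)
  open Field
  open Sums
  open Factors
  open Mobius

  open ≡-Reasoning

  ι*inv* : ∀ m n → 1 ℕ.≤ m → ι m * inv (m ℕ.* n) ≡ inv n
  ι*inv* m@(suc _) n _ = begin
    ι m * inv (m ℕ.* n)     ≡⟨ cong (ι m *_) (inv-* m n) ⟩
    ι m * (inv m * inv n)   ≡⟨ *-assoc _ _ _ ⟨
    ι m * inv m * inv n     ≡⟨ cong (_* inv n) (trans (*-comm _ _) (inv*ι m)) ⟩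
    ι 1 * inv n             ≡⟨ *-identityˡ _ ⟩
    inv n                   ∎

  frac : ∀ x k → 1 ℕ.≤ k → (ι (x ÷ k) ≤ ι x * inv k) × (ι x * inv k ≤ ι (x ÷ k) + ι 1)
  frac x k@(suc _) p = ι-cancelˡ k (≤-trans (≤-reflexive (sym (ι-* k (x ÷ k)))) (≤-trans (ι-mono (÷-* x k)) (≤-reflexive (sym kx))))
                     , ι-cancelˡ k (≤-trans (≤-reflexive kx) (≤-trans (ι-mono (ℕ.<⇒≤ (÷-< x k p))) (≤-reflexive (trans (ι-* k _) (cong (ι k *_) (ι-suc _))))))
    where
    kx : ι k * (ι x * inv k) ≡ ι x
    kx = trans (ring 3 λ k x i → k :* (x :* i) := x :* (i :* k)) (trans (cong (ι x *_) (inv*ι k)) (*-identityʳ _))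

  inv-diff : ∀ n → inv (suc n) - inv (suc (suc n)) ≡ inv (suc n) * inv (suc (suc n))
  inv-diff n = begin
    a - b                               ≡⟨ ring 2 (λ a b → a :- b := a :* con 1 :- con 1 :* b) ⟩
    a * ι 1 - ι 1 * b                   ≡⟨ cong₂ (λ u v → a * u - v * b) (inv*ι (suc (suc n))) (inv*ι (suc n)) ⟨
    a * (b * ι (suc (suc n))) - a * ι (suc n) * b ≡⟨ cong (λ z → a * (b * z) - a * ι (suc n) * b) (ι-suc (suc n)) ⟩
    a * (b * (ι (suc n) + ι 1)) - a * ι (suc n) * b ≡⟨ ring 3 (λ a b k → a :* (b :* (k :+ con 1)) :- a :* k :* b := a :* b) ⟩
    a * b                               ∎
    where
    a = inv (suc n)
    b = inv (suc (suc n))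

  -- DiffBound X L: on [1, X] the additive extension of L moves like the logarithm.
  DiffBound : ℕ → (ℕ → ℚ) → Set
  DiffBound X L = ∀ n → 1 ℕ.≤ n → n ℕ.< X → Bd (ℓ (suc n) - ℓ n - inv n) (ι 2 * (inv n - inv (suc n)))
    where open Additive L

  module Existence where

    H : ℕ → ℚ
    H n = ∑ n inv

    inv-block : ∀ m K → 1 ℕ.≤ m → 1 ℕ.≤ K → (inv (suc K) ≤ H (m ℕ.* suc K) - H (m ℕ.* K)) × (H (m ℕ.* suc K) - H (m ℕ.* K) ≤ inv K)
    inv-block m K 1≤m 1≤K = subst (inv (suc K) ≤_) (sym eq) lower , subst (_≤ inv K) (sym eq) upper
      where
      instance
        m≢0 : ℕ.NonZero m
        m≢0 = ℕ.>-nonZero 1≤m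
        mK≢0 : ℕ.NonZero (m ℕ.* K)
        mK≢0 = ℕ.>-nonZero (ℕ.*-mono-≤ 1≤m 1≤K)
      eq : H (m ℕ.* suc K) - H (m ℕ.* K) ≡ ∑ m (λ i → inv (m ℕ.* K ℕ.+ i))
      eq = trans (cong (λ z → H z - H (m ℕ.* K)) (trans (ℕ.*-suc m K) (ℕ.+-comm m _)))
             (trans (cong (_- H (m ℕ.* K)) (∑-split (m ℕ.* K) m inv)) (ring 2 λ a b → a :+ b :- a := b))
      lower : inv (suc K) ≤ ∑ m (λ i → inv (m ℕ.* K ℕ.+ i))
      lower = ≤-trans (≤-reflexive (sym (trans (∑-const m _) (ι*inv* m (suc K) 1≤m))))
        (∑-mono m (λ i 1≤i i≤m → inv-anti {m ℕ.* K ℕ.+ i} {m ℕ.* suc K} {{ℕ.>-nonZero (ℕ.≤-trans 1≤i (ℕ.m≤n+m i _))}} (ℕ.≤-trans (ℕ.+-monoʳ-≤ (m ℕ.* K) i≤m) (ℕ.≤-reflexive (trans (ℕ.+-comm _ m) (sym (ℕ.*-suc m K)))))))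
      upper : ∑ m (λ i → inv (m ℕ.* K ℕ.+ i)) ≤ inv K
      upper = ≤-trans (∑-mono m (λ i _ _ → inv-anti (ℕ.m≤m+n (m ℕ.* K) i))) (≤-reflexive (trans (∑-const m _) (ι*inv* m K 1≤m)))

    -- When `K` grows by one, H(m K) - H(K) gains a block sum from [1 / (K + 1), 1 / K] and loses 1
    -- / (K + 1). The gain is between 0 and 1 / K - 1 / (K + 1), and these telescope.
    D-bound : ∀ m K k → 1 ℕ.≤ m → 1 ℕ.≤ K →
      Bd ((H (m ℕ.* (k ℕ.+ K)) - H (k ℕ.+ K)) - (H (m ℕ.* K) - H K)) (inv K - inv (k ℕ.+ K))
    D-bound m K zero 1≤m 1≤K = Bd-≡ (ring 2 λ a b → con 0 := (a :- b) :- (a :- b)) (Bd-0 (≤-reflexive (ring 1 λ a → con 0 := a :- a)))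
    D-bound m K (suc k) 1≤m 1≤K with D-bound m K k 1≤m 1≤K | inv-block m (k ℕ.+ K) 1≤m (ℕ.≤-trans 1≤K (ℕ.m≤n+m K k))
    ... | l , u | lo , up =
        lin (l ⊞ lo ⊞ inv-anti {k ℕ.+ K} {suc (k ℕ.+ K)} {{ℕ.>-nonZero (ℕ.≤-trans 1≤K (ℕ.m≤n+m K k))}} (ℕ.n≤1+n _)) (ring 8 λ hm hm′ h hmK hK i i′ iK →
          (hm′ :- (h :+ i′)) :- (hmK :- hK) :+ (:- (iK :- i) :+ (i′ :+ i′)) := :- (iK :- i′) :+ (((hm :- h) :- (hmK :- hK)) :+ (hm′ :- hm :+ i)))
      , lin (u ⊞ up) (ring 8 λ hm hm′ h hmK hK i i′ iK →
          (iK :- i′) :+ (((hm :- h) :- (hmK :- hK)) :+ (hm′ :- hm)) := ((hm′ :- (h :+ i′)) :- (hmK :- hK)) :+ ((iK :- i) :+ i))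

    module _ (M : ℕ) (1≤M : 1 ℕ.≤ M) where
      private
        instance
          M≢0 : ℕ.NonZero M
          M≢0 = ℕ.>-nonZero 1≤M

      -- The harmonic sum over (M, n M], close to log n. It is additive only up to 1 / M, so just
      -- its values at primes enter `ℓ`.
      h : ℕ → ℚ
      h n = H (n ℕ.* M) - H M

      open Additive h

      h-* : ∀ m n → 1 ℕ.≤ m → 1 ℕ.≤ n → Bd (h (m ℕ.* n) - (h m + h n)) (inv M)
      h-* m (suc n) 1≤m _ with D-bound m M (n ℕ.* M) 1≤m 1≤M
      ... | b rewrite ℕ.+-comm (n ℕ.* M) M = Bd-≤ (lin (inv≥0 (M ℕ.+ n ℕ.* M)) (ring 2 λ a b → a :+ con 0 := a :- b :+ b))
            (Bd-≡ (trans (cong (λ z → (H z - H (M ℕ.+ n ℕ.* M)) - (H (m ℕ.* M) - H M)) (sym (ℕ.*-assoc m (suc n) M)))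
               (ring 4 λ a b c d → (a :- b) :- (c :- d) := (a :- d) :- ((c :- d) :+ (b :- d)))) b)

      h-sum : ∀ ps → All Prime ps → Bd (sumL ps - h (product ps)) (ι (length ps) * inv M)
      h-sum [] [] = Bd-≡ (trans (ring 1 λ a → con 0 := con 0 :- (a :- a)) (cong (λ z → ι 0 - (H z - H M)) (sym (ℕ.*-identityˡ M)))) (Bd-0 (*≥0 (ι≥0 0) (inv≥0 M)))
      h-sum (p ∷ ps) (pr ∷ prs) = Bd-≡ (ring 4 λ hp s hps hpps → s :- hps :- (hpps :- (hp :+ hps)) := hp :+ s :- hpps)
        (Bd-≤ (≤-reflexive (trans (ring 2 λ n i → n :* i :+ i := (n :+ con 1) :* i) (cong (_* inv M) (sym (ι-suc (length ps))))))
          (Bd-- (h-sum ps prs) (h-* p (product ps) (prime>0 pr) (productOfPrimes≥1 prs))))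

      length≤product : ∀ ps → All Prime ps → length ps ℕ.≤ product ps
      length≤product [] [] = z≤n
      length≤product (p ∷ ps) (pr ∷ prs) = ℕ.≤-trans (ℕ.+-mono-≤ (productOfPrimes≥1 prs) (length≤product ps prs))
        (ℕ.≤-trans (ℕ.≤-reflexive (cong (product ps ℕ.+_) (sym (ℕ.+-identityʳ _)))) (ℕ.*-monoˡ-≤ (product ps) (prime>1 pr)))

      -- An error of 1 / M arises for each prime factor, and `n` has at most `n` of them.
      ℓ-h : ∀ n → 1 ℕ.≤ n → Bd (ℓ n - h n) (ι n * inv M)
      ℓ-h n 1≤n = subst (λ z → Bd (ℓ n - h z) (ι n * inv M)) (facs-product 1≤n)
        (Bd-≤ (*-mono (ι≥0 _) (inv≥0 M) (ι-mono (subst (length (facs n) ℕ.≤_) (facs-product 1≤n) (length≤product (facs n) (facs-prime n)))) ≤-refl) (h-sum (facs n) (facs-prime n)))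

      ℓ-diff : ∀ n → 1 ℕ.≤ n → (suc (n ℕ.+ n)) ℕ.* (n ℕ.* suc n) ℕ.≤ M → Bd (ℓ (suc n) - ℓ n - inv n) (ι 2 * (inv n - inv (suc n)))
      ℓ-diff n@(suc n′) 1≤n le = Bd-≡ (ring 5 λ l l′ k k′ i → (l′ :- k′) :- (l :- k) :+ (k′ :- k :- i) := l′ :- l :- i)
        (Bd-≤ small (Bd-+ (Bd-- (ℓ-h (suc n) (s≤s z≤n)) (ℓ-h n 1≤n)) hdiff))
        where
        hd = inv-block M n 1≤M 1≤n
        e : ∀ k → h k ≡ H (M ℕ.* k) - H M
        e k = cong (λ z → H z - H M) (ℕ.*-comm k M)
        hdiff : Bd (h (suc n) - h n - inv n) (inv n - inv (suc n))
        hdiff rewrite e (suc n) | e n =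
            lin (proj₁ hd) (ring 5 λ a b c i i′ → (a :- c :- (b :- c) :- i) :+ i′ := :- (i :- i′) :+ (a :- b))
          , lin (proj₂ hd ⊞ inv-anti (ℕ.n≤1+n n)) (ring 5 λ a b c i i′ → (i :- i′) :+ (a :- b :+ i′) := (a :- c :- (b :- c) :- i) :+ (i :+ i))
        bound : ι (suc (n ℕ.+ n)) * inv M ≤ inv n - inv (suc n)
        bound = ≤-trans (ι≥0 (suc (n ℕ.+ n)) ⊛ inv-anti le) (≤-reflexive (trans (ι*inv* (suc (n ℕ.+ n)) (n ℕ.* suc n) (s≤s z≤n)) (trans (inv-* n (suc n)) (sym (inv-diff n′)))))
        small : ι (suc n) * inv M + ι n * inv M + (inv n - inv (suc n)) ≤ ι 2 * (inv n - inv (suc n))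
        small = lin (bound ⊞ ≤-reflexive (cong (_* inv M) (sym (ι-suc (n ℕ.+ n)))) ⊞ ≤-reflexive (cong (_* inv M) (sym (ι-+ n n))) ⊞ ≤-reflexive (cong (_* inv M) (ι-suc n)))
          (ring 6 λ s n sn nn i d → con 2 :* d :+ (s :* i :+ ((nn :+ con 1) :* i :+ ((n :+ n) :* i :+ sn :* i))) :=
                                    sn :* i :+ n :* i :+ d :+ (d :+ (s :* i :+ (nn :* i :+ (n :+ con 1) :* i))))

    logarithm : ∀ X → Σ (ℕ → ℚ) (DiffBound X)
    logarithm X = h M 1≤M , λ n 1≤n n<X → ℓ-diff M 1≤M n 1≤n
        (ℕ.≤-trans (ℕ.*-mono-≤ (s≤s (ℕ.+-mono-≤ (ℕ.<⇒≤ n<X) (ℕ.<⇒≤ n<X))) (ℕ.*-mono-≤ (ℕ.<⇒≤ n<X) (ℕ.m≤n⇒m≤1+n n<X))) (ℕ.n≤1+n _))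
      where
      -- Exceeds (2 n + 1) n (n + 1) for all n < X, so that the errors (2 n + 1) / M from `ℓ-h` fit
      -- into 1 / n - 1 / (n + 1). The outer `suc` keeps it positive for X = 0.
      M = suc (suc (X ℕ.+ X) ℕ.* (X ℕ.* suc X))
      1≤M : 1 ℕ.≤ M
      1≤M = s≤s z≤n

  module Estimates (X : ℕ) (L : ℕ → ℚ) (diff : DiffBound X L) where
    open Additive L public

    private
      inv-step : ∀ n → 1 ℕ.≤ n → inv (suc n) ≤ inv n
      inv-step (suc n) _ = inv-anti (ℕ.n≤1+n _)

      inv-half : ∀ n → 1 ℕ.≤ n → inv n ≤ ι 2 * inv (suc n)
      inv-half (suc n) _ = ≤-trans (≤-reflexive (sym (ι*inv* 2 (suc n) (s≤s z≤n)))) (ι≥0 2 ⊛ inv-anti {suc (suc n)} {2 ℕ.* suc n} (ℕ.≤-trans (s≤s (ℕ.m≤n+m (suc n) n)) (ℕ.≤-reflexive (cong (suc n ℕ.+_) (sym (ℕ.+-identityʳ (suc n)))))))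

    ℓ-diff≥ : ∀ n → 1 ℕ.≤ n → n ℕ.< X → ι 2 * inv (suc n) - inv n ≤ ℓ (suc n) - ℓ n
    ℓ-diff≥ n p q = lin (proj₁ (diff n p q)) (ring 4 λ l l′ i i′ → l′ :- l :+ :- (con 2 :* (i :- i′)) := con 2 :* i′ :- i :+ (l′ :- l :- i))

    ℓ-diff≤ : ∀ n → 1 ℕ.≤ n → n ℕ.< X → ℓ (suc n) - ℓ n ≤ ι 2 * inv n
    ℓ-diff≤ n p q = lin (proj₂ (diff n p q) ⊞ inv-half n p) (ring 4 λ l l′ i i′ → con 2 :* i :+ (l′ :- l :- i :+ i) := l′ :- l :+ (con 2 :* (i :- i′) :+ con 2 :* i′))

    ℓ-step : ∀ n → 1 ℕ.≤ n → n ℕ.< X → ℓ n ≤ ℓ (suc n)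
    ℓ-step n p q = lin (ℓ-diff≥ n p q ⊞ inv-half n p) (ring 4 λ l l′ i i′ → l′ :+ (con 2 :* i′ :- i :+ i) := l :+ (l′ :- l :+ con 2 :* i′))

    ℓ-mono : ∀ {m n} → 1 ℕ.≤ m → m ℕ.≤ n → n ℕ.≤ X → ℓ m ≤ ℓ n
    ℓ-mono {m} {n} 1≤m m≤n n≤X = go (ℕ.≤⇒≤′ m≤n) n≤X
      where
      go : ∀ {n} → m ℕ.≤′ n → n ℕ.≤ X → ℓ m ≤ ℓ n
      go (ℕ.≤′-reflexive refl) _ = ≤-refl
      go (ℕ.≤′-step h) q = ≤-trans (go h (ℕ.<⇒≤ q)) (ℓ-step _ (ℕ.≤-trans 1≤m (ℕ.≤′⇒≤ h)) q)

    ℓ≥0 : ∀ {n} → 1 ℕ.≤ n → n ℕ.≤ X → ι 0 ≤ ℓ n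
    ℓ≥0 {n} p q = subst (_≤ ℓ n) ℓ-1 (ℓ-mono ℕ.≤-refl p q)

    ℓ≤2n : ∀ n → n ℕ.< X → ℓ (suc n) ≤ ι 2 * ι n
    ℓ≤2n zero q = ≤-reflexive (trans ℓ-1 (ring 0 (con 0 := con 2 :* con 0)))
    ℓ≤2n (suc n) q = lin (ℓ≤2n n (ℕ.<⇒≤ q) ⊞ ℓ-diff≤ (suc n) (s≤s z≤n) q ⊞ ι≥0 2 ⊛ inv≤1 (suc n) ⊞ ι≥0 2 ⊛ ≤-reflexive (sym (ι-suc n)))
      (ring 5 λ l l′ n n′ i → con 2 :* n′ :+ (l :+ (l′ :- l :+ (con 2 :* i :+ con 2 :* (n :+ con 1)))) := l′ :+ (con 2 :* n :+ (con 2 :* i :+ (con 2 :* con 1 :+ con 2 :* n′))))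

    -- Stirling's formula. The induction carries a sharper error, smaller by 2 / y: a step costs y ·
    -- 2 (1 / y - 1 / (y + 1)) = 2 / (y + 1), and this is paid by the growth of 2 ℓ(y), which is at
    -- least 4 / (y + 1) - 2 / y.
    ∑ℓ : ∀ y → 1 ℕ.≤ y → y ℕ.≤ X → Bd (∑ y ℓ - ι y * ℓ y + ι y) (ι 2 * ℓ y + ι 3)
    ∑ℓ y p q = Bd-≤ (lin (inv≥0 y) (ring 2 λ l i → con 2 :* l :+ con 3 :+ con 0 := con 2 :* l :+ con 3 :- con 2 :* i :+ i :+ i) ∙ inv≥0 y) (go y p q)
      where
      _∙_ : ∀ {a b i} → a + i ≤ b → ι 0 ≤ i → a ≤ b
      _∙_ h h′ = lin (h ⊞ h′) (ring 3 λ a b i → b :+ (a :+ i :+ con 0) := a :+ (b :+ i))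
      go : ∀ y → 1 ℕ.≤ y → y ℕ.≤ X → Bd (∑ y ℓ - ι y * ℓ y + ι y) (ι 2 * ℓ y + ι 3 - ι 2 * inv y)
      go 1 p q = Bd-≡ (ring 1 λ l → con 1 := con 0 :+ l :- con 1 :* l :+ con 1) (Bd-≤ (≤-reflexive (trans (ring 0 (con 1 := con 2 :* con 0 :+ con 3 :- con 2 :* con 1)) (cong₂ (λ a b → ι 2 * a + ι 3 - ι 2 * b) (sym ℓ-1) (sym inv1)))) (Bd-self 0≤1))
      go (suc y@(suc y′)) p q with go y (s≤s z≤n) (ℕ.<⇒≤ q)
      ... | ih = Bd-≡ eq (Bd-≤ le (Bd-- ih (Bd-*ˡ (ι≥0 y) (diff y (s≤s z≤n) q))))
        where
        yinv : ι y * inv y ≡ ι 1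
        yinv = trans (*-comm _ _) (inv*ι y)
        eq : ∑ y ℓ - ι y * ℓ y + ι y - ι y * (ℓ (suc y) - ℓ y - inv y) ≡ ∑ y ℓ + ℓ (suc y) - ι (suc y) * ℓ (suc y) + ι (suc y)
        eq = trans (ring 5 λ s y l l′ i → s :- y :* l :+ y :- y :* (l′ :- l :- i) := s :+ l′ :- (y :+ con 1) :* l′ :+ (y :+ y :* i)) (cong₂ (λ a b → ∑ y ℓ + ℓ (suc y) - a * ℓ (suc y) + b) (sym (ι-suc y)) (trans (cong (λ z → ι y + z) yinv) (sym (ι-suc y))))
        yd : ι y * (inv y - inv (suc y)) ≡ inv (suc y)
        yd = trans (cong (ι y *_) (inv-diff y′)) (trans (sym (*-assoc _ _ _)) (trans (cong (_* inv (suc y)) yinv) (*-identityˡ _)))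
        le : ι 2 * ℓ y + ι 3 - ι 2 * inv y + ι y * (ι 2 * (inv y - inv (suc y))) ≤ ι 2 * ℓ (suc y) + ι 3 - ι 2 * inv (suc y)
        le = lin (ι≥0 2 ⊛ ℓ-diff≥ y (s≤s z≤n) q ⊞ ι≥0 2 ⊛ ≤-reflexive yd)
          (ring 5 λ l l′ i i′ y → con 2 :* l′ :+ con 3 :- con 2 :* i′ :+ (con 2 :* (con 2 :* i′ :- i) :+ con 2 :* (y :* (i :- i′))) := con 2 :* l :+ con 3 :- con 2 :* i :+ y :* (con 2 :* (i :- i′)) :+ (con 2 :* (l′ :- l) :+ con 2 :* i′))

    H-ℓ : ∀ y k → 1 ℕ.≤ y → y ℕ.+ k ℕ.≤ X → Bd (∑ (y ℕ.+ k) inv - ∑ y inv - (ℓ (y ℕ.+ k) - ℓ y)) (ι 3 * inv y)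
    H-ℓ y k 1≤y q = Bd-≤ (lin (ι≥0 3 ⊛ inv≥0 (y ℕ.+ k)) (ring 2 λ a b → con 3 :* a :+ con 3 :* con 0 := con 3 :* (a :- b) :+ con 3 :* b)) (go k q)
      where
      go : ∀ k → y ℕ.+ k ℕ.≤ X → Bd (∑ (y ℕ.+ k) inv - ∑ y inv - (ℓ (y ℕ.+ k) - ℓ y)) (ι 3 * (inv y - inv (y ℕ.+ k)))
      go zero _ rewrite ℕ.+-identityʳ y = Bd-≡ (ring 2 λ h l → con 0 := h :- h :- (l :- l)) (Bd-0 (≤-reflexive (ring 1 λ a → con 0 := con 3 :* (a :- a))))
      go (suc k) q rewrite ℕ.+-suc y k = Bd-≡ (ring 6 λ h h₀ l l₀ l′ i → h :- h₀ :- (l :- l₀) :+ :- (l′ :- l :- i) := h :+ i :- h₀ :- (l′ :- l₀))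
        (go-step)
        where
        1≤ = ℕ.≤-trans 1≤y (ℕ.m≤m+n y k)
        d = diff (y ℕ.+ k) 1≤ q
        st = inv-step (y ℕ.+ k) 1≤
        go-step : Bd (∑ (y ℕ.+ k) inv - ∑ y inv - (ℓ (y ℕ.+ k) - ℓ y) + - (ℓ (suc (y ℕ.+ k)) - ℓ (y ℕ.+ k) - inv (suc (y ℕ.+ k)))) (ι 3 * (inv y - inv (suc (y ℕ.+ k))))
        go-step = Bd-≤ (≤-reflexive (ring 3 λ a b c → con 3 :* (a :- b) :+ con 3 :* (b :- c) := con 3 :* (a :- c))) (Bd-+ (go k (ℕ.<⇒≤ q))
          ( lin (proj₂ d) (ring 4 λ l l′ i i′ → :- (l′ :- l :- i′) :+ (l′ :- l :- i) := :- (con 3 :* (i :- i′)) :+ con 2 :* (i :- i′))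
          , lin (proj₁ d ⊞ ι≥0 2 ⊛ st) (ring 4 λ l l′ i i′ → con 3 :* (i :- i′) :+ (:- (con 2 :* (i :- i′)) :+ con 2 :* i′) := :- (l′ :- l :- i′) :+ (l′ :- l :- i :+ con 2 :* i))))

    ∑-log : ∀ x → 1 ℕ.≤ x → x ℕ.≤ X → ∑ x (λ d → ℓ x - ℓ d) ≤ ι 2 * ι x
    ∑-log 1 p q = lin (ι≥0 2) (ring 1 λ l → con 2 :* con 1 :+ con 0 := con 0 :+ (l :- l) :+ con 2)
    ∑-log (suc x@(suc _)) p q = ≤-trans (≤-reflexive eq) (lin (∑-log x (s≤s z≤n) (ℕ.<⇒≤ q) ⊞ ι≥0 x ⊛ ℓ-diff≤ x (s≤s z≤n) q ⊞ ι≥0 2 ⊛ ≤-reflexive (trans (*-comm _ _) (inv*ι x)) ⊞ ι≥0 2 ⊛ ≤-reflexive (sym (ι-suc x)))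
        (ring 6 λ s x x′ l l′ i → con 2 :* x′ :+ (s :+ (x :* (l′ :- l) :+ (con 2 :* (x :* i) :+ con 2 :* (x :+ con 1)))) := s :+ x :* (l′ :- l) :+ (con 2 :* x :+ (x :* (con 2 :* i) :+ (con 2 :* con 1 :+ con 2 :* x′)))))
      where
      eq : ∑ x (λ d → ℓ (suc x) - ℓ d) + (ℓ (suc x) - ℓ (suc x)) ≡ ∑ x (λ d → ℓ x - ℓ d) + ι x * (ℓ (suc x) - ℓ x)
      eq = trans (cong (_+ (ℓ (suc x) - ℓ (suc x))) (trans (∑-cong′ x (λ d → ring 3 λ a b c → a :- b := c :- b :+ (a :- c))) (trans (∑-+ x _ _) (cong (λ z → ∑ x (λ d → ℓ x - ℓ d) + z) (∑-const x _))))) (ring 3 λ a b c → a :+ b :+ (c :- c) := a :+ b)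

    -- Passing from `x` to x + 1 raises every logarithm by δ ≤ 2 / x. The cross terms add at most 2
    -- δ · 2 x ≤ 8 and the squares x δ² ≤ 4, whence 12.
    ∑-log² : ∀ x → 1 ℕ.≤ x → x ℕ.≤ X → ∑ x (λ d → (ℓ x - ℓ d) * (ℓ x - ℓ d)) ≤ ι 12 * ι x
    ∑-log² 1 p q = lin (ι≥0 12) (ring 1 λ l → con 12 :* con 1 :+ con 0 := con 0 :+ (l :- l) :* (l :- l) :+ con 12)
    ∑-log² (suc x@(suc _)) p q = ≤-trans (≤-reflexive eq) (lin
        (∑-log² x (s≤s z≤n) (ℕ.<⇒≤ q) ⊞ *≥0 (ι≥0 2) δ≥0 ⊛ ∑-log x (s≤s z≤n) (ℕ.<⇒≤ q) ⊞ ι≥0 4 ⊛ xδ ⊞ *-mono δ≥0 (ι≥0 2) δ≤ xδ ⊞ ι≥0 12 ⊛ ≤-reflexive (sym (ι-suc x)))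
        (ring 5 λ s u x x′ t → con 12 :* x′ :+ (t :+ (con 2 :* s :* u :+ (con 4 :* (x :* s) :+ (s :* (x :* s) :+ con 12 :* (x :+ con 1))))) :=
           t :+ con 2 :* s :* u :+ s :* (x :* s) :+ (con 12 :* x :+ (con 2 :* s :* (con 2 :* x) :+ (con 4 :* con 2 :+ (con 2 :* con 2 :+ con 12 :* x′))))))
      where
      δ = ℓ (suc x) - ℓ x
      δ≥0 : ι 0 ≤ δ
      δ≥0 = sub≥0 (ℓ-step x (s≤s z≤n) q)
      xδ : ι x * δ ≤ ι 2
      xδ = ≤-trans (ι≥0 x ⊛ ℓ-diff≤ x (s≤s z≤n) q) (≤-reflexive (trans (ring 2 λ x i → x :* (con 2 :* i) := con 2 :* (i :* x)) (trans (cong (ι 2 *_) (inv*ι x)) (*-identityʳ _))))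
      δ≤ : δ ≤ ι 2
      δ≤ = ≤-trans (ℓ-diff≤ x (s≤s z≤n) q) (lin (ι≥0 2 ⊛ inv≤1 x) (ring 1 λ i → con 2 :+ con 2 :* i := con 2 :* i :+ con 2 :* con 1))
      U = ∑ x (λ d → ℓ x - ℓ d)
      eq : ∑ x (λ d → (ℓ (suc x) - ℓ d) * (ℓ (suc x) - ℓ d)) + (ℓ (suc x) - ℓ (suc x)) * (ℓ (suc x) - ℓ (suc x)) ≡ ∑ x (λ d → (ℓ x - ℓ d) * (ℓ x - ℓ d)) + ι 2 * δ * U + δ * (ι x * δ)
      eq = begin
        _ ≡⟨ cong (_+ (ℓ (suc x) - ℓ (suc x)) * (ℓ (suc x) - ℓ (suc x))) (∑-cong′ x (λ d → ring 3 λ a b c → (a :- b) :* (a :- b) := (c :- b) :* (c :- b) :+ con 2 :* (a :- c) :* (c :- b) :+ (a :- c) :* (a :- c))) ⟩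
        _ ≡⟨ cong (_+ (ℓ (suc x) - ℓ (suc x)) * (ℓ (suc x) - ℓ (suc x))) (trans (∑-+ x _ _) (cong₂ _+_ (trans (∑-+ x _ _) (cong (λ z → ∑ x (λ d → (ℓ x - ℓ d) * (ℓ x - ℓ d)) + z) (∑-*ˡ x _ _))) (∑-const x _))) ⟩
        _ ≡⟨ ring 5 (λ t u s x c → t :+ con 2 :* s :* u :+ x :* (s :* s) :+ (c :- c) :* (c :- c) := t :+ con 2 :* s :* u :+ s :* (x :* s)) ⟩
        _ ∎

    module _ (4≤X : 4 ℕ.≤ X) where
      ℓ2≤2 : ℓ 2 ≤ ι 2
      ℓ2≤2 = ≤-trans (ℓ≤2n 1 (ℕ.≤-trans (s≤s (s≤s z≤n)) 4≤X)) (≤-reflexive (*-identityʳ _))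

      -- As ℓ 4 = 2 ℓ 2, the value ℓ 2 is the sum of the differences at 2 and 3, at least (2/3 -
      -- 1/2) + (2/4 - 1/3) = 1/3.
      ℓ2≥ : inv 3 ≤ ℓ 2
      ℓ2≥ = lin (ℓ-diff≥ 2 (s≤s z≤n) (ℕ.≤-trans (s≤s (s≤s (s≤s z≤n))) 4≤X) ⊞ ℓ-diff≥ 3 (s≤s z≤n) 4≤X ⊞ ≤-reflexive (ℓ-* {2} {2} (s≤s z≤n) (s≤s z≤n)) ⊞ ≤-reflexive (sym (ι*inv* 2 2 (s≤s z≤n))))
        (ring 6 λ l2 l3 l4 i2 i3 i4 → l2 :+ (con 2 :* i3 :- i2 :+ (con 2 :* i4 :- i3 :+ (l4 :+ i2))) := i3 :+ (l3 :- l2 :+ (l4 :- l3 :+ (l2 :+ l2 :+ con 2 :* i4))))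

      ℓ-window : ∀ y y′ → 1 ℕ.≤ y → y′ ℕ.≤ 2 ℕ.* y → 1 ℕ.≤ y′ → 2 ℕ.* y ℕ.≤ X → ℓ y′ ≤ ℓ y + ι 2
      ℓ-window y y′ p q r s = lin (ℓ-mono r q s ⊞ ≤-reflexive (ℓ-* {2} {y} (s≤s z≤n) p) ⊞ ℓ2≤2) (ring 4 λ a b c d → b :+ con 2 :+ (a :+ (c :+ d)) := a :+ (c :+ (d :+ b :+ con 2)))

-- Residue classes modulo g.

module Residues (g : ℕ) {{g≢0 : NonZero g}} where
  open import Data.Nat.DivMod using (_%_; %-distribˡ-*; [m+n]%n≡m%n; [m+kn]%n≡m%n; m%n<n; m<n⇒m%n≡m; n%n≡0; m≡m%n+[m/n]*n)
  open import Data.Nat.Divisibility using (_∣_; ∣m+n∣m⇒∣n; ∣m∣n⇒∣m+n; n∣m*n; ∣-trans; ∣m⇒∣m*n; ∣n⇒∣m*n)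
  open import Data.Nat.Coprimality using (Coprime; coprime?; coprime-Bézout; 1-coprimeTo; coprime-divisor)
  open import Data.Nat.GCD using (module Bézout)
  open import Data.Nat.Solver using (module +-*-Solver)
  open Field
  open Sums

  infix 4 _≈_ _≈?_
  _≈_ : ℕ → ℕ → Set
  a ≈ b = a % g ≡ b % g

  _≈?_ : ∀ a b → Dec (a ≈ b)
  a ≈? b = a % g ℕ.≟ b % g

  *-cong≈ : ∀ {a b c d} → a ≈ b → c ≈ d → a ℕ.* c ≈ b ℕ.* d
  *-cong≈ {a} {b} {c} {d} p q = trans (%-distribˡ-* a c g) (trans (cong₂ (λ u v → u ℕ.* v % g) p q) (sym (%-distribˡ-* b d g)))

  ≡⇒≈ : ∀ {a b} → a ≡ b → a ≈ b
  ≡⇒≈ = cong (_% g)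

  ≈-cop : ∀ {a b} → a ≈ b → Coprime a g → Coprime b g
  ≈-cop {a} {b} p c {i} (i∣b , i∣g) = c (subst (i ∣_) (sym (m≡m%n+[m/n]*n a g)) (∣m∣n⇒∣m+n (subst (i ∣_) (sym p) i∣r) (∣-trans i∣g (n∣m*n (a ℕ./ g)))) , i∣g)
    where
    i∣r : i ∣ b % g
    i∣r = ∣m+n∣m⇒∣n (subst (i ∣_) (trans (m≡m%n+[m/n]*n b g) (ℕ.+-comm (b % g) _)) i∣b) (∣-trans i∣g (n∣m*n (b ℕ./ g)))

  cop-1 : Coprime 1 g
  cop-1 = 1-coprimeTo g

  cop-*⁻ˡ : ∀ {a} b → Coprime (a ℕ.* b) g → Coprime a g
  cop-*⁻ˡ b c (i∣a , i∣g) = c (∣m⇒∣m*n b i∣a , i∣g)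

  cop-*⁻ʳ : ∀ a {b} → Coprime (a ℕ.* b) g → Coprime b g
  cop-*⁻ʳ a c (i∣b , i∣g) = c (∣n⇒∣m*n a i∣b , i∣g)

  cop-* : ∀ {a b} → Coprime a g → Coprime b g → Coprime (a ℕ.* b) g
  cop-* {a} ca cb {i} (i∣ab , i∣g) = cb (coprime-divisor {n = a} (λ { (j∣i , j∣a) → ca (j∣a , ∣-trans j∣i i∣g) }) i∣ab , i∣g)

  inverse : ∀ k → Coprime k g → Σ ℕ λ k̄ → k ℕ.* k̄ ≈ 1
  inverse k c with coprime-Bézout c
  ... | Bézout.+- x y eq = x , trans (cong (_% g) (trans (ℕ.*-comm k x) (sym eq))) ([m+kn]%n≡m%n 1 y g)
  ... | Bézout.-+ x y eq = g′ ℕ.* x , trans (sym ([m+kn]%n≡m%n (k ℕ.* (g′ ℕ.* x)) y g)) (trans (cong (_% g) e) ([m+kn]%n≡m%n 1 (x ℕ.* k) g))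
    where
    g′ = ℕ.pred g
    e : k ℕ.* (g′ ℕ.* x) ℕ.+ y ℕ.* g ≡ 1 ℕ.+ (x ℕ.* k) ℕ.* g
    e = trans (cong (k ℕ.* (g′ ℕ.* x) ℕ.+_) (sym eq))
          (trans (solve 3 (λ k h x → k :× (h :× x) :⊕ (con 1 :⊕ x :× k) :≡ con 1 :⊕ (x :× k) :× (con 1 :⊕ h)) refl k g′ x)
                 (cong (λ z → 1 ℕ.+ (x ℕ.* k) ℕ.* z) (ℕ.suc-pred g)))
      where open +-*-Solver renaming (_:+_ to _:⊕_; _:*_ to _:×_; _:=_ to _:≡_) using (solve; con)

  inverse-cop : ∀ {k k̄} → k ℕ.* k̄ ≈ 1 → Coprime k̄ g
  inverse-cop {k} {k̄} p = cop-*⁻ʳ k (≈-cop {1} {k ℕ.* k̄} (sym p) cop-1)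

  *-cancel≈ : ∀ {k a b} → Coprime k g → k ℕ.* a ≈ k ℕ.* b → a ≈ b
  *-cancel≈ {k} {a} {b} c p with inverse k c
  ... | k̄ , q = trans (sym (e a)) (trans (*-cong≈ {k̄} {k̄} {k ℕ.* a} {k ℕ.* b} refl p) (e b))
    where
    e : ∀ x → k̄ ℕ.* (k ℕ.* x) ≈ x
    e x = trans (≡⇒≈ {k̄ ℕ.* (k ℕ.* x)} {k ℕ.* k̄ ℕ.* x} (trans (sym (ℕ.*-assoc k̄ k x)) (cong (ℕ._* x) (ℕ.*-comm k̄ k))))
            (trans (*-cong≈ {k ℕ.* k̄} {1} {x} {x} q refl) (≡⇒≈ {1 ℕ.* x} {x} (ℕ.*-identityˡ x)))

  divide : ∀ k a → Coprime k g → Coprime a g → Σ ℕ λ b → Coprime b g × b ℕ.* k ≈ a × (∀ j → j ℕ.* k ≈ a → j ≈ b) × (∀ j → j ≈ b → j ℕ.* k ≈ a)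
  divide k a ck ca with inverse k ck
  ... | k̄ , q = a ℕ.* k̄ , cop-* ca (inverse-cop {k} {k̄} q) , bk , to , λ j p → trans (*-cong≈ {j} {a ℕ.* k̄} {k} {k} p refl) bk
    where
    bk : a ℕ.* k̄ ℕ.* k ≈ a
    bk = trans (≡⇒≈ {a ℕ.* k̄ ℕ.* k} {a ℕ.* (k ℕ.* k̄)} (trans (ℕ.*-assoc a k̄ k) (cong (a ℕ.*_) (ℕ.*-comm k̄ k))))
           (trans (*-cong≈ {a} {a} {k ℕ.* k̄} {1} refl q) (≡⇒≈ {a ℕ.* 1} {a} (ℕ.*-identityʳ a)))
    to : ∀ j → j ℕ.* k ≈ a → j ≈ a ℕ.* k̄
    to j p = *-cancel≈ {k} {j} {a ℕ.* k̄} ck (trans (≡⇒≈ {k ℕ.* j} {j ℕ.* k} (ℕ.*-comm k j)) (trans p (trans (sym bk) (≡⇒≈ {a ℕ.* k̄ ℕ.* k} {k ℕ.* (a ℕ.* k̄)} (ℕ.*-comm _ k)))))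

  -- Representatives lie in 1, ..., g, the range of `∑ g`; the zero class is represented by `g`.
  rep : ℕ → ℕ
  rep a with a % g
  ... | zero = g
  ... | suc r = suc r

  rep≥1 : ∀ a → 1 ℕ.≤ rep a
  rep≥1 a with a % g
  ... | zero = ℕ.>-nonZero⁻¹ g
  ... | suc r = s≤s z≤n

  rep≤g : ∀ a → rep a ℕ.≤ g
  rep≤g a with a % g in eq
  ... | zero = ℕ.≤-refl
  ... | suc r = ℕ.<⇒≤ (subst (ℕ._< g) eq (m%n<n a g))

  rep≈ : ∀ a → rep a ≈ a
  rep≈ a with a % g in eq
  ... | zero = n%n≡0 g
  ... | suc r = m<n⇒m%n≡m (subst (ℕ._< g) eq (m%n<n a g))

  ≈-unique : ∀ {m n} → 1 ℕ.≤ m → m ℕ.≤ g → 1 ℕ.≤ n → n ℕ.≤ g → m ≈ n → m ≡ n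
  ≈-unique {m} {n} 1≤m m≤g 1≤n n≤g p with ℕ.m≤n⇒m<n∨m≡n m≤g | ℕ.m≤n⇒m<n∨m≡n n≤g
  ... | inj₁ m<g | inj₁ n<g = trans (sym (m<n⇒m%n≡m m<g)) (trans p (m<n⇒m%n≡m n<g))
  ... | inj₁ m<g | inj₂ refl = ⊥-elim (ℕ.<⇒≢ 1≤m (trans (sym (n%n≡0 g)) (trans (sym p) (m<n⇒m%n≡m m<g))))
  ... | inj₂ refl | inj₁ n<g = ⊥-elim (ℕ.<⇒≢ 1≤n (trans (sym (n%n≡0 g)) (trans p (m<n⇒m%n≡m n<g))))
  ... | inj₂ refl | inj₂ refl = refl

  rep-cong : ∀ {a b} → a ≈ b → rep a ≡ rep b
  rep-cong {a} {b} p = ≈-unique (rep≥1 a) (rep≤g a) (rep≥1 b) (rep≤g b) (trans (rep≈ a) (trans p (sym (rep≈ b))))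

  rep-id : ∀ {a} → 1 ℕ.≤ a → a ℕ.≤ g → rep a ≡ a
  rep-id {a} p q = ≈-unique (rep≥1 a) (rep≤g a) p q (rep≈ a)

  ∑-class : ∀ b → (f : ℕ → ℚ) → ∑ g (λ s → 𝟙 (s ≈? b) * f s) ≡ f (rep b)
  ∑-class b f = trans (∑-cong g (λ s p q → cong (_* f s) (𝟙-⇔ (s ≈? b) (s ℕ.≟ rep b) (λ h → ≈-unique p q (rep≥1 b) (rep≤g b) (trans h (sym (rep≈ b)))) λ { refl → rep≈ b })))
    (∑-single g (rep b) (rep≥1 b) (rep≤g b))

  period≈ : ∀ i → g ℕ.+ i ≈ i
  period≈ i = trans (cong (_% g) (ℕ.+-comm g i)) ([m+n]%n≡m%n i g)

  -- The principal character modulo `g`.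
  e : ℕ → ℚ
  e m = 𝟙 (coprime? m g)

  e-≈ : ∀ {a b} → a ≈ b → e a ≡ e b
  e-≈ {a} {b} p = 𝟙-⇔ (coprime? a g) (coprime? b g) (≈-cop {a} {b} p) (≈-cop {b} {a} (sym p))

  e-* : ∀ a b → e (a ℕ.* b) ≡ e a * e b
  e-* a b with coprime? a g | coprime? b g
  ... | yes p | yes q = trans (𝟙-yes (coprime? (a ℕ.* b) g) (cop-* p q)) (sym (*-identityˡ _))
  ... | yes p | no q = trans (𝟙-no (coprime? (a ℕ.* b) g) (λ h → q (cop-*⁻ʳ a h))) (sym (*-identityˡ _))
  ... | no p | _ = trans (𝟙-no (coprime? (a ℕ.* b) g) (λ h → p (cop-*⁻ˡ b h))) (sym (*-zeroˡ _))

  e≥0 : ∀ m → ι 0 ≤ e m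
  e≥0 m = 𝟙≥0 (coprime? m g)

  e≤1 : ∀ m → e m ≤ ι 1
  e≤1 m = 𝟙≤1 (coprime? m g)

  count : ℕ → ℕ
  count zero = 0
  count (suc n) with coprime? (suc n) g
  ... | yes _ = suc (count n)
  ... | no _ = count n

  ι-count : ∀ n → ι (count n) ≡ ∑ n e
  ι-count zero = refl
  ι-count (suc n) with coprime? (suc n) g
  ... | yes _ = trans (ι-suc (count n)) (cong (_+ ι 1) (ι-count n))
  ... | no _ = trans (ι-count n) (sym (+-identityʳ _))

  φ : ℕ
  φ = count g

  ι-φ : ι φ ≡ ∑ g e
  ι-φ = ι-count g

  φ≥1 : 1 ℕ.≤ φ
  φ≥1 = ι-cancel (subst₂ _≤_ (𝟙-yes (coprime? 1 g) cop-1) (sym ι-φ) (∑-≥ g {e} 1 ℕ.≤-refl (ℕ.>-nonZero⁻¹ g) (λ i _ _ → e≥0 i)))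

  instance
    φ≢0 : NonZero φ
    φ≢0 = ℕ.>-nonZero φ≥1

  φ≤g : ι φ ≤ ι g
  φ≤g = subst (_≤ ι g) (sym ι-φ) (≤-trans (∑-mono g (λ i _ _ → e≤1 i)) (≤-reflexive (trans (∑-const g _) (*-identityʳ _))))

  private
    1≤g : ι 1 ≤ ι g
    1≤g = ι-mono (ℕ.>-nonZero⁻¹ g)

  gg : ℚ
  gg = ι g * ι g

  -- Scaling the indicator by `g` and subtracting 1 gives zero sum over a period, so that the
  -- partial sums stay bounded and partial summation applies.
  class-partial : ∀ b n → Bd (∑ n (λ i → ι g * 𝟙 (i ≈? b) - ι 1)) gg
  class-partial b = periodic-Bd g _ (λ i → cong (λ z → ι g * z - ι 1) (𝟙-⇔ (g ℕ.+ i ≈? b) (i ≈? b) (trans (sym (period≈ i))) (trans (period≈ i))))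
    (λ i → bd (i ≈? b)) (trans (∑-- g _ _) (trans (cong₂ _-_ (trans (∑-*ˡ g (ι g) _) (cong (ι g *_) sum1)) (∑-const g (ι 1))) (ring 1 λ a → a :* con 1 :- a :* con 1 := con 0)))
    where
    sum1 : ∑ g (λ i → 𝟙 (i ≈? b)) ≡ ι 1
    sum1 = trans (∑-cong′ g (λ i → sym (*-identityʳ _))) (∑-class b (λ _ → ι 1))
    bd : ∀ {P : Set} (d : Dec P) → Bd (ι g * 𝟙 d - ι 1) (ι g)
    bd d = lin (1≤g ⊞ ι≥0 g ⊛ 𝟙≥0 d) (ring 2 λ g i → g :* i :- con 1 :+ (con 1 :+ g :* con 0) := :- g :+ (g :+ g :* i))
         , lin (ι≥0 g ⊛ 𝟙≤1 d ⊞ 0≤1) (ring 2 λ g i → g :+ (g :* i :+ con 0) := g :* i :- con 1 :+ (g :* con 1 :+ con 1))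

  cop-partial : ∀ n → Bd (∑ n (λ i → ι g * e i - ι φ)) gg
  cop-partial = periodic-Bd g _ (λ i → cong (λ z → ι g * z - ι φ) (e-≈ {g ℕ.+ i} {i} (period≈ i))) bd
    (trans (∑-- g _ _) (trans (cong₂ _-_ (trans (∑-*ˡ g (ι g) e) (cong (ι g *_) (sym ι-φ))) (∑-const g (ι φ))) (ring 2 λ a b → a :* b :- a :* b := con 0)))
    where
    bd : ∀ i → Bd (ι g * e i - ι φ) (ι g)
    bd i = lin (φ≤g ⊞ ι≥0 g ⊛ e≥0 i) (ring 3 λ g i f → g :* i :- f :+ (f :+ g :* con 0) := :- g :+ (g :+ g :* i))
         , lin (ι≥0 g ⊛ e≤1 i ⊞ ι≥0 φ) (ring 3 λ g i f → g :+ (g :* i :+ con 0) := g :* i :- f :+ (g :* con 1 :+ f))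

-- Chebyshev, Mertens and Selberg's symmetry formula in residue classes.

module Selberg (g : ℕ) {{g≢0 : NonZero g}} (X : ℕ) (4≤X : 4 ℕ.≤ X) (L : ℕ → Field.ℚ) (diff : Log.DiffBound X L) where
  open Field
  open Log
  open import Data.Nat.Divisibility using (_∣?_; ∣⇒≤; m∣m*n)
  open import Data.Nat.Coprimality using (Coprime; coprime?)
  open import Data.Nat.Induction using (<-rec)
  open Sums
  open Factors
  open Mobius
  open Estimates X L diff
  open Residues g

  open ≡-Reasoning

  Λ≥0 : ∀ n → 1 ℕ.≤ n → n ℕ.≤ X → ι 0 ≤ Λ n
  Λ≥0 n p q with Λ-cases n p
  ... | inj₁ z = ≤-reflexive (sym z)
  ... | inj₂ (r , k , pr , refl , z) = subst (ι 0 ≤_) (sym z) (ℓ≥0 (prime>0 pr) (ℕ.≤-trans (∣⇒≤ {{ℕ.>-nonZero p}} (m∣m*n (r ℕ.^ k))) q))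

  ψ : ℕ → ℚ
  ψ y = ∑ y Λ

  -- Write ℓ(n) as the sum of Λ(k) over k ∣ n and put n = k m. All later estimates of sums of `Λ`
  -- compare the two sides of this identity for some `h`.
  ∑-ℓ-Λ : ∀ y (h : ℕ → ℚ) → ∑ y (λ n → ℓ n * h n) ≡ ∑ y (λ k → Λ k * ∑ (y ÷ k) (λ m → h (k ℕ.* m)))
  ∑-ℓ-Λ y h = begin
    ∑ y (λ n → ℓ n * h n)                                      ≡⟨ ∑-cong y (λ n p q → trans (cong (_* h n) (sym (∑-Λ y n p q))) (sym (∑-*ʳ y (h n) _))) ⟩
    ∑ y (λ n → ∑ y (λ k → 𝟙 (k ∣? n) * Λ k * h n))             ≡⟨ ∑-cong′ y (λ n → ∑-cong′ y (λ k → *-assoc _ _ _)) ⟩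
    ∑ y (λ n → ∑ y (λ k → 𝟙 (k ∣? n) * (Λ k * h n)))           ≡⟨ ∑-divisors y (λ k n → Λ k * h n) ⟩
    ∑ y (λ k → ∑ (y ÷ k) (λ m → Λ k * h (k ℕ.* m)))            ≡⟨ ∑-cong′ y (λ k → ∑-*ˡ (y ÷ k) (Λ k) _) ⟩
    ∑ y (λ k → Λ k * ∑ (y ÷ k) (λ m → h (k ℕ.* m)))            ∎

  private
    T≡ : ∀ y → ∑ y ℓ ≡ ∑ y (λ k → Λ k * ι (y ÷ k))
    T≡ y = trans (∑-cong′ y (λ n → sym (*-identityʳ _))) (trans (∑-ℓ-Λ y (λ _ → ι 1)) (∑-cong′ y (λ k → cong (Λ k *_) (trans (∑-const (y ÷ k) (ι 1)) (*-identityʳ _)))))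

    double : ∀ y → y ℕ.+ y ≡ 2 ℕ.* y
    double y = cong (y ℕ.+_) (sym (ℕ.+-identityʳ y))

    -- The left side plays the role of the logarithm of the central binomial coefficient. A step
    -- adds ℓ(2 y + 1) + ℓ(2 y + 2) - 2 ℓ(y + 1), at most 2 ℓ 2 ≤ 4.
    T-double : ∀ y → y ℕ.+ y ℕ.≤ X → ∑ (y ℕ.+ y) ℓ - ι 2 * ∑ y ℓ ≤ ι 4 * ι y
    T-double zero _ = ≤-reflexive (ring 0 (con 0 :- con 2 :* con 0 := con 4 :* con 0))
    T-double (suc y) q rewrite ℕ.+-suc y y = lin
        (T-double y (ℕ.<⇒≤ (ℕ.<⇒≤ q)) ⊞ ℓ-mono (s≤s z≤n) (ℕ.n≤1+n _) q ⊞ ι≥0 2 ⊛ ≤-reflexive ℓ2y ⊞ ι≥0 2 ⊛ ℓ2≤2 4≤X ⊞ ι≥0 4 ⊛ ≤-reflexive (sym (ι-suc y)))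
        (ring 8 λ S s a b c l2 y y′ → con 4 :* y′ :+ (S :- con 2 :* s :+ (a :+ (con 2 :* b :+ (con 2 :* l2 :+ con 4 :* (y :+ con 1))))) :=
           S :+ a :+ b :- con 2 :* (s :+ c) :+ (con 4 :* y :+ (b :+ (con 2 :* (l2 :+ c) :+ (con 2 :* con 2 :+ con 4 :* y′)))))
      where
      ℓ2y : ℓ (suc (suc (y ℕ.+ y))) ≡ ℓ 2 + ℓ (suc y)
      ℓ2y = trans (cong ℓ (trans (cong suc (sym (ℕ.+-suc y y))) (double (suc y)))) (ℓ-* {2} {suc y} (s≤s z≤n) (s≤s z≤n))

  -- In the difference of `T-double` the coefficient ⌊2 y / k⌋ - 2 ⌊y / k⌋ of Λ(k) is never negative
  -- and is at least 1 for y < k ≤ 2 y.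
  ψ-double : ∀ y → y ℕ.+ y ℕ.≤ X → ψ (y ℕ.+ y) - ψ y ≤ ι 4 * ι y
  ψ-double y q = ≤-trans (≤-trans le1 (≤-reflexive eq)) (T-double y q)
    where
    2y = y ℕ.+ y
    y≤2y = ℕ.m≤m+n y y
    pos : ∀ k → 1 ℕ.≤ k → k ℕ.≤ 2y → ι 2 * ι (y ÷ k) + (ι 1 - 𝟙 (k ℕ.≤? y)) ≤ ι (2y ÷ k)
    pos k p r with k ℕ.≤? y
    ... | yes _ = ≤-trans (≤-reflexive (trans (ring 1 λ a → con 2 :* a :+ (con 1 :- con 1) := a :+ a) (sym (ι-+ _ _))))
            (ι-mono (÷-≤ p (ℕ.≤-trans (ℕ.≤-reflexive (ℕ.*-distribˡ-+ k _ _)) (ℕ.+-mono-≤ (÷-* y k) (÷-* y k)))))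
    ... | no k≰y = ≤-trans (≤-reflexive (trans (cong (λ z → ι 2 * ι z + (ι 1 - ι 0)) z0) (ring 0 (con 2 :* con 0 :+ (con 1 :- con 0) := con 1)))) (ι-mono (1≤÷ p r))
      where
      z0 : y ÷ k ≡ 0
      z0 = ℕ.n<1⇒n≡0 (ℕ.≰⇒> (λ h → k≰y (subst (ℕ._≤ y) (ℕ.*-identityʳ k) (≤-÷ {y} {k} h))))
    le1 : ψ 2y - ψ y ≤ ∑ 2y (λ k → Λ k * ι (2y ÷ k)) - ι 2 * ∑ 2y (λ k → Λ k * ι (y ÷ k))
    le1 = lin (∑-mono 2y {λ k → Λ k * (ι 2 * ι (y ÷ k) + (ι 1 - 𝟙 (k ℕ.≤? y)))} {λ k → Λ k * ι (2y ÷ k)} (λ k p r → Λ≥0 k p (ℕ.≤-trans r q) ⊛ pos k p r)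
            ⊞ ≤-reflexive (trans (sym (trans (∑-cong′ 2y (λ k → ring 3 λ l a b → l :* (con 2 :* a :+ (con 1 :- b)) := (con 2 :* (l :* a) :+ l) :- b :* l))
                (trans (∑-- 2y _ _) (cong₂ _-_ (trans (∑-+ 2y _ _) (cong (_+ ψ 2y) (∑-*ˡ 2y (ι 2) _))) (∑-restrict Λ y≤2y))))) refl))
          (ring 5 λ A B C P Q → A :- con 2 :* B :+ (C :+ (con 2 :* B :+ P :- Q)) := P :- Q :+ (A :+ C))
    eq : ∑ 2y (λ k → Λ k * ι (2y ÷ k)) - ι 2 * ∑ 2y (λ k → Λ k * ι (y ÷ k)) ≡ ∑ 2y ℓ - ι 2 * ∑ y ℓ
    eq = cong₂ (λ a b → a - ι 2 * b) (sym (T≡ 2y)) (trans (∑-extend y≤2y (λ k y<k _ → trans (cong (λ z → Λ k * ι z) (ℕ.n<1⇒n≡0 (ℕ.≰⇒> (λ h → ℕ.<⇒≱ y<k (subst (ℕ._≤ y) (ℕ.*-identityʳ k) (≤-÷ {y} {k} h)))))) (*-zeroʳ _))) (sym (T≡ y)))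

  ψ-mono : ∀ {y z} → y ℕ.≤ z → z ℕ.≤ X → ψ y ≤ ψ z
  ψ-mono p q = ∑-mono-range p (λ i y<i i≤z → Λ≥0 i (ℕ.≤-trans (s≤s z≤n) y<i) (ℕ.≤-trans i≤z q))

  chebyshev : ∀ y → y ℕ.< X → ψ y ≤ ι 8 * ι y
  chebyshev zero _ = ≤-reflexive (ring 0 (con 0 := con 8 :* con 0))
  chebyshev (suc y) q = lin (<-rec P go (suc y) (s≤s z≤n) q ⊞ ι≥0 8) (ring 2 λ p y → con 8 :* y :+ (p :+ con 8 :+ con 0) := p :+ (con 8 :* y :+ con 8))
    where
    -- The 8 on the left absorbs the rounding of y / 2 up to `h`: 12 h - 8 with 2 h ≤ y + 1 is at
    -- most 6 y - 2, and this is at most 8 y - 8 once y ≥ 3.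
    P : ℕ → Set
    P y = 1 ℕ.≤ y → y ℕ.< X → ψ y + ι 8 ≤ ι 8 * ι y
    go : ∀ y → (∀ {z} → z ℕ.< y → P z) → P y
    go 1 rec _ _ = ≤-reflexive (trans (cong (λ z → ι 0 + z + ι 8) Λ-1) (ring 0 (con 0 :+ con 0 :+ con 8 := con 8 :* con 1)))
    go 2 rec _ q = lin (rec {1} ℕ.≤-refl ℕ.≤-refl (ℕ.<⇒≤ q) ⊞ ψ-double 1 (ℕ.<⇒≤ q) ⊞ ι≥0 4) (ring 2 λ p p′ → con 8 :* con 2 :+ (p :+ con 8 :+ (p′ :- p :+ con 0)) := p′ :+ con 8 :+ (con 8 :* con 1 :+ (con 4 :* con 1 :+ con 4)))
    go y@(suc (suc (suc y′))) rec _ q = lin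
        (ψ-mono y≤2h 2h≤X ⊞ ψ-double h 2h≤X ⊞ rec {h} h<y 1≤h (ℕ.<-trans h<y q) ⊞ ι≥0 6 ⊛ ι-mono 2h≤ ⊞ ι≥0 6 ⊛ ≤-reflexive (sym (ι-+ h h)) ⊞ ι≥0 6 ⊛ ≤-reflexive (ι-suc y) ⊞ ι≥0 2 ⊛ ι-mono {3} {y} (s≤s (s≤s (s≤s z≤n))))
        (ring 7 λ a b c hq y h2 y1 → con 8 :* y :+ (a :+ (b :- c :+ (c :+ con 8 :+ (con 6 :* h2 :+ (con 6 :* (hq :+ hq) :+ (con 6 :* y1 :+ con 2 :* con 3)))))) :=
          a :+ con 8 :+ (b :+ (con 4 :* hq :+ (con 8 :* hq :+ (con 6 :* y1 :+ (con 6 :* h2 :+ (con 6 :* (y :+ con 1) :+ con 2 :* y)))))))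
      where
      h = ℕ.⌈ y /2⌉
      y≤2h : y ℕ.≤ h ℕ.+ h
      y≤2h = subst (ℕ._≤ h ℕ.+ h) (ℕ.⌊n/2⌋+⌈n/2⌉≡n y) (ℕ.+-monoˡ-≤ h (ℕ.⌊n/2⌋≤⌈n/2⌉ y))
      h<y : h ℕ.< y
      h<y = ℕ.⌈n/2⌉<n (suc y′)
      1≤h : 1 ℕ.≤ h
      1≤h = s≤s z≤n
      2h≤ : h ℕ.+ h ℕ.≤ suc y
      2h≤ = subst (h ℕ.+ h ℕ.≤_) (ℕ.⌊n/2⌋+⌈n/2⌉≡n (suc y)) (ℕ.+-monoʳ-≤ h (ℕ.⌊n/2⌋≤⌈n/2⌉ (suc y)))
      2h≤X : h ℕ.+ h ℕ.≤ X
      2h≤X = ℕ.≤-trans 2h≤ q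

  private
    q Q : ℚ
    q = gg
    Q = gg * gg

    1≤g : ι 1 ≤ ι g
    1≤g = ι-mono (ℕ.>-nonZero⁻¹ g)

  1≤gg : ι 1 ≤ gg
  1≤gg = lin (1≤g ⊞ ι≥0 g ⊛ 1≤g) (ring 1 λ g → g :* g :+ (con 1 :+ g :* con 1) := con 1 :+ (g :+ g :* g))

  gg≥0 : ι 0 ≤ gg
  gg≥0 = ≤-trans 0≤1 1≤gg

  gg≤Q : gg ≤ gg * gg
  gg≤Q = lin (gg≥0 ⊛ 1≤gg) (ring 1 λ q → q :* q :+ q :* con 1 := q :+ q :* q)

  private
    φ≤gg : ι φ ≤ gg
    φ≤gg = ≤-trans φ≤g (lin (ι≥0 g ⊛ 1≤g) (ring 1 λ g → g :* g :+ g :* con 1 := g :+ g :* g))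

  invφ : ℚ
  invφ = inv φ

  invφ≥0 : ι 0 ≤ invφ
  invφ≥0 = inv≥0 φ

  invφ≤1 : invφ ≤ ι 1
  invφ≤1 = inv≤1 φ

  private
    ℓ-inc : ∀ n → n ℕ.< X → ∀ i → 1 ℕ.≤ i → i ℕ.≤ n → ℓ i ≤ ℓ (suc i)
    ℓ-inc n n<X i p r = ℓ-step i p (ℕ.<-≤-trans (s≤s r) n<X)

  class-∑ℓ : ∀ b y → 1 ℕ.≤ y → y ℕ.≤ X → Bd (ι g * ∑ y (λ n → ℓ n * 𝟙 (n ≈? b)) - ∑ y ℓ) ((gg + gg) * ℓ y)
  class-∑ℓ b (suc y) _ r = Bd-≡ (trans (∑-cong′ (suc y) (λ n → ring 3 λ g i l → (g :* i :- con 1) :* l := g :* (l :* i) :- l)) (trans (∑-- (suc y) _ _) (cong (_- ∑ (suc y) ℓ) (∑-*ˡ (suc y) (ι g) _))))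
    (abel-increasing _ (class-partial b) ℓ y (ℓ-inc y r) (≤-reflexive (sym ℓ-1)))

  cop-∑ℓ : ∀ y → 1 ℕ.≤ y → y ℕ.≤ X → Bd (ι g * ∑ y (λ n → ℓ n * e n) - ι φ * ∑ y ℓ) ((gg + gg) * ℓ y)
  cop-∑ℓ (suc y) _ r = Bd-≡ (trans (∑-cong′ (suc y) (λ n → ring 4 λ g i l f → (g :* i :- f) :* l := g :* (l :* i) :- f :* l)) (trans (∑-- (suc y) _ _) (cong₂ _-_ (∑-*ˡ (suc y) (ι g) _) (∑-*ˡ (suc y) (ι φ) ℓ))))
    (abel-increasing _ cop-partial ℓ y (ℓ-inc y r) (≤-reflexive (sym ℓ-1)))

  cop-∑1 : ∀ y → Bd (ι g * ∑ y e - ι φ * ι y) gg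
  cop-∑1 y = Bd-≡ (trans (∑-- y _ _) (cong₂ _-_ (∑-*ˡ y (ι g) e) (trans (∑-const y (ι φ)) (*-comm _ _)))) (cop-partial y)

  M : ℕ → ℚ
  M y = ∑ y (λ k → e k * Λ k * inv k)

  ψ° : ℕ → ℚ
  ψ° y = ∑ y (λ k → e k * Λ k)

  eΛ≥0 : ∀ {y} → y ℕ.≤ X → ∀ k → 1 ℕ.≤ k → k ℕ.≤ y → ι 0 ≤ e k * Λ k
  eΛ≥0 r k p s = *≥0 (e≥0 k) (Λ≥0 k p (ℕ.≤-trans s r))

  ψ°≤ψ : ∀ y → y ℕ.≤ X → ψ° y ≤ ψ y
  ψ°≤ψ y r = ∑-mono y (λ k p s → 𝟙*-≤ (coprime? k g) (Λ≥0 k p (ℕ.≤-trans s r)))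

  ψ°-Bd : ∀ y → y ℕ.< X → Bd (ψ° y) (ι 8 * ι y)
  ψ°-Bd y r = Bd-≤ (≤-trans (ψ°≤ψ y (ℕ.<⇒≤ r)) (chebyshev y r)) (Bd-self (∑≥0 y (eΛ≥0 (ℕ.<⇒≤ r))))

  ℓ≤2y : ∀ y → 1 ℕ.≤ y → y ℕ.≤ X → ℓ y ≤ ι 2 * ι y
  ℓ≤2y (suc y) _ r = ≤-trans (ℓ≤2n y r) (ι≥0 2 ⊛ ι-mono (ℕ.n≤1+n y))

  -- The sum of ℓ(n) over n ≤ y prime to `g` is evaluated by partial summation and Stirling, and
  -- again through `Λ`. The comparison bounds φ y (M(y) - ℓ(y)) by O(y).
  mertens : ∀ y → 1 ℕ.≤ y → y ℕ.< X → Bd (M y - ℓ y) (ι 28 * gg)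
  mertens y 1≤y r = Bd-cancel φ (Bd-cancel y {{ℕ.>-nonZero 1≤y}} (Bd-≡ eq (Bd-≤ le (Bd-+ (Bd-- b2 b1) (Bd-*ˡ (ι≥0 φ) b3)))))
    where
    T = ∑ y (λ n → ℓ n * e n)
    E : ℕ → ℚ
    E z = ∑ z e
    T≡′ : T ≡ ∑ y (λ k → e k * Λ k * E (y ÷ k))
    T≡′ = trans (∑-ℓ-Λ y e) (∑-cong′ y (λ k → trans (cong (Λ k *_) (trans (∑-cong′ (y ÷ k) (λ m → e-* k m)) (∑-*ˡ (y ÷ k) (e k) e))) (ring 3 λ l a b → l :* (a :* b) := a :* l :* b)))
    term : ∀ k → 1 ℕ.≤ k → k ℕ.≤ y → Bd (ι g * E (y ÷ k) - ι φ * (ι y * inv k)) (ι 2 * gg)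
    term k p s = Bd-≡ (ring 5 λ g E f yk z → g :* E :- f :* yk :- f :* (z :- yk) := g :* E :- f :* z)
      (Bd-≤ (lin φ≤gg (ring 2 λ q f → con 2 :* q :+ f := q :+ f :* con 1 :+ q))
        (Bd-- (cop-∑1 (y ÷ k)) (Bd-*ˡ {ι φ} {ι y * inv k - ι (y ÷ k)} {ι 1} (ι≥0 φ)
          (Bd-≤ (lin (proj₂ fr) (ring 2 λ a b → con 1 :+ a := a :- b :+ (b :+ con 1))) (Bd-self (sub≥0 (proj₁ fr)))))))
      where fr = frac y k p
    b1 : Bd (ι g * T - ι φ * ι y * M y) (ι 16 * gg * ι y)
    b1 = Bd-≡ eq1 (Bd-≤ le1 (∑-Bd y (λ k p s → Bd-*ˡ (eΛ≥0 (ℕ.<⇒≤ r) k p s) (term k p s))))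
      where
      eq1 : ∑ y (λ k → e k * Λ k * (ι g * E (y ÷ k) - ι φ * (ι y * inv k))) ≡ ι g * T - ι φ * ι y * M y
      eq1 = trans (∑-cong′ y (λ k → ring 6 λ el g E f y i → el :* (g :* E :- f :* (y :* i)) := g :* (el :* E) :- f :* y :* (el :* i)))
             (trans (∑-- y _ _) (cong₂ _-_ (trans (∑-*ˡ y (ι g) _) (cong (ι g *_) (sym T≡′))) (∑-*ˡ y (ι φ * ι y) _)))
      le1 : ∑ y (λ k → e k * Λ k * (ι 2 * gg)) ≤ ι 16 * gg * ι y
      le1 = ≤-trans (≤-reflexive (∑-*ʳ y (ι 2 * gg) _)) (lin (*≥0 (ι≥0 2) gg≥0 ⊛ proj₂ (ψ°-Bd y r)) (ring 3 λ p q y → con 16 :* q :* y :+ con 2 :* q :* p := p :* (con 2 :* q) :+ con 2 :* q :* (con 8 :* y)))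
    b2 = cop-∑ℓ y 1≤y (ℕ.<⇒≤ r)
    b3 : Bd (∑ y ℓ - ι y * ℓ y) (ι 8 * ι y)
    b3 = Bd-≡ (ring 3 λ s y l → s :- y :* l :+ y :- y := s :- y :* l) (Bd-≤ (lin (ι≥0 2 ⊛ ℓ≤2y y 1≤y (ℕ.<⇒≤ r) ⊞ ι≥0 3 ⊛ ι-mono 1≤y) (ring 2 λ l y → con 8 :* y :+ (con 2 :* l :+ con 3 :* con 1) := con 2 :* l :+ con 3 :+ y :+ (con 2 :* (con 2 :* y) :+ con 3 :* y)))
        (Bd-- (∑ℓ y 1≤y (ℕ.<⇒≤ r)) (Bd-self (ι≥0 y))))
    eq : ι g * T - ι φ * ∑ y ℓ - (ι g * T - ι φ * ι y * M y) + ι φ * (∑ y ℓ - ι y * ℓ y) ≡ ι y * (ι φ * (M y - ℓ y))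
    eq = ring 6 λ t f s y m l → t :- f :* s :- (t :- f :* y :* m) :+ f :* (s :- y :* l) := y :* (f :* (m :- l))
    le : (gg + gg) * ℓ y + ι 16 * gg * ι y + ι φ * (ι 8 * ι y) ≤ ι y * (ι φ * (ι 28 * gg))
    le = lin ((+≥0 gg≥0 gg≥0) ⊛ ℓ≤2y y 1≤y (ℕ.<⇒≤ r) ⊞ *≥0 (ι≥0 8) (*≥0 (ι≥0 y) (ι≥0 φ)) ⊛ 1≤gg ⊞ *≥0 (ι≥0 20) (*≥0 gg≥0 (ι≥0 y)) ⊛ ι-mono φ≥1)
      (ring 4 λ q l y f → y :* (f :* (con 28 :* q)) :+ ((q :+ q) :* l :+ (con 8 :* (y :* f) :* con 1 :+ con 20 :* (q :* y) :* con 1)) :=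
         (q :+ q) :* l :+ con 16 :* q :* y :+ f :* (con 8 :* y) :+ ((q :+ q) :* (con 2 :* y) :+ (con 8 :* (y :* f) :* q :+ con 20 :* (q :* y) :* f)))

  -- Γ plays the role of g times the Euler constant of the integers prime to g.

  He : ℕ → ℚ
  He y = ∑ y (λ m → e m * inv m)

  Γ : ℚ
  Γ = ι g * He X - ι φ * ℓ X

  private
    inv-decr : ∀ i → 1 ℕ.≤ i → inv (suc i) ≤ inv i
    inv-decr (suc i) _ = inv-anti (ℕ.n≤1+n _)

  -- `Γ` is the value at `X` and not a limit, so only the change from `y` to `X` must be bounded: by
  -- partial summation against 1 / i and by `H-ℓ`.
  He-asymp : ∀ y → 1 ℕ.≤ y → y ℕ.≤ X → Bd (ι g * He y - ι φ * ℓ y - Γ) (ι 5 * gg * inv y)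
  He-asymp y 1≤y y≤X with ℕ.m≤n⇒m<n∨m≡n y≤X
  ... | inj₂ refl = Bd-≡ (ring 1 λ a → con 0 := a :- a) (Bd-0 (*≥0 (*≥0 (ι≥0 5) gg≥0) (inv≥0 y)))
  ... | inj₁ y<X = Bd-≡ eq (Bd-≤ le (Bd-+ (Bd-neg ab) (Bd-neg (Bd-*ˡ (ι≥0 φ) hl))))
    where
    k = ℕ.pred (X ℕ.∸ y)
    X≡ : y ℕ.+ suc k ≡ X
    X≡ = trans (cong (y ℕ.+_) (ℕ.suc-pred (X ℕ.∸ y) {{ℕ.>-nonZero (ℕ.m<n⇒0<n∸m y<X)}})) (ℕ.m+[n∸m]≡n y≤X)
    S : ℕ → ℚ
    S z = ∑ z (λ i → (ι g * e i - ι φ) * inv i)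
    S≡ : ∀ z → S z ≡ ι g * He z - ι φ * ∑ z inv
    S≡ z = trans (∑-cong′ z (λ i → ring 4 λ g e f i → (g :* e :- f) :* i := g :* (e :* i) :- f :* i)) (trans (∑-- z _ _) (cong₂ _-_ (∑-*ˡ z (ι g) _) (∑-*ˡ z (ι φ) inv)))
    ab : Bd (S X - S y) ((gg + gg) * inv (suc y))
    ab = subst (λ z → Bd (S z - S y) ((gg + gg) * inv (suc y))) X≡ (abel-decreasing _ cop-partial inv y k (λ i p _ → inv-decr i (ℕ.≤-trans (s≤s z≤n) p)) (inv≥0 _))
    hl : Bd (∑ X inv - ∑ y inv - (ℓ X - ℓ y)) (ι 3 * inv y)
    hl = subst (λ z → Bd (∑ z inv - ∑ y inv - (ℓ z - ℓ y)) (ι 3 * inv y)) X≡ (H-ℓ y (suc k) 1≤y (ℕ.≤-reflexive X≡))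
    eq : - (S X - S y) + - (ι φ * (∑ X inv - ∑ y inv - (ℓ X - ℓ y))) ≡ ι g * He y - ι φ * ℓ y - Γ
    eq = trans (cong₂ (λ a b → - (a - b) + - (ι φ * (∑ X inv - ∑ y inv - (ℓ X - ℓ y)))) (S≡ X) (S≡ y))
      (ring 7 λ a b f h h′ l l′ → :- ((a :- f :* h) :- (b :- f :* h′)) :+ :- (f :* (h :- h′ :- (l :- l′))) := b :- f :* l′ :- (a :- f :* l))
    le : (gg + gg) * inv (suc y) + ι φ * (ι 3 * inv y) ≤ ι 5 * gg * inv y
    le = lin ((+≥0 gg≥0 gg≥0) ⊛ inv-decr y 1≤y ⊞ *≥0 (ι≥0 3) (inv≥0 y) ⊛ φ≤gg)
      (ring 4 λ q i i′ f → con 5 :* q :* i :+ ((q :+ q) :* i′ :+ con 3 :* i :* f) := (q :+ q) :* i′ :+ f :* (con 3 :* i) :+ ((q :+ q) :* i :+ con 3 :* i :* q))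

  Γ-Bd : Bd Γ (ι 6 * gg)
  Γ-Bd = Bd-≡ (ring 2 λ a b → a :- (a :- b) := b) (Bd-≤ le (Bd-- (Bd-self (ι≥0 g)) b))
    where
    b : Bd (ι g - Γ) (ι 5 * gg)
    b = Bd-≡ (cong₂ (λ u v → u - v - Γ) (trans (cong (ι g *_) h1) (*-identityʳ _)) (trans (cong (ι φ *_) ℓ-1) (*-zeroʳ _)) ∙ ring 2 λ a b → a :- con 0 :- b := a :- b)
          (Bd-≤ (≤-reflexive (trans (cong (ι 5 * gg *_) inv1) (*-identityʳ _))) (He-asymp 1 ℕ.≤-refl (ℕ.≤-trans (s≤s z≤n) 4≤X)))
      where
      _∙_ = trans
      h1 : He 1 ≡ ι 1
      h1 = trans (cong₂ (λ a b → ι 0 + a * b) (𝟙-yes (coprime? 1 g) cop-1) inv1) (ring 0 (con 0 :+ con 1 :* con 1 := con 1))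
    le : ι g + ι 5 * gg ≤ ι 6 * gg
    le = lin (ι≥0 g ⊛ 1≤g) (ring 1 λ g → con 6 :* (g :* g) :+ g :* con 1 := g :+ con 5 :* (g :* g) :+ g :* g)

  -- Chosen so that the terms linear in y = x ÷ d cancel in g `A d`: they are - y from Stirling, - y
  -- Γ / φ from the reciprocals and C φ y.
  C : ℚ
  C = invφ * (ι 1 + Γ * invφ)

  C-Bd : Bd C (ι 7 * gg)
  C-Bd = Bd-≤ (lin 1≤gg (ring 1 λ q → con 7 :* q :+ con 1 := con 1 :* (con 1 :+ con 6 :* q :* con 1) :+ q)) (Bd-* iB (Bd-+ (Bd-self 0≤1) (Bd-* Γ-Bd iB)))
    where
    iB : Bd invφ (ι 1)
    iB = Bd-≤ invφ≤1 (Bd-self invφ≥0)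

  -- Selberg's symmetry formula, by the Tatuzawa–Iseki inversion applied to the error F of the prime number theorem.

  ψ[_] : ℕ → ℕ → ℚ
  ψ[ a ] y = ∑ y (λ j → 𝟙 (j ≈? a) * Λ j)

  S₂ : ℕ → ℕ → ℚ
  S₂ a x = ∑ x (λ k → Λ k * ∑ (x ÷ k) (λ j → 𝟙 (j ℕ.* k ≈? a) * Λ j))

  module _ (a : ℕ) (cop-a : Coprime a g) (x : ℕ) (1≤x : 1 ℕ.≤ x) (x<X : x ℕ.< X) where
    private
      x≤X = ℕ.<⇒≤ x<X
      -- `F k` is the error of the main term x / (φ k) for the class a / k up to x / k, shifted by
      -- `C`; `A d` collects it over the multiples of `d`.
      Ψ F A : ℕ → ℚ
      Ψ k = ∑ (x ÷ k) (λ j → 𝟙 (j ℕ.* k ≈? a) * Λ j)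
      F k = e k * (Ψ k - ι x * invφ * inv k + C)
      A d = ∑ (x ÷ d) (λ m → F (d ℕ.* m))

      drop-e : ∀ j m {t} → (j ℕ.* m ≈ a → Coprime m g) → e m * (𝟙 (j ℕ.* m ≈? a) * t) ≡ 𝟙 (j ℕ.* m ≈? a) * t
      drop-e j m {t} h with j ℕ.* m ≈? a
      ... | no _ = ring 2 λ e t → e :* (con 0 :* t) := con 0 :* t
      ... | yes p = trans (cong (_* (ι 1 * t)) (𝟙-yes (coprime? m g) (h p))) (*-identityˡ _)

      e*Ψ : ∀ k → e k * Ψ k ≡ Ψ k
      e*Ψ k = trans (sym (∑-*ˡ (x ÷ k) (e k) _)) (∑-cong′ (x ÷ k) (λ j → drop-e j k (λ p → cop-*⁻ʳ j (≈-cop {a} {j ℕ.* k} (sym p) cop-a))))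

      module Cop (d : ℕ) (1≤d : 1 ℕ.≤ d) (d≤x : d ℕ.≤ x) (cop-d : Coprime d g) where
        y = x ÷ d
        1≤y = 1≤÷ 1≤d d≤x
        y≤X = ℕ.≤-trans (÷≤ x d) x≤X
        b = proj₁ (divide d a cop-d cop-a)
        b-to = proj₁ (proj₂ (proj₂ (proj₂ (divide d a cop-d cop-a))))
        b-from = proj₂ (proj₂ (proj₂ (proj₂ (divide d a cop-d cop-a))))
        z = ι x * inv d
        T′ = ∑ y (λ n → ℓ n * 𝟙 (n ≈? b))
        E′ = ∑ y e

        first : ∑ y (λ m → Ψ (d ℕ.* m)) ≡ T′
        first = begin
          ∑ y (λ m → ∑ (x ÷ (d ℕ.* m)) (λ j → 𝟙 (j ℕ.* (d ℕ.* m) ≈? a) * Λ j))  ≡⟨ ∑-cong y (λ m 1≤m _ → cong (λ w → ∑ w (λ j → 𝟙 (j ℕ.* (d ℕ.* m) ≈? a) * Λ j)) (sym (÷-÷ x d m 1≤d 1≤m))) ⟩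
          ∑ y (λ m → ∑ (y ÷ m) (λ j → 𝟙 (j ℕ.* (d ℕ.* m) ≈? a) * Λ j))          ≡⟨ hyperbola-swap y _ ⟩
          ∑ y (λ j → ∑ (y ÷ j) (λ m → 𝟙 (j ℕ.* (d ℕ.* m) ≈? a) * Λ j))          ≡⟨ ∑-cong′ y (λ j → trans (∑-cong′ (y ÷ j) (λ m → trans (cong (_* Λ j) (ind j m)) (*-comm _ _))) (∑-*ˡ (y ÷ j) (Λ j) _)) ⟩
          ∑ y (λ j → Λ j * ∑ (y ÷ j) (λ m → 𝟙 (j ℕ.* m ≈? b)))                  ≡⟨ ∑-ℓ-Λ y (λ n → 𝟙 (n ≈? b)) ⟨
          T′                                                                    ∎
          where
          re : ∀ j m → j ℕ.* (d ℕ.* m) ≡ j ℕ.* m ℕ.* d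
          re j m = trans (cong (j ℕ.*_) (ℕ.*-comm d m)) (sym (ℕ.*-assoc j m d))
          ind : ∀ j m → 𝟙 (j ℕ.* (d ℕ.* m) ≈? a) ≡ 𝟙 (j ℕ.* m ≈? b)
          ind j m = 𝟙-⇔ (j ℕ.* (d ℕ.* m) ≈? a) (j ℕ.* m ≈? b) (λ h → b-to (j ℕ.* m) (trans (≡⇒≈ (sym (re j m))) h)) (λ h → trans (≡⇒≈ (re j m)) (b-from (j ℕ.* m) h))

        A≡ : A d ≡ T′ - z * invφ * He y + C * E′
        A≡ = begin
          ∑ y (λ m → F (d ℕ.* m))                                                     ≡⟨ ∑-cong′ y lem ⟩
          ∑ y (λ m → Ψ (d ℕ.* m) - z * invφ * (e m * inv m) + C * e m)                 ≡⟨ ∑-+ y _ _ ⟩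
          ∑ y (λ m → Ψ (d ℕ.* m) - z * invφ * (e m * inv m)) + ∑ y (λ m → C * e m)     ≡⟨ cong₂ _+_ (trans (∑-- y _ _) (cong₂ _-_ first (∑-*ˡ y (z * invφ) _))) (∑-*ˡ y C e) ⟩
          T′ - z * invφ * He y + C * E′                                               ∎
          where
          lem : ∀ m → F (d ℕ.* m) ≡ Ψ (d ℕ.* m) - z * invφ * (e m * inv m) + C * e m
          lem m = trans (ring 6 λ e ψ x f i c → e :* (ψ :- x :* f :* i :+ c) := e :* ψ :- x :* i :* f :* e :+ c :* e)
            (trans (cong₂ (λ u v → u - ι x * inv (d ℕ.* m) * invφ * v + C * v) (e*Ψ (d ℕ.* m)) (trans (e-* d m) (trans (cong (_* e m) (𝟙-yes (coprime? d g) cop-d)) (*-identityˡ _))))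
              (trans (cong (λ w → Ψ (d ℕ.* m) - ι x * w * invφ * e m + C * e m) (inv-* d m)) (ring 7 λ ψ x d m f e c → ψ :- x :* (d :* m) :* f :* e :+ c :* e := ψ :- x :* d :* f :* (e :* m) :+ c :* e)))

        -- `r1` to `r4` replace the sums in `A≡` by their asymptotic values, and `r5` is the cost of
        -- the floor in y = x ÷ d. By the choice of `C` all terms of order y have cancelled.
        bound : Bd (A d) (ι 26 * Q * (ι 1 + ℓ y))
        bound = Bd-cancel g (Bd-≡ eq (Bd-≤ le (Bd-- (Bd-+ (Bd-- (Bd-+ r1 r2) r3) r4) r5)))
          where
          l≥0 : ι 0 ≤ ℓ y
          l≥0 = ℓ≥0 1≤y y≤X
          fr = frac x d 1≤d
          z≤2y : z ≤ ι 2 * ι y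
          z≤2y = lin (proj₂ fr ⊞ ι-mono 1≤y) (ring 2 λ z y → con 2 :* y :+ (z :+ con 1) := z :+ (y :+ con 1 :+ y))
          r1 = class-∑ℓ b y 1≤y y≤X
          r2 = ∑ℓ y 1≤y y≤X
          r3 : Bd (z * invφ * (ι g * He y - ι φ * ℓ y - Γ)) (ι 10 * gg)
          r3 = Bd-≤ le3 (Bd-* zp (He-asymp y 1≤y y≤X))
            where
            zp : Bd (z * invφ) (ι 2 * ι y)
            zp = Bd-≤ (≤-trans (*-mono (*≥0 (ι≥0 x) (inv≥0 d)) 0≤1 ≤-refl invφ≤1) (≤-trans (≤-reflexive (*-identityʳ _)) z≤2y)) (Bd-self (*≥0 (*≥0 (ι≥0 x) (inv≥0 d)) invφ≥0))
            le3 : ι 2 * ι y * (ι 5 * gg * inv y) ≤ ι 10 * gg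
            le3 = ≤-reflexive (trans (ring 3 λ y q i → con 2 :* y :* (con 5 :* q :* i) := con 10 :* q :* (i :* y)) (trans (cong (ι 10 * gg *_) (inv*ι y {{ℕ.>-nonZero 1≤y}})) (*-identityʳ _)))
          r4 : Bd (C * (ι g * E′ - ι φ * ι y)) (ι 7 * gg * gg)
          r4 = Bd-* C-Bd (cop-∑1 y)
          r5 : Bd ((z - ι y) * (ℓ y + Γ * invφ)) (ι 1 * (ℓ y + ι 6 * gg * ι 1))
          r5 = Bd-* (Bd-≤ (lin (proj₂ fr) (ring 2 λ z y → con 1 :+ z := z :- y :+ (y :+ con 1))) (Bd-self (sub≥0 (proj₁ fr)))) (Bd-+ (Bd-self l≥0) (Bd-* Γ-Bd (Bd-≤ invφ≤1 (Bd-self invφ≥0))))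
          rhs = (ι g * T′ - ∑ y ℓ) + (∑ y ℓ - ι y * ℓ y + ι y) - z * invφ * (ι g * He y - ι φ * ℓ y - Γ) + C * (ι g * E′ - ι φ * ι y) - (z - ι y) * (ℓ y + Γ * invφ)
          -- The normaliser treats `invφ` as a free variable. Subtracting this multiple of invφ φ -
          -- 1 = 0 turns the claim into a ring identity.
          s = z * ℓ y - ι y * (ι 1 + Γ * invφ)
          eq : rhs ≡ ι g * A d
          eq = begin
            rhs                                      ≡⟨ ring 2 (λ r s → r := r :- (con 1 :- con 1) :* s) ⟩
            rhs - (ι 1 - ι 1) * s                    ≡⟨ cong (λ w → rhs - (w - ι 1) * s) (inv*ι φ) ⟨
            rhs - (invφ * ι φ - ι 1) * s             ≡⟨ expand ⟩
            ι g * (T′ - z * invφ * He y + C * E′)    ≡⟨ cong (ι g *_) A≡ ⟨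
            ι g * A d                                ∎
            where
            expand : rhs - (invφ * ι φ - ι 1) * s ≡ ι g * (T′ - z * invφ * He y + C * E′)
            expand = ring 11 (λ g t S y l z p H f G E → (g :* t :- S) :+ (S :- y :* l :+ y) :- z :* p :* (g :* H :- f :* l :- G) :+ p :* (con 1 :+ G :* p) :* (g :* E :- f :* y) :- (z :- y) :* (l :+ G :* p) :- (p :* f :- con 1) :* (z :* l :- y :* (con 1 :+ G :* p)) :=
                                                            g :* (t :- z :* p :* H :+ p :* (con 1 :+ G :* p) :* E))
          le : (gg + gg) * ℓ y + (ι 2 * ℓ y + ι 3) + ι 10 * gg + ι 7 * gg * gg + ι 1 * (ℓ y + ι 6 * gg * ι 1) ≤ ι g * (ι 26 * Q * (ι 1 + ℓ y))
          le = lin (*≥0 (ι≥0 2) l≥0 ⊛ gg≤Q ⊞ ι≥0 16 ⊛ gg≤Q ⊞ +≥0 (*≥0 (ι≥0 3) l≥0) (ι≥0 3) ⊛ ≤-trans 1≤gg gg≤Q ⊞ *≥0 (ι≥0 21) l≥0 ⊛ ≤-trans gg≥0 gg≤Q ⊞ *≥0 (*≥0 (ι≥0 26) (≤-trans gg≥0 gg≤Q)) (+≥0 0≤1 l≥0) ⊛ 1≤g)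
            (ring 3 λ q l g → g :* (con 26 :* (q :* q) :* (con 1 :+ l)) :+ (con 2 :* l :* q :+ (con 16 :* q :+ ((con 3 :* l :+ con 3) :* con 1 :+ (con 21 :* l :* con 0 :+ con 26 :* (q :* q) :* (con 1 :+ l) :* con 1)))) :=
               (q :+ q) :* l :+ (con 2 :* l :+ con 3) :+ con 10 :* q :+ con 7 :* q :* q :+ con 1 :* (l :+ con 6 :* q :* con 1) :+
                 (con 2 :* l :* (q :* q) :+ (con 16 :* (q :* q) :+ ((con 3 :* l :+ con 3) :* (q :* q) :+ (con 21 :* l :* (q :* q) :+ con 26 :* (q :* q) :* (con 1 :+ l) :* g)))))

      A-Bd : ∀ d → 1 ℕ.≤ d → d ℕ.≤ x → Bd (A d) (ι 26 * Q * (ι 1 + ℓ (x ÷ d)))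
      A-Bd d p r with coprime? d g
      ... | yes c = Cop.bound d p r c
      ... | no ¬c = Bd-≡ (sym (∑-zero (x ÷ d) (λ m _ _ → trans (cong (_* (Ψ (d ℕ.* m) - ι x * invφ * inv (d ℕ.* m) + C)) (𝟙-no (coprime? (d ℕ.* m) g) (λ h → ¬c (cop-*⁻ˡ m h)))) (*-zeroˡ _))))
          (Bd-0 (*≥0 (*≥0 (ι≥0 26) (*≥0 gg≥0 gg≥0)) (+≥0 0≤1 (ℓ≥0 (1≤÷ p r) (ℕ.≤-trans (÷≤ x d) x≤X)))))

      -- With n = d m, the coefficient of F(n) is the sum of μ(d) (ℓ(x) - ℓ(d)) over d ∣ n, which is
      -- Λ(n), plus ℓ(x) when n = 1.
      inversion : ∑ x (λ d → μ d * (ℓ x - ℓ d) * A d) ≡ F 1 * ℓ x + ∑ x (λ k → Λ k * F k)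
      inversion = begin
        ∑ x (λ d → μ d * (ℓ x - ℓ d) * A d)                                            ≡⟨ ∑-cong′ x (λ d → sym (∑-*ˡ (x ÷ d) _ _)) ⟩
        ∑ x (λ d → ∑ (x ÷ d) (λ m → μ d * (ℓ x - ℓ d) * F (d ℕ.* m)))                  ≡⟨ ∑-divisors x (λ d n → μ d * (ℓ x - ℓ d) * F n) ⟨
        ∑ x (λ n → ∑ x (λ d → 𝟙 (d ∣? n) * (μ d * (ℓ x - ℓ d) * F n)))                 ≡⟨ ∑-cong x collect ⟩
        ∑ x (λ n → 𝟙 (n ℕ.≟ 1) * (ℓ x * F n) + Λ n * F n)                              ≡⟨ ∑-+ x _ _ ⟩
        ∑ x (λ n → 𝟙 (n ℕ.≟ 1) * (ℓ x * F n)) + ∑ x (λ n → Λ n * F n)                  ≡⟨ cong (_+ ∑ x (λ n → Λ n * F n)) (trans (∑-single x 1 ℕ.≤-refl 1≤x) (*-comm _ _)) ⟩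
        F 1 * ℓ x + ∑ x (λ k → Λ k * F k)                                              ∎
        where
        collect : ∀ n → 1 ℕ.≤ n → n ℕ.≤ x → ∑ x (λ d → 𝟙 (d ∣? n) * (μ d * (ℓ x - ℓ d) * F n)) ≡ 𝟙 (n ℕ.≟ 1) * (ℓ x * F n) + Λ n * F n
        collect n p r = begin
          ∑ x (λ d → 𝟙 (d ∣? n) * (μ d * (ℓ x - ℓ d) * F n))                            ≡⟨ ∑-cong′ x (λ d → ring 5 λ i m u v f → i :* (m :* (u :- v) :* f) := i :* m :* (u :* f) :- i :* (m :* v) :* f) ⟩
          ∑ x (λ d → 𝟙 (d ∣? n) * μ d * (ℓ x * F n) - 𝟙 (d ∣? n) * (μ d * ℓ d) * F n)   ≡⟨ ∑-- x _ _ ⟩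
          _                                                                            ≡⟨ cong₂ _-_ (trans (∑-*ʳ x (ℓ x * F n) _) (cong (_* (ℓ x * F n)) (∑-μ x n p r))) (∑-*ʳ x (F n) _) ⟩
          𝟙 (n ℕ.≟ 1) * (ℓ x * F n) - ∑ x (λ d → 𝟙 (d ∣? n) * (μ d * ℓ d)) * F n        ≡⟨ ring 3 (λ a b f → a :- b :* f := a :+ :- b :* f) ⟩
          𝟙 (n ℕ.≟ 1) * (ℓ x * F n) + - ∑ x (λ d → 𝟙 (d ∣? n) * (μ d * ℓ d)) * F n      ≡⟨ cong (λ w → 𝟙 (n ℕ.≟ 1) * (ℓ x * F n) + w * F n) (Λ-def x n p r) ⟨
          𝟙 (n ℕ.≟ 1) * (ℓ x * F n) + Λ n * F n                                        ∎

      -- Since ℓ(x ÷ d) ≤ w for w = ℓ(x) - ℓ(d), the term at `d` is at most 26 Q (w + w²); by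
      -- `∑-log` and `∑-log²` this sums to 26 (2 + 12) = 364.
      main-Bd : Bd (∑ x (λ d → μ d * (ℓ x - ℓ d) * A d)) (ι 364 * Q * ι x)
      main-Bd = Bd-≤ le (∑-Bd x term)
        where
        K = ι 26 * Q
        K≥0 : ι 0 ≤ K
        K≥0 = *≥0 (ι≥0 26) (*≥0 gg≥0 gg≥0)
        term : ∀ d → 1 ℕ.≤ d → d ℕ.≤ x → Bd (μ d * (ℓ x - ℓ d) * A d) (K * (ℓ x - ℓ d) + K * ((ℓ x - ℓ d) * (ℓ x - ℓ d)))
        term d p r = Bd-≤ le1 (Bd-* (Bd-* (μ-Bd d) (Bd-self w≥0)) (A-Bd d p r))
          where
          w≥0 : ι 0 ≤ ℓ x - ℓ d
          w≥0 = sub≥0 (ℓ-mono p r x≤X)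
          ly : ℓ (x ÷ d) ≤ ℓ x - ℓ d
          ly = lin (ℓ-mono (ℕ.*-mono-≤ p (1≤÷ p r)) (÷-* x d) x≤X ⊞ ≤-reflexive (sym (ℓ-* p (1≤÷ p r)))) (ring 4 λ a b c d → c :- d :+ (a :+ (d :+ b)) := b :+ (c :+ a))
          le1 : ι 1 * (ℓ x - ℓ d) * (K * (ι 1 + ℓ (x ÷ d))) ≤ K * (ℓ x - ℓ d) + K * ((ℓ x - ℓ d) * (ℓ x - ℓ d))
          le1 = lin (*≥0 K≥0 w≥0 ⊛ ly) (ring 3 λ k w l → k :* w :+ k :* (w :* w) :+ k :* w :* l := con 1 :* w :* (k :* (con 1 :+ l)) :+ k :* w :* w)
        le : ∑ x (λ d → K * (ℓ x - ℓ d) + K * ((ℓ x - ℓ d) * (ℓ x - ℓ d))) ≤ ι 364 * Q * ι x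
        le = ≤-trans (≤-reflexive (trans (∑-+ x _ _) (cong₂ _+_ (∑-*ˡ x K _) (∑-*ˡ x K _)))) (lin (K≥0 ⊛ ∑-log x 1≤x x≤X ⊞ K≥0 ⊛ ∑-log² x 1≤x x≤X)
          (ring 4 λ Q u v x → con 364 :* Q :* x :+ (con 26 :* Q :* u :+ con 26 :* Q :* v) := con 26 :* Q :* u :+ con 26 :* Q :* v :+ (con 26 :* Q :* (con 2 :* x) :+ con 26 :* Q :* (con 12 :* x))))

    -- Unfolding `F` in `inversion` leaves, besides the formula, the sums of e Λ / k and of e Λ,
    -- which Mertens and Chebyshev control: 462 = 364 + 28 + 70.
    selberg : Bd (ψ[ a ] x * ℓ x + S₂ a x - ι 2 * invφ * (ι x * ℓ x)) (ι 462 * (gg * gg) * ι x)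
    selberg = Bd-≡ eq (Bd-≤ le (Bd-- (Bd-+ main-Bd (Bd-*ˡ (*≥0 (ι≥0 x) invφ≥0) (mertens x 1≤x x<X))) (Bd-* C-Bd (Bd-+ (Bd-≤ (ℓ≤2y x 1≤x x≤X) (Bd-self (ℓ≥0 1≤x x≤X))) (ψ°-Bd x x<X)))))
      where
      F1 : F 1 ≡ ψ[ a ] x - ι x * invφ + C
      F1 = trans (cong₂ (λ u v → u * (Ψ 1 - ι x * invφ * v + C)) (𝟙-yes (coprime? 1 g) cop-1) inv1)
             (trans (cong (λ w → ι 1 * (w - ι x * invφ * ι 1 + C)) Ψ1) (ring 4 λ p x f c → con 1 :* (p :- x :* f :* con 1 :+ c) := p :- x :* f :+ c))
        where
        x÷1 : x ÷ 1 ≡ x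
        x÷1 = ℕ.≤-antisym (÷≤ x 1) (÷-≤ ℕ.≤-refl (ℕ.≤-reflexive (ℕ.*-identityˡ x)))
        Ψ1 : Ψ 1 ≡ ψ[ a ] x
        Ψ1 = trans (cong (λ w → ∑ w (λ j → 𝟙 (j ℕ.* 1 ≈? a) * Λ j)) x÷1) (∑-cong′ x (λ j → cong (λ w → 𝟙 (w ≈? a) * Λ j) (ℕ.*-identityʳ j)))
      ΛF : ∑ x (λ k → Λ k * F k) ≡ S₂ a x - ι x * invφ * M x + C * ψ° x
      ΛF = trans (∑-cong′ x (λ k → trans (ring 6 λ l e ψ x i c → l :* (e :* (ψ :- x :* i :+ c)) := l :* (e :* ψ) :- x :* (e :* l :* i) :+ c :* (e :* l)) (cong (λ w → Λ k * w - ι x * invφ * (e k * Λ k * inv k) + C * (e k * Λ k)) (e*Ψ k))))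
             (trans (∑-+ x _ _) (cong₂ _+_ (trans (∑-- x _ _) (cong (λ w → S₂ a x - w) (∑-*ˡ x (ι x * invφ) _))) (∑-*ˡ x C _)))
      eq : ∑ x (λ d → μ d * (ℓ x - ℓ d) * A d) + ι x * invφ * (M x - ℓ x) - C * (ℓ x + ψ° x) ≡ ψ[ a ] x * ℓ x + S₂ a x - ι 2 * invφ * (ι x * ℓ x)
      eq = trans (cong (λ w → w + ι x * invφ * (M x - ℓ x) - C * (ℓ x + ψ° x)) (trans inversion (cong₂ (λ u v → u * ℓ x + v) F1 ΛF)))
        (ring 8 λ p l x f c s m o → (p :- x :* f :+ c) :* l :+ (s :- x :* f :* m :+ c :* o) :+ x :* f :* (m :- l) :- c :* (l :+ o) := p :* l :+ s :- con 2 :* f :* (x :* l))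
      le : ι 364 * Q * ι x + ι x * invφ * (ι 28 * gg) + ι 7 * gg * (ι 2 * ι x + ι 8 * ι x) ≤ ι 462 * (gg * gg) * ι x
      le = lin (*≥0 (ι≥0 28) (*≥0 (ι≥0 x) gg≥0) ⊛ invφ≤1 ⊞ *≥0 (ι≥0 98) (ι≥0 x) ⊛ gg≤Q)
        (ring 3 λ q x f → con 462 :* (q :* q) :* x :+ (con 28 :* (x :* q) :* f :+ con 98 :* x :* q) := con 364 :* (q :* q) :* x :+ x :* f :* (con 28 :* q) :+ con 7 :* q :* (con 2 :* x :+ con 8 :* x) :+ (con 28 :* (x :* q) :* con 1 :+ con 98 :* x :* (q :* q)))

-- A lower bound for L(1, χ) with χ real.

module Character (g : ℕ) {{g≢0 : NonZero g}} where
  open import Data.Nat.Divisibility using (_∣_; _∣?_; divides; ∣⇒≤; m∣m*n; ∣-trans; *-cancelˡ-∣; *-monoʳ-∣; ∣n⇒∣m*n)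
  open import Data.Nat.Induction using (<-rec)
  open import Data.Nat.Tactic.RingSolver using (solve-∀)
  open import Data.Nat.Primality using (euclidsLemma)
  open import Data.Sum using (reduce)
  open Field
  open Sums
  open Factors
  open Log using (ι*inv*; frac; inv-diff; DiffBound; module Estimates)
  open import Relation.Binary.Definitions as Tri using (tri<; tri≈; tri>)

  open ≡-Reasoning

  -- `balanced` is what excludes the principal character and bounds the partial sums of χ.
  record RealCharacter : Set where
    field
      χ : ℕ → ℚ
      values : ∀ n → (χ n ≡ ι 1) ⊎ ((χ n ≡ - ι 1) ⊎ (χ n ≡ ι 0))
      χ-* : ∀ m n → χ (m ℕ.* n) ≡ χ m * χ n
      χ-1 : χ 1 ≡ ι 1
      periodic : ∀ i → χ (g ℕ.+ i) ≡ χ i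
      balanced : ∑ g χ ≡ ι 0

  private
    1≤g : 1 ℕ.≤ g
    1≤g = ℕ.>-nonZero⁻¹ g

    regroup : ∀ g Y → 32 ℕ.* g ℕ.* Y ≡ 2 ℕ.* g ℕ.* (16 ℕ.* Y)
    regroup = solve-∀

  -- The lower bound for L(1, χ) comes from comparing sums up to 4 Y², with the character sum cut at D.
  abstract
    Y D : ℕ
    Y = 1028 ℕ.* (g ℕ.* g)
    D = 32 ℕ.* g ℕ.* Y

    Y≥1 : 1 ℕ.≤ Y
    Y≥1 = ℕ.*-mono-≤ {1} {1028} (s≤s z≤n) (ℕ.*-mono-≤ 1≤g 1≤g)

    D≥1 : 1 ℕ.≤ D
    D≥1 = ℕ.*-mono-≤ (ℕ.*-mono-≤ {1} {32} (s≤s z≤n) 1≤g) Y≥1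

    ι-Y : ι Y ≡ ι 1028 * (ι g * ι g)
    ι-Y = trans (ι-* 1028 (g ℕ.* g)) (cong (ι 1028 *_) (ι-* g g))

    ι-D : ι D ≡ ι 32 * ι g * ι Y
    ι-D = trans (ι-* (32 ℕ.* g) Y) (cong (_* ι Y) (ι-* 32 g))

    D≡ : D ≡ 2 ℕ.* g ℕ.* (16 ℕ.* Y)
    D≡ = regroup g Y

  module _ (χχ : RealCharacter) where
    open RealCharacter χχ

    χ-Bd : ∀ n → Bd (χ n) (ι 1)
    χ-Bd n with values n
    ... | inj₁ h = Bd-≡ (sym h) (Bd-self 0≤1)
    ... | inj₂ (inj₁ h) = Bd-≡ (sym h) (Bd-neg (Bd-self 0≤1))
    ... | inj₂ (inj₂ h) = Bd-≡ (sym h) (Bd-0 0≤1)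

    χ-partial : ∀ n → Bd (∑ n χ) (ι g)
    χ-partial n = Bd-≤ (≤-reflexive (*-identityʳ _)) (periodic-Bd g χ periodic χ-Bd balanced n)

    R : ℕ → ℚ
    R n = ∑ n (λ d → 𝟙 (d ∣? n) * χ d)

    -- Multiplying the argument by `p` does not change this sum. With it, the recursion for `R`
    -- closes one factor `p` at a time, without splitting off a full power of `p`.
    N : ℕ → ℕ → ℚ
    N p n = ∑ n (λ d → 𝟙 (d ∣? n) * ((ι 1 - 𝟙 (p ∣? d)) * χ d))

    private
      extend : ∀ {n x} (f : ℕ → ℚ) → 1 ℕ.≤ n → n ℕ.≤ x → ∑ x (λ d → 𝟙 (d ∣? n) * f d) ≡ ∑ n (λ d → 𝟙 (d ∣? n) * f d)
      extend {n} f 1≤n n≤x = ∑-extend n≤x (λ d n<d _ → trans (cong (_* f d) (𝟙-no (d ∣? n) (λ h → ℕ.<⇒≱ n<d (∣⇒≤ {{ℕ.>-nonZero 1≤n}} h)))) (*-zeroˡ _))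

      strip : ∀ {p d m} → Prime p → ¬ (p ∣ d) → d ∣ p ℕ.* m → d ∣ m
      strip {p} {d} {m} pr p∤d (divides q eq) with euclidsLemma q d pr (subst (p ∣_) eq (m∣m*n m))
      ... | inj₂ h = contradiction h p∤d
      ... | inj₁ (divides r refl) = divides r (ℕ.*-cancelˡ-≡ m (r ℕ.* d) p {{ℕ.>-nonZero (prime>0 pr)}} (trans eq (trans (cong (ℕ._* d) (ℕ.*-comm r p)) (ℕ.*-assoc p r d))))

      coprime-part : ∀ {p} m → Prime p → 1 ℕ.≤ m → ∑ (p ℕ.* m) (λ d → 𝟙 (d ∣? (p ℕ.* m)) * ((ι 1 - 𝟙 (p ∣? d)) * χ d)) ≡ N p m
      coprime-part {p} m pr 1≤m = trans (∑-cong′ (p ℕ.* m) eq) (extend (λ d → (ι 1 - 𝟙 (p ∣? d)) * χ d) 1≤m (ℕ.m≤n*m m p {{ℕ.>-nonZero (prime>0 pr)}}))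
        where
        eq : ∀ d → 𝟙 (d ∣? (p ℕ.* m)) * ((ι 1 - 𝟙 (p ∣? d)) * χ d) ≡ 𝟙 (d ∣? m) * ((ι 1 - 𝟙 (p ∣? d)) * χ d)
        eq d with p ∣? d
        ... | yes _ = ring 3 λ a b c → a :* ((con 1 :- con 1) :* c) := b :* ((con 1 :- con 1) :* c)
        ... | no p∤d = cong (_* ((ι 1 - ι 0) * χ d)) (𝟙-⇔ (d ∣? (p ℕ.* m)) (d ∣? m) (strip pr p∤d) (∣n⇒∣m*n p))

    N-p : ∀ {p} m → Prime p → 1 ℕ.≤ m → N p (p ℕ.* m) ≡ N p m
    N-p m pr 1≤m = coprime-part m pr 1≤m

    N-∤ : ∀ {p} m → 1 ℕ.≤ m → ¬ (p ∣ m) → N p m ≡ R m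
    N-∤ {p} m 1≤m p∤m = ∑-cong′ m λ d → 𝟙*-cong (d ∣? m) (λ d∣m → trans (cong (λ z → (ι 1 - z) * χ d) (𝟙-no (p ∣? d) (λ h → p∤m (∣-trans h d∣m)))) (ring 1 λ a → (con 1 :- con 0) :* a := a))

    -- The divisors of p m that are multiples of `p` are p times the divisors of m; the others are
    -- the divisors of m prime to `p`.
    R-p : ∀ {p} m → Prime p → 1 ℕ.≤ m → R (p ℕ.* m) ≡ χ p * R m + N p m
    R-p {p} m pr 1≤m = begin
      ∑ x (λ d → h d)                                                       ≡⟨ ∑-cong′ x (λ d → ring 3 λ a t c → t :* c := a :* (t :* c) :+ t :* ((con 1 :- a) :* c)) ⟩
      ∑ x (λ d → 𝟙 (p ∣? d) * h d + 𝟙 (d ∣? x) * ((ι 1 - 𝟙 (p ∣? d)) * χ d)) ≡⟨ ∑-+ x _ _ ⟩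
      _                                                                     ≡⟨ cong₂ _+_ (trans (∑-multiples x p h (prime>0 pr)) mult) (coprime-part m pr 1≤m) ⟩
      χ p * R m + N p m                                                     ∎
      where
      x = p ℕ.* m
      instance
        p≢0 : NonZero p
        p≢0 = ℕ.>-nonZero (prime>0 pr)
      h : ℕ → ℚ
      h d = 𝟙 (d ∣? x) * χ d
      x÷p : x ÷ p ≡ m
      x÷p = ℕ.≤-antisym (ℕ.*-cancelˡ-≤ p (÷-* x p)) (÷-≤ (prime>0 pr) ℕ.≤-refl)
      mult : ∑ (x ÷ p) (λ k → h (p ℕ.* k)) ≡ χ p * R m
      mult = trans (cong (λ w → ∑ w (λ k → h (p ℕ.* k))) x÷p) (trans (∑-cong′ m (λ k → trans (cong₂ _*_ (𝟙-⇔ (p ℕ.* k ∣? x) (k ∣? m) (*-cancelˡ-∣ p) (*-monoʳ-∣ p)) (χ-* p k)) (ring 3 λ a b c → a :* (b :* c) := b :* (a :* c)))) (∑-*ˡ m (χ p) _))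

    private
      R1 : R 1 ≡ ι 1
      R1 = trans (cong₂ (λ a b → ι 0 + a * b) (𝟙-yes (1 ∣? 1) (divides 1 refl)) χ-1) (ring 0 (con 0 :+ con 1 :* con 1 := con 1))

      smaller : ∀ {p m} → Prime p → 1 ℕ.≤ m → m ℕ.< p ℕ.* m
      smaller {p} {m} pr 1≤m = subst (ℕ._< p ℕ.* m) (ℕ.*-identityˡ m) (ℕ.*-monoˡ-< m {{ℕ.>-nonZero 1≤m}} (prime>1 pr))

      factor : ∀ {p m} → 1 ℕ.≤ m → p ∣ m → Σ ℕ λ k → 1 ℕ.≤ k × m ≡ p ℕ.* k
      factor {p} 1≤m (divides zero refl) = ⊥-elim (ℕ.<-irrefl refl 1≤m)
      factor {p} 1≤m (divides k@(suc _) refl) = k , s≤s z≤n , ℕ.*-comm k p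

    -- By the value of χ(p) in `R-p`: for 1 and 0 no negative term appears; for - 1 the result is 0
    -- if p ∤ m, and two steps give R(p² k) = R(k).
    RN≥0 : ∀ n → 1 ℕ.≤ n → (ι 0 ≤ R n) × (∀ p → Prime p → ι 0 ≤ N p n)
    RN≥0 = <-rec _ go
      where
      go : ∀ n → (∀ {m} → m ℕ.< n → 1 ℕ.≤ m → (ι 0 ≤ R m) × (∀ p → Prime p → ι 0 ≤ N p m)) → 1 ℕ.≤ n → (ι 0 ≤ R n) × (∀ p → Prime p → ι 0 ≤ N p n)
      go n rec 1≤n = Rn , Nn
        where
        Rn : ι 0 ≤ R n
        Rn with ℕ.m≤n⇒m<n∨m≡n 1≤n
        ... | inj₂ refl = subst (ι 0 ≤_) (sym R1) 0≤1
        ... | inj₁ 2≤n with prime-divisor 2≤n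
        ... | p , pr , p∣n with factor 1≤n p∣n
        ... | m , 1≤m , refl with rec (smaller pr 1≤m) 1≤m | values p
        ... | r , nn | inj₁ h = subst (ι 0 ≤_) (sym (trans (R-p m pr 1≤m) (trans (cong (λ w → w * R m + N p m) h) (cong (_+ N p m) (*-identityˡ _))))) (+≥0 r (nn p pr))
        ... | r , nn | inj₂ (inj₂ h) = subst (ι 0 ≤_) (sym (trans (R-p m pr 1≤m) (trans (cong (λ w → w * R m + N p m) h) (ring 2 λ a b → con 0 :* a :+ b := b)))) (nn p pr)
        ... | r , nn | inj₂ (inj₁ h) with p ∣? m
        ...   | no p∤m = ≤-reflexive (sym (trans (R-p m pr 1≤m) (trans (cong₂ (λ w v → w * R m + v) h (N-∤ m 1≤m p∤m)) (ring 1 λ a → :- con 1 :* a :+ a := con 0))))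
        ...   | yes p∣m with factor 1≤m p∣m
        ...     | k , 1≤k , refl = subst (ι 0 ≤_) (sym (trans (R-p (p ℕ.* k) pr 1≤m) (trans (cong₂ (λ w v → w * R (p ℕ.* k) + v) h (N-p k pr 1≤k)) (trans (cong (λ w → - ι 1 * w + N p k) (trans (R-p k pr 1≤k) (cong (λ w → w * R k + N p k) h))) (ring 2 λ a b → :- con 1 :* (:- con 1 :* a :+ b) :+ b := a)))))
                      (proj₁ (rec (ℕ.<-trans (smaller pr 1≤k) (smaller pr 1≤m)) 1≤k))
        Nn : ∀ p → Prime p → ι 0 ≤ N p n
        Nn p pr with p ∣? n
        ... | no p∤n = subst (ι 0 ≤_) (sym (N-∤ n 1≤n p∤n)) Rn
        ... | yes p∣n with factor 1≤n p∣n
        ... | m , 1≤m , refl = subst (ι 0 ≤_) (sym (N-p m pr 1≤m)) (proj₂ (rec (smaller pr 1≤m) 1≤m) p pr)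

    -- Two steps of `R-p` lead from m² to (p m)². With χ(p) = - 1 they reproduce R(m²), with χ(p) =
    -- 1 they add 2 N(m²) ≥ 0, and χ(p) = 0 leaves N(m²), for which the bound on `N` is carried
    -- along.
    R-square : ∀ k → 1 ℕ.≤ k → (ι 1 ≤ R (k ℕ.* k)) × (∀ p → Prime p → ι 1 ≤ N p (k ℕ.* k))
    R-square = <-rec _ go
      where
      go : ∀ n → (∀ {m} → m ℕ.< n → 1 ℕ.≤ m → (ι 1 ≤ R (m ℕ.* m)) × (∀ p → Prime p → ι 1 ≤ N p (m ℕ.* m))) → 1 ℕ.≤ n → (ι 1 ≤ R (n ℕ.* n)) × (∀ p → Prime p → ι 1 ≤ N p (n ℕ.* n))
      go n rec 1≤n = Rn , Nn
        where
        sq : ∀ p m → p ℕ.* m ℕ.* (p ℕ.* m) ≡ p ℕ.* (p ℕ.* (m ℕ.* m))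
        sq p m = trans (ℕ.*-assoc p m (p ℕ.* m)) (cong (p ℕ.*_) (trans (sym (ℕ.*-assoc m p m)) (trans (cong (ℕ._* m) (ℕ.*-comm m p)) (ℕ.*-assoc p m m))))
        Rn : ι 1 ≤ R (n ℕ.* n)
        Rn with ℕ.m≤n⇒m<n∨m≡n 1≤n
        ... | inj₂ refl = ≤-reflexive (sym R1)
        ... | inj₁ 2≤n with prime-divisor 2≤n
        ... | p , pr , p∣n with factor 1≤n p∣n
        ... | m , 1≤m , refl = subst (ι 1 ≤_) (sym formula) (final (values p))
          where
          ih = rec (smaller pr 1≤m) 1≤m
          mm = m ℕ.* m
          1≤mm : 1 ℕ.≤ mm
          1≤mm = ℕ.*-mono-≤ 1≤m 1≤m
          pos = RN≥0 mm 1≤mm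
          formula : R (p ℕ.* m ℕ.* (p ℕ.* m)) ≡ χ p * (χ p * R mm + N p mm) + N p mm
          formula = trans (cong R (sq p m)) (trans (R-p (p ℕ.* mm) pr (ℕ.*-mono-≤ (prime>0 pr) 1≤mm)) (cong₂ (λ u v → χ p * u + v) (R-p mm pr 1≤mm) (N-p mm pr 1≤mm)))
          final : (χ p ≡ ι 1) ⊎ ((χ p ≡ - ι 1) ⊎ (χ p ≡ ι 0)) → ι 1 ≤ χ p * (χ p * R mm + N p mm) + N p mm
          final (inj₁ h) rewrite h = lin (proj₁ ih ⊞ ι≥0 2 ⊛ proj₂ pos p pr) (ring 2 λ a b → con 1 :* (con 1 :* a :+ b) :+ b :+ (con 1 :+ con 2 :* con 0) := con 1 :+ (a :+ con 2 :* b))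
          final (inj₂ (inj₁ h)) rewrite h = lin (proj₁ ih) (ring 2 λ a b → :- con 1 :* (:- con 1 :* a :+ b) :+ b :+ con 1 := con 1 :+ a)
          final (inj₂ (inj₂ h)) rewrite h = lin (proj₂ ih p pr) (ring 2 λ a b → con 0 :* (con 0 :* a :+ b) :+ b :+ con 1 := con 1 :+ b)
        Nn : ∀ p → Prime p → ι 1 ≤ N p (n ℕ.* n)
        Nn p pr with p ∣? n
        ... | no p∤n = subst (ι 1 ≤_) (sym (N-∤ (n ℕ.* n) (ℕ.*-mono-≤ 1≤n 1≤n) (λ h → p∤n (reduce (euclidsLemma n n pr h))))) Rn
        ... | yes p∣n with factor 1≤n p∣n
        ... | m , 1≤m , refl = subst (ι 1 ≤_) (sym (trans (cong (N p) (sq p m)) (trans (N-p (p ℕ.* (m ℕ.* m)) pr (ℕ.*-mono-≤ (prime>0 pr) 1≤mm)) (N-p (m ℕ.* m) pr 1≤mm)))) (proj₂ (rec (smaller pr 1≤m) 1≤m) p pr)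
          where
          1≤mm : 1 ℕ.≤ m ℕ.* m
          1≤mm = ℕ.*-mono-≤ 1≤m 1≤m

    P : ℕ → ℚ
    P z = ∑ z (λ d → χ d * inv d)

    private
      inv-decr : ∀ i → 1 ℕ.≤ i → inv (suc i) ≤ inv i
      inv-decr (suc i) _ = inv-anti (ℕ.n≤1+n _)

      split-≤ : ∀ {m n} → m ℕ.< n → Σ ℕ λ k → m ℕ.+ suc k ≡ n
      split-≤ {m} {n} m<n = ℕ.pred (n ℕ.∸ m) , trans (cong (m ℕ.+_) (ℕ.suc-pred (n ℕ.∸ m) {{ℕ.>-nonZero (ℕ.m<n⇒0<n∸m m<n)}})) (ℕ.m+[n∸m]≡n (ℕ.<⇒≤ m<n))

    P-tail : ∀ z Z → z ℕ.≤ Z → Bd (P Z - P z) (ι 2 * ι g * inv (suc z))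
    P-tail z Z z≤Z with ℕ.m≤n⇒m<n∨m≡n z≤Z
    ... | inj₂ refl = Bd-≡ (ring 1 λ a → con 0 := a :- a) (Bd-0 (*≥0 (*≥0 (ι≥0 2) (ι≥0 g)) (inv≥0 _)))
    ... | inj₁ z<Z with split-≤ z<Z
    ... | k , refl = Bd-≤ (≤-reflexive (ring 2 λ g i → (g :+ g) :* i := con 2 :* g :* i)) (abel-decreasing χ χ-partial inv z k (λ i p _ → inv-decr i (ℕ.≤-trans (s≤s z≤n) p)) (inv≥0 _))

    private
      y = 4 ℕ.* (Y ℕ.* Y)
      yq Yq Gq : ℚ
      yq = ι y
      Yq = ι Y
      Gq = ι g

      y≡ : yq ≡ ι 4 * (Yq * Yq)
      y≡ = trans (ι-* 4 (Y ℕ.* Y)) (cong (ι 4 *_) (ι-* Y Y))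

      -- The linear weight y - n replaces a sharp cut-off: twice this sum is y² / d - y up to an
      -- error of at most d, and it decreases in d.
      V : ℕ → ℚ
      V d = ∑ (y ÷ d) (λ m → yq - ι (d ℕ.* m))

      V-term≥0 : ∀ d m → m ℕ.≤ y ÷ d → ι 0 ≤ yq - ι (d ℕ.* m)
      V-term≥0 d m h = sub≥0 (ι-mono (≤-÷ {y} {d} h))

      V≥0 : ∀ d → ι 0 ≤ V d
      V≥0 d = ∑≥0 (y ÷ d) (λ m _ h → V-term≥0 d m h)

      V-decr : ∀ d → 1 ℕ.≤ d → V (suc d) ≤ V d
      V-decr d 1≤d = ≤-trans (∑-mono (y ÷ suc d) (λ m _ _ → lin (ι-mono (ℕ.*-monoˡ-≤ m (ℕ.n≤1+n d))) (ring 3 λ y a b → y :- a :+ a := y :- b :+ b)))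
        (∑-mono-range (÷-≤ 1≤d (ℕ.≤-trans (ℕ.*-monoˡ-≤ (y ÷ suc d) (ℕ.n≤1+n d)) (÷-* y (suc d)))) (λ m _ h → V-term≥0 d m h))

      ∑-id : ∀ z → ι 2 * ∑ z ι ≡ ι z * (ι z + ι 1)
      ∑-id zero = ring 0 (con 2 :* con 0 := con 0 :* (con 0 :+ con 1))
      ∑-id (suc z) = trans (*-distribˡ-+ _ _ _) (trans (cong₂ (λ a b → a + ι 2 * b) (∑-id z) (ι-suc z)) (trans (ring 1 λ z → z :* (z :+ con 1) :+ con 2 :* (z :+ con 1) := (z :+ con 1) :* (z :+ con 1 :+ con 1)) (cong (λ w → w * (w + ι 1)) (sym (ι-suc z)))))

      V-error : ℕ → ℚ
      V-error d = ι 2 * V d - (yq * yq * inv d - yq)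

      -- With θ the fractional part of y / d, the error is exactly d θ (1 - θ).
      V-error-Bd : ∀ d → 1 ℕ.≤ d → Bd (V-error d) (ι d)
      V-error-Bd d 1≤d = Bd-≡ (trans (ring 2 λ a b → b := a :+ b :- a) (cong (_- (yq * yq * inv d - yq)) (sym eq))) (Bd-≤ ε≤ (Bd-self (*≥0 (ι≥0 d) (*≥0 θ≥0 (sub≥0 θ≤1)))))
        where
        z = y ÷ d
        w = yq * inv d
        θ = w - ι z
        fr = frac y d 1≤d
        θ≥0 : ι 0 ≤ θ
        θ≥0 = sub≥0 (proj₁ fr)
        θ≤1 : θ ≤ ι 1
        θ≤1 = lin (proj₂ fr) (ring 2 λ w z → con 1 :+ w := w :- z :+ (z :+ con 1))
        ε≤ : ι d * (θ * (ι 1 - θ)) ≤ ι d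
        ε≤ = lin (ι≥0 d ⊛ (θ≤1 ⊞ sq≥0 θ)) (ring 2 λ d t → d :+ d :* (t :+ con 0) := d :* (t :* (con 1 :- t)) :+ d :* (con 1 :+ t :* t))
        dw : ι d * w ≡ yq
        dw = trans (ring 3 λ d y i → d :* (y :* i) := y :* (i :* d)) (trans (cong (yq *_) (inv*ι d {{ℕ.>-nonZero 1≤d}})) (*-identityʳ _))
        eq : ι 2 * V d ≡ yq * yq * inv d - yq + ι d * (θ * (ι 1 - θ))
        eq = begin
          ι 2 * V d                                             ≡⟨ cong (ι 2 *_) (trans (∑-- z _ _) (cong₂ _-_ (∑-const z yq) (trans (∑-cong′ z (λ m → ι-* d m)) (∑-*ˡ z (ι d) ι)))) ⟩
          ι 2 * (ι z * yq - ι d * ∑ z ι)                        ≡⟨ ring 4 (λ z y d s → con 2 :* (z :* y :- d :* s) := con 2 :* z :* y :- d :* (con 2 :* s)) ⟩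
          ι 2 * ι z * yq - ι d * (ι 2 * ∑ z ι)                  ≡⟨ cong (λ s → ι 2 * ι z * yq - ι d * s) (∑-id z) ⟩
          ι 2 * ι z * yq - ι d * (ι z * (ι z + ι 1))            ≡⟨ cong (λ v → ι 2 * ι z * v - ι d * (ι z * (ι z + ι 1))) dw ⟨
          ι 2 * ι z * (ι d * w) - ι d * (ι z * (ι z + ι 1))     ≡⟨ ring 3 (λ z d w → con 2 :* z :* (d :* w) :- d :* (z :* (z :+ con 1)) := d :* w :* w :- d :* w :+ d :* ((w :- z) :* (con 1 :- (w :- z)))) ⟩
          ι d * w * w - ι d * w + ι d * (θ * (ι 1 - θ))         ≡⟨ cong (λ v → v * w - v + ι d * (θ * (ι 1 - θ))) dw ⟩
          yq * w - yq + ι d * (θ * (ι 1 - θ))                   ≡⟨ ring 3 (λ y i t → y :* (y :* i) :- y :+ t := y :* y :* i :- y :+ t) ⟩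
          yq * yq * inv d - yq + ι d * (θ * (ι 1 - θ))          ∎

      W : ℚ
      W = ∑ y (λ n → R n * (yq - ι n))

      W≡ : W ≡ ∑ y (λ d → χ d * V d)
      W≡ = begin
        ∑ y (λ n → R n * (yq - ι n))                                        ≡⟨ ∑-cong y (λ n p q → trans (cong (_* (yq - ι n)) (sym (extend χ p q))) (sym (∑-*ʳ y (yq - ι n) _))) ⟩
        ∑ y (λ n → ∑ y (λ d → 𝟙 (d ∣? n) * χ d * (yq - ι n)))               ≡⟨ ∑-cong′ y (λ n → ∑-cong′ y (λ d → *-assoc _ _ _)) ⟩
        ∑ y (λ n → ∑ y (λ d → 𝟙 (d ∣? n) * (χ d * (yq - ι n))))             ≡⟨ ∑-divisors y (λ d n → χ d * (yq - ι n)) ⟩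
        ∑ y (λ d → ∑ (y ÷ d) (λ m → χ d * (yq - ι (d ℕ.* m))))              ≡⟨ ∑-cong′ y (λ d → ∑-*ˡ (y ÷ d) (χ d) _) ⟩
        ∑ y (λ d → χ d * V d)                                               ∎

      sq-inj : ∀ {a b} → a ℕ.* a ≡ b ℕ.* b → a ≡ b
      sq-inj {a} {b} h with ℕ.<-cmp a b
      ... | Tri.tri< a<b _ _ = ⊥-elim (ℕ.<-irrefl h (ℕ.*-mono-< a<b a<b))
      ... | Tri.tri≈ _ e _ = e
      ... | Tri.tri> _ _ b<a = ⊥-elim (ℕ.<-irrefl (sym h) (ℕ.*-mono-< b<a b<a))

      -- At most one `k` has k² = n, and then `R-square` applies; otherwise the left side is 0.
      squares≤R : ∀ n → 1 ℕ.≤ n → ∑ Y (λ k → 𝟙 (n ℕ.≟ k ℕ.* k)) ≤ R n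
      squares≤R n 1≤n with ℕ.anyUpTo? (λ k → n ℕ.≟ k ℕ.* k) (suc Y)
      ... | no none = ≤-trans (≤-reflexive (∑-zero Y (λ k _ q → 𝟙-no (n ℕ.≟ k ℕ.* k) (λ h → none (k , s≤s q , h))))) (proj₁ (RN≥0 n 1≤n))
      ... | yes (zero , _ , refl) = ⊥-elim (ℕ.<-irrefl refl 1≤n)
      ... | yes (k@(suc _) , s≤s k≤Y , refl) = ≤-trans (≤-reflexive (trans (∑-cong′ Y (λ j → trans (𝟙-⇔ (k ℕ.* k ℕ.≟ j ℕ.* j) (j ℕ.≟ k) (λ h → sym (sq-inj {k} {j} h)) (λ { refl → refl })) (sym (*-identityʳ _)))) (∑-single Y k {λ _ → ι 1} (s≤s z≤n) k≤Y))) (proj₁ (R-square k (s≤s z≤n)))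

      -- Each square k² ≤ Y² contributes at least y - k² ≥ 3 Y², and no other term is negative.
      W≥ : ι 3 * (Yq * Yq * Yq) ≤ W
      W≥ = ≤-trans (≤-trans step1 (≤-reflexive step2)) (∑-mono y (λ n p q → ≤-trans (≤-reflexive (*-comm _ _)) (≤-trans (sub≥0 (ι-mono q) ⊛ squares≤R n p) (≤-reflexive (*-comm _ _)))))
        where
        YY≤y : Y ℕ.* Y ℕ.≤ y
        YY≤y = ℕ.m≤n*m (Y ℕ.* Y) 4
        step1 : ι 3 * (Yq * Yq * Yq) ≤ ∑ Y (λ k → yq - ι (k ℕ.* k))
        step1 = ≤-trans (≤-reflexive (trans (ring 1 λ Y → con 3 :* (Y :* Y :* Y) := Y :* (con 3 :* (Y :* Y))) (sym (∑-const Y _)))) (∑-mono Y (λ k _ q → lin (ι-mono (ℕ.*-mono-≤ q q) ⊞ ≤-reflexive (ι-* Y Y) ⊞ ≤-reflexive (sym y≡)) (ring 4 λ Y y kk YY → y :- kk :+ (kk :+ (YY :+ con 4 :* (Y :* Y))) := con 3 :* (Y :* Y) :+ (YY :+ (Y :* Y :+ y)))))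
        step2 : ∑ Y (λ k → yq - ι (k ℕ.* k)) ≡ ∑ y (λ n → ∑ Y (λ k → 𝟙 (n ℕ.≟ k ℕ.* k)) * (yq - ι n))
        step2 = trans (∑-cong Y (λ k p q → sym (∑-single y (k ℕ.* k) {λ n → yq - ι n} (ℕ.*-mono-≤ p p) (ℕ.≤-trans (ℕ.*-mono-≤ q q) YY≤y)))) (trans (∑-swap Y y _) (∑-cong′ y (λ n → ∑-*ʳ Y (yq - ι n) _)))

      g≤gg : Gq ≤ Gq * Gq
      g≤gg = lin (ι≥0 g ⊛ ι-mono 1≤g) (ring 1 λ g → g :* g :+ g :* con 1 := g :+ g :* g)

      D<y : D ℕ.< y
      D<y = ι-cancel (lin (≤-reflexive (ι-suc D) ⊞ ≤-reflexive ι-D ⊞ ≤-reflexive (sym y≡) ⊞ *≥0 (ι≥0 32) (ι≥0 Y) ⊛ g≤gg ⊞ ι-mono Y≥1 ⊞ ι≥0 Y ⊛ ι-mono Y≥1 ⊞ ι≥0 2 ⊛ sq≥0 Yq ⊞ ι≥0 Y ⊛ ≤-reflexive (sym ι-Y) ⊞ *≥0 (ι≥0 996) (ι≥0 Y) ⊛ sq≥0 Gq)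
        (ring 5 λ y D′ D Y g → y :+ (D′ :+ (D :+ (con 4 :* (Y :* Y) :+ (con 32 :* Y :* g :+ (con 1 :+ (Y :* con 1 :+ (con 2 :* con 0 :+ (Y :* (con 1028 :* (g :* g)) :+ con 996 :* Y :* con 0)))))))) :=
           D′ :+ (D :+ con 1 :+ (con 32 :* g :* Y :+ (y :+ (con 32 :* Y :* (g :* g) :+ (Y :+ (Y :* Y :+ (con 2 :* (Y :* Y) :+ (Y :* Y :+ con 996 :* Y :* (g :* g)))))))))))

      -- Up to `D` each V(d) is expanded, which gives y² P(D) and the errors y g and D². Beyond `D`,
      -- partial summation against the decreasing `V` leaves 2 g y² / D.
      W≤ : ι 2 * W ≤ yq * yq * P D + yq * Gq + ι D * ι D + ι 2 * Gq * (yq * yq * inv D)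
      W≤ = ≤-trans (≤-reflexive (cong (ι 2 *_) W≡)) (lin (proj₂ tail ⊞ head) (ring 6 λ A B C E s t → A :+ B :+ C :+ E :+ (con 2 :* (s :- t) :+ con 2 :* t) := con 2 :* s :+ (E :+ (A :+ B :+ C))))
        where
        k = proj₁ (split-≤ D<y)
        Dk≡y = proj₂ (split-≤ D<y)
        S : ℕ → ℚ
        S n = ∑ n (λ d → χ d * V d)
        V≤ : ι 2 * V (suc D) ≤ yq * yq * inv D
        V≤ = lin (proj₂ (V-error-Bd (suc D) (s≤s z≤n)) ⊞ ι-mono D<y ⊞ *≥0 (ι≥0 y) (ι≥0 y) ⊛ inv-decr D D≥1) (ring 5 λ v y i i′ d → y :* y :* i :+ (v :- (y :* y :* i′ :- y) :+ (d :+ y :* y :* i′)) := v :+ (d :+ (y :+ y :* y :* i)))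
        tail : Bd (ι 2 * (S y - S D)) (ι 2 * Gq * (yq * yq * inv D))
        tail = Bd-≤ (lin (*≥0 (ι≥0 2) (ι≥0 g) ⊛ V≤) (ring 3 λ g v t → con 2 :* g :* t :+ con 2 :* g :* (con 2 :* v) := con 2 :* ((g :+ g) :* v) :+ con 2 :* g :* t))
          (Bd-*ˡ (ι≥0 2) (subst (λ n → Bd (S n - S D) ((Gq + Gq) * V (suc D))) Dk≡y (abel-decreasing χ χ-partial V D k (λ i p _ → V-decr i (ℕ.≤-trans (s≤s z≤n) p)) (V≥0 (D ℕ.+ suc k)))))
        ε-Bd : ∀ d → 1 ℕ.≤ d → d ℕ.≤ D → Bd (χ d * V-error d) (ι D)
        ε-Bd d p q = Bd-≤ (≤-trans (≤-reflexive (*-identityˡ _)) (ι-mono q)) (Bd-* (χ-Bd d) (V-error-Bd d p))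
        head : ι 2 * S D ≤ yq * yq * P D + yq * Gq + ι D * ι D
        head = ≤-trans (≤-reflexive eqS) (lin (proj₂ (∑-Bd D ε-Bd) ⊞ ≤-reflexive (∑-const D (ι D)) ⊞ proj₂ (Bd-*ˡ (ι≥0 y) (Bd-neg (χ-partial D))))
            (ring 7 λ a s y g e c dd → a :+ y :* g :+ dd :+ (e :+ (c :+ y :* :- s)) := a :- y :* s :+ e :+ (c :+ (dd :+ y :* g))))
          where
          eqS : ι 2 * S D ≡ yq * yq * P D - yq * ∑ D χ + ∑ D (λ d → χ d * V-error d)
          eqS = trans (sym (∑-*ˡ D (ι 2) _)) (trans (∑-cong′ D (λ d → ring 4 λ c v y i → con 2 :* (c :* v) := (y :* y :* (c :* i) :- y :* c) :+ c :* (con 2 :* v :- (y :* y :* i :- y)))) (trans (∑-+ D _ _) (cong (_+ ∑ D (λ d → χ d * V-error d)) (trans (∑-- D _ _) (cong₂ _-_ (∑-*ˡ D (yq * yq) _) (∑-*ˡ D yq χ))))))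

      -- With y = 4 Y² and D = 32 g Y the last error in `W≤` is Y³, and the two others are at most
      -- (4 + 1024) g² Y² = Y³, the origin of 1028. Against 2 W ≥ 6 Y³ this leaves 16 Y⁴ P(D) ≥ 4
      -- Y³.
      PD≥ : inv (4 ℕ.* Y) ≤ P D
      PD≥ = ι-cancelˡ (4 ℕ.* Y) {{ℕ.>-nonZero (ℕ.*-mono-≤ {1} {4} (s≤s z≤n) Y≥1)}} (≤-trans (≤-reflexive (trans (*-comm _ _) (inv*ι (4 ℕ.* Y) {{ℕ.>-nonZero (ℕ.*-mono-≤ {1} {4} (s≤s z≤n) Y≥1)}}))) (≤-trans main (≤-reflexive (cong (_* P D) (sym (ι-* 4 Y))))))
        where
        instance
          Y≢0 : NonZero Y
          Y≢0 = ℕ.>-nonZero Y≥1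
        last-term : ι 2 * Gq * (yq * yq * inv D) ≡ Yq * Yq * Yq
        last-term = begin
          ι 2 * Gq * (yq * yq * inv D)                          ≡⟨ cong (λ v → ι 2 * Gq * (v * v * inv D)) y≡ ⟩
          ι 2 * Gq * (ι 4 * (Yq * Yq) * (ι 4 * (Yq * Yq)) * inv D) ≡⟨ ring 3 (λ g Y i → con 2 :* g :* (con 4 :* (Y :* Y) :* (con 4 :* (Y :* Y)) :* i) := Y :* Y :* Y :* (i :* (con 32 :* g :* Y))) ⟩
          Yq * Yq * Yq * (inv D * (ι 32 * Gq * Yq))             ≡⟨ cong (λ v → Yq * Yq * Yq * (inv D * v)) ι-D ⟨
          Yq * Yq * Yq * (inv D * ι D)                          ≡⟨ cong (Yq * Yq * Yq *_) (inv*ι D {{ℕ.>-nonZero D≥1}}) ⟩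
          Yq * Yq * Yq * ι 1                                    ≡⟨ *-identityʳ _ ⟩
          Yq * Yq * Yq                                          ∎
        W≤′ : ι 2 * W ≤ ι 4 * (Yq * Yq) * (ι 4 * (Yq * Yq)) * P D + ι 4 * (Yq * Yq) * Gq + ι 32 * Gq * Yq * (ι 32 * Gq * Yq) + Yq * Yq * Yq
        W≤′ = subst₂ (λ a b → ι 2 * W ≤ a * a * P D + a * Gq + b * b + Yq * Yq * Yq) y≡ ι-D (subst (λ t → ι 2 * W ≤ yq * yq * P D + yq * Gq + ι D * ι D + t) last-term W≤)
        main : ι 1 ≤ ι 4 * Yq * P D
        main = ι-cancelˡ 4 (ι-cancelˡ Y (ι-cancelˡ Y (ι-cancelˡ Y (lin (ι≥0 2 ⊛ W≥ ⊞ W≤′ ⊞ *≥0 (ι≥0 4) (*≥0 (ι≥0 Y) (ι≥0 Y)) ⊛ g≤gg ⊞ *≥0 (ι≥0 Y) (ι≥0 Y) ⊛ ≤-reflexive (sym ι-Y))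
          (ring 4 λ Y g W p → Y :* (Y :* (Y :* (con 4 :* (con 4 :* Y :* p)))) :+ (con 2 :* (con 3 :* (Y :* Y :* Y)) :+ (con 2 :* W :+ (con 4 :* (Y :* Y) :* g :+ Y :* Y :* (con 1028 :* (g :* g))))) :=
             Y :* (Y :* (Y :* (con 4 :* con 1))) :+ (con 2 :* W :+ (con 4 :* (Y :* Y) :* (con 4 :* (Y :* Y)) :* p :+ con 4 :* (Y :* Y) :* g :+ con 32 :* g :* Y :* (con 32 :* g :* Y) :+ Y :* Y :* Y :+ (con 4 :* (Y :* Y) :* (g :* g) :+ Y :* Y :* Y))))))))

    -- The tail beyond `D` is at most 2 g / D = 1 / (16 Y), well below the 1 / (4 Y) of `PD≥`.
    L-lower : ∀ Z → D ℕ.≤ Z → inv (16 ℕ.* Y) ≤ P Z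
    L-lower Z D≤Z = lin (PD≥ ⊞ proj₁ (P-tail D Z D≤Z) ⊞ *≥0 (ι≥0 2) (ι≥0 g) ⊛ inv-decr D D≥1 ⊞ ≤-reflexive e1 ⊞ ≤-reflexive e2 ⊞ ι≥0 2 ⊛ inv≥0 (16 ℕ.* Y))
        (ring 7 λ p P i4 i16 g iD iD′ → P :+ (i4 :+ (:- (con 2 :* g :* iD′) :+ (con 2 :* g :* iD′ :+ (con 4 :* i16 :+ (con 2 :* g :* iD :+ con 2 :* con 0))))) := i16 :+ (p :+ (P :- p :+ (con 2 :* g :* iD :+ (i4 :+ (i16 :+ con 2 :* i16))))))
      where
      e1 : ι 4 * inv (16 ℕ.* Y) ≡ inv (4 ℕ.* Y)
      e1 = trans (cong (λ w → ι 4 * inv w) (ℕ.*-assoc 4 4 Y)) (ι*inv* 4 (4 ℕ.* Y) (s≤s z≤n))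
      e2 : ι 2 * Gq * inv D ≡ inv (16 ℕ.* Y)
      e2 = trans (cong₂ _*_ (sym (ι-* 2 g)) (cong inv D≡)) (ι*inv* (2 ℕ.* g) (16 ℕ.* Y) (ℕ.*-mono-≤ {1} {2} (s≤s z≤n) 1≤g))

-- Mertens' estimate twisted by a real character.

module CharacterMertens (g : ℕ) {{g≢0 : NonZero g}} (X : ℕ) (4≤X : 4 ℕ.≤ X) (L : ℕ → Field.ℚ) (diff : Log.DiffBound X L) where
  open Field
  open Log
  open Sums
  open Estimates X L diff
  open Selberg g X 4≤X L diff
  open Character g

  private
    -- ℓ(i) / i grows at first. The summand 2 makes it decrease from i = 1 on, and 2 / i is
    -- subtracted again after partial summation.
    decreasing : ∀ i → 1 ℕ.≤ i → i ℕ.< X → (ℓ (suc i) + ι 2) * inv (suc i) ≤ (ℓ i + ι 2) * inv i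
    decreasing i@(suc i′) p q = lin (inv≥0 (suc i) ⊛ ℓ-diff≤ i p q ⊞ +≥0 (ℓ≥0 p (ℕ.<⇒≤ q)) (ι≥0 2) ⊛ ≤-reflexive (sym (inv-diff i′)) ⊞ ℓ≥0 p (ℕ.<⇒≤ q) ⊛ *≥0 (inv≥0 i) (inv≥0 (suc i)))
      (ring 4 λ l l′ i i′ → (l :+ con 2) :* i :+ (i′ :* (l′ :- l) :+ ((l :+ con 2) :* (i :* i′) :+ l :* con 0)) := (l′ :+ con 2) :* i′ :+ (i′ :* (con 2 :* i) :+ ((l :+ con 2) :* (i :- i′) :+ l :* (i :* i′))))

  module _ (χχ : RealCharacter) (D≤X : D ℕ.≤ X) where
    open RealCharacter χχ

    Nχ : ℕ → ℚ
    Nχ y = ∑ y (λ k → χ k * Λ k * inv k)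

    private
      G = ι g
      lhs : ℕ → ℚ
      lhs y = ∑ y (λ n → ℓ n * (χ n * inv n))

      lhs-Bd : ∀ y → y ℕ.< X → Bd (lhs (suc y)) (ι 8 * G)
      lhs-Bd y q = Bd-≡ (trans (sym (∑-- (suc y) _ _)) (∑-cong′ (suc y) (λ n → ring 3 λ c l i → c :* ((l :+ con 2) :* i) :- c :* (con 2 :* i) := l :* (c :* i))))
        (Bd-≤ le (Bd-- (Bd-≡ (ring 1 λ a → a :- con 0 := a) (abel-decreasing χ (χ-partial χχ) (λ i → (ℓ i + ι 2) * inv i) 0 y (λ i p r → decreasing i p (ℕ.<-≤-trans r q)) (*≥0 (+≥0 (ℓ≥0 (s≤s z≤n) q) (ι≥0 2)) (inv≥0 (suc y)))))
                       (Bd-≡ (ring 1 λ a → a :- con 0 := a) (abel-decreasing χ (χ-partial χχ) (λ i → ι 2 * inv i) 0 y (λ i p r → ι≥0 2 ⊛ inv-decr i p) (*≥0 (ι≥0 2) (inv≥0 (suc y)))))))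
        where
        inv-decr : ∀ i → 1 ℕ.≤ i → inv (suc i) ≤ inv i
        inv-decr (suc i) _ = inv-anti (ℕ.n≤1+n _)
        le : (G + G) * ((ℓ 1 + ι 2) * inv 1) + (G + G) * (ι 2 * inv 1) ≤ ι 8 * G
        le = ≤-reflexive (trans (cong₂ (λ a b → (G + G) * ((a + ι 2) * b) + (G + G) * (ι 2 * b)) ℓ-1 inv1) (ring 1 λ g → (g :+ g) :* ((con 0 :+ con 2) :* con 1) :+ (g :+ g) :* (con 2 :* con 1) := con 8 :* g))

      lhs≡ : ∀ y → lhs y ≡ ∑ y (λ k → χ k * Λ k * inv k * P χχ (y ÷ k))
      lhs≡ y = trans (∑-ℓ-Λ y (λ n → χ n * inv n)) (∑-cong′ y (λ k → trans (cong (Λ k *_) (trans (∑-cong′ (y ÷ k) (λ m → trans (cong₂ _*_ (χ-* k m) (inv-* k m)) (ring 4 λ a b c d → a :* b :* (c :* d) := a :* c :* (b :* d)))) (∑-*ˡ (y ÷ k) (χ k * inv k) _))) (ring 4 λ l c i p → l :* (c :* i :* p) := c :* l :* i :* p)))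

      PX = P χχ X

      term : ∀ y k → 1 ℕ.≤ k → k ℕ.≤ y → y ℕ.≤ X → Bd (χ k * Λ k * inv k * (PX - P χχ (y ÷ k))) (Λ k * (ι 2 * G * inv y))
      term y k p q r = Bd-≤ le (Bd-* (Bd-* (Bd-* (χ-Bd χχ k) (Bd-self (Λ≥0 k p (ℕ.≤-trans q r)))) (Bd-self (inv≥0 k))) (P-tail χχ (y ÷ k) X (ℕ.≤-trans (÷≤ y k) r)))
        where
        instance
          k≢0 : NonZero k
          k≢0 = ℕ.>-nonZero p
          y≢0 : NonZero y
          y≢0 = ℕ.>-nonZero (ℕ.≤-trans p q)
        s = suc (y ÷ k)
        inv-le : inv k * inv s ≤ inv y
        inv-le = ≤-trans (≤-reflexive (sym (inv-* k s))) (inv-anti (ℕ.<⇒≤ (÷-< y k p)))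
        le : ι 1 * Λ k * inv k * (ι 2 * G * inv s) ≤ Λ k * (ι 2 * G * inv y)
        le = lin (*≥0 (*≥0 (ι≥0 2) (ι≥0 g)) (Λ≥0 k p (ℕ.≤-trans q r)) ⊛ inv-le) (ring 5 λ l k g s y → l :* (con 2 :* g :* y) :+ con 2 :* g :* l :* (k :* s) := con 1 :* l :* k :* (con 2 :* g :* s) :+ con 2 :* g :* l :* y)

      -- Expanding `ℓ` through `Λ` turns the bounded sum of ℓ(n) χ(n) / n into the partial sums P(y
      -- ÷ k) weighted by χ(k) Λ(k) / k. Replacing each of them by P(X) costs O(1), by `P-tail` and
      -- Chebyshev.
      PN : ∀ y → 1 ℕ.≤ y → y ℕ.< X → Bd (PX * Nχ y) (ι 24 * G)
      PN y@(suc y′) p q = Bd-≡ eq (Bd-≤ le (Bd-+ (lhs-Bd y′ (ℕ.<⇒≤ q)) (∑-Bd y (λ k a b → term y k a b (ℕ.<⇒≤ q)))))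
        where
        eq : lhs y + ∑ y (λ k → χ k * Λ k * inv k * (PX - P χχ (y ÷ k))) ≡ PX * Nχ y
        eq = trans (cong (_+ ∑ y (λ k → χ k * Λ k * inv k * (PX - P χχ (y ÷ k)))) (lhs≡ y)) (trans (sym (∑-+ y _ _)) (trans (∑-cong′ y (λ k → ring 3 λ a p P → a :* p :+ a :* (P :- p) := P :* a)) (∑-*ˡ y PX _)))
        le : ι 8 * G + ∑ y (λ k → Λ k * (ι 2 * G * inv y)) ≤ ι 24 * G
        le = lin (≤-reflexive (∑-*ʳ y (ι 2 * G * inv y) Λ) ⊞ *≥0 (*≥0 (ι≥0 2) (ι≥0 g)) (inv≥0 y) ⊛ chebyshev y q ⊞ *≥0 (ι≥0 16) (ι≥0 g) ⊛ ≤-reflexive (inv*ι y))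
          (ring 5 λ g s p i y → con 24 :* g :+ (s :+ (con 2 :* g :* i :* p :+ con 16 :* g :* (i :* y))) := con 8 :* g :+ s :+ (p :* (con 2 :* g :* i) :+ (con 2 :* g :* i :* (con 8 :* y) :+ con 16 :* g :* con 1)))

    mertens-χ : ∀ y → 1 ℕ.≤ y → y ℕ.< X → Bd (Nχ y) (ι (16 ℕ.* Y) * (ι 24 * G))
    mertens-χ y p q = lower , upper
      where
      Z = 16 ℕ.* Y
      instance
        Z≢0 : NonZero Z
        Z≢0 = ℕ.>-nonZero (ℕ.*-mono-≤ {1} {16} (s≤s z≤n) Y≥1)
      LP = L-lower χχ X D≤X
      b = PN y p q
      K = ι 24 * G
      K≥0 : ι 0 ≤ K
      K≥0 = *≥0 (ι≥0 24) (ι≥0 g)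
      -- N ≤ Z K because Z⁻¹ N ≤ L N ≤ K when N ≥ 0
      scale : ∀ {n} → ι 0 ≤ n → PX * n ≤ K → n ≤ ι Z * K
      scale {n} n≥0 h = lin (ι≥0 Z ⊛ (n≥0 ⊛ LP ⊞ h) ⊞ n≥0 ⊛ ≤-reflexive (sym (inv*ι Z))) (ring 5 λ n z k i P → z :* k :+ (z :* (n :* i :+ P :* n) :+ n :* con 1) := n :+ (z :* (n :* P :+ k) :+ n :* (i :* z)))
      upper : Nχ y ≤ ι Z * K
      upper with ≤-total (ι 0) (Nχ y)
      ... | inj₁ h = scale h (proj₂ b)
      ... | inj₂ h = ≤-trans h (*≥0 (ι≥0 Z) K≥0)
      lower : - (ι Z * K) ≤ Nχ y
      lower with ≤-total (ι 0) (Nχ y)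
      ... | inj₁ h = ≤-trans (lin (*≥0 (ι≥0 Z) K≥0) (ring 1 λ a → con 0 :+ con 0 := :- a :+ a)) h
      ... | inj₂ h = lin (scale { - Nχ y} (lin h (ring 1 λ n → :- n :+ n := con 0 :+ con 0)) (lin (proj₁ b) (ring 3 λ P n k → k :+ :- k := P :* :- n :+ P :* n))) (ring 2 λ n k → n :+ :- n := :- k :+ k)

-- Upper bounds for primes of a class in a window.

module Windows (g : ℕ) {{g≢0 : NonZero g}} (X : ℕ) (4≤X : 4 ℕ.≤ X) (L : ℕ → Field.ℚ) (diff : Log.DiffBound X L) where
  open Field
  open Log
  open import Data.Nat.Coprimality using (Coprime)
  open Sums
  open Residues g
  open Estimates X L diff
  open Selberg g X 4≤X L diff

  cancel-pos : ∀ {t s l} → ι 1 ≤ l → t * l ≤ s * l → t ≤ s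
  cancel-pos {t} {s} {l} 1≤l h with ≤-total t s
  ... | inj₁ p = p
  ... | inj₂ p = lin (h ⊞ sub≥0 p ⊛ 1≤l) (ring 3 λ t s l → s :+ (t :* l :+ (t :- s) :* con 1) := t :+ (s :* l :+ (t :- s) :* l))

  -- `β` is twice the expected density 1 / φ. `KU` collects the Selberg errors at y′ ≤ 2 y and at
  -- `y`, hence 3 KS, and 8 for replacing ℓ(y′) by ℓ(y) + 2 in the main term.
  β KS KU : ℚ
  β = ι 2 * invφ
  KS = ι 462 * (gg * gg)
  KU = ι 3 * KS + ι 8

  β≥0 : ι 0 ≤ β
  β≥0 = *≥0 (ι≥0 2) invφ≥0

  β≤2 : β ≤ ι 2
  β≤2 = lin (ι≥0 2 ⊛ invφ≤1) (ring 1 λ f → con 2 :+ con 2 :* f := con 2 :* f :+ con 2 :* con 1)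

  KS≥0 : ι 0 ≤ KS
  KS≥0 = *≥0 (ι≥0 462) (*≥0 gg≥0 gg≥0)

  -- the Λ-mass of the class of b in the window (u, v]
  mass : ℕ → ℕ → ℕ → ℚ
  mass b u v = ψ[ b ] v - ψ[ b ] u

  ψ-term≥0 : ∀ b → ∀ i → 1 ℕ.≤ i → i ℕ.≤ X → ι 0 ≤ 𝟙 (i ≈? b) * Λ i
  ψ-term≥0 b i p q = *≥0 (𝟙≥0 (i ≈? b)) (Λ≥0 i p q)

  ψ[]-mono : ∀ b {u v} → u ℕ.≤ v → v ℕ.≤ X → ψ[ b ] u ≤ ψ[ b ] v
  ψ[]-mono b u≤v v≤X = ∑-mono-range u≤v (λ i p q → ψ-term≥0 b i (ℕ.≤-trans (s≤s z≤n) p) (ℕ.≤-trans q v≤X))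

  mass≥0 : ∀ b {u v} → u ℕ.≤ v → v ℕ.≤ X → ι 0 ≤ mass b u v
  mass≥0 b u≤v v≤X = sub≥0 (ψ[]-mono b u≤v v≤X)

  mass-+ : ∀ b u v w → mass b u w ≡ mass b u v + mass b v w
  mass-+ b u v w = ring 3 λ a b c → c :- a := b :- a :+ (c :- b)

  ψ[]-≤ : ∀ b y → y ℕ.< X → ψ[ b ] y ≤ ι 8 * ι y
  ψ[]-≤ b y q = ≤-trans (∑-mono y (λ i p r → 𝟙*-≤ (i ≈? b) (Λ≥0 i p (ℕ.≤-trans r (ℕ.<⇒≤ q))))) (chebyshev y q)

  Ψ : ℕ → ℕ → ℕ → ℚ
  Ψ z x k = ∑ (x ÷ k) (λ j → 𝟙 (j ℕ.* k ≈? z) * Λ j)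

  Ψ-mono : ∀ z k {x x′} → x ℕ.≤ x′ → x′ ℕ.≤ X → Ψ z x k ≤ Ψ z x′ k
  Ψ-mono z k x≤x′ x′≤X = ∑-mono-range (÷-mono k x≤x′) (λ i p q → *≥0 (𝟙≥0 (i ℕ.* k ≈? z)) (Λ≥0 i (ℕ.≤-trans (s≤s z≤n) p) (ℕ.≤-trans q (ℕ.≤-trans (÷≤ _ k) x′≤X))))

  S₂-extend : ∀ z {x x′} → x ℕ.≤ x′ → S₂ z x ≡ ∑ x′ (λ k → Λ k * Ψ z x k)
  S₂-extend z {x} {x′} x≤x′ = sym (∑-extend x≤x′ (λ k x<k _ → trans (cong (λ w → Λ k * ∑ w (λ j → 𝟙 (j ℕ.* k ≈? z) * Λ j)) (ℕ.n<1⇒n≡0 (ℕ.≰⇒> (λ h → ℕ.<⇒≱ x<k (subst (ℕ._≤ x) (ℕ.*-identityʳ k) (≤-÷ {x} {k} h)))))) (*-zeroʳ _)))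

  S₂-diff : ∀ z {x x′} → x ℕ.≤ x′ → S₂ z x′ - S₂ z x ≡ ∑ x′ (λ k → Λ k * (Ψ z x′ k - Ψ z x k))
  S₂-diff z {x} {x′} x≤x′ = trans (cong (λ w → S₂ z x′ - w) (S₂-extend z x≤x′)) (trans (sym (∑-- x′ _ _)) (∑-cong′ x′ (λ k → ring 3 λ l a b → l :* a :- l :* b := l :* (a :- b))))

  S₂-mono : ∀ z {x x′} → x ℕ.≤ x′ → x′ ℕ.≤ X → S₂ z x ≤ S₂ z x′
  S₂-mono z {x} {x′} x≤x′ x′≤X = ≤-trans (≤-reflexive (S₂-extend z x≤x′)) (∑-mono x′ (λ k p q → Λ≥0 k p (ℕ.≤-trans q x′≤X) ⊛ Ψ-mono z k x≤x′ x′≤X))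

  -- Brun–Titchmarsh with constant 2, a by-product of Selberg's formula.
  window-upper : ∀ b y y′ → Coprime b g → 1 ℕ.≤ y → y ℕ.≤ y′ → y′ ℕ.≤ 2 ℕ.* y → 2 ℕ.* y ℕ.< X →
    (mass b y y′ - β * (ι y′ - ι y)) * ℓ y ≤ KU * ι y
  window-upper b y y′ cb 1≤y y≤y′ y′≤2y 2y<X = lin
    (proj₂ (selberg b cb y′ 1≤y′ y′<X) ⊞ proj₁ (selberg b cb y 1≤y (ℕ.≤-<-trans y≤y′ y′<X)) ⊞ S₂-mono b y≤y′ (ℕ.<⇒≤ y′<X) ⊞ ψ≥0 ⊛ ℓ-mono 1≤y y≤y′ (ℕ.<⇒≤ y′<X)
     ⊞ *≥0 β≥0 (ι≥0 y′) ⊛ ℓ-window 4≤X y y′ 1≤y y′≤2y 1≤y′ (ℕ.<⇒≤ 2y<X) ⊞ *≥0 (ι≥0 2) (ι≥0 y′) ⊛ β≤2 ⊞ +≥0 KS≥0 (ι≥0 4) ⊛ y′q)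
    (ring 10 λ p′ l′ s′ f y′ p l s y K →
      (con 3 :* K :+ con 8) :* y :+
        (p′ :* l′ :+ s′ :- con 2 :* f :* (y′ :* l′) :+ (:- (K :* y) :+ (s :+ (p′ :* l :+ (con 2 :* f :* y′ :* l′ :+ (con 2 :* y′ :* (con 2 :* f) :+ (K :+ con 4) :* y′))))))
      := (p′ :- p :- con 2 :* f :* (y′ :- y)) :* l :+
        (K :* y′ :+ (p :* l :+ s :- con 2 :* f :* (y :* l) :+ (s′ :+ (p′ :* l′ :+ (con 2 :* f :* y′ :* (l :+ con 2) :+ (con 2 :* y′ :* con 2 :+ (K :+ con 4) :* (con 2 :* y))))))))
    where
    1≤y′ = ℕ.≤-trans 1≤y y≤y′
    y′<X = ℕ.≤-<-trans y′≤2y 2y<X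
    y′q : ι y′ ≤ ι 2 * ι y
    y′q = ≤-trans (ι-mono y′≤2y) (≤-reflexive (ι-* 2 y))
    ψ≥0 : ι 0 ≤ ψ[ b ] y′
    ψ≥0 = ∑≥0 y′ (λ i p q → ψ-term≥0 b i p (ℕ.≤-trans q (ℕ.<⇒≤ y′<X)))

  ℓ-power : ∀ n → ℓ (2 ℕ.^ n) ≡ ι n * ℓ 2
  ℓ-power zero = trans ℓ-1 (sym (*-zeroˡ _))
  ℓ-power (suc n) = trans (ℓ-* {2} {2 ℕ.^ n} (s≤s z≤n) (ℕ.m^n>0 2 n)) (trans (cong (ℓ 2 +_) (ℓ-power n)) (trans (ring 2 λ l n → l :+ n :* l := (n :+ con 1) :* l) (cong (_* ℓ 2) (sym (ι-suc n)))))

  -- ℓ(2^(3 m)) = 3 m ℓ 2 and ℓ 2 ≥ 1/3. Largeness conditions on `ℓ` thereby become thresholds in ℕ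
  -- that do not mention `L`.
  ℓ-large : ∀ m {y} → 2 ℕ.^ (3 ℕ.* m) ℕ.≤ y → y ℕ.≤ X → ι m ≤ ℓ y
  ℓ-large m {y} h q = ≤-trans (lin (ι≥0 (3 ℕ.* m) ⊛ ℓ2≥ 4≤X ⊞ ≤-reflexive (sym (ℓ-power (3 ℕ.* m))) ⊞ ≤-reflexive third) (ring 5 λ m k l l2 i → l :+ (k :* i :+ (k :* l2 :+ m)) := m :+ (k :* l2 :+ (l :+ k :* i))))
      (ℓ-mono (ℕ.m^n>0 2 (3 ℕ.* m)) h q)
    where
    third : ι m ≡ ι (3 ℕ.* m) * inv 3
    third = sym (trans (cong (_* inv 3) (ι-* 3 m)) (trans (ring 3 λ a m i → a :* m :* i := m :* (i :* a)) (trans (cong (ι m *_) (inv*ι 3)) (*-identityʳ _))))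

-- Erdős's argument: a sparse class forces every class to be full or empty on a stretch.

module Erdos (g : ℕ) {{g≢0 : NonZero g}} (X : ℕ) (4≤X : 4 ℕ.≤ X) (L : ℕ → Field.ℚ) (diff : Log.DiffBound X L) where
  open Field
  open Log
  open import Data.Nat.Coprimality using (Coprime; coprime?)
  open import Relation.Nullary.Decidable using (_×-dec_)
  open Sums
  open Residues g
  open Estimates X L diff
  open Selberg g X 4≤X L diff
  open Windows g X 4≤X L diff

  -- The errors of `Total.total` divided by `x`: 84 gg from Mertens with B ≤ 3 x, 3 KS from Selberg
  -- at both ends of the window, 18 from replacing ℓ(x + h) by ℓ(x) + 2, and 256 T from the large
  -- `k`.
  K₁ : ℕ → ℚ
  K₁ T = ι 84 * gg + ι 3 * KS + ι 18 + ι 256 * ι T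

  module Window (x h : ℕ) (1≤h : 1 ℕ.≤ h) (2h≤x : h ℕ.+ h ℕ.≤ x) (2x′<X : 2 ℕ.* (x ℕ.+ h) ℕ.< X)
                (ε : ℚ) (ε≥0 : ι 0 ≤ ε) (ε≤1 : ε ≤ ι 1)
                (T : ℕ) (3≤T : 3 ℕ.≤ T) (T-large : ∀ y → T ℕ.≤ y → y ℕ.≤ X → (KU ≤ ε * ℓ y) × (ι 1 ≤ ℓ y)) (εT : ι 2 ≤ ε * ι T) where

    x′ : ℕ
    x′ = x ℕ.+ h

    x≤x′ : x ℕ.≤ x′
    x≤x′ = ℕ.m≤m+n x h

    x′<X : x′ ℕ.< X
    x′<X = ℕ.≤-<-trans (ℕ.m≤n*m x′ 2) 2x′<X

    x<X : x ℕ.< X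
    x<X = ℕ.≤-<-trans x≤x′ x′<X

    1≤x : 1 ℕ.≤ x
    1≤x = ℕ.≤-trans 1≤h (ℕ.≤-trans (ℕ.m≤m+n h h) 2h≤x)

    h≤x : h ℕ.≤ x
    h≤x = ℕ.≤-trans (ℕ.m≤m+n h h) 2h≤x

    x′≡ : ι x′ ≡ ι x + ι h
    x′≡ = ι-+ x h

    2h≤x′ : ι h + ι h ≤ ι x
    2h≤x′ = ≤-trans (≤-reflexive (sym (ι-+ h h))) (ι-mono 2h≤x)

    -- From `T` on, the error KU u / ℓ(u) of `window-upper` is at most ε u.
    mass-upper : ∀ b u v → Coprime b g → T ℕ.≤ u → u ℕ.≤ v → v ℕ.≤ 2 ℕ.* u → v ℕ.≤ x′ → mass b u v ≤ β * (ι v - ι u) + ε * ι u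
    mass-upper b u v cb T≤u u≤v v≤2u v≤x′ = lin (cancel-pos (proj₂ large) (≤-trans (window-upper b u v cb 1≤u u≤v v≤2u 2u<X) (lin (ι≥0 u ⊛ proj₁ large) (ring 4 λ k u ε l → ε :* u :* l :+ u :* k := k :* u :+ u :* (ε :* l)))))
        (ring 3 λ m d e → d :+ e :+ (m :- d) := m :+ e)
      where
      1≤u = ℕ.≤-trans (ℕ.≤-trans (s≤s z≤n) 3≤T) T≤u
      2u<X = ℕ.≤-<-trans (ℕ.*-monoʳ-≤ 2 (ℕ.≤-trans u≤v v≤x′)) 2x′<X
      large = T-large u T≤u (ℕ.≤-trans (ℕ.≤-trans u≤v v≤x′) (ℕ.<⇒≤ x′<X))

    -- What `k` contributes to the growth of `S₂` from `x` to `x′`; by `W-mass` it is the mass of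
    -- the class z / k in the window scaled down by `k`.
    W : ℕ → ℕ → ℚ
    W z k = Ψ z x′ k - Ψ z x k

    Ψ-class : ∀ {z k b} y → (∀ j → j ℕ.* k ≈ z → j ≈ b) → (∀ j → j ≈ b → j ℕ.* k ≈ z) → Ψ z y k ≡ ψ[ b ] (y ÷ k)
    Ψ-class {z} {k} {b} y to from = ∑-cong′ (y ÷ k) (λ j → cong (_* Λ j) (𝟙-⇔ (j ℕ.* k ≈? z) (j ≈? b) (to j) (from j)))

    W-mass : ∀ {z k b} → Coprime k g → b ℕ.* k ≈ z → W z k ≡ mass b (x ÷ k) (x′ ÷ k)
    W-mass {z} {k} {b} ck bk = cong₂ _-_ (Ψ-class x′ to from) (Ψ-class x to from)
      where
      to : ∀ j → j ℕ.* k ≈ z → j ≈ b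
      to j p = *-cancel≈ {k} {j} {b} ck (trans (≡⇒≈ {k ℕ.* j} {j ℕ.* k} (ℕ.*-comm k j)) (trans p (trans (sym bk) (≡⇒≈ {b ℕ.* k} {k ℕ.* b} (ℕ.*-comm b k)))))
      from : ∀ j → j ≈ b → j ℕ.* k ≈ z
      from j p = trans (*-cong≈ {j} {b} {k} {k} p refl) bk

    Ψ-noncop : ∀ {z k} y → Coprime z g → ¬ Coprime k g → Ψ z y k ≡ ι 0
    Ψ-noncop {z} {k} y cz ¬ck = ∑-zero (y ÷ k) (λ j _ _ → trans (cong (_* Λ j) (𝟙-no (j ℕ.* k ≈? z) (λ p → ¬ck (cop-*⁻ʳ j (≈-cop {z} {j ℕ.* k} (sym p) cz))))) (*-zeroˡ _))

    module Range {k : ℕ} (1≤k : 1 ℕ.≤ k) (k≤ : k ℕ.≤ x ÷ T) where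
      y = x ÷ k
      y′ = x′ ÷ k
      private instance
        k≢0 : NonZero k
        k≢0 = ℕ.>-nonZero 1≤k
      T≤y : T ℕ.≤ y
      T≤y = ÷-≤ 1≤k (subst (ℕ._≤ x) (ℕ.*-comm T k) (≤-÷ {x} {T} k≤))
      y≤y′ : y ℕ.≤ y′
      y≤y′ = ÷-mono k x≤x′
      y≤xk : ι y ≤ ι x * inv k
      y≤xk = proj₁ (frac x k 1≤k)
      xk≤y : ι x * inv k ≤ ι y + ι 1
      xk≤y = proj₂ (frac x k 1≤k)
      y′≤xk : ι y′ ≤ ι x * inv k + ι h * inv k
      y′≤xk = ≤-trans (proj₁ (frac x′ k 1≤k)) (≤-reflexive (trans (cong (_* inv k) x′≡) (*-distribʳ-+ _ _ _)))
      hk≤ : ι h * inv k + ι h * inv k ≤ ι x * inv k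
      hk≤ = lin (inv≥0 k ⊛ 2h≤x′) (ring 3 λ h x i → x :* i :+ i :* (h :+ h) := h :* i :+ h :* i :+ i :* x)
      y′≤2y : y′ ℕ.≤ 2 ℕ.* y
      y′≤2y = ι-cancel (≤-trans (ι-cancelˡ 2 {ι y′} {ι 2 * ι y} (lin (ι≥0 2 ⊛ y′≤xk ⊞ hk≤ ⊞ ι≥0 3 ⊛ xk≤y ⊞ ι-mono (ℕ.≤-trans 3≤T T≤y))
                 (ring 4 λ y′ y xk hk → con 2 :* (con 2 :* y) :+ (con 2 :* y′ :+ (hk :+ hk :+ (con 3 :* xk :+ con 3))) := con 2 :* y′ :+ (con 2 :* (xk :+ hk) :+ (xk :+ (con 3 :* (y :+ con 1) :+ y)))))) (≤-reflexive (sym (ι-* 2 y))))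
      2≤εxk : ι 2 ≤ ε * (ι x * inv k)
      2≤εxk = ≤-trans εT (ε≥0 ⊛ ≤-trans (ι-mono T≤y) y≤xk)
      y′≤x′ : y′ ℕ.≤ x′
      y′≤x′ = ÷≤ x′ k
      W-upper : ∀ {z} → Coprime z g → Coprime k g → W z k ≤ (β * ι h + ι 2 * ε * ι x) * inv k
      W-upper {z} cz ck = ≤-trans (≤-reflexive (W-mass ck bk)) (lin
          (mass-upper b y y′ cb T≤y y≤y′ y′≤2y y′≤x′ ⊞ β≥0 ⊛ y′≤xk ⊞ β≥0 ⊛ xk≤y ⊞ ε≥0 ⊛ y≤xk ⊞ β≤2 ⊞ 2≤εxk)
          (ring 8 λ m b y′ y h x ε i → (b :* h :+ con 2 :* ε :* x) :* i :+ (m :+ (b :* y′ :+ (b :* (x :* i) :+ (ε :* y :+ (b :+ con 2))))) :=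
             m :+ (b :* (y′ :- y) :+ ε :* y :+ (b :* (x :* i :+ h :* i) :+ (b :* (y :+ con 1) :+ (ε :* (x :* i) :+ (con 2 :+ ε :* (x :* i))))))))
        where
        dv = divide k z ck cz
        b = proj₁ dv
        cb = proj₁ (proj₂ dv)
        bk = proj₁ (proj₂ (proj₂ dv))

    B : ℚ
    B = β * ι h + ι 2 * ε * ι x

    -- The deficit of `W z k` below the largest value permitted by `W-upper`.
    v : ℕ → ℕ → ℚ
    v z k = B * inv k - W z k

    v≥0 : ∀ {z k} → Coprime z g → Coprime k g → 1 ℕ.≤ k → k ℕ.≤ x ÷ T → ι 0 ≤ v z k
    v≥0 cz ck p q = sub≥0 (Range.W-upper p q cz ck)

    B≤3x : B ≤ ι 3 * ι x
    B≤3x = lin (ι≥0 h ⊛ β≤2 ⊞ 2h≤x′ ⊞ *≥0 (ι≥0 2) (ι≥0 x) ⊛ ε≤1) (ring 4 λ b h x ε → con 3 :* x :+ (h :* b :+ (h :+ h :+ con 2 :* x :* ε)) := b :* h :+ con 2 :* ε :* x :+ (h :* con 2 :+ (x :+ con 2 :* x :* con 1)))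

    B≥0 : ι 0 ≤ B
    B≥0 = +≥0 (*≥0 β≥0 (ι≥0 h)) (*≥0 (*≥0 (ι≥0 2) ε≥0) (ι≥0 x))

    2T<X : T ℕ.≤ x → 2 ℕ.* T ℕ.< X
    2T<X T≤x = ℕ.≤-<-trans (ℕ.*-monoʳ-≤ 2 (ℕ.≤-trans T≤x x≤x′)) 2x′<X

    module Total (T≤x : T ℕ.≤ x) (x-large : K₁ T ≤ ε * ℓ x) {z : ℕ} (cz : Coprime z g) (sparse : mass z x x′ ≤ ε * ι x) where
      N = x ÷ T
      N≤x = ÷≤ x T
      1≤T = ℕ.≤-trans (s≤s z≤n) 3≤T
      x≤X = ℕ.<⇒≤ x<X
      x′≤X = ℕ.<⇒≤ x′<X

      eΛW : ∀ k → e k * Λ k * W z k ≡ Λ k * W z k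
      eΛW k with coprime? k g
      ... | yes _ = cong (_* W z k) (*-identityˡ _)
      ... | no ¬ck = trans (cong (λ w → ι 0 * Λ k * w) W0) (trans (ring 1 λ l → con 0 :* l :* con 0 := l :* con 0) (cong (Λ k *_) (sym W0)))
        where
        W0 : W z k ≡ ι 0
        W0 = trans (cong₂ _-_ (Ψ-noncop x′ cz ¬ck) (Ψ-noncop x cz ¬ck)) (ring 0 (con 0 :- con 0 := con 0))

      -- the total of Λ W is forced from below by Selberg's formula
      ∑ΛW≥ : β * ι h * ℓ x - ι 3 * KS * ι x - ε * ι x * (ℓ x + ι 2) - ι 16 * ι x ≤ ∑ x′ (λ k → Λ k * W z k)
      ∑ΛW≥ = ≤-trans (lin (proj₁ (selberg z cz x′ (ℕ.≤-trans 1≤x x≤x′) x′<X) ⊞ proj₂ (selberg z cz x 1≤x x<X)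
            ⊞ *≥0 β≥0 (ι≥0 x′) ⊛ ℓ≤ℓ′ ⊞ ℓ′≥0 ⊛ sparse ⊞ *≥0 ε≥0 (ι≥0 x) ⊛ ℓ′≤ ⊞ ψ≥0 ⊛ ℓ′≤ ⊞ ι≥0 2 ⊛ ψ[]-≤ z x x<X ⊞ KS≥0 ⊛ (≤-reflexive x′≡ ⊞ ι-mono h≤x) ⊞ *≥0 β≥0 ℓ≥0′ ⊛ ≤-reflexive (sym x′≡))
          (ring 12 λ p′ p s′ s l′ l f x′ x h ε K →
            s′ :- s :+ (:- (K :* x′) :+ (p :* l :+ s :- con 2 :* f :* (x :* l) :+ (con 2 :* f :* x′ :* l :+ (l′ :* (p′ :- p) :+ (ε :* x :* l′ :+ (p :* l′ :+ (con 2 :* p :+ (K :* (x′ :+ h) :+ con 2 :* f :* l :* (x :+ h)))))))))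
            := con 2 :* f :* h :* l :- con 3 :* K :* x :- ε :* x :* (l :+ con 2) :- con 16 :* x :+
               (p′ :* l′ :+ s′ :- con 2 :* f :* (x′ :* l′) :+ (K :* x :+ (con 2 :* f :* x′ :* l′ :+ (l′ :* (ε :* x) :+ (ε :* x :* (l :+ con 2) :+ (p :* (l :+ con 2) :+ (con 2 :* (con 8 :* x) :+ (K :* (x :+ h :+ x) :+ con 2 :* f :* l :* x′)))))))))) (≤-reflexive (S₂-diff z x≤x′))
        where
        ℓ≤ℓ′ : ℓ x ≤ ℓ x′
        ℓ≤ℓ′ = ℓ-mono 1≤x x≤x′ x′≤X
        ℓ≥0′ : ι 0 ≤ ℓ x
        ℓ≥0′ = ℓ≥0 1≤x x≤X
        ℓ′≥0 : ι 0 ≤ ℓ x′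
        ℓ′≥0 = ≤-trans ℓ≥0′ ℓ≤ℓ′
        ℓ′≤ : ℓ x′ ≤ ℓ x + ι 2
        ℓ′≤ = ℓ-window 4≤X x x′ 1≤x (ℕ.≤-trans (ℕ.+-monoʳ-≤ x h≤x) (ℕ.≤-reflexive (cong (x ℕ.+_) (sym (ℕ.+-identityʳ x))))) (ℕ.≤-trans 1≤x x≤x′) (ℕ.<⇒≤ (ℕ.≤-<-trans (ℕ.*-monoʳ-≤ 2 x≤x′) 2x′<X))
        ψ≥0 : ι 0 ≤ ψ[ z ] x
        ψ≥0 = ∑≥0 x (λ i p q → ψ-term≥0 z i p (ℕ.≤-trans q x≤X))

      -- For k > x ÷ T the scaled window ends at or below 2 T, so W ≤ 8 · 2 T; moreover ψ(x′) ≤ 16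
      -- x.
      tail : ∑ x′ (λ k → Λ k * W z k) - ∑ N (λ k → Λ k * W z k) ≤ ι 256 * ι T * ι x
      tail = ≤-trans (≤-reflexive eq) (≤-trans (∑-mono x′ bound) (≤-trans (≤-reflexive (∑-*ʳ x′ (ι 16 * ι T) Λ))
          (lin (*≥0 (ι≥0 16) (ι≥0 T) ⊛ (chebyshev x′ x′<X ⊞ ι≥0 8 ⊛ (≤-reflexive x′≡ ⊞ ι-mono h≤x))) (ring 5 λ p T x′ x h → con 256 :* T :* x :+ con 16 :* T :* (p :+ con 8 :* (x′ :+ h)) := p :* (con 16 :* T) :+ con 16 :* T :* (con 8 :* x′ :+ con 8 :* (x :+ h :+ x))))))
        where
        N≤x′ = ℕ.≤-trans N≤x x≤x′
        f : ℕ → ℚ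
        f k = Λ k * W z k
        eq : ∑ x′ f - ∑ N f ≡ ∑ x′ (λ k → (ι 1 - 𝟙 (k ℕ.≤? N)) * f k)
        eq = trans (cong (λ w → ∑ x′ f - w) (sym (∑-restrict f N≤x′))) (trans (sym (∑-- x′ _ _)) (∑-cong′ x′ (λ k → ring 2 λ f i → f :- i :* f := (con 1 :- i) :* f)))
        bound : ∀ k → 1 ℕ.≤ k → k ℕ.≤ x′ → (ι 1 - 𝟙 (k ℕ.≤? N)) * f k ≤ Λ k * (ι 16 * ι T)
        bound k 1≤k k≤x′ with k ℕ.≤? N
        ... | yes _ = ≤-trans (≤-reflexive (ring 1 λ f → (con 1 :- con 1) :* f := con 0)) (*≥0 (Λ≥0 k 1≤k (ℕ.≤-trans k≤x′ x′≤X)) (*≥0 (ι≥0 16) (ι≥0 T)))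
        ... | no k≰N = ≤-trans (≤-reflexive (ring 1 λ f → (con 1 :- con 0) :* f := f)) (Λ≥0 k 1≤k (ℕ.≤-trans k≤x′ x′≤X) ⊛ W≤)
          where
          xTk : x ℕ.< k ℕ.* T
          xTk = ℕ.<-≤-trans (÷-< x T 1≤T) (ℕ.≤-trans (ℕ.*-monoʳ-≤ T (ℕ.≰⇒> k≰N)) (ℕ.≤-reflexive (ℕ.*-comm T k)))
          x′÷k≤ : x′ ÷ k ℕ.≤ 2 ℕ.* T
          x′÷k≤ = ℕ.*-cancelˡ-≤ k {{ℕ.>-nonZero 1≤k}} (ℕ.≤-trans (÷-* x′ k) (ℕ.≤-trans (ℕ.+-monoʳ-≤ x h≤x) (ℕ.≤-trans (ℕ.+-mono-≤ (ℕ.<⇒≤ xTk) (ℕ.<⇒≤ xTk)) (ℕ.≤-reflexive (trans (sym (ℕ.*-distribˡ-+ k T T)) (cong (λ w → k ℕ.* (T ℕ.+ w)) (sym (ℕ.+-identityʳ T))))))))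
          W≤ : W z k ≤ ι 16 * ι T
          W≤ = lin (Ψ≥0 ⊞ ∑-mono (x′ ÷ k) {λ j → 𝟙 (j ℕ.* k ≈? z) * Λ j} {Λ} (λ j p q → 𝟙*-≤ (j ℕ.* k ≈? z) (Λ≥0 j p (ℕ.≤-trans q (ℕ.≤-trans (÷≤ x′ k) x′≤X)))) ⊞ ψ-mono x′÷k≤ (ℕ.<⇒≤ (2T<X T≤x)) ⊞ chebyshev (2 ℕ.* T) (2T<X T≤x) ⊞ ι≥0 8 ⊛ ≤-reflexive (ι-* 2 T))
              (ring 6 λ a b p p′ T t → con 16 :* T :+ (con 0 :+ (a :+ (p :+ (p′ :+ con 8 :* t)))) := a :- b :+ (b :+ (p :+ (p′ :+ (con 8 :* t :+ con 8 :* (con 2 :* T))))))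
            where
            Ψ≥0 : ι 0 ≤ Ψ z x k
            Ψ≥0 = ∑≥0 (x ÷ k) (λ j p q → *≥0 (𝟙≥0 (j ℕ.* k ≈? z)) (Λ≥0 j p (ℕ.≤-trans q (ℕ.≤-trans (÷≤ x k) x≤X))))

      -- A sparse `z` leaves almost nothing to the first term of Selberg's formula on the window, so
      -- the sum of Λ W must nearly reach its maximum B M(N), and the deficits are small on average.
      -- Of the 4 ε, two come from `B`, one from the sparse mass and one from `x-large`.
      total : ∑ N (λ k → e k * Λ k * v z k) ≤ ι 4 * ε * ι x * ℓ x
      total = ≤-trans (≤-reflexive eq) (lin
          (B≥0 ⊛ M-mono ⊞ B≥0 ⊛ proj₂ (mertens x 1≤x x<X) ⊞ *≥0 (ι≥0 28) gg≥0 ⊛ B≤3x ⊞ ∑ΛW≥ ⊞ tail ⊞ ι≥0 x ⊛ x-large ⊞ *≥0 (ι≥0 2) (ι≥0 x) ⊛ ε≤1)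
          (ring 12 λ b h ε x MN Mx l q K F FN T → let B = b :* h :+ con 2 :* ε :* x in
            con 4 :* ε :* x :* l :+ (B :* MN :+ (B :* (Mx :- l) :+ (con 28 :* q :* B :+ (b :* h :* l :- con 3 :* K :* x :- ε :* x :* (l :+ con 2) :- con 16 :* x :+ (F :- FN :+ (x :* (con 84 :* q :+ con 3 :* K :+ con 18 :+ con 256 :* T) :+ con 2 :* x :* ε))))))
            := B :* MN :- FN :+ (B :* Mx :+ (B :* (con 28 :* q) :+ (con 28 :* q :* (con 3 :* x) :+ (F :+ (con 256 :* T :* x :+ (x :* (ε :* l) :+ con 2 :* x :* con 1))))))))
        where
        M-mono : M N ≤ M x
        M-mono = ∑-mono-range N≤x (λ i p q → *≥0 (eΛ≥0 x≤X i (ℕ.≤-trans (s≤s z≤n) p) q) (inv≥0 i))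
        eq : ∑ N (λ k → e k * Λ k * v z k) ≡ B * M N - ∑ N (λ k → Λ k * W z k)
        eq = trans (∑-cong′ N (λ k → trans (ring 4 λ el B i w → el :* (B :* i :- w) := B :* (el :* i) :- el :* w) (cong (λ w → B * (e k * Λ k * inv k) - w) (eΛW k)))) (trans (∑-- N _ _) (cong (_- ∑ N (λ k → Λ k * W z k)) (∑-*ˡ N B _)))

    module Classes (T≤x : T ℕ.≤ x) (x-large : K₁ T ≤ ε * ℓ x) (Z : ℕ → Set) (Z? : ∀ z → Dec (Z z)) (Z-cop : ∀ {z} → Z z → Coprime z g)
                   (sparse : ∀ {z} → Z z → mass z x x′ ≤ ε * ι x) (θ : ℚ) (θ≥0 : ι 0 ≤ θ) where
      N : ℕ
      N = x ÷ T

      N≤x : N ℕ.≤ x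
      N≤x = ÷≤ x T

      private
        x≤X = ℕ.<⇒≤ x<X

      -- Summed over `Z`, so that a single good `k` serves all sparse classes at once.
      V : ℕ → ℚ
      V k = ∑ g (λ z → 𝟙 (Z? z) * v z k)

      V-term≥0 : ∀ {k} → Coprime k g → 1 ℕ.≤ k → k ℕ.≤ N → ∀ z → ι 0 ≤ 𝟙 (Z? z) * v z k
      V-term≥0 {k} ck p q z with Z? z
      ... | yes Zz = ≤-trans (v≥0 (Z-cop Zz) ck p q) (≤-reflexive (sym (*-identityˡ _)))
      ... | no _ = ≤-reflexive (sym (*-zeroˡ _))

      V≥0 : ∀ {k} → Coprime k g → 1 ℕ.≤ k → k ℕ.≤ N → ι 0 ≤ V k
      V≥0 ck p q = ∑≥0 g (λ z _ _ → V-term≥0 ck p q z)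

      v≤V : ∀ {k z} → Coprime k g → 1 ℕ.≤ k → k ℕ.≤ N → Z z → 1 ℕ.≤ z → z ℕ.≤ g → v z k ≤ V k
      v≤V {k} {z} ck p q Zz 1≤z z≤g = ≤-trans (≤-reflexive (sym (trans (cong (_* v z k) (𝟙-yes (Z? z) Zz)) (*-identityˡ _)))) (∑-≥ g z 1≤z z≤g (λ z _ _ → V-term≥0 ck p q z))

      c : ℕ → ℚ
      c k = e k * Λ k * V k

      c≥0 : ∀ k → 1 ℕ.≤ k → k ℕ.≤ N → ι 0 ≤ c k
      c≥0 k p q with coprime? k g
      ... | yes ck = *≥0 (*≥0 0≤1 (Λ≥0 k p (ℕ.≤-trans q (ℕ.≤-trans N≤x x≤X)))) (V≥0 ck p q)
      ... | no _ = ≤-reflexive (ring 2 λ a b → con 0 := con 0 :* a :* b)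

      ∑c : ∑ N c ≤ ι g * (ι 4 * ε * ι x * ℓ x)
      ∑c = ≤-trans (≤-reflexive eq) (≤-trans (∑-mono g {λ z → 𝟙 (Z? z) * ∑ N (λ k → e k * Λ k * v z k)} {λ _ → ι 4 * ε * ι x * ℓ x} (λ z _ _ → each z)) (≤-reflexive (∑-const g _)))
        where
        eq : ∑ N c ≡ ∑ g (λ z → 𝟙 (Z? z) * ∑ N (λ k → e k * Λ k * v z k))
        eq = trans (∑-cong′ N (λ k → sym (∑-*ˡ g (e k * Λ k) _))) (trans (∑-swap N g _) (∑-cong′ g (λ z → trans (∑-cong′ N (λ k → ring 3 λ a i v → a :* (i :* v) := i :* (a :* v))) (∑-*ˡ N (𝟙 (Z? z)) _))))
        each : ∀ z → 𝟙 (Z? z) * ∑ N (λ k → e k * Λ k * v z k) ≤ ι 4 * ε * ι x * ℓ x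
        each z with Z? z
        ... | yes Zz = ≤-trans (≤-reflexive (*-identityˡ _)) (Total.total T≤x x-large (Z-cop Zz) (sparse Zz))
        ... | no _ = ≤-trans (≤-reflexive (*-zeroˡ _)) (*≥0 (*≥0 (*≥0 (ι≥0 4) ε≥0) (ι≥0 x)) (ℓ≥0 1≤x x≤X))

      Good : ℕ → Set
      Good k = V k ≤ θ * (ι x * inv k)

      -- The whole scaled window has nearly maximal mass, and the pieces before `u` and after `v`
      -- cannot exceed `mass-upper`; so the part between cannot fall short.
      good-mass : ∀ {k z b} u v → Good k → Coprime k g → 1 ℕ.≤ k → k ℕ.≤ N → Z z → 1 ℕ.≤ z → z ℕ.≤ g → Coprime b g → b ℕ.* k ≈ z →
        x ÷ k ℕ.≤ u → u ℕ.≤ v → v ℕ.≤ x′ ÷ k → β * (ι v - ι u) - (θ + ι 2 * ε) * (ι x * inv k) ≤ mass b u v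
      good-mass {k} {z} {b} u v good ck p q Zz 1≤z z≤g cb bk y≤u u≤v v≤y′ = lin
          (good ⊞ v≤V ck p q Zz 1≤z z≤g ⊞ ≤-reflexive (W-mass {z} {k} {b} ck bk) ⊞ mass-upper b y u cb T≤y y≤u u≤2y (ℕ.≤-trans u≤v v≤x′) ⊞ mass-upper b v y′ cb T≤v v≤y′ y′≤2v y′≤x′
            ⊞ ε≥0 ⊛ y≤xk ⊞ ε≥0 ⊛ (ι-mono v≤y′ ⊞ y′≤xk ⊞ hk≤ ⊞ hk≥0) ⊞ β≥0 ⊛ (y′≤xk ⊞ xk≤y) ⊞ β≤2 ⊞ 2≤εxk)
          (ring 17 λ pu pv py py′ u v y y′ x h i ε θ b V w w′ →
            pv :- pu :+ (V :+ ((b :* h :+ con 2 :* ε :* x) :* i :- (w :- w′) :+ (w :- w′ :+ (pu :- py :+ (py′ :- pv :+ (ε :* y :+ (ε :* (v :+ (y′ :+ (h :* i :+ h :* i :+ con 0))) :+ (b :* (y′ :+ x :* i) :+ (b :+ con 2)))))))))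
            := b :* (v :- u) :- (θ :+ con 2 :* ε) :* (x :* i) :+
               (θ :* (x :* i) :+ (V :+ (py′ :- py :+ (b :* (u :- y) :+ ε :* y :+ (b :* (y′ :- v) :+ ε :* v :+ (ε :* (x :* i) :+ (ε :* (y′ :+ (x :* i :+ h :* i :+ (x :* i :+ h :* i))) :+ (b :* (x :* i :+ h :* i :+ (y :+ con 1)) :+ (con 2 :+ ε :* (x :* i)))))))))))
        where
        open Range p q
        T≤v = ℕ.≤-trans T≤y (ℕ.≤-trans y≤u u≤v)
        v≤x′ = ℕ.≤-trans v≤y′ y′≤x′
        u≤2y = ℕ.≤-trans (ℕ.≤-trans u≤v v≤y′) y′≤2y
        y′≤2v = ℕ.≤-trans y′≤2y (ℕ.*-monoʳ-≤ 2 (ℕ.≤-trans y≤u u≤v))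
        hk≥0 : ι 0 ≤ ι h * inv k
        hk≥0 = *≥0 (ι≥0 h) (inv≥0 k)

      -- If no `k` of the class `s` in (u, v] were good, each would add at least ρ Λ(k) to the sum
      -- of `c`, with ρ = θ x / v. The total ρ m ≥ 2 τ x would exceed τ x. The number `t` witnesses
      -- τ > 0.
      find : ∀ {s m τ t} u v → 1 ℕ.≤ v → u ℕ.≤ v → v ℕ.≤ N → Coprime s g → ∑ v c - ∑ u c ≤ τ * ι x → m ≤ mass s u v → (τ + τ) * ι v ≤ m * θ → ι 1 ≤ τ * ι t →
        Σ ℕ λ k → u ℕ.< k × k ℕ.≤ v × k ≈ s × Good k
      find {s} {m} {τ} {t} u v 1≤v u≤v v≤N cs sum≤ m≤ τ≤ 1≤τ with ℕ.anyUpTo? (λ k → (u ℕ.<? k) ×-dec ((k ≈? s) ×-dec (V k ≤? θ * (ι x * inv k)))) (suc v)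
      ... | yes (k , s≤s k≤v , u<k , k≈s , gd) = k , u<k , k≤v , k≈s , gd
      ... | no none = ⊥-elim (1≰0 (≤-trans step (≤-reflexive (*-zeroʳ (ι t)))))
        where
        instance
          v≢0 : NonZero v
          v≢0 = ℕ.>-nonZero 1≤v
        ρ = θ * (ι x * inv v)
        ρ≥0 : ι 0 ≤ ρ
        ρ≥0 = *≥0 θ≥0 (*≥0 (ι≥0 x) (inv≥0 v))
        each : ∀ k → u ℕ.< k → k ℕ.≤ v → ρ * (𝟙 (k ≈? s) * Λ k) ≤ c k
        each k u<k k≤v with k ≈? s
        ... | no _ = ≤-trans (≤-reflexive (ring 2 λ r l → r :* (con 0 :* l) := con 0)) (c≥0 k (ℕ.≤-trans (s≤s z≤n) u<k) (ℕ.≤-trans k≤v v≤N))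
        ... | yes k≈s = ≤-trans (≤-trans (lin (Λ≥0 k 1≤k k≤X ⊛ V≥) (ring 3 λ r l V → l :* V :+ l :* r := r :* (con 1 :* l) :+ l :* V)) (≤-reflexive (sym (*-identityˡ _))))
               (≤-reflexive (trans (sym (*-assoc _ _ _)) (cong (λ w → w * Λ k * V k) (sym (𝟙-yes (coprime? k g) (≈-cop {s} {k} (sym k≈s) cs))))))
          where
          1≤k = ℕ.≤-trans (s≤s z≤n) u<k
          k≤X = ℕ.≤-trans (ℕ.≤-trans k≤v v≤N) (ℕ.≤-trans N≤x x≤X)
          V≥ : ρ ≤ V k
          V≥ = ≤-trans (θ≥0 ⊛ (ι≥0 x ⊛ inv-anti {k} {v} {{ℕ.>-nonZero 1≤k}} k≤v)) (≰⇒≥ (λ gd → none (k , s≤s k≤v , u<k , k≈s , gd)))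
        sum≥ : ρ * mass s u v ≤ τ * ι x
        sum≥ = ≤-trans (≤-reflexive (trans (ring 3 λ r a b → r :* (a :- b) := r :* a :- r :* b) (cong₂ _-_ (sym (∑-*ˡ v ρ _)) (sym (∑-*ˡ u ρ _))))) (≤-trans (∑-diff-mono u≤v each) sum≤)
        ρv : ρ * ι v ≡ θ * ι x
        ρv = trans (ring 4 λ θ x i v → θ :* (x :* i) :* v := θ :* x :* (i :* v)) (trans (cong (θ * ι x *_) (inv*ι v)) (*-identityʳ _))
        τxv≤0 : τ * ι x * ι v ≤ ι 0
        τxv≤0 = lin (ι≥0 v ⊛ (ρ≥0 ⊛ m≤ ⊞ sum≥) ⊞ ι≥0 x ⊛ τ≤ ⊞ ≤-reflexive (cong (m *_) (sym ρv)))
          (ring 7 λ τ x v r m M θ → con 0 :+ (v :* (r :* m :+ r :* M) :+ (x :* ((τ :+ τ) :* v) :+ m :* (θ :* x))) := τ :* x :* v :+ (v :* (r :* M :+ τ :* x) :+ (x :* (m :* θ) :+ m :* (r :* v))))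
        step : ι 1 ≤ ι t * ι 0
        step = ≤-trans (lin (1≤τ ⊞ *≥0 0≤1 (≤-trans 0≤1 1≤τ) ⊛ xv≥1) (ring 3 λ τ t xv → t :* (τ :* xv) :+ (con 1 :+ con 1 :* (τ :* t) :* con 1) := con 1 :+ (τ :* t :+ con 1 :* (τ :* t) :* xv)))
                 (≤-trans (≤-reflexive (ring 4 λ t τ x v → t :* (τ :* (x :* v)) := t :* (τ :* x :* v))) (ι≥0 t ⊛ τxv≤0))
          where
          xv≥1 : ι 1 ≤ ι x * ι v
          xv≥1 = ≤-trans (ι-mono (ℕ.*-mono-≤ 1≤x 1≤v)) (≤-reflexive (ι-* x v))

      ∑c-mono : ∀ {u v} → u ℕ.≤ v → v ℕ.≤ N → ∑ u c ≤ ∑ v c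
      ∑c-mono u≤v v≤N = ∑-mono-range u≤v (λ i p r → c≥0 i (ℕ.≤-trans (s≤s z≤n) p) (ℕ.≤-trans r v≤N))

      -- The stretch (Q δ, R Q δ] is cut into cells of length δ. `sumI` bounds the deficits on it,
      -- `sumJ` those on its image under k ↦ x / k, where `Step` looks for partners. `c1` to `c5`
      -- say how small θ, ε, τ and κ have to be.
      module Stretch (q : ℕ) (1≤q : 1 ℕ.≤ q) (x≡ : x ≡ q ℕ.* h) (Q R δ : ℕ) (1≤δ : 1 ℕ.≤ δ) (2q<Q : 2 ℕ.* q ℕ.< Q)
                     (T≤A : T ℕ.≤ Q ℕ.* δ) (RA≤N : R ℕ.* Q ℕ.* δ ℕ.≤ N) (4q≤T : 4 ℕ.* q ℕ.≤ T)
                     (τ : ℚ) (t : ℕ) (τ≥0 : ι 0 ≤ τ) (1≤τt : ι 1 ≤ τ * ι t) (κ : ℚ)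
                     (sumI : ∑ (R ℕ.* Q ℕ.* δ) c - ∑ (Q ℕ.* δ) c ≤ τ * ι x)
                     (sumJ : ∑ (x ÷ (Q ℕ.* δ)) c - ∑ (x ÷ (R ℕ.* Q ℕ.* δ)) c ≤ τ * ι x)
                     (c1 : ι 2 * θ + ι 5 * ε ≤ β * inv (8 ℕ.* q)) (c2 : ι 4 * τ ≤ β * inv (8 ℕ.* q) * θ)
                     (c3 : (θ + ι 2 * ε) * ι (R ℕ.* Q) ≤ κ) (c4 : ι 2 * τ * ι (R ℕ.* Q) ≤ κ * θ) (c5 : κ + κ ≤ β) where

        cell : ℕ → ℕ → ℚ
        cell s j = mass s (j ℕ.* δ) (suc j ℕ.* δ)

        private
          RQ = R ℕ.* Q
          D = RQ ℕ.* δ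
          θ2ε≥0 : ι 0 ≤ θ + ι 2 * ε
          θ2ε≥0 = +≥0 θ≥0 (*≥0 (ι≥0 2) ε≥0)
          δ>0 : ∀ n → 1 ℕ.≤ n → 1 ℕ.≤ n ℕ.* δ
          δ>0 n p = ℕ.*-mono-≤ p 1≤δ

        HasGood : ℕ → ℕ → Set
        HasGood s j = Σ ℕ λ k → j ℕ.* δ ℕ.< k × k ℕ.≤ suc j ℕ.* δ × k ≈ s × Good k

        -- Two reflections k ↦ x / k. A good `k₁` in cell a + 1 fills its scaled window in the class
        -- z / s. That window contains (P, P′], which does not depend on `k₁`, and there a good `k₂`
        -- of this class is found. The scaled window of `k₂` covers the cells a, a + 1, a + 2 and is
        -- full in the class z′ / k₂, that is s′.
        module Step (a : ℕ) (2Q≤ : 2 ℕ.* Q ℕ.≤ suc a) (<RQ : suc a ℕ.< RQ) {s s′ z z′ : ℕ} (cs : Coprime s g) (cs′ : Coprime s′ g)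
                    (Zz : Z z) (1≤z : 1 ℕ.≤ z) (z≤g : z ℕ.≤ g) (Zz′ : Z z′) (1≤z′ : 1 ℕ.≤ z′) (z′≤g : z′ ℕ.≤ g)
                    (ss′ : s′ ℕ.* z ≈ s ℕ.* z′) (hg : HasGood s (suc a)) where
          private
            k₁ = proj₁ hg
            k₁> = proj₁ (proj₂ hg)
            k₁≤ = proj₁ (proj₂ (proj₂ hg))
            k₁≈s = proj₁ (proj₂ (proj₂ (proj₂ hg)))
            good₁ = proj₂ (proj₂ (proj₂ (proj₂ hg)))
            4q<a : 4 ℕ.* q ℕ.< a
            4q<a = ℕ.s≤s⁻¹ (ℕ.≤-trans (ℕ.≤-trans (ℕ.≤-reflexive e4) (ℕ.*-monoʳ-≤ 2 2q<Q)) 2Q≤)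
              where
              e4 : suc (suc (4 ℕ.* q)) ≡ 2 ℕ.* suc (2 ℕ.* q)
              e4 = trans (cong (λ w → suc (suc w)) (ℕ.*-assoc 2 2 q)) (sym (ℕ.*-suc 2 (2 ℕ.* q)))
            1≤a : 1 ℕ.≤ a
            1≤a = ℕ.≤-trans (s≤s z≤n) 4q<a
            aδ = a ℕ.* δ
            m = suc (suc a) ℕ.* δ
            M₃ = suc (suc (suc a)) ℕ.* δ
            m≤N : m ℕ.≤ N
            m≤N = ℕ.≤-trans (ℕ.*-monoˡ-≤ δ <RQ) RA≤N
            1≤m : 1 ℕ.≤ m
            1≤m = δ>0 (suc (suc a)) (s≤s z≤n)
            aδ≤m : aδ ℕ.≤ m
            aδ≤m = ℕ.*-monoˡ-≤ δ (ℕ.≤-trans (ℕ.n≤1+n a) (ℕ.n≤1+n (suc a)))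
            m≤M₃ : m ℕ.≤ M₃
            m≤M₃ = ℕ.*-monoˡ-≤ δ (ℕ.n≤1+n (suc (suc a)))
            1≤aδ = δ>0 a 1≤a
            aδ<k₁ : aδ ℕ.< k₁
            aδ<k₁ = ℕ.≤-<-trans (ℕ.*-monoˡ-≤ δ (ℕ.n≤1+n a)) k₁>
            1≤k₁ : 1 ℕ.≤ k₁
            1≤k₁ = ℕ.≤-trans (s≤s z≤n) k₁>
            k₁≤N = ℕ.≤-trans k₁≤ m≤N
            ck₁ : Coprime k₁ g
            ck₁ = ≈-cop {s} {k₁} (sym k₁≈s) cs
            dv = divide k₁ z ck₁ (Z-cop Zz)
            b₁ = proj₁ dv
            cb₁ = proj₁ (proj₂ dv)
            b₁k₁ = proj₁ (proj₂ (proj₂ dv))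
            P = x ÷ aδ
            P′ = x′ ÷ M₃
            ω = ι x * inv m
            module Rm = Range 1≤m m≤N
            T≤ω : ι T ≤ ω
            T≤ω = ≤-trans (ι-mono Rm.T≤y) Rm.y≤xk
            ω≥0 : ι 0 ≤ ω
            ω≥0 = ≤-trans (ι≥0 T) T≤ω
            instance
              q≢0 : NonZero q
              q≢0 = ℕ.>-nonZero 1≤q
              4q≢0 : NonZero (4 ℕ.* q)
              4q≢0 = ℕ.>-nonZero (ℕ.*-mono-≤ {1} {4} (s≤s z≤n) 1≤q)
              a≢0 : NonZero a
              a≢0 = ℕ.>-nonZero 1≤a
            hi ih : ℚ
            hi = inv (4 ℕ.* q)
            ih = inv (8 ℕ.* q)
            hi≡ : hi ≡ ι 2 * ih
            hi≡ = sym (trans (cong (λ w → ι 2 * inv w) (ℕ.*-assoc 2 4 q)) (ι*inv* 2 (4 ℕ.* q) (s≤s z≤n)))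

            -- x′/(a+3) − x/a ≥ x/(4q(a+2)), the integer inequality 3a² + 5a ≥ 12qa + 24q divided by 4a(a+2)(a+3)
            gap : ι x * inv aδ + ω * hi ≤ ι x′ * inv M₃
            gap = subst₂ _≤_ (sym lhs≡) (sym rhs≡) (*≥0 (ι≥0 h) (inv≥0 δ) ⊛ core)
              where
              A = ι a
              i0 = inv a
              i2 = inv (suc (suc a))
              i3 = inv (suc (suc (suc a)))
              i4 = inv 4
              qq = ι q
              A2≡ : ι (suc (suc a)) ≡ A + ι 2
              A2≡ = trans (ι-+ 2 a) (+-comm _ _)
              A3≡ : ι (suc (suc (suc a))) ≡ A + ι 3
              A3≡ = trans (ι-+ 3 a) (+-comm _ _)
              u1 : i0 * A ≡ ι 1
              u1 = inv*ι a
              u2 : i2 * (A + ι 2) ≡ ι 1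
              u2 = trans (cong (i2 *_) (sym A2≡)) (inv*ι (suc (suc a)))
              u3 : i3 * (A + ι 3) ≡ ι 1
              u3 = trans (cong (i3 *_) (sym A3≡)) (inv*ι (suc (suc (suc a))))
              u4 : i4 * ι 4 ≡ ι 1
              u4 = inv*ι 4
              4q1≤A : ι 4 * qq + ι 1 ≤ A
              4q1≤A = ≤-trans (≤-reflexive (trans (cong (_+ ι 1) (sym (ι-* 4 q))) (sym (ι-suc (4 ℕ.* q))))) (ι-mono 4q<a)
              integer : qq * (ι 4 * (A + ι 2) * (A + ι 3)) + A * (A + ι 3) ≤ (qq + ι 1) * (ι 4 * (A + ι 2) * A)
              integer = lin (*≥0 (ι≥0 3) (ι≥0 a) ⊛ 4q1≤A ⊞ ι≥0 8 ⊛ 4q1≤A ⊞ *≥0 (ι≥0 8) (ι≥0 q) ⊛ 0≤1 ⊞ ι≥0 8)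
                (ring 2 λ A q → (q :+ con 1) :* (con 4 :* (A :+ con 2) :* A) :+ (con 3 :* A :* (con 4 :* q :+ con 1) :+ (con 8 :* (con 4 :* q :+ con 1) :+ (con 8 :* q :* con 0 :+ con 0))) := q :* (con 4 :* (A :+ con 2) :* (A :+ con 3)) :+ A :* (A :+ con 3) :+ (con 3 :* A :* A :+ (con 8 :* A :+ (con 8 :* q :* con 1 :+ con 8))))
              w = i0 * i2 * (i3 * i4)
              w≥0 : ι 0 ≤ w
              w≥0 = *≥0 (*≥0 (inv≥0 a) (inv≥0 _)) (*≥0 (inv≥0 _) (inv≥0 4))
              core : qq * i0 + i4 * i2 ≤ (qq + ι 1) * i3
              core = subst₂ _≤_
                (trans (ring 6 λ A q a b c d → a :* b :* (c :* d) :* (q :* (con 4 :* (A :+ con 2) :* (A :+ con 3)) :+ A :* (A :+ con 3)) := q :* a :* ((d :* con 4) :* (b :* (A :+ con 2)) :* (c :* (A :+ con 3))) :+ d :* b :* ((a :* A) :* (c :* (A :+ con 3))))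
                  (trans (cong₂ (λ u v → qq * i0 * u + i4 * i2 * v) (cong₂ _*_ (cong₂ _*_ u4 u2) u3) (cong₂ _*_ u1 u3)) (ring 4 λ q a d b → q :* a :* (con 1 :* con 1 :* con 1) :+ d :* b :* (con 1 :* con 1) := q :* a :+ d :* b)))
                (trans (ring 6 λ A q a b c d → a :* b :* (c :* d) :* ((q :+ con 1) :* (con 4 :* (A :+ con 2) :* A)) := (q :+ con 1) :* c :* ((d :* con 4) :* (b :* (A :+ con 2)) :* (a :* A)))
                  (trans (cong (λ u → (qq + ι 1) * i3 * u) (cong₂ _*_ (cong₂ _*_ u4 u2) u1)) (ring 2 λ q c → (q :+ con 1) :* c :* (con 1 :* con 1 :* con 1) := (q :+ con 1) :* c)))
                (w≥0 ⊛ integer)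
              xq : ι x ≡ qq * ι h
              xq = trans (cong ι x≡) (ι-* q h)
              lhs≡ : ι x * inv aδ + ω * hi ≡ ι h * inv δ * (qq * i0 + i4 * i2)
              lhs≡ = trans (cong₂ _+_ (cong₂ _*_ xq (inv-* a δ)) (cong₂ _*_ (cong₂ _*_ xq (inv-* (suc (suc a)) δ)) (inv-* 4 q)))
                (trans (ring 7 λ q h a d b f iq → q :* h :* (a :* d) :+ q :* h :* (b :* d) :* (f :* iq) := h :* d :* (q :* a :+ f :* b :* (iq :* q)))
                  (trans (cong (λ u → ι h * inv δ * (qq * i0 + i4 * i2 * u)) (inv*ι q)) (ring 6 λ h d q a f b → h :* d :* (q :* a :+ f :* b :* con 1) := h :* d :* (q :* a :+ f :* b))))
              rhs≡ : ι x′ * inv M₃ ≡ ι h * inv δ * ((qq + ι 1) * i3)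
              rhs≡ = trans (cong₂ _*_ (trans x′≡ (cong (_+ ι h) xq)) (inv-* (suc (suc (suc a))) δ)) (ring 4 λ q h c d → (q :* h :+ h) :* (c :* d) := h :* d :* ((q :+ con 1) :* c))

            PP′ : ω * hi - ι 1 ≤ ι P′ - ι P
            PP′ = lin (gap ⊞ proj₁ (frac x aδ 1≤aδ) ⊞ proj₂ (frac x′ M₃ (δ>0 (suc (suc (suc a))) (s≤s z≤n)))) (ring 5 λ a w p p′ c → p′ :- p :+ (a :+ w :+ (p :+ c)) := w :- con 1 :+ (c :+ (a :+ (p′ :+ con 1))))
            1≤ωhi : ι 1 ≤ ω * hi
            1≤ωhi = ≤-trans (≤-reflexive (trans (sym (inv*ι (4 ℕ.* q))) (*-comm _ _))) (≤-trans (*-mono (ι≥0 _) (inv≥0 _) (≤-trans (ι-mono 4q≤T) T≤ω) ≤-refl) ≤-refl)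
            P≤P′ : P ℕ.≤ P′
            P≤P′ = ι-cancel (lin (PP′ ⊞ 1≤ωhi) (ring 3 λ w p p′ → p′ :+ (w :- con 1 :+ con 1) := p :+ (p′ :- p :+ w)))
            xk₁≤ : ι x * inv k₁ ≤ ι 2 * ω
            xk₁≤ = lin (ι≥0 x ⊛ ≤-trans (inv-anti {suc a ℕ.* δ} {k₁} {{ℕ.>-nonZero (δ>0 (suc a) (s≤s z≤n))}} (ℕ.<⇒≤ k₁>)) half) (ring 3 λ x i j → con 2 :* (x :* j) :+ x :* i := x :* i :+ x :* (con 2 :* j))
              where
              half : inv (suc a ℕ.* δ) ≤ ι 2 * inv m
              half = ≤-trans (≤-reflexive (sym (ι*inv* 2 (suc a ℕ.* δ) (s≤s z≤n)))) (ι≥0 2 ⊛ inv-anti {m} {2 ℕ.* (suc a ℕ.* δ)} {{ℕ.>-nonZero 1≤m}} (ℕ.≤-trans (ℕ.*-monoˡ-≤ δ (ℕ.≤-trans (s≤s (ℕ.m≤n+m (suc a) a)) (ℕ.≤-reflexive (cong (suc a ℕ.+_) (sym (ℕ.+-identityʳ (suc a))))))) (ℕ.≤-reflexive (ℕ.*-assoc 2 (suc a) δ))))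
            -- Half of the β ω / (4 q) that `gap` provides; by `c1` the other half pays for θ, ε and
            -- the rounding of `P` and `P′`.
            m₀ = ω * (β * ih)
            mass₁ : m₀ ≤ mass b₁ P P′
            mass₁ = lin (good-mass P P′ good₁ ck₁ 1≤k₁ k₁≤N Zz 1≤z z≤g cb₁ b₁k₁ (÷-anti x 1≤aδ (ℕ.<⇒≤ aδ<k₁)) P≤P′ (÷-anti x′ 1≤k₁ (ℕ.≤-trans k₁≤ m≤M₃))
                  ⊞ β≥0 ⊛ PP′ ⊞ *≥0 β≥0 ω≥0 ⊛ ≤-reflexive (sym hi≡) ⊞ θ2ε≥0 ⊛ xk₁≤ ⊞ ω≥0 ⊛ c1 ⊞ β≤2 ⊞ Rm.2≤εxk)
              (ring 10 λ M b P P′ θ ε xk w hi ih → M :+ (b :* (P′ :- P) :- (θ :+ con 2 :* ε) :* xk :+ (b :* (w :* hi :- con 1) :+ (b :* w :* (con 2 :* ih) :+ ((θ :+ con 2 :* ε) :* xk :+ (w :* (con 2 :* θ :+ con 5 :* ε) :+ (b :+ con 2))))))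
                := w :* (b :* ih) :+ (M :+ (b :* (P′ :- P) :+ (b :* w :* hi :+ ((θ :+ con 2 :* ε) :* (con 2 :* w) :+ (w :* (b :* ih) :+ (con 2 :+ ε :* w)))))))
            A₀ = Q ℕ.* δ
            1≤A₀ : 1 ℕ.≤ A₀
            1≤A₀ = ℕ.≤-trans (ℕ.≤-trans (s≤s z≤n) 3≤T) T≤A
            -- Cells start at 2 Q and not at Q to make up for x′ ≤ 2 x; thus (P, P′] stays inside
            -- the range of `sumJ`.
            P′≤A : P′ ℕ.≤ x ÷ A₀
            P′≤A = ÷-≤ 1≤A₀ (ℕ.*-cancelˡ-≤ 2 (ℕ.≤-trans (ℕ.≤-reflexive (trans (sym (ℕ.*-assoc 2 A₀ P′)) (cong (ℕ._* P′) (sym (ℕ.*-assoc 2 Q δ)))))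
                     (ℕ.≤-trans (ℕ.*-monoˡ-≤ P′ (ℕ.*-monoˡ-≤ δ (ℕ.≤-trans 2Q≤ (ℕ.≤-trans (ℕ.n≤1+n _) (ℕ.n≤1+n _))))) (ℕ.≤-trans (÷-* x′ M₃) (ℕ.≤-trans (ℕ.+-monoʳ-≤ x h≤x) (ℕ.≤-reflexive (cong (x ℕ.+_) (sym (ℕ.+-identityʳ x)))))))))
            A≤N : x ÷ A₀ ℕ.≤ N
            A≤N = ÷-anti x (ℕ.≤-trans (s≤s z≤n) 3≤T) T≤A
            P′≤N = ℕ.≤-trans P′≤A A≤N
            1≤P′ : 1 ℕ.≤ P′
            1≤P′ = ℕ.≤-trans (1≤÷ 1≤aδ (ℕ.≤-trans aδ≤m (ℕ.≤-trans m≤N N≤x))) P≤P′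
            sum₂ : ∑ P′ c - ∑ P c ≤ τ * ι x
            sum₂ = lin (sumJ ⊞ ∑c-mono P′≤A A≤N ⊞ ∑c-mono (÷-anti x 1≤aδ (ℕ.≤-trans aδ≤m (ℕ.*-monoˡ-≤ δ <RQ))) (ℕ.≤-trans P≤P′ P′≤N)) (ring 5 λ t a b p p′ → t :+ (a :- b :+ (p′ :+ b)) := p′ :- p :+ (t :+ (a :+ p)))
            P′≤2ω : ι P′ ≤ ι 2 * ω
            P′≤2ω = ≤-trans (proj₁ (frac x′ M₃ (δ>0 (suc (suc (suc a))) (s≤s z≤n)))) (≤-trans (ι≥0 x′ ⊛ inv-anti {m} {M₃} {{ℕ.>-nonZero 1≤m}} m≤M₃) (lin (inv≥0 m ⊛ (≤-reflexive x′≡ ⊞ ι-mono h≤x)) (ring 4 λ x′ x h i → con 2 :* (x :* i) :+ i :* (x′ :+ h) := x′ :* i :+ i :* (x :+ h :+ x))))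
            found : Σ ℕ λ k → P ℕ.< k × k ℕ.≤ P′ × k ≈ b₁ × Good k
            found = find {b₁} {m₀} {τ} {t} P P′ 1≤P′ P≤P′ P′≤N cb₁ sum₂ mass₁
              (lin (+≥0 τ≥0 τ≥0 ⊛ P′≤2ω ⊞ ω≥0 ⊛ c2) (ring 6 λ τ p w b i θ → w :* (b :* i) :* θ :+ ((τ :+ τ) :* p :+ w :* (con 4 :* τ)) := (τ :+ τ) :* p :+ ((τ :+ τ) :* (con 2 :* w) :+ w :* (b :* i :* θ)))) 1≤τt
            k₂ = proj₁ found
            k₂> = proj₁ (proj₂ found)
            k₂≤ = proj₁ (proj₂ (proj₂ found))
            k₂≈b = proj₁ (proj₂ (proj₂ (proj₂ found)))
            good₂ = proj₂ (proj₂ (proj₂ (proj₂ found)))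
            1≤k₂ : 1 ℕ.≤ k₂
            1≤k₂ = ℕ.≤-trans (s≤s z≤n) k₂>
            s′k₂ : s′ ℕ.* k₂ ≈ z′
            s′k₂ = *-cancel≈ {s} {s′ ℕ.* k₂} {z′} cs (trans e1 (trans (*-cong≈ {s′} {s′} {k₂ ℕ.* s} {z} refl k₂s) ss′))
              where
              e1 : s ℕ.* (s′ ℕ.* k₂) ≈ s′ ℕ.* (k₂ ℕ.* s)
              e1 = ≡⇒≈ {s ℕ.* (s′ ℕ.* k₂)} {s′ ℕ.* (k₂ ℕ.* s)} (trans (ℕ.*-comm s _) (ℕ.*-assoc s′ k₂ s))
              k₂s : k₂ ℕ.* s ≈ z
              k₂s = trans (*-cong≈ {k₂} {b₁} {s} {k₁} k₂≈b (sym k₁≈s)) b₁k₁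
            x<k₂ : x ℕ.< aδ ℕ.* k₂
            x<k₂ = ℕ.<-≤-trans (÷-< x aδ 1≤aδ) (ℕ.*-monoʳ-≤ aδ k₂>)

          dense : ∀ j → a ℕ.≤ j → j ℕ.≤ suc (suc a) → (β - κ) * ι δ ≤ cell s′ j
          dense j a≤j j≤ = lin (good-mass (j ℕ.* δ) (suc j ℕ.* δ) good₂ (≈-cop {b₁} {k₂} (sym k₂≈b) cb₁) 1≤k₂ (ℕ.≤-trans k₂≤ P′≤N) Zz′ 1≤z′ z′≤g cs′ s′k₂ low (ℕ.*-monoˡ-≤ δ (ℕ.n≤1+n j)) high
                ⊞ θ2ε≥0 ⊛ xk₂ ⊞ ι≥0 δ ⊛ c3 ⊞ β≥0 ⊛ ≤-reflexive (sym jδ))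
              (ring 10 λ M b u w d θ ε xk RQ κ → M :+ (b :* (w :- u) :- (θ :+ con 2 :* ε) :* xk :+ ((θ :+ con 2 :* ε) :* xk :+ (d :* ((θ :+ con 2 :* ε) :* RQ) :+ b :* (d :+ u)))) := (b :- κ) :* d :+ (M :+ ((θ :+ con 2 :* ε) :* (RQ :* d) :+ (d :* κ :+ b :* w))))
            where
            low : x ÷ k₂ ℕ.≤ j ℕ.* δ
            low = ℕ.≤-trans (ℕ.≮⇒≥ (λ lt → ℕ.<⇒≱ x<k₂ (ℕ.≤-trans (ℕ.≤-reflexive (ℕ.*-comm aδ k₂)) (≤-÷ {x} {k₂} (ℕ.<⇒≤ lt))))) (ℕ.*-monoˡ-≤ δ a≤j)
            high : suc j ℕ.* δ ℕ.≤ x′ ÷ k₂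
            high = ÷-≤ 1≤k₂ (ℕ.≤-trans (ℕ.≤-trans (ℕ.*-mono-≤ k₂≤ (ℕ.*-monoˡ-≤ δ (s≤s j≤))) (ℕ.≤-reflexive (ℕ.*-comm P′ M₃))) (÷-* x′ M₃))
            jδ : ι (suc j ℕ.* δ) ≡ ι δ + ι (j ℕ.* δ)
            jδ = ι-+ δ (j ℕ.* δ)
            xk₂ : ι x * inv k₂ ≤ ι RQ * ι δ
            xk₂ = ≤-trans (lin (inv≥0 k₂ ⊛ ι-mono (ℕ.<⇒≤ x<k₂) ⊞ inv≥0 k₂ ⊛ ≤-reflexive (ι-* aδ k₂) ⊞ ι≥0 aδ ⊛ ≤-reflexive (inv*ι k₂ {{ℕ.>-nonZero 1≤k₂}}))
                      (ring 5 λ x i ak A k → A :+ (i :* x :+ (i :* ak :+ A :* (i :* k))) := x :* i :+ (i :* ak :+ (i :* (A :* k) :+ A :* con 1))))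
                    (≤-trans (ι-mono (ℕ.≤-trans aδ≤m (ℕ.*-monoˡ-≤ δ <RQ))) (≤-reflexive (ι-* RQ δ)))

        -- One cell of mass κ δ is asked for, far below the full β δ; by `dense-cell` every cell
        -- then is nearly full.
        Dense : ℕ → Set
        Dense s = Σ ℕ λ j → j ℕ.< RQ × 2 ℕ.* Q ℕ.≤ j × κ * ι δ ≤ cell s j

        dense? : ∀ s → Dec (Dense s)
        dense? s = ℕ.anyUpTo? (λ j → (2 ℕ.* Q ℕ.≤? j) ×-dec (κ * ι δ ≤? cell s j)) RQ

        private
          RA≤x : D ℕ.≤ x
          RA≤x = ℕ.≤-trans RA≤N N≤x
          cell≤ : ∀ {j} → j ℕ.< RQ → suc j ℕ.* δ ℕ.≤ D
          cell≤ = ℕ.*-monoˡ-≤ δ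
          cell≥ : ∀ {j} → 2 ℕ.* Q ℕ.≤ j → Q ℕ.* δ ℕ.≤ j ℕ.* δ
          cell≥ p = ℕ.*-monoˡ-≤ δ (ℕ.≤-trans (ℕ.m≤n*m Q 2) p)
          -- Here κ ≤ β / 2 enters: a cell filled by `Step` passes the test for a good `k` again, so
          -- that the spreading can be iterated.
          β-κ≥κ : κ * ι δ ≤ (β - κ) * ι δ
          β-κ≥κ = lin (ι≥0 δ ⊛ c5) (ring 3 λ b k d → (b :- k) :* d :+ d :* (k :+ k) := k :* d :+ d :* b)

        hasGood : ∀ {s} j → Coprime s g → j ℕ.< RQ → 2 ℕ.* Q ℕ.≤ j → κ * ι δ ≤ cell s j → HasGood s j
        hasGood {s} j cs j< j≥ h = find {s} {κ * ι δ} {τ} {t} (j ℕ.* δ) (suc j ℕ.* δ) (δ>0 (suc j) (s≤s z≤n)) (ℕ.*-monoˡ-≤ δ (ℕ.n≤1+n j)) (ℕ.≤-trans (cell≤ j<) RA≤N) cs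
          (lin (sumI ⊞ ∑c-mono (cell≤ j<) RA≤N ⊞ ∑c-mono (cell≥ j≥) (ℕ.≤-trans (ℕ.*-monoˡ-≤ δ (ℕ.n≤1+n j)) (ℕ.≤-trans (cell≤ j<) RA≤N))) (ring 5 λ t a b u v → t :+ (a :- b :+ (v :+ b)) := v :- u :+ (t :+ (a :+ u))))
          h
          (lin (+≥0 τ≥0 τ≥0 ⊛ ι-mono (cell≤ j<) ⊞ +≥0 τ≥0 τ≥0 ⊛ ≤-reflexive (ι-* RQ δ) ⊞ ι≥0 δ ⊛ c4) (ring 7 λ τ v D κ d θ RQ → κ :* d :* θ :+ ((τ :+ τ) :* v :+ ((τ :+ τ) :* D :+ d :* (con 2 :* τ :* RQ))) := (τ :+ τ) :* v :+ ((τ :+ τ) :* D :+ ((τ :+ τ) :* (RQ :* d) :+ d :* (κ :* θ)))))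
          1≤τt

        cell-upper : ∀ {s} j → Coprime s g → j ℕ.< RQ → 2 ℕ.* Q ℕ.≤ j → cell s j ≤ (β + κ) * ι δ
        cell-upper {s} j cs j< j≥ = lin (mass-upper s (j ℕ.* δ) (suc j ℕ.* δ) cs (ℕ.≤-trans T≤A (cell≥ j≥)) (ℕ.*-monoˡ-≤ δ (ℕ.n≤1+n j)) v≤2u (ℕ.≤-trans (ℕ.≤-trans (cell≤ j<) RA≤x) x≤x′)
              ⊞ β≥0 ⊛ ≤-reflexive (ι-+ δ (j ℕ.* δ)) ⊞ ε≥0 ⊛ ≤-trans (ι-mono (ℕ.*-monoˡ-≤ δ (ℕ.<⇒≤ j<))) (≤-reflexive (ι-* RQ δ)) ⊞ ι≥0 δ ⊛ c3 ⊞ *≥0 (+≥0 θ≥0 ε≥0) (*≥0 (ι≥0 RQ) (ι≥0 δ)) ⊛ 0≤1)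
            (ring 9 λ M b u w d ε θ RQ κ → (b :+ κ) :* d :+ (M :+ (b :* w :+ (ε :* u :+ (d :* ((θ :+ con 2 :* ε) :* RQ) :+ (θ :+ ε) :* (RQ :* d) :* con 0)))) := M :+ (b :* (w :- u) :+ ε :* u :+ (b :* (d :+ u) :+ (ε :* (RQ :* d) :+ (d :* κ :+ (θ :+ ε) :* (RQ :* d) :* con 1)))))
          where
          1≤j : 1 ℕ.≤ j
          1≤j = ℕ.≤-trans (ℕ.≤-trans (ℕ.≤-trans (s≤s z≤n) 2q<Q) (ℕ.m≤n*m Q 2)) j≥
          v≤2u : suc j ℕ.* δ ℕ.≤ 2 ℕ.* (j ℕ.* δ)
          v≤2u = ℕ.≤-trans (ℕ.*-monoˡ-≤ δ (ℕ.≤-trans (ℕ.+-monoˡ-≤ j 1≤j) (ℕ.≤-reflexive (cong (j ℕ.+_) (sym (ℕ.+-identityʳ j)))))) (ℕ.≤-reflexive (ℕ.*-assoc 2 j δ))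

        module _ {z₀ : ℕ} (Zz₀ : Z z₀) (1≤z₀ : 1 ℕ.≤ z₀) (z₀≤g : z₀ ℕ.≤ g) where
          -- `Step` with s = s′ and z = z′: a good `k` in a cell fills that cell and its two
          -- neighbours. `up` and `down` carry this through the stretch.
          spread : ∀ {s} j j′ → Coprime s g → j ℕ.< RQ → 2 ℕ.* Q ℕ.≤ j → HasGood s j → j ℕ.≤ suc j′ → j′ ℕ.≤ suc j → (β - κ) * ι δ ≤ cell s j′
          spread zero j′ cs j< j≥ _ _ _ = ⊥-elim (ℕ.<⇒≱ (ℕ.≤-trans (ℕ.≤-trans (s≤s z≤n) 2q<Q) (ℕ.m≤n*m Q 2)) j≥)
          spread (suc a) j′ cs j< j≥ hg p r = Step.dense a j≥ j< cs cs Zz₀ 1≤z₀ z₀≤g Zz₀ 1≤z₀ z₀≤g refl hg j′ (ℕ.s≤s⁻¹ p) r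

          spread-good : ∀ {s} j j′ → Coprime s g → j ℕ.< RQ → 2 ℕ.* Q ℕ.≤ j → HasGood s j → j ℕ.≤ suc j′ → j′ ℕ.≤ suc j → j′ ℕ.< RQ → 2 ℕ.* Q ℕ.≤ j′ → HasGood s j′
          spread-good j j′ cs j< j≥ hg p r j′< j′≥ = hasGood j′ cs j′< j′≥ (≤-trans β-κ≥κ (spread j j′ cs j< j≥ hg p r))

          up : ∀ {s} j n → Coprime s g → 2 ℕ.* Q ℕ.≤ j → HasGood s j → n ℕ.+ j ℕ.< RQ → HasGood s (n ℕ.+ j)
          up j zero cs j≥ hg _ = hg
          up j (suc n) cs j≥ hg lt = spread-good (n ℕ.+ j) (suc (n ℕ.+ j)) cs (ℕ.<-trans (ℕ.n<1+n _) lt) n+j≥ (up j n cs j≥ hg (ℕ.<-trans (ℕ.n<1+n _) lt)) (ℕ.≤-trans (ℕ.n≤1+n _) (ℕ.n≤1+n _)) ℕ.≤-refl lt (ℕ.m≤n⇒m≤1+n n+j≥)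
            where n+j≥ = ℕ.≤-trans j≥ (ℕ.m≤n+m j n)

          down : ∀ {s} j n → Coprime s g → 2 ℕ.* Q ℕ.≤ j → HasGood s (n ℕ.+ j) → n ℕ.+ j ℕ.< RQ → HasGood s j
          down j zero cs j≥ hg _ = hg
          down j (suc n) cs j≥ hg lt = down j n cs j≥ (spread-good (suc (n ℕ.+ j)) (n ℕ.+ j) cs lt (ℕ.m≤n⇒m≤1+n n+j≥) hg ℕ.≤-refl (ℕ.≤-trans (ℕ.n≤1+n _) (ℕ.n≤1+n _)) (ℕ.<-trans (ℕ.n<1+n _) lt) n+j≥) (ℕ.<-trans (ℕ.n<1+n _) lt)
            where n+j≥ = ℕ.≤-trans j≥ (ℕ.m≤n+m j n)

          dense-good : ∀ {s} j → Coprime s g → Dense s → j ℕ.< RQ → 2 ℕ.* Q ℕ.≤ j → HasGood s j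
          dense-good {s} j cs (j₀ , j₀< , j₀≥ , h) j< j≥ with ℕ.≤-total j₀ j
          ... | inj₁ le = subst (HasGood s) (ℕ.m∸n+n≡m le) (up j₀ (j ℕ.∸ j₀) cs j₀≥ (hasGood j₀ cs j₀< j₀≥ h) (subst (ℕ._< RQ) (sym (ℕ.m∸n+n≡m le)) j<))
          ... | inj₂ le = down j (j₀ ℕ.∸ j) cs j≥ (subst (HasGood s) (sym (ℕ.m∸n+n≡m le)) (hasGood j₀ cs j₀< j₀≥ h)) (subst (ℕ._< RQ) (sym (ℕ.m∸n+n≡m le)) j₀<)

          dense-cell : ∀ {s} j → Coprime s g → Dense s → j ℕ.< RQ → 2 ℕ.* Q ℕ.≤ j → Bd (cell s j - β * ι δ) (κ * ι δ)
          dense-cell {s} j cs d j< j≥ =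
              lin (spread j j cs j< j≥ (dense-good j cs d j< j≥) (ℕ.n≤1+n j) (ℕ.n≤1+n j)) (ring 4 λ m b k d → m :- b :* d :+ (b :- k) :* d := :- (k :* d) :+ m)
            , lin (cell-upper j cs j< j≥) (ring 4 λ m b k d → k :* d :+ m := m :- b :* d :+ (b :+ k) :* d)

          -- `Step` with s′ = s z′ / z carries density from s to s′; these quotients of elements of
          -- `Z` are the source of the group structure.
          closed : ∀ {s s′ z z′} → 2 ℕ.* Q ℕ.< RQ → Coprime s g → Coprime s′ g → Dense s → Z z → 1 ℕ.≤ z → z ℕ.≤ g → Z z′ → 1 ℕ.≤ z′ → z′ ℕ.≤ g → s′ ℕ.* z ≈ s ℕ.* z′ → Dense s′
          closed {s} {s′} {z} {z′} 2Q<RQ cs cs′ d Zz 1≤z z≤g Zz′ 1≤z′ z′≤g ss′ = go (2 ℕ.* Q) refl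
            where
            hg = dense-good (2 ℕ.* Q) cs d 2Q<RQ ℕ.≤-refl
            go : ∀ n → n ≡ 2 ℕ.* Q → Dense s′
            go zero e0 = ⊥-elim (ℕ.<⇒≢ (ℕ.≤-trans (ℕ.≤-trans (s≤s z≤n) 2q<Q) (ℕ.m≤n*m Q 2)) e0)
            go (suc a) e0 = suc a , subst (ℕ._< RQ) (sym e0) 2Q<RQ , ℕ.≤-reflexive (sym e0) , ≤-trans β-κ≥κ (Step.dense a (ℕ.≤-reflexive (sym e0)) (subst (ℕ._< RQ) (sym e0) 2Q<RQ) {s} {s′} {z} {z′} cs cs′ Zz 1≤z z≤g Zz′ 1≤z′ z′≤g ss′ (subst (HasGood s) (sym e0) hg) (suc a) (ℕ.n≤1+n a) (ℕ.n≤1+n _))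

        empty-cell : ∀ {s} j → ¬ Dense s → j ℕ.< RQ → 2 ℕ.* Q ℕ.≤ j → Bd (cell s j) (κ * ι δ)
        empty-cell {s} j ¬d j< j≥ = Bd-≤ (≰⇒≥ (λ h → ¬d (j , j< , j≥ , h))) (Bd-self (mass≥0 s (ℕ.*-monoˡ-≤ δ (ℕ.n≤1+n j)) (ℕ.≤-trans (ℕ.≤-trans (cell≤ j<) RA≤x) x≤X)))

-- Exponential growth against powers.

module Growth where
  open import Data.Nat.DivMod using (_/_; m/n*n≤m)
  open import Data.Nat.Tactic.RingSolver using (solve-∀)
  open Field
  open Sums using (÷-≤; ÷-<)

  n≤2^n : ∀ n → n ℕ.≤ 2 ℕ.^ n
  n≤2^n zero = z≤n
  n≤2^n (suc n) = ℕ.≤-trans (ℕ.+-mono-≤ (ℕ.m^n>0 2 n) (n≤2^n n)) (ℕ.≤-reflexive (cong (2 ℕ.^ n ℕ.+_) (sym (ℕ.+-identityʳ _))))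

  log-floor : ∀ R c x → 2 ℕ.≤ R → 1 ℕ.≤ c → c ℕ.≤ x → Σ ℕ λ n → c ℕ.* R ℕ.^ n ℕ.≤ x × x ℕ.< c ℕ.* R ℕ.^ suc n
  log-floor R c x 2≤R 1≤c c≤x = go x (ℕ.≤-<-trans (n≤2^n x) (ℕ.≤-<-trans (ℕ.^-monoˡ-≤ x 2≤R) (ℕ.<-≤-trans (ℕ.m<m*n (R ℕ.^ x) R {{ℕ.>-nonZero (ℕ.m^n>0 R {{R≢0}} x)}} 2≤R) (ℕ.≤-trans (ℕ.≤-reflexive (ℕ.*-comm (R ℕ.^ x) R)) (ℕ.m≤n*m (R ℕ.^ suc x) c {{ℕ.>-nonZero 1≤c}})))))
    where
    R≢0 = ℕ.>-nonZero (ℕ.≤-trans (s≤s z≤n) 2≤R)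
    go : ∀ n → x ℕ.< c ℕ.* R ℕ.^ suc n → Σ ℕ λ n → c ℕ.* R ℕ.^ n ℕ.≤ x × x ℕ.< c ℕ.* R ℕ.^ suc n
    go n lt with c ℕ.* R ℕ.^ n ℕ.≤? x
    ... | yes p = n , p , lt
    go zero lt | no p = ⊥-elim (p (ℕ.≤-trans (ℕ.≤-reflexive (ℕ.*-identityʳ c)) c≤x))
    go (suc n) lt | no p = go n (ℕ.≰⇒> p)

  private
    sq : ℕ → ℕ
    sq m = m ℕ.* m

    2^8m : ∀ m → 2 ℕ.^ (8 ℕ.* m) ≡ sq (sq (sq (2 ℕ.^ m)))
    2^8m m = trans (cong (2 ℕ.^_) (ℕ.*-comm 8 m)) (trans (sym (ℕ.^-*-assoc 2 m 8)) (e8 (2 ℕ.^ m)))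
      where
      e8 : ∀ a → a ℕ.* (a ℕ.* (a ℕ.* (a ℕ.* (a ℕ.* (a ℕ.* (a ℕ.* (a ℕ.* 1))))))) ≡ a ℕ.* a ℕ.* (a ℕ.* a) ℕ.* (a ℕ.* a ℕ.* (a ℕ.* a))
      e8 = solve-∀

  abstract
    -- the exponent from which 2ⁿ ≥ 128 E² (n + 1)⁴
    expo : ℕ → ℕ
    expo E = 8 ℕ.* (2897 ℕ.* E)

    expo-÷ : ∀ {E n} → expo E ℕ.≤ n → 2897 ℕ.* E ℕ.≤ n / 8
    expo-÷ {E} {n} p = ÷-≤ {n} {8} (s≤s z≤n) p

  -- With m = ⌊n / 8⌋ one has 2ⁿ ≥ (2^m)⁸ ≥ m⁸ and n + 1 ≤ 16 m. The constant 2897 is the least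
  -- integer whose square reaches 128 · 16⁴.
  128E²[n+1]⁴≤2^n : ∀ E n → 1 ℕ.≤ E → expo E ℕ.≤ n → 128 ℕ.* sq E ℕ.* sq (sq (suc n)) ℕ.≤ 2 ℕ.^ n
  128E²[n+1]⁴≤2^n E n 1≤E n≥ = ℕ.≤-trans (ℕ.*-monoʳ-≤ (128 ℕ.* sq E) (sq-mono (sq-mono n+1≤16m))) (ℕ.≤-trans step (ℕ.≤-trans (ℕ.≤-trans (sq-mono (sq-mono (sq-mono (n≤2^n m)))) (ℕ.≤-reflexive (sym (2^8m m)))) (ℕ.^-monoʳ-≤ 2 8m≤n)))
    where
    m = n / 8
    sq-mono : ∀ {a b} → a ℕ.≤ b → sq a ℕ.≤ sq b
    sq-mono p = ℕ.*-mono-≤ p p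
    8m≤n : 8 ℕ.* m ℕ.≤ n
    8m≤n = ℕ.≤-trans (ℕ.≤-reflexive (ℕ.*-comm 8 m)) (m/n*n≤m n 8)
    m≥ : 2897 ℕ.* E ℕ.≤ m
    m≥ = expo-÷ n≥
    n<8m+8 : n ℕ.< 8 ℕ.+ 8 ℕ.* m
    n<8m+8 = ℕ.<-≤-trans (÷-< n 8 (s≤s z≤n)) (ℕ.≤-reflexive (ℕ.*-suc 8 m))
    1≤m : 1 ℕ.≤ m
    1≤m = ℕ.≤-trans (ℕ.*-mono-≤ {1} {2897} (s≤s z≤n) 1≤E) m≥
    n+1≤16m : suc n ℕ.≤ 16 ℕ.* m
    n+1≤16m = ℕ.≤-trans n<8m+8 (ℕ.≤-trans (ℕ.+-monoˡ-≤ (8 ℕ.* m) (ℕ.*-monoʳ-≤ 8 1≤m)) (ℕ.≤-reflexive (sym (ℕ.*-distribʳ-+ m 8 8))))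
    step : 128 ℕ.* sq E ℕ.* sq (sq (16 ℕ.* m)) ℕ.≤ sq (sq (sq m))
    step = ι-cancel (≤-trans (≤-reflexive lhs≡) (≤-trans core (≤-reflexive (sym rhs≡))))
      where
      a = ι E
      b = ι m
      lhs≡ : ι (128 ℕ.* sq E ℕ.* sq (sq (16 ℕ.* m))) ≡ ι 128 * (a * a) * (ι 16 * b * (ι 16 * b) * (ι 16 * b * (ι 16 * b)))
      lhs≡ = trans (ι-* (128 ℕ.* sq E) (sq (sq (16 ℕ.* m)))) (cong₂ _*_ (trans (ι-* 128 (sq E)) (cong (ι 128 *_) (ι-* E E)))
        (trans (ι-* (sq (16 ℕ.* m)) (sq (16 ℕ.* m))) (cong (λ w → w * w) (trans (ι-* (16 ℕ.* m) (16 ℕ.* m)) (cong (λ w → w * w) (ι-* 16 m))))))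
      rhs≡ : ι (sq (sq (sq m))) ≡ b * b * (b * b) * (b * b * (b * b))
      rhs≡ = trans (ι-* (sq (sq m)) (sq (sq m))) (cong (λ w → w * w) (trans (ι-* (sq m) (sq m)) (cong (λ w → w * w) (ι-* m m))))
      ab : ι 2897 * a ≤ b
      ab = ≤-trans (≤-reflexive (sym (ι-* 2897 E))) (ι-mono m≥)
      bb≥0 : ι 0 ≤ b * b
      bb≥0 = sq≥0 b
      1≤bb : ι 1 ≤ b * b
      1≤bb = ≤-trans (≤-reflexive (sym (*-identityʳ _))) (*-mono 0≤1 (ι≥0 m) (ι-mono 1≤m) (ι-mono 1≤m))
      core : ι 128 * (a * a) * (ι 16 * b * (ι 16 * b) * (ι 16 * b * (ι 16 * b))) ≤ b * b * (b * b) * (b * b * (b * b))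
      core = lin (*≥0 bb≥0 bb≥0 ⊛ (*-mono (*≥0 (ι≥0 2897) (ι≥0 E)) (ι≥0 m) ab ab ⊞ bb≥0 ⊛ 1≤bb ⊞ ι≥0 4001 ⊛ sq≥0 a))
        (ring 2 λ a b → b :* b :* (b :* b) :* (b :* b :* (b :* b)) :+ b :* b :* (b :* b) :* (con 2897 :* a :* (con 2897 :* a) :+ (b :* b :* con 1 :+ con 4001 :* con 0)) :=
          con 128 :* (a :* a) :* (con 16 :* b :* (con 16 :* b) :* (con 16 :* b :* (con 16 :* b))) :+ b :* b :* (b :* b) :* (b :* b :+ (b :* b :* (b :* b) :+ con 4001 :* (a :* a))))

-- Constants of a pass and the choice of scale by pigeonhole.

module Levels where
  open import Data.Nat.Coprimality using (Coprime)
  open import Data.Nat.Tactic.RingSolver using (solve-∀)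
  open Field
  open Sums
  open Log
  open Growth

  telescope : ∀ m (f : ℕ → ℚ) → ∑ m (λ i → f (suc i) - f i) ≡ f (suc m) - f 1
  telescope zero f = ring 1 λ a → con 0 := a :- a
  telescope (suc m) f = trans (cong (_+ (f (suc (suc m)) - f (suc m))) (telescope m f)) (ring 3 λ a b c → b :- a :+ (c :- b) := c :- a)

  -- The parameters of one pass of the argument; κ = 1/κn is the precision asked for.
  module Constants (g q R Q κn B : ℕ) where
    abstract
      -- Reciprocals of θ, τ and ε, followed by thresholds. `τn` serves `c2` and `c4`; `εn` is so
      -- large that the deficits, averaged over all scales, are at most τ x; `kuN` and `k1N` are
      -- `KU` and `K₁ T`. `B` is a lower bound imposed on the start of the stretch.
      θn τn εn kuN T k1N i₀ c₀ x₀ : ℕ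
      θn = 32 ℕ.* (g ℕ.* q) ℕ.* (κn ℕ.* (R ℕ.* Q))
      τn = 16 ℕ.* (g ℕ.* q) ℕ.* (κn ℕ.* (R ℕ.* Q)) ℕ.* θn
      εn = 8 ℕ.* g ℕ.* suc (2 ℕ.* R) ℕ.* τn
      kuN = 1386 ℕ.* (g ℕ.* g ℕ.* (g ℕ.* g)) ℕ.+ 8
      T = 2 ℕ.^ (3 ℕ.* (kuN ℕ.* εn)) ℕ.+ (4 ℕ.* q ℕ.+ (2 ℕ.* εn ℕ.+ 3))
      k1N = 84 ℕ.* (g ℕ.* g) ℕ.+ 1386 ℕ.* (g ℕ.* g ℕ.* (g ℕ.* g)) ℕ.+ 18 ℕ.+ 256 ℕ.* T
      i₀ = T ℕ.+ B
      c₀ = Q ℕ.* R ℕ.^ (i₀ ℕ.+ 2) ℕ.* T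
      x₀ = c₀ ℕ.* R ℕ.^ (2 ℕ.* c₀) ℕ.+ (2 ℕ.^ (3 ℕ.* (k1N ℕ.* εn)) ℕ.+ T)

      θn-def : θn ≡ 32 ℕ.* (g ℕ.* q) ℕ.* (κn ℕ.* (R ℕ.* Q))
      θn-def = refl

      τn-def : τn ≡ 16 ℕ.* (g ℕ.* q) ℕ.* (κn ℕ.* (R ℕ.* Q)) ℕ.* θn
      τn-def = refl

      εn-def : εn ≡ 8 ℕ.* g ℕ.* suc (2 ℕ.* R) ℕ.* τn
      εn-def = refl

      kuN-def : kuN ≡ 1386 ℕ.* (g ℕ.* g ℕ.* (g ℕ.* g)) ℕ.+ 8
      kuN-def = refl

      T-def : T ≡ 2 ℕ.^ (3 ℕ.* (kuN ℕ.* εn)) ℕ.+ (4 ℕ.* q ℕ.+ (2 ℕ.* εn ℕ.+ 3))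
      T-def = refl

      k1N-def : k1N ≡ 84 ℕ.* (g ℕ.* g) ℕ.+ 1386 ℕ.* (g ℕ.* g ℕ.* (g ℕ.* g)) ℕ.+ 18 ℕ.+ 256 ℕ.* T
      k1N-def = refl

      i₀-def : i₀ ≡ T ℕ.+ B
      i₀-def = refl

      c₀-def : c₀ ≡ Q ℕ.* R ℕ.^ (i₀ ℕ.+ 2) ℕ.* T
      c₀-def = refl

      x₀-def : x₀ ≡ c₀ ℕ.* R ℕ.^ (2 ℕ.* c₀) ℕ.+ (2 ℕ.^ (3 ℕ.* (k1N ℕ.* εn)) ℕ.+ T)
      x₀-def = refl

  module _ (g : ℕ) {{g≢0 : NonZero g}} (X : ℕ) (4≤X : 4 ℕ.≤ X) (L : ℕ → ℚ) (diff : DiffBound X L) where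
    open Residues g
    open Estimates X L diff
    open Selberg g X 4≤X L diff
    open Windows g X 4≤X L diff
    open Erdos g X 4≤X L diff

    -- The interface between the passes: θ, τ and ε are forgotten, only the precision κ remains.
    -- `B≤A` lets the first pass place its stretch above the threshold of the second.
    record Stretch₀ (Z : ℕ → Set) (Q R : ℕ) (κ : ℚ) (B x : ℕ) : Set₁ where
      field
        δ : ℕ
        1≤δ : 1 ℕ.≤ δ
        B≤A : B ℕ.≤ Q ℕ.* δ
        RA≤x : R ℕ.* Q ℕ.* δ ℕ.≤ x
        Dense : ℕ → Set
        dense? : ∀ s → Dec (Dense s)
        dense-cell : ∀ {s} j → Coprime s g → Dense s → j ℕ.< R ℕ.* Q → 2 ℕ.* Q ℕ.≤ j → Bd (mass s (j ℕ.* δ) (suc j ℕ.* δ) - β * ι δ) (κ * ι δ)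
        empty-cell : ∀ {s} j → ¬ Dense s → j ℕ.< R ℕ.* Q → 2 ℕ.* Q ℕ.≤ j → Bd (mass s (j ℕ.* δ) (suc j ℕ.* δ)) (κ * ι δ)
        closed : ∀ {s s′ z z′} → Coprime s g → Coprime s′ g → Dense s → Z z → 1 ℕ.≤ z → z ℕ.≤ g → Z z′ → 1 ℕ.≤ z′ → z′ ℕ.≤ g → s′ ℕ.* z ≈ s ℕ.* z′ → Dense s′

    module _ (q R Q κn B : ℕ) (2≤q : 2 ℕ.≤ q) (3≤R : 3 ℕ.≤ R) (2q<Q : 2 ℕ.* q ℕ.< Q) (g≤κn : g ℕ.≤ κn)
             (x h : ℕ) (x≡ : x ≡ q ℕ.* h) (1≤h : 1 ℕ.≤ h) where
      open Constants g q R Q κn B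

      private
        1≤g : 1 ℕ.≤ g
        1≤g = ℕ.>-nonZero⁻¹ g
        1≤q = ℕ.≤-trans (s≤s z≤n) 2≤q
        1≤R = ℕ.≤-trans (s≤s z≤n) 3≤R
        1≤Q = ℕ.≤-trans (s≤s z≤n) 2q<Q
        1≤κn = ℕ.≤-trans 1≤g g≤κn
        S = κn ℕ.* (R ℕ.* Q)
        1≤RQ : 1 ℕ.≤ R ℕ.* Q
        1≤RQ = ℕ.*-mono-≤ 1≤R 1≤Q
        1≤S : 1 ℕ.≤ S
        1≤S = ℕ.*-mono-≤ 1≤κn 1≤RQ
        1≤gq : 1 ℕ.≤ g ℕ.* q
        1≤gq = ℕ.*-mono-≤ 1≤g 1≤q
        1≤θn : 1 ℕ.≤ θn
        1≤θn = subst (1 ℕ.≤_) (sym θn-def) (ℕ.*-mono-≤ (ℕ.*-mono-≤ {1} {32} (s≤s z≤n) 1≤gq) 1≤S)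
        1≤τn : 1 ℕ.≤ τn
        1≤τn = subst (1 ℕ.≤_) (sym τn-def) (ℕ.*-mono-≤ (ℕ.*-mono-≤ (ℕ.*-mono-≤ {1} {16} (s≤s z≤n) 1≤gq) 1≤S) 1≤θn)
        1≤εn : 1 ℕ.≤ εn
        1≤εn = subst (1 ℕ.≤_) (sym εn-def) (ℕ.*-mono-≤ (ℕ.*-mono-≤ (ℕ.*-mono-≤ {1} {8} (s≤s z≤n) 1≤g) (s≤s {0} {2 ℕ.* R} z≤n)) 1≤τn)
        θ τ ε κ : ℚ
        θ = inv θn
        τ = inv τn
        ε = inv εn
        κ = inv κn
        instance
          θn≢0 : NonZero θn
          θn≢0 = ℕ.>-nonZero 1≤θn
          τn≢0 : NonZero τn
          τn≢0 = ℕ.>-nonZero 1≤τn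
          εn≢0 : NonZero εn
          εn≢0 = ℕ.>-nonZero 1≤εn
          κn≢0 : NonZero κn
          κn≢0 = ℕ.>-nonZero 1≤κn
          gq≢0 : NonZero (g ℕ.* q)
          gq≢0 = ℕ.>-nonZero 1≤gq
          S≢0 : NonZero S
          S≢0 = ℕ.>-nonZero 1≤S

        ε≤θ : ε ≤ θ
        ε≤θ = inv-anti (ℕ.≤-trans (ℕ.≤-trans (ℕ.m≤n*m θn (16 ℕ.* (g ℕ.* q) ℕ.* S) {{ℕ.>-nonZero (ℕ.*-mono-≤ (ℕ.*-mono-≤ {1} {16} (s≤s z≤n) 1≤gq) 1≤S)}}) (ℕ.≤-reflexive (sym τn-def)))
                 (ℕ.≤-trans (ℕ.m≤n*m τn (8 ℕ.* g ℕ.* suc (2 ℕ.* R)) {{ℕ.>-nonZero (ℕ.*-mono-≤ (ℕ.*-mono-≤ {1} {8} (s≤s z≤n) 1≤g) (s≤s {0} {2 ℕ.* R} z≤n))}}) (ℕ.≤-reflexive (sym εn-def))))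

        β≥ : ι 2 * inv g ≤ β
        β≥ = ι≥0 2 ⊛ inv-anti {φ} {g} (ι-cancel φ≤g)

        θ≡ : ι 32 * θ ≡ inv (g ℕ.* q) * inv S
        θ≡ = trans (cong (λ w → ι 32 * inv w) (trans θn-def (ℕ.*-assoc 32 (g ℕ.* q) S))) (trans (ι*inv* 32 (g ℕ.* q ℕ.* S) (s≤s z≤n)) (inv-* (g ℕ.* q) S))

        β8q : inv (g ℕ.* q) ≤ ι 4 * (β * inv (8 ℕ.* q))
        β8q = ≤-trans (≤-reflexive e1) (≤-trans (*≥0 (inv≥0 2) (inv≥0 q) ⊛ β≥) (≤-reflexive (trans (*-comm _ _) (trans (cong (β *_) e2) (ring 2 λ b i → b :* (con 4 :* i) := con 4 :* (b :* i))))))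
          where
          e1 : inv (g ℕ.* q) ≡ inv 2 * inv q * (ι 2 * inv g)
          e1 = trans (inv-* g q) (trans (ring 2 λ a b → a :* b := con 1 :* b :* a) (trans (cong (λ w → w * inv q * inv g) (sym (inv*ι 2))) (ring 4 λ a t b c → a :* t :* b :* c := a :* b :* (t :* c))))
          e2 : inv 2 * inv q ≡ ι 4 * inv (8 ℕ.* q)
          e2 = trans (sym (inv-* 2 q)) (sym (trans (cong (λ w → ι 4 * inv w) (ℕ.*-assoc 4 2 q)) (ι*inv* 4 (2 ℕ.* q) (s≤s z≤n))))

        θ≥0 : ι 0 ≤ θ
        θ≥0 = inv≥0 θn
        τ≥0 : ι 0 ≤ τ
        τ≥0 = inv≥0 τn
        ε≥0 : ι 0 ≤ ε
        ε≥0 = inv≥0 εn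
        κ≥0 : ι 0 ≤ κ
        κ≥0 = inv≥0 κn
        gi Si : ℚ
        gi = inv (g ℕ.* q)
        Si = inv S
        gi≥0 : ι 0 ≤ gi
        gi≥0 = inv≥0 (g ℕ.* q)

        τ≡ : ι 16 * τ ≡ gi * Si * θ
        τ≡ = trans (cong (λ w → ι 16 * inv w) (trans τn-def (trans (cong (ℕ._* θn) (ℕ.*-assoc 16 (g ℕ.* q) S)) (ℕ.*-assoc 16 (g ℕ.* q ℕ.* S) θn)))) (trans (ι*inv* 16 (g ℕ.* q ℕ.* S ℕ.* θn) (s≤s z≤n)) (trans (inv-* (g ℕ.* q ℕ.* S) θn) (cong (_* θ) (inv-* (g ℕ.* q) S))))

        SRQ : Si * ι (R ℕ.* Q) ≡ κ
        SRQ = trans (cong (_* ι (R ℕ.* Q)) (inv-* κn (R ℕ.* Q))) (trans (*-assoc _ _ _) (trans (cong (κ *_) (inv*ι (R ℕ.* Q) {{ℕ.>-nonZero 1≤RQ}})) (*-identityʳ _)))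

        c1 : ι 2 * θ + ι 5 * ε ≤ β * inv (8 ℕ.* q)
        c1 = ι-cancelˡ 4 (lin (ι≥0 20 ⊛ ε≤θ ⊞ ι≥0 4 ⊛ θ≥0 ⊞ ≤-reflexive θ≡ ⊞ gi≥0 ⊛ inv≤1 S ⊞ β8q) (ring 5 λ θ ε b g s → con 4 :* b :+ (con 20 :* ε :+ (con 4 :* con 0 :+ (con 32 :* θ :+ (g :* s :+ g)))) := con 4 :* (con 2 :* θ :+ con 5 :* ε) :+ (con 20 :* θ :+ (con 4 :* θ :+ (g :* s :+ (g :* con 1 :+ con 4 :* b))))))

        c2 : ι 4 * τ ≤ β * inv (8 ℕ.* q) * θ
        c2 = ι-cancelˡ 4 (lin (≤-reflexive τ≡ ⊞ *≥0 gi≥0 θ≥0 ⊛ inv≤1 S ⊞ θ≥0 ⊛ β8q) (ring 5 λ τ θ b g s → con 4 :* (b :* θ) :+ (con 16 :* τ :+ (g :* θ :* s :+ θ :* g)) := con 4 :* (con 4 :* τ) :+ (g :* s :* θ :+ (g :* θ :* con 1 :+ θ :* (con 4 :* b)))))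

        c3 : (θ + ι 2 * ε) * ι (R ℕ.* Q) ≤ κ
        c3 = ι-cancelˡ 32 (lin (*≥0 (ι≥0 64) (ι≥0 (R ℕ.* Q)) ⊛ ε≤θ ⊞ *≥0 (ι≥0 3) (ι≥0 (R ℕ.* Q)) ⊛ ≤-reflexive θ≡ ⊞ *≥0 (ι≥0 3) gi≥0 ⊛ ≤-reflexive SRQ ⊞ *≥0 (ι≥0 3) κ≥0 ⊛ inv≤1 (g ℕ.* q) ⊞ *≥0 (ι≥0 29) κ≥0 ⊛ 0≤1)
          (ring 6 λ θ ε r κ g s → con 32 :* κ :+ (con 64 :* r :* ε :+ (con 3 :* r :* (con 32 :* θ) :+ (con 3 :* g :* (s :* r) :+ (con 3 :* κ :* g :+ con 29 :* κ :* con 0)))) := con 32 :* ((θ :+ con 2 :* ε) :* r) :+ (con 64 :* r :* θ :+ (con 3 :* r :* (g :* s) :+ (con 3 :* g :* κ :+ (con 3 :* κ :* con 1 :+ con 29 :* κ :* con 1))))))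

        c4 : ι 2 * τ * ι (R ℕ.* Q) ≤ κ * θ
        c4 = ι-cancelˡ 16 (lin (*≥0 (ι≥0 2) (ι≥0 (R ℕ.* Q)) ⊛ ≤-reflexive τ≡ ⊞ *≥0 (ι≥0 2) (*≥0 gi≥0 θ≥0) ⊛ ≤-reflexive SRQ ⊞ *≥0 (ι≥0 2) (*≥0 κ≥0 θ≥0) ⊛ inv≤1 (g ℕ.* q) ⊞ *≥0 (ι≥0 14) (*≥0 κ≥0 θ≥0) ⊛ 0≤1)
          (ring 6 λ τ θ r κ g s → con 16 :* (κ :* θ) :+ (con 2 :* r :* (con 16 :* τ) :+ (con 2 :* (g :* θ) :* (s :* r) :+ (con 2 :* (κ :* θ) :* g :+ con 14 :* (κ :* θ) :* con 0))) := con 16 :* (con 2 :* τ :* r) :+ (con 2 :* r :* (g :* s :* θ) :+ (con 2 :* (g :* θ) :* κ :+ (con 2 :* (κ :* θ) :* con 1 :+ con 14 :* (κ :* θ) :* con 1)))))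

        c5 : κ + κ ≤ β
        c5 = ≤-trans (lin (ι≥0 2 ⊛ inv-anti {g} {κn} g≤κn) (ring 2 λ k g → con 2 :* g :+ con 2 :* k := k :+ k :+ con 2 :* g)) β≥

        λN = suc (2 ℕ.* R)
        ε≡ : ι (8 ℕ.* g ℕ.* λN) * ε ≡ τ
        ε≡ = trans (cong (λ w → ι (8 ℕ.* g ℕ.* λN) * inv w) εn-def) (ι*inv* (8 ℕ.* g ℕ.* λN) τn (ℕ.*-mono-≤ (ℕ.*-mono-≤ {1} {8} (s≤s z≤n) 1≤g) (s≤s {0} {2 ℕ.* R} z≤n)))

        gggg : ι (g ℕ.* g ℕ.* (g ℕ.* g)) ≡ gg * gg
        gggg = trans (ι-* (g ℕ.* g) (g ℕ.* g)) (cong₂ _*_ (ι-* g g) (ι-* g g))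

        KU≡ : ι kuN ≡ KU
        KU≡ = trans (cong ι kuN-def) (trans (ι-+ (1386 ℕ.* (g ℕ.* g ℕ.* (g ℕ.* g))) 8) (trans (cong (_+ ι 8) (trans (ι-* 1386 (g ℕ.* g ℕ.* (g ℕ.* g))) (cong (ι 1386 *_) gggg))) (ring 1 λ Q → con 1386 :* Q :+ con 8 := con 3 :* (con 462 :* Q) :+ con 8)))

        K₁≡ : ι k1N ≡ K₁ T
        K₁≡ = trans (cong ι k1N-def) (trans (ι-+ (u ℕ.+ v ℕ.+ 18) (256 ℕ.* T)) (trans (cong₂ _+_ (trans (ι-+ (u ℕ.+ v) 18) (cong (_+ ι 18) (trans (ι-+ u v) (cong₂ _+_ (trans (ι-* 84 (g ℕ.* g)) (cong (ι 84 *_) (ι-* g g))) (trans (ι-* 1386 (g ℕ.* g ℕ.* (g ℕ.* g))) (cong (ι 1386 *_) gggg)))))) (ι-* 256 T))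
                 (ring 3 λ q Q T → con 84 :* q :+ con 1386 :* Q :+ con 18 :+ con 256 :* T := con 84 :* q :+ con 3 :* (con 462 :* Q) :+ con 18 :+ con 256 :* T)))
          where
          u = 84 ℕ.* (g ℕ.* g)
          v = 1386 ℕ.* (g ℕ.* g ℕ.* (g ℕ.* g))

        2^≤T : 2 ℕ.^ (3 ℕ.* (kuN ℕ.* εn)) ℕ.≤ T
        2^≤T = subst (2 ℕ.^ (3 ℕ.* (kuN ℕ.* εn)) ℕ.≤_) (sym T-def) (ℕ.m≤m+n _ _)
        rest≤T : 4 ℕ.* q ℕ.+ (2 ℕ.* εn ℕ.+ 3) ℕ.≤ T
        rest≤T = subst (4 ℕ.* q ℕ.+ (2 ℕ.* εn ℕ.+ 3) ℕ.≤_) (sym T-def) (ℕ.m≤n+m _ (2 ℕ.^ (3 ℕ.* (kuN ℕ.* εn))))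
        4q≤T : 4 ℕ.* q ℕ.≤ T
        4q≤T = ℕ.≤-trans (ℕ.m≤m+n (4 ℕ.* q) _) rest≤T
        2ε3≤T : 2 ℕ.* εn ℕ.+ 3 ℕ.≤ T
        2ε3≤T = ℕ.≤-trans (ℕ.m≤n+m (2 ℕ.* εn ℕ.+ 3) (4 ℕ.* q)) rest≤T
        3≤T : 3 ℕ.≤ T
        3≤T = ℕ.≤-trans (ℕ.m≤n+m 3 (2 ℕ.* εn)) 2ε3≤T
        1≤T = ℕ.≤-trans (s≤s z≤n) 3≤T

        εT : ι 2 ≤ ε * ι T
        εT = ≤-trans (≤-reflexive (sym (trans (cong (ε *_) (ι-* 2 εn)) (trans (ring 2 λ e n → e :* (con 2 :* n) := con 2 :* (e :* n)) (trans (cong (ι 2 *_) (inv*ι εn)) (*-identityʳ _)))))) (ε≥0 ⊛ ι-mono (ℕ.≤-trans (ℕ.m≤m+n (2 ℕ.* εn) 3) 2ε3≤T))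

        ε-large : ∀ m {y} → 2 ℕ.^ (3 ℕ.* (m ℕ.* εn)) ℕ.≤ y → y ℕ.≤ X → ι m ≤ ε * ℓ y
        ε-large m {y} p r = ≤-trans (≤-reflexive (sym (trans (cong (ε *_) (ι-* m εn)) (trans (ring 3 λ e m n → e :* (m :* n) := m :* (e :* n)) (trans (cong (ι m *_) (inv*ι εn)) (*-identityʳ _)))))) (ε≥0 ⊛ ℓ-large (m ℕ.* εn) p r)

        kuN≥1 : 1 ℕ.≤ kuN
        kuN≥1 = subst (1 ℕ.≤_) (sym kuN-def) (ℕ.≤-trans (s≤s z≤n) (ℕ.m≤n+m 8 (1386 ℕ.* (g ℕ.* g ℕ.* (g ℕ.* g)))))

        T-large : ∀ y → T ℕ.≤ y → y ℕ.≤ X → (KU ≤ ε * ℓ y) × (ι 1 ≤ ℓ y)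
        T-large y p r = subst (_≤ ε * ℓ y) KU≡ (ε-large kuN (ℕ.≤-trans 2^≤T p) r)
                      , ≤-trans (ι-mono (ℕ.*-mono-≤ kuN≥1 1≤εn)) (ℓ-large (kuN ℕ.* εn) (ℕ.≤-trans 2^≤T p) r)

        2h≤x : h ℕ.+ h ℕ.≤ x
        2h≤x = subst (h ℕ.+ h ℕ.≤_) (sym x≡) (ℕ.≤-trans (ℕ.≤-reflexive (cong (h ℕ.+_) (sym (ℕ.+-identityʳ h)))) (ℕ.*-monoˡ-≤ h 2≤q))

      module _ (x₀≤x : x₀ ℕ.≤ x) (2x′<X : 2 ℕ.* (x ℕ.+ h) ℕ.< X) (Rx≤X : R ℕ.* x ℕ.≤ X)
               (Z : ℕ → Set) (Z? : ∀ z → Dec (Z z)) (Z-cop : ∀ {z} → Z z → Coprime z g) (sparse : ∀ {z} → Z z → mass z x (x ℕ.+ h) ≤ inv εn * ι x)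
               (z₀ : ℕ) (Zz₀ : Z z₀) (1≤z₀ : 1 ℕ.≤ z₀) (z₀≤g : z₀ ℕ.≤ g) where
        private
          pow = 2 ℕ.^ (3 ℕ.* (k1N ℕ.* εn))
          big = c₀ ℕ.* R ℕ.^ (2 ℕ.* c₀)
          big≤x : big ℕ.≤ x
          big≤x = ℕ.≤-trans (ℕ.m≤m+n big (pow ℕ.+ T)) (subst (ℕ._≤ x) x₀-def x₀≤x)
          powT≤x : pow ℕ.+ T ℕ.≤ x
          powT≤x = ℕ.≤-trans (ℕ.m≤n+m (pow ℕ.+ T) big) (subst (ℕ._≤ x) x₀-def x₀≤x)
          T≤x : T ℕ.≤ x
          T≤x = ℕ.≤-trans (ℕ.m≤n+m T pow) powT≤x
          x≤X : x ℕ.≤ X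
          x≤X = ℕ.≤-trans (ℕ.m≤n*m x R {{ℕ.>-nonZero 1≤R}}) Rx≤X
          x-large : K₁ T ≤ ε * ℓ x
          x-large = subst (_≤ ε * ℓ x) K₁≡ (ε-large k1N (ℕ.≤-trans (ℕ.m≤m+n pow T) powT≤x) x≤X)

          open Window x h 1≤h 2h≤x 2x′<X ε ε≥0 (inv≤1 εn) T 3≤T T-large εT using (module Classes)
          open Classes T≤x x-large Z Z? Z-cop sparse θ θ≥0

          instance
            R≢0 : NonZero R
            R≢0 = ℕ.>-nonZero 1≤R

          1≤c₀ : 1 ℕ.≤ c₀
          1≤c₀ = subst (1 ℕ.≤_) (sym c₀-def) (ℕ.*-mono-≤ (ℕ.*-mono-≤ 1≤Q (ℕ.m^n>0 R (i₀ ℕ.+ 2))) 1≤T)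

          nn : Σ ℕ λ n → c₀ ℕ.* R ℕ.^ n ℕ.≤ x × x ℕ.< c₀ ℕ.* R ℕ.^ suc n
          nn = log-floor R c₀ x (ℕ.≤-trans (s≤s (s≤s z≤n)) 3≤R) 1≤c₀ (ℕ.≤-trans (ℕ.m≤m*n c₀ (R ℕ.^ (2 ℕ.* c₀)) {{ℕ.>-nonZero (ℕ.m^n>0 R (2 ℕ.* c₀))}}) big≤x)
          n = proj₁ nn
          n≥ : 2 ℕ.* c₀ ℕ.≤ n
          n≥ = ℕ.≮⇒≥ (λ lt → ℕ.<⇒≱ (proj₂ (proj₂ nn)) (ℕ.≤-trans (ℕ.*-monoʳ-≤ c₀ (ℕ.^-monoʳ-≤ R lt)) big≤x))

          -- The number of scales is at least proportional to ℓ(x): x < c₀ R^(n + 1), where ℓ(R) ≤ 2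
          -- R and, by `n≥`, ℓ(c₀) ≤ 2 c₀ ≤ n + 1.
          ℓx≤ : ℓ x ≤ ι (suc n) * ι λN
          ℓx≤ = ≤-trans (ℓ-mono (ℕ.≤-trans 1≤T T≤x) (ℕ.<⇒≤ (proj₂ (proj₂ nn))) cR≤X) (≤-trans (≤-reflexive (trans (ℓ-* 1≤c₀ (ℕ.m^n>0 R (suc n))) (cong (ℓ c₀ +_) (ℓ-pow (suc n)))))
              (lin (ℓ≤2y c₀ 1≤c₀ c₀≤X ⊞ ≤-reflexive (sym (ι-* 2 c₀)) ⊞ ι-mono (ℕ.m≤n⇒m≤1+n n≥) ⊞ ι≥0 (suc n) ⊛ (ℓ≤2y R 1≤R R≤X ⊞ ≤-reflexive (trans (cong (_+ ι 1) (sym (ι-* 2 R))) (sym (ι-suc (2 ℕ.* R))))))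
                (ring 7 λ lc c c2 n lR R l → n :* l :+ (lc :+ (con 2 :* c :+ (c2 :+ n :* (lR :+ (con 2 :* R :+ con 1))))) := lc :+ n :* lR :+ (con 2 :* c :+ (c2 :+ (n :+ n :* (con 2 :* R :+ l)))))))
            where
            cR≤X : c₀ ℕ.* R ℕ.^ suc n ℕ.≤ X
            cR≤X = ℕ.≤-trans (ℕ.≤-reflexive (trans (sym (ℕ.*-assoc c₀ R _)) (trans (cong (ℕ._* R ℕ.^ n) (ℕ.*-comm c₀ R)) (ℕ.*-assoc R c₀ _)))) (ℕ.≤-trans (ℕ.*-monoʳ-≤ R (proj₁ (proj₂ nn))) Rx≤X)
            c₀≤X : c₀ ℕ.≤ X
            c₀≤X = ℕ.≤-trans (ℕ.m≤m*n c₀ (R ℕ.^ suc n) {{ℕ.>-nonZero (ℕ.m^n>0 R (suc n))}}) cR≤X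
            R≤X : R ℕ.≤ X
            R≤X = ℕ.≤-trans (ℕ.m≤m*n R x {{ℕ.>-nonZero (ℕ.≤-trans 1≤T T≤x)}}) Rx≤X
            ℓ-pow : ∀ k → ℓ (R ℕ.^ k) ≡ ι k * ℓ R
            ℓ-pow zero = trans ℓ-1 (sym (*-zeroˡ _))
            ℓ-pow (suc k) = trans (ℓ-* 1≤R (ℕ.m^n>0 R k)) (trans (cong (ℓ R +_) (ℓ-pow k)) (trans (ring 2 λ l n → l :+ n :* l := (n :+ con 1) :* l) (cong (_* ℓ R) (sym (ι-suc k)))))

          A : ℕ → ℕ
          A i = Q ℕ.* R ℕ.^ (i₀ ℕ.+ i)
          RA : ∀ i → R ℕ.* Q ℕ.* R ℕ.^ (i₀ ℕ.+ i) ≡ A (suc i)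
          RA i = trans (trans (cong (ℕ._* R ℕ.^ (i₀ ℕ.+ i)) (ℕ.*-comm R Q)) (ℕ.*-assoc Q R _)) (cong (λ w → Q ℕ.* R ℕ.^ w) (sym (ℕ.+-suc i₀ i)))
          A-mono : ∀ {i j} → i ℕ.≤ j → A i ℕ.≤ A j
          A-mono p = ℕ.*-monoʳ-≤ Q (ℕ.^-monoʳ-≤ R (ℕ.+-monoʳ-≤ i₀ p))
          1≤A : ∀ i → 1 ℕ.≤ A i
          1≤A i = ℕ.*-mono-≤ 1≤Q (ℕ.m^n>0 R (i₀ ℕ.+ i))
          i₀≤A : ∀ i → i₀ ℕ.≤ A i
          i₀≤A i = ℕ.≤-trans (ℕ.≤-trans (n≤2^n i₀) (ℕ.≤-trans (ℕ.^-monoˡ-≤ i₀ (ℕ.≤-trans (s≤s (s≤s z≤n)) 3≤R)) (ℕ.^-monoʳ-≤ R (ℕ.m≤m+n i₀ i)))) (ℕ.m≤n*m _ Q {{ℕ.>-nonZero 1≤Q}})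
          T≤A : ∀ i → T ℕ.≤ A i
          T≤A i = ℕ.≤-trans (ℕ.≤-trans (ℕ.m≤m+n T B) (ℕ.≤-reflexive (sym i₀-def))) (i₀≤A i)
          B≤A′ : ∀ i → B ℕ.≤ A i
          B≤A′ i = ℕ.≤-trans (ℕ.≤-trans (ℕ.m≤n+m B T) (ℕ.≤-reflexive (sym i₀-def))) (i₀≤A i)
          A≤N : ∀ {i} → i ℕ.≤ suc (suc n) → A i ℕ.≤ N
          A≤N {i} p = ℕ.≤-trans (A-mono p) (÷-≤ 1≤T (ℕ.≤-trans (ℕ.≤-reflexive eqA) (proj₁ (proj₂ nn))))
            where
            eqA : T ℕ.* A (suc (suc n)) ≡ c₀ ℕ.* R ℕ.^ n
            eqA = trans (cong (λ w → T ℕ.* (Q ℕ.* w)) (trans (cong (R ℕ.^_) (trans (ℕ.+-comm i₀ _) (trans (cong (λ w → suc (suc w)) (ℕ.+-comm n i₀)) (trans (ℕ.+-comm 2 (i₀ ℕ.+ n)) (trans (ℕ.+-assoc i₀ n 2) (trans (cong (i₀ ℕ.+_) (ℕ.+-comm n 2)) (sym (ℕ.+-assoc i₀ 2 n)))))))) (ℕ.^-distribˡ-+-* R (i₀ ℕ.+ 2) n)))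
                    (trans (regroup T Q (R ℕ.^ (i₀ ℕ.+ 2)) (R ℕ.^ n)) (cong (ℕ._* R ℕ.^ n) (sym c₀-def)))
              where
              regroup : ∀ t q a b → t ℕ.* (q ℕ.* (a ℕ.* b)) ≡ q ℕ.* a ℕ.* t ℕ.* b
              regroup = solve-∀

          -- Deficits on a scale and on its reflection are taken together, so that one choice of `i`
          -- yields both `sumI` and `sumJ`.
          s : ℕ → ℚ
          s i = (∑ (A (suc i)) c - ∑ (A i) c) + (∑ (x ÷ A i) c - ∑ (x ÷ A (suc i)) c)

          -- Both parts telescope to at most the full sum of `c`, of order ε x ℓ(x). By `ℓx≤` this
          -- is of order ε x per scale, and `εn` was chosen to make it τ x.
          s-sum : ∑ (suc n) s ≤ ι (suc n) * (τ * ι x)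
          s-sum = ≤-trans (≤-reflexive (trans (∑-+ (suc n) _ _) (cong₂ _+_ (telescope (suc n) (λ i → ∑ (A i) c)) (trans (∑-cong′ (suc n) (λ i → ring 2 λ a b → a :- b := :- b :- :- a)) (telescope (suc n) (λ i → - ∑ (x ÷ A i) c))))))
              (lin (∑c-mono (A≤N ℕ.≤-refl) ℕ.≤-refl ⊞ ∑c-mono xA≤N ℕ.≤-refl ⊞ ∑c≥0 (A≤N (s≤s z≤n)) ⊞ ∑c≥0 (ℕ.≤-trans (÷-anti x (1≤A 1) (A-mono (s≤s z≤n))) xA≤N)
                    ⊞ ι≥0 2 ⊛ ∑c ⊞ *≥0 (*≥0 (*≥0 (ι≥0 8) (ι≥0 g)) ε≥0) (ι≥0 x) ⊛ ℓx≤ ⊞ *≥0 (ι≥0 (suc n)) (ι≥0 x) ⊛ ≤-reflexive ε≡′)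
                (ring 12 λ a b u v C g ε x l n lam τ → n :* (τ :* x) :+ (a :+ (u :+ (con 0 :+ (con 0 :+ (con 2 :* C :+ (con 8 :* g :* ε :* x :* l :+ n :* x :* (con 8 :* g :* lam :* ε))))))) :=
                   a :- b :+ (:- v :- :- u) :+ (C :+ (C :+ (b :+ (v :+ (con 2 :* (g :* (con 4 :* ε :* x :* l)) :+ (con 8 :* g :* ε :* x :* (n :* lam) :+ n :* x :* τ)))))) ))
            where
            xA≤N : x ÷ A 1 ℕ.≤ N
            xA≤N = ÷-anti x 1≤T (T≤A 1)
            ∑c≥0 : ∀ {m} → m ℕ.≤ N → ι 0 ≤ ∑ m c
            ∑c≥0 p = ∑c-mono z≤n p
            ε≡′ : ι 8 * ι g * ι λN * ε ≡ τ
            ε≡′ = trans (cong (_* ε) (sym (trans (ι-* (8 ℕ.* g) λN) (cong (_* ι λN) (ι-* 8 g))))) ε≡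

          ph = pigeonhole n {s} (τ * ι x) s-sum
          i = proj₁ ph
          i≤ : i ℕ.≤ suc n
          i≤ = proj₁ (proj₂ (proj₂ ph))
          si≤ : s i ≤ τ * ι x
          si≤ = proj₂ (proj₂ (proj₂ ph))
          δ = R ℕ.^ (i₀ ℕ.+ i)
          RA≤N : R ℕ.* Q ℕ.* δ ℕ.≤ N
          RA≤N = subst (ℕ._≤ N) (sym (RA i)) (A≤N (s≤s i≤))
          sumI : ∑ (R ℕ.* Q ℕ.* δ) c - ∑ (Q ℕ.* δ) c ≤ τ * ι x
          sumI = subst (λ w → ∑ w c - ∑ (A i) c ≤ τ * ι x) (sym (RA i)) (lin (si≤ ⊞ ∑c-mono (÷-anti x (1≤A i) (A-mono (ℕ.n≤1+n i))) (÷-anti x 1≤T (T≤A i))) (ring 5 λ t a b u v → t :+ (a :- b :+ (u :- v) :+ v) := a :- b :+ (t :+ u)))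
          sumJ : ∑ (x ÷ (Q ℕ.* δ)) c - ∑ (x ÷ (R ℕ.* Q ℕ.* δ)) c ≤ τ * ι x
          sumJ = subst (λ w → ∑ (x ÷ A i) c - ∑ (x ÷ w) c ≤ τ * ι x) (sym (RA i)) (lin (si≤ ⊞ ∑c-mono (A-mono (ℕ.n≤1+n i)) (A≤N (s≤s i≤))) (ring 5 λ t a b u v → t :+ (a :- b :+ (u :- v) :+ b) := u :- v :+ (t :+ a)))

          module St = Stretch q 1≤q x≡ Q R δ (ℕ.m^n>0 R (i₀ ℕ.+ i)) 2q<Q (T≤A i) RA≤N 4q≤T τ τn τ≥0 (≤-reflexive (sym (inv*ι τn))) κ sumI sumJ c1 c2 c3 c4 c5

          2Q<RQ : 2 ℕ.* Q ℕ.< R ℕ.* Q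
          2Q<RQ = ℕ.*-monoˡ-< Q {{ℕ.>-nonZero 1≤Q}} 3≤R

        stretch : Stretch₀ Z Q R (inv κn) B x
        stretch = record
          { δ = δ
          ; 1≤δ = ℕ.m^n>0 R (i₀ ℕ.+ i)
          ; B≤A = B≤A′ i
          ; RA≤x = ℕ.≤-trans RA≤N N≤x
          ; Dense = St.Dense
          ; dense? = St.dense?
          ; dense-cell = λ j cs d j< j≥ → St.dense-cell Zz₀ 1≤z₀ z₀≤g j cs d j< j≥
          ; empty-cell = λ j ¬d j< j≥ → St.empty-cell j ¬d j< j≥
          ; closed = λ cs cs′ d Zz p r Zz′ p′ r′ h → St.closed Zz₀ 1≤z₀ z₀≤g 2Q<RQ cs cs′ d Zz p r Zz′ p′ r′ h
          }

-- Mertens sums over a stretch count the dense classes.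

module Density (g : ℕ) {{g≢0 : NonZero g}} (X : ℕ) (4≤X : 4 ℕ.≤ X) (L : ℕ → Field.ℚ) (diff : Log.DiffBound X L) where
  open import Data.Nat.Coprimality using (Coprime; coprime?)
  open Field
  open Sums
  open Log
  open Residues g
  open Estimates X L diff
  open Selberg g X 4≤X L diff
  open Windows g X 4≤X L diff
  open Levels

  module Consequence {Z : ℕ → Set} {Q R : ℕ} {κ : ℚ} {B x : ℕ} (κ≥0 : ι 0 ≤ κ) (1≤Q : 1 ℕ.≤ Q) (2≤R : 2 ℕ.≤ R) (x<X : x ℕ.< X)
    (S₀ : Stretch₀ g X 4≤X L diff Z Q R κ B x) where
    open Stretch₀ S₀

    private
      RQ = R ℕ.* Q
      2Q = 2 ℕ.* Q
      instance
        Q≢0 : NonZero Q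
        Q≢0 = ℕ.>-nonZero 1≤Q
        δ≢0 : NonZero δ
        δ≢0 = ℕ.>-nonZero 1≤δ
      2Q≤RQ : 2Q ℕ.≤ RQ
      2Q≤RQ = ℕ.*-monoˡ-≤ Q 2≤R
      1≤2Q : 1 ℕ.≤ 2Q
      1≤2Q = ℕ.≤-trans 1≤Q (ℕ.m≤n*m Q 2)
      RQδ≤X : RQ ℕ.* δ ℕ.≤ X
      RQδ≤X = ℕ.≤-trans RA≤x (ℕ.<⇒≤ x<X)
      RQ≤X : RQ ℕ.≤ X
      RQ≤X = ℕ.≤-trans (ℕ.m≤m*n RQ δ) RQδ≤X

      G : ℕ → ℕ → ℚ
      G s y = ∑ y (λ k → 𝟙 (k ≈? s) * Λ k * inv k)

      D : ℕ → ℚ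
      D s = 𝟙 (dense? s)

      -- The error per cell: κ / Q from its mass and 2 / Q² from the variation of 1 / k across it.
      η : ℚ
      η = (κ + ι 2 * inv Q) * inv Q

      cell-mass : ∀ {s} j → Coprime s g → j ℕ.< RQ → 2Q ℕ.≤ j → Bd (mass s (j ℕ.* δ) (suc j ℕ.* δ) - β * D s * ι δ) (κ * ι δ)
      cell-mass {s} j cs j< j≥ = go (dense? s)
        where
        go : (d : Dec (Dense s)) → Bd (mass s (j ℕ.* δ) (suc j ℕ.* δ) - β * 𝟙 d * ι δ) (κ * ι δ)
        go (yes d) = Bd-≡ (cong (λ w → mass s (j ℕ.* δ) (suc j ℕ.* δ) - w * ι δ) (sym (*-identityʳ β))) (dense-cell j cs d j< j≥)
        go (no ¬d) = Bd-≡ (ring 3 λ m b d → m := m :- b :* con 0 :* d) (empty-cell j ¬d j< j≥)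

      cellG : ∀ {s} j → Coprime s g → j ℕ.< RQ → 2Q ℕ.≤ j → Bd (G s (suc j ℕ.* δ) - G s (j ℕ.* δ) - β * D s * inv (suc j)) η
      cellG {s} j@(suc _) cs j< j≥ =
          lin (lower ⊞ inv≥0 (suc j) ⊛ proj₁ m₁ ⊞ κ≥0 ⊛ inv-anti Q≤sj ⊞ *≥0 (*≥0 (ι≥0 2) (inv≥0 Q)) (inv≥0 Q) ⊛ 0≤1)
            (ring 7 λ g₁ g₀ m b i k iQ → g₁ :- g₀ :- b :* i :+ (i :* m :+ (i :* :- k :+ (k :* i :+ con 2 :* iQ :* iQ :* con 0))) := :- ((k :+ con 2 :* iQ) :* iQ) :+ (g₁ :- g₀ :+ (i :* (m :- b) :+ (k :* iQ :+ con 2 :* iQ :* iQ :* con 1))))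
        , lin (upper ⊞ inv≥0 j ⊛ proj₂ m₁ ⊞ κ≥0 ⊛ inv-anti Q≤j ⊞ bD≥0 ⊛ ≤-reflexive (inv-diff _) ⊞ *≥0 (inv≥0 j) (inv≥0 (suc j)) ⊛ bD≤2 ⊞ ι≥0 2 ⊛ *-mono (inv≥0 j) (inv≥0 Q) (inv-anti Q≤j) (inv-anti Q≤sj))
            (ring 8 λ g₁ g₀ m b i j k iQ → (k :+ con 2 :* iQ) :* iQ :+ (g₁ :- g₀ :+ (j :* (m :- b) :+ (k :* j :+ (b :* (j :- i) :+ (j :* i :* b :+ con 2 :* (j :* i)))))) := g₁ :- g₀ :- b :* i :+ (j :* m :+ (j :* k :+ (k :* iQ :+ (b :* (j :* i) :+ (j :* i :* con 2 :+ con 2 :* (iQ :* iQ)))))))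
        where
        jδ = j ℕ.* δ
        sjδ = suc j ℕ.* δ
        Q≤j : Q ℕ.≤ j
        Q≤j = ℕ.≤-trans (ℕ.m≤n*m Q 2) j≥
        Q≤sj = ℕ.m≤n⇒m≤1+n Q≤j
        bD = β * D s
        bD≥0 : ι 0 ≤ bD
        bD≥0 = *≥0 β≥0 (𝟙≥0 (dense? s))
        bD≤2 : bD ≤ ι 2
        bD≤2 = ≤-trans (β≥0 ⊛ 𝟙≤1 (dense? s)) (≤-trans (≤-reflexive (*-identityʳ β)) β≤2)
        m₁′ = inv δ * mass s jδ sjδ
        m₁ : Bd (m₁′ - bD) κ
        m₁ = Bd-≡ (trans (ring 4 λ i m b d → i :* (m :- b :* d) := i :* m :- b :* (i :* d)) (cong (λ w → m₁′ - w) (trans (cong (bD *_) (inv*ι δ)) (*-identityʳ _))))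
               (Bd-≤ (≤-reflexive (trans (ring 3 λ i k d → i :* (k :* d) := k :* (i :* d)) (trans (cong (κ *_) (inv*ι δ)) (*-identityʳ _)))) (Bd-*ˡ (inv≥0 δ) (cell-mass j cs j< j≥)))
        sjδ≤X : sjδ ℕ.≤ X
        sjδ≤X = ℕ.≤-trans (ℕ.*-monoˡ-≤ δ j<) RQδ≤X
        term≥0 : ∀ k → jδ ℕ.< k → k ℕ.≤ sjδ → ι 0 ≤ 𝟙 (k ≈? s) * Λ k
        term≥0 k p r = ψ-term≥0 s k (ℕ.≤-trans (s≤s z≤n) p) (ℕ.≤-trans r sjδ≤X)
        lower : inv (suc j) * m₁′ ≤ G s sjδ - G s jδ
        lower = ≤-trans (≤-reflexive (trans (sym (*-assoc _ _ _)) (trans (cong (_* mass s jδ sjδ) (sym (inv-* (suc j) δ))) (trans (ring 3 λ i a b → i :* (a :- b) := a :* i :- b :* i) (cong₂ _-_ (sym (∑-*ʳ sjδ (inv sjδ) _)) (sym (∑-*ʳ jδ (inv sjδ) _)))))))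
          (∑-diff-mono (ℕ.*-monoˡ-≤ δ (ℕ.n≤1+n j)) (λ k p r → term≥0 k p r ⊛ inv-anti {k} {sjδ} {{ℕ.>-nonZero (ℕ.≤-trans (s≤s z≤n) p)}} r))
        upper : G s sjδ - G s jδ ≤ inv j * m₁′
        upper = ≤-trans (∑-diff-mono (ℕ.*-monoˡ-≤ δ (ℕ.n≤1+n j)) (λ k p r → term≥0 k p r ⊛ inv-anti {jδ} {k} {{ℕ.>-nonZero (ℕ.*-mono-≤ {1} {j} (s≤s z≤n) 1≤δ)}} (ℕ.<⇒≤ p)))
          (≤-reflexive (sym (trans (sym (*-assoc _ _ _)) (trans (cong (_* mass s jδ sjδ) (sym (inv-* j δ))) (trans (ring 3 λ i a b → i :* (a :- b) := a :* i :- b :* i) (cong₂ _-_ (sym (∑-*ʳ sjδ (inv jδ) _)) (sym (∑-*ʳ jδ (inv jδ) _))))))))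
      cellG zero cs j< j≥ = ⊥-elim (ℕ.<⇒≱ 1≤2Q j≥)

      sumG : ∀ {s} n → Coprime s g → 2Q ℕ.+ n ℕ.≤ RQ → Bd (G s ((2Q ℕ.+ n) ℕ.* δ) - G s (2Q ℕ.* δ) - β * D s * ∑ n (λ i → inv (2Q ℕ.+ i))) (ι n * η)
      sumG {s} zero cs le rewrite ℕ.+-identityʳ Q | ℕ.+-identityʳ (Q ℕ.+ Q) = Bd-≡ (ring 2 λ a b → con 0 := a :- a :- b :* con 0) (Bd-0 (≤-reflexive (sym (*-zeroˡ _))))
      sumG {s} (suc n) cs le = Bd-≡ eq (Bd-≤ (≤-reflexive (trans (ring 2 λ n e → n :* e :+ e := (n :+ con 1) :* e) (cong (_* η) (sym (ι-suc n))))) (Bd-+ (sumG n cs (ℕ.≤-trans (ℕ.+-monoʳ-≤ 2Q (ℕ.n≤1+n n)) le)) (cellG (2Q ℕ.+ n) cs (subst (ℕ._≤ RQ) (ℕ.+-suc 2Q n) le) (ℕ.m≤m+n 2Q n))))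
        where
        eq : (G s ((2Q ℕ.+ n) ℕ.* δ) - G s (2Q ℕ.* δ) - β * D s * ∑ n (λ i → inv (2Q ℕ.+ i))) + (G s (suc (2Q ℕ.+ n) ℕ.* δ) - G s ((2Q ℕ.+ n) ℕ.* δ) - β * D s * inv (suc (2Q ℕ.+ n))) ≡ G s ((2Q ℕ.+ suc n) ℕ.* δ) - G s (2Q ℕ.* δ) - β * D s * (∑ n (λ i → inv (2Q ℕ.+ i)) + inv (2Q ℕ.+ suc n))
        eq rewrite ℕ.+-suc 2Q n = ring 6 λ a b c d e f → (a :- b :- d :* e) :+ (c :- a :- d :* f) := c :- b :- d :* (e :+ f)

      lam : ℚ
      lam = ℓ R - ℓ 2

      harmonic : Bd (∑ (RQ ℕ.∸ 2Q) (λ i → inv (2Q ℕ.+ i)) - lam) (ι 3 * inv Q)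
      harmonic = Bd-≡ eq (Bd-≤ (ι≥0 3 ⊛ inv-anti (ℕ.m≤n*m Q 2)) (H-ℓ 2Q (RQ ℕ.∸ 2Q) 1≤2Q (ℕ.≤-trans (ℕ.≤-reflexive sumRQ) RQ≤X)))
        where
        sumRQ : 2Q ℕ.+ (RQ ℕ.∸ 2Q) ≡ RQ
        sumRQ = ℕ.m+[n∸m]≡n 2Q≤RQ
        1≤R = ℕ.≤-trans (s≤s z≤n) 2≤R
        eq : ∑ (2Q ℕ.+ (RQ ℕ.∸ 2Q)) inv - ∑ 2Q inv - (ℓ (2Q ℕ.+ (RQ ℕ.∸ 2Q)) - ℓ 2Q) ≡ ∑ (RQ ℕ.∸ 2Q) (λ i → inv (2Q ℕ.+ i)) - lam
        eq = trans (cong₂ (λ u v → u - ∑ 2Q inv - (v - ℓ 2Q)) (∑-split 2Q (RQ ℕ.∸ 2Q) inv) (trans (cong ℓ sumRQ) (ℓ-* 1≤R 1≤Q))) (trans (cong (λ w → (∑ 2Q inv + ∑ (RQ ℕ.∸ 2Q) (λ i → inv (2Q ℕ.+ i))) - ∑ 2Q inv - (ℓ R + ℓ Q - w)) (ℓ-* {2} {Q} (s≤s z≤n) 1≤Q))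
               (ring 5 λ a b r q t → (a :+ b) :- a :- (r :+ q :- (t :+ q)) := b :- (r :- t)))

      η′ : ℚ
      η′ = ι R * (κ + ι 2 * inv Q) + ι 6 * inv Q

      G-diff : ∀ {s} → Coprime s g → Bd (G s (RQ ℕ.* δ) - G s (2Q ℕ.* δ) - β * D s * lam) η′
      G-diff {s} cs = Bd-≡ eq (Bd-≤ le (Bd-+ (sumG (RQ ℕ.∸ 2Q) cs (ℕ.≤-reflexive (ℕ.m+[n∸m]≡n 2Q≤RQ))) (Bd-*ˡ bD≥0 harmonic)))
        where
        bD≥0 : ι 0 ≤ β * D s
        bD≥0 = *≥0 β≥0 (𝟙≥0 (dense? s))
        bD≤2 : β * D s ≤ ι 2
        bD≤2 = ≤-trans (β≥0 ⊛ 𝟙≤1 (dense? s)) (≤-trans (≤-reflexive (*-identityʳ β)) β≤2)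
        Hs = ∑ (RQ ℕ.∸ 2Q) (λ i → inv (2Q ℕ.+ i))
        eq : (G s ((2Q ℕ.+ (RQ ℕ.∸ 2Q)) ℕ.* δ) - G s (2Q ℕ.* δ) - β * D s * Hs) + β * D s * (Hs - lam) ≡ G s (RQ ℕ.* δ) - G s (2Q ℕ.* δ) - β * D s * lam
        eq = trans (cong (λ w → (G s (w ℕ.* δ) - G s (2Q ℕ.* δ) - β * D s * Hs) + β * D s * (Hs - lam)) (ℕ.m+[n∸m]≡n 2Q≤RQ)) (ring 5 λ a b c h l → (a :- b :- c :* h) :+ c :* (h :- l) := a :- b :- c :* l)
        le : ι (RQ ℕ.∸ 2Q) * η + β * D s * (ι 3 * inv Q) ≤ η′
        le = lin (η≥0 ⊛ ≤-trans (ι-mono (ℕ.m∸n≤m RQ 2Q)) (≤-reflexive (ι-* R Q)) ⊞ *≥0 (ι≥0 R) k2≥0 ⊛ ≤-reflexive (inv*ι Q) ⊞ *≥0 (ι≥0 3) (inv≥0 Q) ⊛ bD≤2)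
          (ring 6 λ n b iQ k R q → R :* (k :+ con 2 :* iQ) :+ con 6 :* iQ :+ ((k :+ con 2 :* iQ) :* iQ :* n :+ (R :* (k :+ con 2 :* iQ) :* (iQ :* q) :+ con 3 :* iQ :* b)) := n :* ((k :+ con 2 :* iQ) :* iQ) :+ b :* (con 3 :* iQ) :+ ((k :+ con 2 :* iQ) :* iQ :* (R :* q) :+ (R :* (k :+ con 2 :* iQ) :* con 1 :+ con 3 :* iQ :* con 2)))
          where
          k2≥0 : ι 0 ≤ κ + ι 2 * inv Q
          k2≥0 = +≥0 κ≥0 (*≥0 (ι≥0 2) (inv≥0 Q))
          η≥0 : ι 0 ≤ η
          η≥0 = *≥0 k2≥0 (inv≥0 Q)

    -- Between 2 Q δ and R Q δ the weighted sum grows by m (ℓ(R) - ℓ(2)) up to 2 K. Computed cell by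
    -- cell, it grows by β (ℓ(R) - ℓ(2)) times the sum of `c` over the dense classes. For large `R`
    -- this determines the latter sum.
    density : ∀ (c : ℕ → ℚ) m K → (∀ n → Bd (c n) (ι 1)) → (∀ {a b} → a ≈ b → c a ≡ c b) → (∀ n → ¬ Coprime n g → c n ≡ ι 0) →
      (∀ y → 1 ℕ.≤ y → y ℕ.< X → Bd (∑ y (λ k → c k * Λ k * inv k) - m * ℓ y) K) →
      Bd ((β * ∑ g (λ s → c s * 𝟙 (dense? s)) - m) * (ℓ R - ℓ 2)) (ι 2 * K + ι g * (ι R * (κ + ι 2 * inv Q) + ι 6 * inv Q))
    density c m K c-Bd c-≈ c-0 mer = Bd-≡ eq (Bd-≤ (≤-reflexive (trans (cong (λ w → K + K + w) (∑-const g η′)) (ring 3 λ k g e → k :+ k :+ g :* e := con 2 :* k :+ g :* e))) (Bd-- (Bd-- (mer y₁ 1≤y₁ y₁<X) (mer y₀ 1≤y₀ y₀<X)) (∑-Bd g term)))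
      where
      y₁ = RQ ℕ.* δ
      y₀ = 2Q ℕ.* δ
      y₁<X = ℕ.≤-<-trans RA≤x x<X
      y₀≤y₁ : y₀ ℕ.≤ y₁
      y₀≤y₁ = ℕ.*-monoˡ-≤ δ 2Q≤RQ
      y₀<X = ℕ.≤-<-trans y₀≤y₁ y₁<X
      1≤y₀ : 1 ℕ.≤ y₀
      1≤y₀ = ℕ.*-mono-≤ 1≤2Q 1≤δ
      1≤y₁ = ℕ.≤-trans 1≤y₀ y₀≤y₁
      F : ℕ → ℚ
      F y = ∑ y (λ k → c k * Λ k * inv k)
      F≡ : ∀ y → F y ≡ ∑ g (λ s → c s * G s y)
      F≡ y = trans (∑-cong′ y (λ k → trans (cong (λ w → w * Λ k * inv k) (sym (trans (∑-class k c) (c-≈ (rep≈ k))))) (trans (*-assoc _ _ _) (trans (sym (∑-*ʳ g (Λ k * inv k) _)) (∑-cong′ g (λ s → trans (cong (λ w → w * c s * (Λ k * inv k)) (𝟙-⇔ (s ≈? k) (k ≈? s) sym sym)) (ring 4 λ i c l v → i :* c :* (l :* v) := c :* (i :* l :* v))))))))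
             (trans (∑-swap y g _) (∑-cong′ g (λ s → ∑-*ˡ y (c s) _)))
      term : ∀ s → 1 ℕ.≤ s → s ℕ.≤ g → Bd (c s * (G s y₁ - G s y₀ - β * D s * lam)) η′
      term s _ _ with coprime? s g
      ... | yes cs = Bd-≤ (≤-reflexive (*-identityˡ _)) (Bd-* (c-Bd s) (G-diff cs))
      ... | no ¬cs = Bd-≡ (sym (trans (cong (_* (G s y₁ - G s y₀ - β * D s * lam)) (c-0 s ¬cs)) (*-zeroˡ _))) (Bd-0 (+≥0 (*≥0 (ι≥0 R) (+≥0 κ≥0 (*≥0 (ι≥0 2) (inv≥0 Q)))) (*≥0 (ι≥0 6) (inv≥0 Q))))
      Sc = ∑ g (λ s → c s * 𝟙 (dense? s))
      sum-eq : ∑ g (λ s → c s * (G s y₁ - G s y₀ - β * D s * lam)) ≡ F y₁ - F y₀ - β * lam * Sc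
      sum-eq = trans (∑-cong′ g (λ s → ring 6 λ c a b β d l → c :* (a :- b :- β :* d :* l) := (c :* a :- c :* b) :- β :* l :* (c :* d))) (trans (∑-- g _ _) (cong₂ _-_ (trans (∑-- g _ _) (cong₂ _-_ (sym (F≡ y₁)) (sym (F≡ y₀)))) (∑-*ˡ g (β * lam) _)))
      ℓd : ℓ y₁ - ℓ y₀ ≡ lam
      ℓd = trans (cong₂ _-_ (trans (ℓ-* {RQ} {δ} (ℕ.≤-trans 1≤2Q 2Q≤RQ) 1≤δ) (cong (_+ ℓ δ) (ℓ-* (ℕ.≤-trans (s≤s z≤n) 2≤R) 1≤Q))) (trans (ℓ-* {2Q} {δ} 1≤2Q 1≤δ) (cong (_+ ℓ δ) (ℓ-* {2} {Q} (s≤s z≤n) 1≤Q)))) (ring 4 λ r q d t → (r :+ q :+ d) :- (t :+ q :+ d) := r :- t)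
      eq : (F y₁ - m * ℓ y₁) - (F y₀ - m * ℓ y₀) - ∑ g (λ s → c s * (G s y₁ - G s y₀ - β * D s * lam)) ≡ (β * Sc - m) * lam
      eq = trans (cong (λ w → (F y₁ - m * ℓ y₁) - (F y₀ - m * ℓ y₀) - w) sum-eq) (trans (ring 7 λ a m l₁ b l₀ t s → (a :- m :* l₁) :- (b :- m :* l₀) :- (a :- b :- t :* s) := t :* s :- m :* (l₁ :- l₀)) (trans (cong (λ w → β * lam * Sc - m * w) ℓd) (ring 4 λ b l s m → b :* l :* s :- m :* l := (b :* s :- m) :* l)))

-- A character of order two from counting classes.

module ClassGroup (g : ℕ) {{g≢0 : NonZero g}} where
  open import Data.Nat.Coprimality using (Coprime; coprime?)
  open Field
  open Sums
  open Residues g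
  open Character g using (RealCharacter)

  -- Multiplication by `b` permutes the classes prime to `g`.
  reindex : ∀ {b} → Coprime b g → (f : ℕ → ℚ) → ∑ g (λ n → e n * f (rep (n ℕ.* b))) ≡ ∑ g (λ n → e n * f n)
  reindex {b} cb f = begin
    ∑ g (λ n → e n * f (rep (n ℕ.* b)))                                  ≡⟨ ∑-cong′ g (λ n → trans (cong (_* f (rep (n ℕ.* b))) (sym (er n))) (sym (∑-class (n ℕ.* b) (λ m → e m * f m)))) ⟩
    ∑ g (λ n → ∑ g (λ m → 𝟙 (m ≈? n ℕ.* b) * (e m * f m)))               ≡⟨ ∑-swap g g _ ⟩
    ∑ g (λ m → ∑ g (λ n → 𝟙 (m ≈? n ℕ.* b) * (e m * f m)))               ≡⟨ ∑-cong′ g inner ⟩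
    ∑ g (λ m → e m * f m)                                                ∎
    where
    open ≡-Reasoning
    er : ∀ n → e (rep (n ℕ.* b)) ≡ e n
    er n = trans (e-≈ {rep (n ℕ.* b)} {n ℕ.* b} (rep≈ (n ℕ.* b))) (trans (e-* n b) (trans (cong (e n *_) (𝟙-yes (coprime? b g) cb)) (*-identityʳ _)))
    inner : ∀ m → ∑ g (λ n → 𝟙 (m ≈? n ℕ.* b) * (e m * f m)) ≡ e m * f m
    inner m = go (coprime? m g)
      where
      go : (d : Dec (Coprime m g)) → ∑ g (λ n → 𝟙 (m ≈? n ℕ.* b) * (𝟙 d * f m)) ≡ 𝟙 d * f m
      go (no _) = trans (∑-zero g (λ n _ _ → ring 2 λ a b → a :* (con 0 :* b) := con 0)) (sym (*-zeroˡ _))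
      go (yes cm) with divide b m cb cm
      ... | b′ , _ , _ , to , from = trans (∑-cong′ g (λ n → cong (_* (ι 1 * f m)) (𝟙-⇔ (m ≈? n ℕ.* b) (n ≈? b′) (λ h → to n (sym h)) (λ h → sym (from n h))))) (∑-class b′ (λ _ → ι 1 * f m))

  module _ {P Q : ℕ → Set} (P? : ∀ n → Dec (P n)) (Q? : ∀ n → Dec (Q n)) where
    -- The differences of the two indicators are nonnegative and sum to zero, so none is positive.
    count-reverse : (∀ n → Coprime n g → P n → Q n) → ∑ g (λ n → e n * 𝟙 (P? n)) ≡ ∑ g (λ n → e n * 𝟙 (Q? n)) →
      ∀ n → 1 ℕ.≤ n → n ℕ.≤ g → Coprime n g → Q n → P n
    count-reverse P⇒Q eq n 1≤n n≤g cn qn with P? n in Pn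
    ... | yes p = p
    ... | no ¬p = ⊥-elim (1≰0 (subst₂ _≤_ one zero′ (∑-≥ g n 1≤n n≤g (λ i _ _ → nonneg i))))
      where
      nonneg : ∀ i → ι 0 ≤ e i * 𝟙 (Q? i) - e i * 𝟙 (P? i)
      nonneg i with coprime? i g
      ... | yes ci = sub≥0 (0≤1 ⊛ 𝟙-mono (P? i) (Q? i) (P⇒Q i ci))
      ... | no _ = ≤-reflexive (ring 2 λ a b → con 0 := con 0 :* a :- con 0 :* b)
      one : e n * 𝟙 (Q? n) - e n * 𝟙 (P? n) ≡ ι 1
      one = trans (cong₂ _-_ (cong₂ _*_ (𝟙-yes (coprime? n g) cn) (𝟙-yes (Q? n) qn)) (cong (e n *_) (𝟙-no (P? n) ¬p))) (ring 1 λ a → con 1 :* con 1 :- a :* con 0 := con 1)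
      zero′ : ∑ g (λ i → e i * 𝟙 (Q? i) - e i * 𝟙 (P? i)) ≡ ι 0
      zero′ = trans (∑-- g _ _) (trans (cong (_- ∑ g (λ n → e n * 𝟙 (P? n))) (sym eq)) (ring 1 λ a → a :- a := con 0))

    module _ (half : ι 2 * ∑ g (λ n → e n * 𝟙 (P? n)) ≡ ι φ) where
      some : Σ ℕ λ n → 1 ℕ.≤ n × n ℕ.≤ g × Coprime n g × P n
      some with ℕ.anyUpTo? (λ n → (1 ℕ.≤? n) ×-dec (coprime? n g ×-dec P? n)) (suc g)
        where open import Relation.Nullary.Decidable using (_×-dec_)
      ... | yes (n , s≤s n≤g , 1≤n , cn , p) = n , 1≤n , n≤g , cn , p
      ... | no none = ⊥-elim (1≰0 (≤-trans (ι-mono φ≥1) (≤-reflexive (trans (sym half) (trans (cong (ι 2 *_) (∑-zero g zeros)) (*-zeroʳ _))))))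
        where
        zeros : ∀ n → 1 ℕ.≤ n → n ℕ.≤ g → e n * 𝟙 (P? n) ≡ ι 0
        zeros n 1≤n n≤g with coprime? n g | P? n
        ... | no _ | _ = *-zeroˡ _
        ... | yes _ | no _ = *-zeroʳ _
        ... | yes cn | yes p = ⊥-elim (none (n , s≤s n≤g , 1≤n , cn , p))

  -- Two sets B, D of half of the classes with D · (B / B) ⊆ D: then B / b₀ is a subgroup of index two, and D is one of its cosets.
  module IndexTwo {B D : ℕ → Set} (B? : ∀ n → Dec (B n)) (D? : ∀ n → Dec (D n))
    (halfB : ι 2 * ∑ g (λ n → e n * 𝟙 (B? n)) ≡ ι φ) (halfD : ι 2 * ∑ g (λ n → e n * 𝟙 (D? n)) ≡ ι φ)
    (closed : ∀ {s s′ z z′} → Coprime s g → Coprime s′ g → D s → B z → 1 ℕ.≤ z → z ℕ.≤ g → B z′ → 1 ℕ.≤ z′ → z′ ℕ.≤ g → s′ ℕ.* z ≈ s ℕ.* z′ → D s′)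
    (b₀ : ℕ) (1≤b₀ : 1 ℕ.≤ b₀) (b₀≤g : b₀ ℕ.≤ g) (cop-b₀ : Coprime b₀ g) (Bb₀ : B b₀) (d₀ : ℕ) (1≤d₀ : 1 ℕ.≤ d₀) (d₀≤g : d₀ ℕ.≤ g) (cop-d₀ : Coprime d₀ g) (Dd₀ : D d₀) where

    HH : ℕ → Set
    HH n = B (rep (n ℕ.* b₀))

    HH? : ∀ n → Dec (HH n)
    HH? n = B? (rep (n ℕ.* b₀))

    private
      cop-rep : ∀ {n} → Coprime n g → Coprime (rep n) g
      cop-rep {n} = ≈-cop {n} {rep n} (sym (rep≈ n))

      HH-≈ : ∀ {m n} → m ≈ n → HH m → HH n
      HH-≈ {m} {n} p = subst B (rep-cong {m ℕ.* b₀} {n ℕ.* b₀} (*-cong≈ {m} {n} {b₀} {b₀} p refl))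

      cancel2 : ∀ {a b} → ι 2 * a ≡ ι 2 * b → a ≡ b
      cancel2 p = ≤-antisym (ι-cancelˡ 2 (≤-reflexive p)) (ι-cancelˡ 2 (≤-reflexive (sym p)))

      ∑HH : ∑ g (λ n → e n * 𝟙 (HH? n)) ≡ ∑ g (λ n → e n * 𝟙 (B? n))
      ∑HH = reindex cop-b₀ (λ n → 𝟙 (B? n))

      -- `closed` with z = b₀ and z′ ≈ n b₀: a member of `HH` is a quotient of two elements of `B`.
      forward : ∀ d n → Coprime d g → Coprime n g → D d → HH n → D (rep (d ℕ.* n))
      forward d n cd cn Dd h = closed {d} {rep (d ℕ.* n)} {b₀} {rep (n ℕ.* b₀)} cd (cop-rep (cop-* cd cn)) Dd Bb₀ 1≤b₀ b₀≤g h (rep≥1 _) (rep≤g _)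
        (trans (*-cong≈ {rep (d ℕ.* n)} {d ℕ.* n} {b₀} {b₀} (rep≈ (d ℕ.* n)) refl) (trans (≡⇒≈ {d ℕ.* n ℕ.* b₀} {d ℕ.* (n ℕ.* b₀)} (ℕ.*-assoc d n b₀)) (*-cong≈ {d} {d} {n ℕ.* b₀} {rep (n ℕ.* b₀)} refl (sym (rep≈ (n ℕ.* b₀))))))

      -- k ↦ k d maps `HH` injectively into `D`; both consist of φ / 2 classes, so the map is onto.
      backward : ∀ d n → Coprime d g → Coprime n g → D d → D (rep (d ℕ.* n)) → HH n
      backward d n cd cn Dd h = HH-≈ {rep n} {n} (rep≈ n) (count-reverse HH? (λ k → D? (rep (k ℕ.* d))) fw eq (rep n) (rep≥1 n) (rep≤g n) (cop-rep cn) (subst D (rep-cong {d ℕ.* n} {rep n ℕ.* d} (trans (≡⇒≈ {d ℕ.* n} {n ℕ.* d} (ℕ.*-comm d n)) (*-cong≈ {n} {rep n} {d} {d} (sym (rep≈ n)) refl))) h))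
        where
        fw : ∀ k → Coprime k g → HH k → D (rep (k ℕ.* d))
        fw k ck hk = subst (λ w → D (rep w)) (ℕ.*-comm d k) (forward d k cd ck Dd hk)
        eq : ∑ g (λ k → e k * 𝟙 (HH? k)) ≡ ∑ g (λ k → e k * 𝟙 (D? (rep (k ℕ.* d))))
        eq = trans ∑HH (trans (cancel2 (trans halfB (sym halfD))) (sym (reindex cd (λ k → 𝟙 (D? k)))))

      HH-* : ∀ m n → Coprime m g → Coprime n g → HH m → HH n → HH (m ℕ.* n)
      HH-* m n cm cn hm hn = backward d₀ (m ℕ.* n) cop-d₀ (cop-* cm cn) Dd₀ (subst D (rep-cong {rep (d₀ ℕ.* m) ℕ.* n} {d₀ ℕ.* (m ℕ.* n)} (trans (*-cong≈ {rep (d₀ ℕ.* m)} {d₀ ℕ.* m} {n} {n} (rep≈ (d₀ ℕ.* m)) refl) (≡⇒≈ {d₀ ℕ.* m ℕ.* n} {d₀ ℕ.* (m ℕ.* n)} (ℕ.*-assoc d₀ m n))))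
        (forward (rep (d₀ ℕ.* m)) n (cop-rep (cop-* cop-d₀ cm)) cn (forward d₀ m cop-d₀ cm Dd₀ hm) hn))

      HH-cancel : ∀ m n → Coprime m g → Coprime n g → HH m → HH (m ℕ.* n) → HH n
      HH-cancel m n cm cn hm hmn = backward (rep (d₀ ℕ.* m)) n (cop-rep (cop-* cop-d₀ cm)) cn (forward d₀ m cop-d₀ cm Dd₀ hm)
        (subst D (rep-cong {d₀ ℕ.* (m ℕ.* n)} {rep (d₀ ℕ.* m) ℕ.* n} (trans (≡⇒≈ {d₀ ℕ.* (m ℕ.* n)} {d₀ ℕ.* m ℕ.* n} (sym (ℕ.*-assoc d₀ m n))) (*-cong≈ {d₀ ℕ.* m} {rep (d₀ ℕ.* m)} {n} {n} (sym (rep≈ (d₀ ℕ.* m))) refl)))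
          (forward d₀ (m ℕ.* n) cop-d₀ (cop-* cm cn) Dd₀ hmn))

      HH-cancelʳ : ∀ m n → Coprime m g → Coprime n g → HH n → HH (m ℕ.* n) → HH m
      HH-cancelʳ m n cm cn hn hmn = HH-cancel n m cn cm hn (subst HH (ℕ.*-comm m n) hmn)

      -- the coset m H of a non-member m is disjoint from H, so by counting it is the complement of H
      HH-¬* : ∀ m n → Coprime m g → Coprime n g → ¬ HH m → ¬ HH n → HH (m ℕ.* n)
      HH-¬* m n cm cn ¬hm ¬hn with HH? (m ℕ.* n)
      ... | yes h = h
      ... | no ¬h = ⊥-elim (¬hn (HH-≈ {rep n} {n} (rep≈ n) (count-reverse HH? (λ k → ¬HH? (rep (k ℕ.* m))) fw eq (rep n) (rep≥1 n) (rep≤g n) (cop-rep cn)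
            (λ h → ¬h (HH-≈ {rep (rep n ℕ.* m)} {m ℕ.* n} (trans (rep≈ (rep n ℕ.* m)) (trans (*-cong≈ {rep n} {n} {m} {m} (rep≈ n) refl) (≡⇒≈ {n ℕ.* m} {m ℕ.* n} (ℕ.*-comm n m)))) h)))))
        where
        open import Relation.Nullary.Decidable using (¬?)
        ¬HH? : ∀ k → Dec (¬ HH k)
        ¬HH? k = ¬? (HH? k)
        fw : ∀ k → Coprime k g → HH k → ¬ HH (rep (k ℕ.* m))
        fw k ck hk h = ¬hm (HH-cancel k m ck cm hk (HH-≈ {rep (k ℕ.* m)} {k ℕ.* m} (rep≈ (k ℕ.* m)) h))
        𝟙-¬ : ∀ {P : Set} (d : Dec P) → 𝟙 (¬? d) ≡ ι 1 - 𝟙 d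
        𝟙-¬ (yes _) = ring 0 (con 0 := con 1 :- con 1)
        𝟙-¬ (no _) = ring 0 (con 1 := con 1 :- con 0)
        eq : ∑ g (λ k → e k * 𝟙 (HH? k)) ≡ ∑ g (λ k → e k * 𝟙 (¬HH? (rep (k ℕ.* m))))
        eq = trans (cancel2 (trans (trans (cong (ι 2 *_) ∑HH) halfB) (trans (trans (ring 1 λ f → f := con 2 :* f :- f) (cong₂ (λ u w → ι 2 * u - w) ι-φ (sym (trans (cong (ι 2 *_) ∑HH) halfB)))) (ring 2 λ a b → con 2 :* a :- con 2 :* b := con 2 :* (a :- b)))))
               (trans (sym (trans (∑-cong′ g (λ k → trans (cong (e k *_) (𝟙-¬ (HH? k))) (ring 2 λ a b → a :* (con 1 :- b) := a :- a :* b))) (∑-- g _ _))) (sym (reindex cm (λ k → 𝟙 (¬HH? k)))))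

    χ : ℕ → ℚ
    χ n = e n * (ι 2 * 𝟙 (HH? n) - ι 1)

    χ-≈ : ∀ {m n} → m ≈ n → χ m ≡ χ n
    χ-≈ {m} {n} p = cong₂ (λ u w → u * (ι 2 * w - ι 1)) (e-≈ {m} {n} p) (𝟙-⇔ (HH? m) (HH? n) (HH-≈ {m} {n} p) (HH-≈ {n} {m} (sym p)))

    χ-noncop : ∀ n → ¬ Coprime n g → χ n ≡ ι 0
    χ-noncop n ¬c = trans (cong (_* (ι 2 * 𝟙 (HH? n) - ι 1)) (𝟙-no (coprime? n g) ¬c)) (*-zeroˡ _)

    χ-yes : ∀ n → Coprime n g → HH n → χ n ≡ ι 1
    χ-yes n c h = trans (cong₂ (λ u w → u * (ι 2 * w - ι 1)) (𝟙-yes (coprime? n g) c) (𝟙-yes (HH? n) h)) (ring 0 (con 1 :* (con 2 :* con 1 :- con 1) := con 1))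

    χ-no : ∀ n → Coprime n g → ¬ HH n → χ n ≡ - ι 1
    χ-no n c h = trans (cong₂ (λ u w → u * (ι 2 * w - ι 1)) (𝟙-yes (coprime? n g) c) (𝟙-no (HH? n) h)) (ring 0 (con 1 :* (con 2 :* con 0 :- con 1) := :- con 1))

    χ-* : ∀ m n → χ (m ℕ.* n) ≡ χ m * χ n
    χ-* m n with coprime? m g | coprime? n g
    ... | no ¬c | _ = trans (χ-noncop (m ℕ.* n) (λ c → ¬c (cop-*⁻ˡ n c))) (ring 2 λ a b → con 0 := con 0 :* a :* b)
    ... | yes _ | no ¬c = trans (χ-noncop (m ℕ.* n) (λ c → ¬c (cop-*⁻ʳ m c))) (ring 2 λ a b → con 0 := a :* (con 0 :* b))
    ... | yes cm | yes cn with HH? m | HH? n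
    ...   | yes hm | yes hn = trans (χ-yes (m ℕ.* n) (cop-* cm cn) (HH-* m n cm cn hm hn)) (ring 0 (con 1 := con 1 :* (con 2 :* con 1 :- con 1) :* (con 1 :* (con 2 :* con 1 :- con 1))))
    ...   | yes hm | no ¬hn = trans (χ-no (m ℕ.* n) (cop-* cm cn) (λ h → ¬hn (HH-cancel m n cm cn hm h))) (ring 0 (:- con 1 := con 1 :* (con 2 :* con 1 :- con 1) :* (con 1 :* (con 2 :* con 0 :- con 1))))
    ...   | no ¬hm | yes hn = trans (χ-no (m ℕ.* n) (cop-* cm cn) (λ h → ¬hm (HH-cancelʳ m n cm cn hn h))) (ring 0 (:- con 1 := con 1 :* (con 2 :* con 0 :- con 1) :* (con 1 :* (con 2 :* con 1 :- con 1))))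
    ...   | no ¬hm | no ¬hn = trans (χ-yes (m ℕ.* n) (cop-* cm cn) (HH-¬* m n cm cn ¬hm ¬hn)) (ring 0 (con 1 := con 1 :* (con 2 :* con 0 :- con 1) :* (con 1 :* (con 2 :* con 0 :- con 1))))

    character : RealCharacter
    character = record
      { χ = χ
      ; values = vals
      ; χ-* = χ-*
      ; χ-1 = χ-yes 1 cop-1 (subst B (sym (trans (cong rep (ℕ.*-identityˡ b₀)) (rep-id 1≤b₀ b₀≤g))) Bb₀)
      ; periodic = λ i → χ-≈ {g ℕ.+ i} {i} (period≈ i)
      ; balanced = trans (∑-cong′ g (λ n → ring 2 λ a b → a :* (con 2 :* b :- con 1) := con 2 :* (a :* b) :- a)) (trans (∑-- g _ _) (trans (cong₂ _-_ (trans (∑-*ˡ g (ι 2) _) (trans (cong (ι 2 *_) ∑HH) halfB)) (sym ι-φ)) (ring 1 λ a → a :- a := con 0)))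
      }
      where
      vals : ∀ n → (χ n ≡ ι 1) ⊎ ((χ n ≡ - ι 1) ⊎ (χ n ≡ ι 0))
      vals n with coprime? n g
      ... | no ¬c = inj₂ (inj₂ (*-zeroˡ _))
      ... | yes c with HH? n
      ...   | yes h = inj₁ (ring 0 (con 1 :* (con 2 :* con 1 :- con 1) := con 1))
      ...   | no ¬h = inj₂ (inj₁ (ring 0 (con 1 :* (con 2 :* con 0 :- con 1) := :- con 1)))

    -- s / d₀ lies in `HH` by `backward`, where χ is 1.
    χ-D : ∀ s → 1 ℕ.≤ s → s ℕ.≤ g → Coprime s g → D s → χ s ≡ χ d₀
    χ-D s 1≤s s≤g cs Ds with divide d₀ s cop-d₀ cs
    ... | n , cn , nd , _ , _ = trans (χ-≈ {s} {n ℕ.* d₀} (sym nd)) (trans (χ-* n d₀) (trans (cong (_* χ d₀) (χ-yes n cn hn)) (*-identityˡ _)))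
      where
      hn : HH n
      hn = backward d₀ n cop-d₀ cn Dd₀ (subst D (sym (trans (rep-cong {d₀ ℕ.* n} {s} (trans (≡⇒≈ {d₀ ℕ.* n} {n ℕ.* d₀} (ℕ.*-comm d₀ n)) nd)) (rep-id 1≤s s≤g))) Ds)

    χ-d₀ : (χ d₀ ≡ ι 1) ⊎ (χ d₀ ≡ - ι 1)
    χ-d₀ with HH? d₀ in hd
    ... | yes h = inj₁ (χ₁ h)
      where
      χ₁ : HH d₀ → _
      χ₁ h = trans (cong (_* (ι 2 * ι 1 - ι 1)) (𝟙-yes (coprime? d₀ g) cop-d₀)) (ring 0 (con 1 :* (con 2 :* con 1 :- con 1) := con 1))
    ... | no ¬h = inj₂ (trans (cong (_* (ι 2 * ι 0 - ι 1)) (𝟙-yes (coprime? d₀ g) cop-d₀)) (ring 0 (con 1 :* (con 2 :* con 0 :- con 1) := :- con 1)))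

-- Proper prime powers have small mass in a window.

module PrimePowers (g : ℕ) {{g≢0 : NonZero g}} (X : ℕ) (4≤X : 4 ℕ.≤ X) (L : ℕ → Field.ℚ) (diff : Log.DiffBound X L) where
  open Field
  open Sums
  open Factors
  open Log
  open Residues g
  open Estimates X L diff
  open Selberg g X 4≤X L diff hiding (M)
  open Windows g X 4≤X L diff
  open Growth

  module _ (x h E : ℕ) (1≤x : 1 ℕ.≤ x) (h≤x : h ℕ.≤ x) (1≤E : 1 ℕ.≤ E) (2x′≤X : 2 ℕ.* (x ℕ.+ h) ℕ.≤ X) (big : 2 ℕ.^ suc (expo E) ℕ.≤ x)
           (no-prime : ∀ p → Prime p → p ≈ 1 → x ℕ.< p → ¬ (p ℕ.≤ x ℕ.+ h)) where
    private
      x′ = x ℕ.+ h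
      x≤x′ = ℕ.m≤m+n x h
      1≤x′ = ℕ.≤-trans 1≤x x≤x′
      lf = log-floor 2 1 x′ ℕ.≤-refl ℕ.≤-refl 1≤x′
      n = proj₁ lf
      2^n≤ : 2 ℕ.^ n ℕ.≤ x′
      2^n≤ = ℕ.≤-trans (ℕ.≤-reflexive (sym (ℕ.*-identityˡ _))) (proj₁ (proj₂ lf))
      <2^ : x′ ℕ.< 2 ℕ.^ suc n
      <2^ = ℕ.<-≤-trans (proj₂ (proj₂ lf)) (ℕ.≤-reflexive (ℕ.*-identityˡ _))
      n≥ : expo E ℕ.≤ n
      n≥ = ℕ.≮⇒≥ (λ lt → ℕ.<⇒≱ <2^ (ℕ.≤-trans (ℕ.^-monoʳ-≤ 2 (s≤s (ℕ.<⇒≤ lt))) (ℕ.≤-trans big x≤x′)))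
      N₁ = suc n ℕ.* suc n
      -- p² ≤ x′ gives p ≤ M or p ≤ x′ ÷ M, so `P` bounds the bases without a square root. The value
      -- of `M` makes (x′ / M) · 2 (n + 1)² at most x / (4 E), and M · 2 (n + 1)² is at most x / (2
      -- E) by `128E²[n+1]⁴≤2^n`.
      M P : ℕ
      M = 16 ℕ.* E ℕ.* N₁
      P = M ℕ.+ x′ ÷ M
      1≤N₁ : 1 ℕ.≤ N₁
      1≤N₁ = ℕ.*-mono-≤ {1} {suc n} (s≤s z≤n) (s≤s z≤n)
      1≤M : 1 ℕ.≤ M
      1≤M = ℕ.*-mono-≤ (ℕ.*-mono-≤ {1} {16} (s≤s z≤n) 1≤E) 1≤N₁
      instance
        M≢0 : NonZero M
        M≢0 = ℕ.>-nonZero 1≤M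
        E≢0 : NonZero E
        E≢0 = ℕ.>-nonZero 1≤E

      lb : ℚ
      lb = ι 2 * ι (suc n)

      ℓ≤lb : ∀ {p} → 1 ℕ.≤ p → p ℕ.≤ x′ → ℓ p ≤ lb
      ℓ≤lb 1≤p p≤ = ≤-trans (ℓ-mono 1≤p (ℕ.≤-trans p≤ (ℕ.<⇒≤ <2^)) (ℕ.≤-trans (ℕ.*-monoʳ-≤ 2 2^n≤) 2x′≤X)) (≤-trans (≤-reflexive (ℓ-power (suc n))) (lin (ι≥0 (suc n) ⊛ ℓ2≤2 4≤X) (ring 2 λ n l → con 2 :* n :+ n :* l := n :* l :+ n :* con 2)))

      lb≥0 : ι 0 ≤ lb
      lb≥0 = *≥0 (ι≥0 2) (ι≥0 (suc n))

      p≤P : ∀ {p} i → 1 ℕ.≤ p → p ℕ.* (p ℕ.* i) ℕ.≤ x′ → 1 ℕ.≤ i → p ℕ.≤ P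
      p≤P {p} i 1≤p le 1≤i with ℕ.≤-total p M
      ... | inj₁ p≤M = ℕ.≤-trans p≤M (ℕ.m≤m+n M _)
      ... | inj₂ M≤p = ℕ.≤-trans (÷-≤ 1≤M (ℕ.≤-trans (ℕ.*-mono-≤ M≤p (ℕ.m≤m*n p i {{ℕ.>-nonZero 1≤i}})) le)) (ℕ.m≤n+m (x′ ÷ M) M)

      -- A crude majorant: all bases up to `P` and exponents up to `n` count with the largest weight
      -- `lb`. It is affordable because `P` falls below `x` by a factor of order E n².
      dom : ℕ → ℚ
      dom k = ∑ P (λ p → ∑ n (λ i → 𝟙 (k ℕ.≟ p ℕ.^ i) * lb))

      dom≥0 : ∀ k → ι 0 ≤ dom k
      dom≥0 k = ∑≥0 P (λ p _ _ → ∑≥0 n (λ i _ _ → *≥0 (𝟙≥0 (k ℕ.≟ p ℕ.^ i)) lb≥0))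

      exp≤ : ∀ {p} i → 2 ℕ.≤ p → p ℕ.^ i ℕ.≤ x′ → i ℕ.≤ n
      exp≤ i 2≤p le = ℕ.≮⇒≥ (λ n<i → ℕ.<⇒≱ <2^ (ℕ.≤-trans (ℕ.^-monoʳ-≤ 2 n<i) (ℕ.≤-trans (ℕ.^-monoˡ-≤ i 2≤p) le)))

      term : ∀ k → x ℕ.< k → k ℕ.≤ x′ → 𝟙 (k ≈? 1) * Λ k ≤ dom k
      term k x<k k≤x′ = go (k ≈? 1) (Λ-cases k 1≤k)
        where
        1≤k = ℕ.≤-trans (s≤s z≤n) x<k
        go : (d : Dec (k ≈ 1)) → (Λ k ≡ ι 0) ⊎ (Σ ℕ λ p → Σ ℕ λ j → Prime p × k ≡ p ℕ.^ suc j × Λ k ≡ ℓ p) → 𝟙 d * Λ k ≤ dom k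
        go (no _) _ = ≤-trans (≤-reflexive (*-zeroˡ _)) (dom≥0 k)
        go (yes _) (inj₁ z) = ≤-trans (≤-reflexive (trans (cong (ι 1 *_) z) (*-zeroʳ _))) (dom≥0 k)
        go (yes k≈1) (inj₂ (p , zero , pr , k≡ , _)) = ⊥-elim (no-prime k (subst Prime (sym (trans k≡ (ℕ.*-identityʳ p))) pr) k≈1 x<k k≤x′)
        go (yes _) (inj₂ (p , suc j , pr , k≡ , z)) = ≤-trans (≤-reflexive (trans (*-identityˡ _) z)) (≤-trans (ℓ≤lb (prime>0 pr) p≤x′)
            (≤-trans (≤-reflexive (sym (trans (cong (_* lb) (𝟙-yes (k ℕ.≟ p ℕ.^ suc (suc j)) k≡)) (*-identityˡ _))))
              (≤-trans (∑-≥ n {λ i → 𝟙 (k ℕ.≟ p ℕ.^ i) * lb} (suc (suc j)) (s≤s z≤n) (exp≤ (suc (suc j)) (prime>1 pr) pk≤) (λ i _ _ → *≥0 (𝟙≥0 (k ℕ.≟ p ℕ.^ i)) lb≥0))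
                (∑-≥ P {λ p → ∑ n (λ i → 𝟙 (k ℕ.≟ p ℕ.^ i) * lb)} p (prime>0 pr) (p≤P (p ℕ.^ j) (prime>0 pr) pk≤ (ℕ.m^n>0 p {{ℕ.>-nonZero (prime>0 pr)}} j)) (λ p _ _ → ∑≥0 n (λ i _ _ → *≥0 (𝟙≥0 (k ℕ.≟ p ℕ.^ i)) lb≥0))))))
          where
          pk≤ : p ℕ.^ suc (suc j) ℕ.≤ x′
          pk≤ = subst (ℕ._≤ x′) k≡ k≤x′
          p≤x′ : p ℕ.≤ x′
          p≤x′ = ℕ.≤-trans (ℕ.m≤m*n p (p ℕ.^ suc j) {{ℕ.>-nonZero (ℕ.m^n>0 p {{ℕ.>-nonZero (prime>0 pr)}} (suc j))}}) pk≤

      ∑dom : ∑ x′ dom ≤ ι P * (ι n * lb)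
      ∑dom = ≤-trans (≤-reflexive (∑-swap x′ P _)) (≤-trans (∑-mono P {λ p → ∑ x′ (λ k → ∑ n (λ i → 𝟙 (k ℕ.≟ p ℕ.^ i) * lb))} {λ _ → ι n * lb} (λ p 1≤p _ → ≤-trans (≤-reflexive (∑-swap x′ n _)) (≤-trans (∑-mono n {λ i → ∑ x′ (λ k → 𝟙 (k ℕ.≟ p ℕ.^ i) * lb)} {λ _ → lb} (λ i _ _ → one (p ℕ.^ i) (ℕ.m^n>0 p {{ℕ.>-nonZero 1≤p}} i))) (≤-reflexive (∑-const n lb))))) (≤-reflexive (∑-const P _)))
        where
        one : ∀ a → 1 ℕ.≤ a → ∑ x′ (λ k → 𝟙 (k ℕ.≟ a) * lb) ≤ lb
        one a 1≤a with ℕ.≤-total a x′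
        ... | inj₁ a≤ = ≤-reflexive (∑-single x′ a {λ _ → lb} 1≤a a≤)
        ... | inj₂ x′≤a with ℕ.m≤n⇒m<n∨m≡n x′≤a
        ...   | inj₂ refl = ≤-reflexive (∑-single x′ a {λ _ → lb} 1≤a ℕ.≤-refl)
        ...   | inj₁ lt = ≤-trans (≤-reflexive (∑-zero x′ (λ k _ k≤ → trans (cong (_* lb) (𝟙-no (k ℕ.≟ a) (λ { refl → ℕ.<⇒≱ lt k≤ }))) (*-zeroˡ _)))) lb≥0

    prime-powers-sparse : mass 1 x x′ ≤ inv E * ι x
    prime-powers-sparse = ≤-trans (∑-diff-mono x≤x′ term) (≤-trans (lin (∑dom ⊞ ∑≥0 x {dom} (λ k _ _ → dom≥0 k)) (ring 3 λ a b c → c :+ (a :+ con 0) := a :- b :+ (c :+ b))) final)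
      where
      nq = ι (suc n)
      Eq = ι E
      iM = inv M
      N1≡ : ι N₁ ≡ nq * nq
      N1≡ = ι-* (suc n) (suc n)
      M≡ : ι M ≡ ι 16 * Eq * (nq * nq)
      M≡ = trans (ι-* (16 ℕ.* E) N₁) (cong₂ _*_ (ι-* 16 E) N1≡)
      P≤ : ι P ≤ ι M + ι x′ * iM
      P≤ = ≤-trans (≤-reflexive (ι-+ M (x′ ÷ M))) (≤-refl ⊞ proj₁ (frac x′ M 1≤M))
      -- 2 n² / M = 1 / (8 E)
      nM : ι 16 * Eq * (nq * nq) * iM ≡ ι 1
      nM = trans (cong (_* iM) (sym M≡)) (trans (*-comm _ _) (inv*ι M))
      poly : ι 128 * (Eq * Eq) * (nq * nq * (nq * nq)) ≤ ι x + ι x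
      poly = ≤-trans (≤-reflexive (sym (trans (ι-* (128 ℕ.* (E ℕ.* E)) (N₁ ℕ.* N₁)) (cong₂ _*_ (trans (ι-* 128 (E ℕ.* E)) (cong (ι 128 *_) (ι-* E E))) (trans (ι-* N₁ N₁) (cong₂ _*_ N1≡ N1≡))))))
               (≤-trans (ι-mono (ℕ.≤-trans (128E²[n+1]⁴≤2^n E n 1≤E n≥) (ℕ.≤-trans 2^n≤ (ℕ.+-monoʳ-≤ x h≤x)))) (≤-reflexive (ι-+ x x)))
      x′≤2x : ι x′ ≤ ι 2 * ι x
      x′≤2x = ≤-trans (ι-mono (ℕ.+-monoʳ-≤ x h≤x)) (≤-trans (≤-reflexive (ι-+ x x)) (≤-reflexive (ring 1 λ x → x :+ x := con 2 :* x)))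
      final : ι P * (ι n * lb) ≤ inv E * ι x
      final = ι-cancelˡ E (≤-trans (ι-cancelˡ 8 {Eq * (ι P * (ι n * lb))} {ι x} (lin
          (*≥0 (*≥0 (ι≥0 8) (ι≥0 E)) lb≥0 ⊛ (ι≥0 P ⊛ ι-mono (ℕ.n≤1+n n)) ⊞ *≥0 (*≥0 (ι≥0 16) (ι≥0 E)) (*≥0 (ι≥0 (suc n)) (ι≥0 (suc n))) ⊛ P≤
            ⊞ *≥0 (*≥0 (ι≥0 16) (ι≥0 E)) (*≥0 (ι≥0 (suc n)) (ι≥0 (suc n))) ⊛ ≤-reflexive M≡ ⊞ ι≥0 2 ⊛ poly ⊞ ι≥0 x′ ⊛ ≤-reflexive nM ⊞ x′≤2x ⊞ ι≥0 2 ⊛ ι≥0 x)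
          (ring 8 λ E P n k M x′ i x → con 8 :* x :+ (con 8 :* E :* (con 2 :* k) :* (P :* n) :+ (con 16 :* E :* (k :* k) :* P :+ (con 16 :* E :* (k :* k) :* M :+ (con 2 :* (con 128 :* (E :* E) :* (k :* k :* (k :* k))) :+ (x′ :* (con 16 :* E :* (k :* k) :* i) :+ (x′ :+ con 2 :* con 0)))))) :=
             con 8 :* (E :* (P :* (n :* (con 2 :* k)))) :+ (con 8 :* E :* (con 2 :* k) :* (P :* k) :+ (con 16 :* E :* (k :* k) :* (M :+ x′ :* i) :+ (con 16 :* E :* (k :* k) :* (con 16 :* E :* (k :* k)) :+ (con 2 :* (x :+ x) :+ (x′ :* con 1 :+ (con 2 :* x :+ con 2 :* x)))))))))
          (≤-reflexive (sym (trans (sym (*-assoc _ _ _)) (trans (cong (_* ι x) (trans (*-comm _ _) (inv*ι E))) (*-identityˡ _))))))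

-- Primes congruent to 1 modulo g in windows of fixed ratio.

module PrimesAP (g : ℕ) {{g≢0 : NonZero g}} (q : ℕ) (2≤q : 2 ℕ.≤ q) where
  open import Data.Nat.Coprimality using (Coprime; coprime?)
  open import Data.Nat.Primality using (prime?)
  open import Data.Nat.Tactic.RingSolver using (solve-∀)
  open import Relation.Binary.Definitions using (tri<; tri≈; tri>)
  open import Relation.Nullary.Decidable using (_×-dec_; ¬?)
  open Field
  open Sums
  open Log
  open Growth
  open Residues g
  open Character g using (Y; D; RealCharacter; χ-Bd)
  open ClassGroup g
  open Levels

  private
    1≤g : 1 ℕ.≤ g
    1≤g = ℕ.>-nonZero⁻¹ g

    1≤q : 1 ℕ.≤ q
    1≤q = ℕ.≤-trans (s≤s z≤n) 2≤q

  abstract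
    -- `KN` exceeds both Mertens constants. `r` makes ℓ(R) - ℓ(2) = r ℓ(2) at least 2 g (2 KN + 1),
    -- so that `density` determines its sums within 1 / (2 g). `Q` and `κn₂` bring the remaining
    -- error down to 1, and the factor 3 q makes 2 Q a multiple of `q` and Q larger than 2 q.
    KN r R Q κn₂ : ℕ
    KN = 28 ℕ.* (g ℕ.* g) ℕ.+ 16 ℕ.* Y ℕ.* (24 ℕ.* g)
    r = 3 ℕ.* (2 ℕ.* g ℕ.* suc (2 ℕ.* KN))
    R = 2 ℕ.^ suc r
    Q = 16 ℕ.* (g ℕ.* R) ℕ.* (3 ℕ.* q)
    κn₂ = 2 ℕ.* (g ℕ.* R)

    KN-def : KN ≡ 28 ℕ.* (g ℕ.* g) ℕ.+ 16 ℕ.* Y ℕ.* (24 ℕ.* g)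
    KN-def = refl

    r-def : r ≡ 3 ℕ.* (2 ℕ.* g ℕ.* suc (2 ℕ.* KN))
    r-def = refl

    R-def : R ≡ 2 ℕ.^ suc r
    R-def = refl

    Q-def : Q ≡ 16 ℕ.* (g ℕ.* R) ℕ.* (3 ℕ.* q)
    Q-def = refl

    κn₂-def : κn₂ ≡ 2 ℕ.* (g ℕ.* R)
    κn₂-def = refl

  open Constants g q R Q κn₂ 1 renaming (εn to εn₂; x₀ to x₀₂) using ()

  -- Multiplying by `εn₂` makes the first pass so precise that the classes it leaves empty are
  -- sparse in the sense of the second.
  κn₁ : ℕ
  κn₁ = κn₂ ℕ.* εn₂

  open Constants g q R Q κn₁ x₀₂ renaming (εn to εn₁; x₀ to x₀₁) using ()

  threshold : ℕ
  threshold = x₀₁ ℕ.+ 2 ℕ.^ suc (expo εn₁)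

  private
    3≤R : 3 ℕ.≤ R
    3≤R = subst (3 ℕ.≤_) (sym R-def) (ℕ.≤-trans (ℕ.≤-trans (ℕ.n≤1+n 3) (ℕ.≤-reflexive refl)) (ℕ.^-monoʳ-≤ 2 {2} {suc r} (s≤s (subst (1 ℕ.≤_) (sym r-def) (ℕ.*-mono-≤ {1} {3} (s≤s z≤n) (ℕ.*-mono-≤ (ℕ.*-mono-≤ {1} {2} (s≤s z≤n) 1≤g) (s≤s {0} {2 ℕ.* KN} z≤n)))))))

    1≤R : 1 ℕ.≤ R
    1≤R = ℕ.≤-trans (s≤s z≤n) 3≤R

    1≤gR : 1 ℕ.≤ g ℕ.* R
    1≤gR = ℕ.*-mono-≤ 1≤g 1≤R

    -- the window (2Qδ, 2Qδ + h₁δ] at the second level consists of h₁ cells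
    h₁ : ℕ
    h₁ = 96 ℕ.* (g ℕ.* R)

    2Q≡ : 2 ℕ.* Q ≡ q ℕ.* h₁
    2Q≡ = trans (cong (2 ℕ.*_) Q-def) (lem (g ℕ.* R) q)
      where
      lem : ∀ a q → 2 ℕ.* (16 ℕ.* a ℕ.* (3 ℕ.* q)) ≡ q ℕ.* (96 ℕ.* a)
      lem = solve-∀

    2h₁≤2Q : 2 ℕ.* h₁ ℕ.≤ 2 ℕ.* Q
    2h₁≤2Q = ℕ.≤-trans (ℕ.*-monoˡ-≤ h₁ 2≤q) (ℕ.≤-reflexive (sym 2Q≡))

    h₁≤Q : h₁ ℕ.≤ Q
    h₁≤Q = ℕ.*-cancelˡ-≤ 2 2h₁≤2Q

    1≤h₁ : 1 ℕ.≤ h₁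
    1≤h₁ = ℕ.*-mono-≤ {1} {96} (s≤s z≤n) 1≤gR

    16gR≤Q : 16 ℕ.* (g ℕ.* R) ℕ.≤ Q
    16gR≤Q = subst (16 ℕ.* (g ℕ.* R) ℕ.≤_) (sym Q-def) (ℕ.m≤m*n (16 ℕ.* (g ℕ.* R)) (3 ℕ.* q) {{ℕ.>-nonZero (ℕ.*-mono-≤ {1} {3} (s≤s z≤n) 1≤q)}})

    1≤Q : 1 ℕ.≤ Q
    1≤Q = ℕ.≤-trans (ℕ.*-mono-≤ {1} {16} (s≤s z≤n) 1≤gR) 16gR≤Q

    2q<Q : 2 ℕ.* q ℕ.< Q
    2q<Q = ℕ.<-≤-trans (ℕ.*-monoˡ-< q {{ℕ.>-nonZero 1≤q}} {2} {3} ℕ.≤-refl) (subst (3 ℕ.* q ℕ.≤_) (sym Q-def) (ℕ.m≤n*m (3 ℕ.* q) (16 ℕ.* (g ℕ.* R)) {{ℕ.>-nonZero (ℕ.*-mono-≤ {1} {16} (s≤s z≤n) 1≤gR)}}))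

    g≤κn₂ : g ℕ.≤ κn₂
    g≤κn₂ = subst (g ℕ.≤_) (sym κn₂-def) (ℕ.≤-trans (ℕ.m≤m*n g R {{ℕ.>-nonZero 1≤R}}) (ℕ.m≤n*m (g ℕ.* R) 2))

    1≤κn₂ = ℕ.≤-trans 1≤g g≤κn₂

    εn≥1 : ∀ κn B → 1 ℕ.≤ κn → 1 ℕ.≤ Constants.εn g q R Q κn B
    εn≥1 κn B p = subst (1 ℕ.≤_) (sym (Constants.εn-def g q R Q κn B)) (ℕ.*-mono-≤ (ℕ.*-mono-≤ (ℕ.*-mono-≤ {1} {8} (s≤s z≤n) 1≤g) (s≤s {0} {2 ℕ.* R} z≤n)) (subst (1 ℕ.≤_) (sym (Constants.τn-def g q R Q κn B)) (ℕ.*-mono-≤ (ℕ.*-mono-≤ (ℕ.*-mono-≤ {1} {16} (s≤s z≤n) (ℕ.*-mono-≤ 1≤g 1≤q)) S≥1) (subst (1 ℕ.≤_) (sym (Constants.θn-def g q R Q κn B)) (ℕ.*-mono-≤ (ℕ.*-mono-≤ {1} {32} (s≤s z≤n) (ℕ.*-mono-≤ 1≤g 1≤q)) S≥1)))))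
      where
      S≥1 : 1 ℕ.≤ κn ℕ.* (R ℕ.* Q)
      S≥1 = ℕ.*-mono-≤ p (ℕ.*-mono-≤ 1≤R 1≤Q)

    1≤εn₂ : 1 ℕ.≤ εn₂
    1≤εn₂ = εn≥1 κn₂ 1 1≤κn₂

    κn₂≤κn₁ : κn₂ ℕ.≤ κn₁
    κn₂≤κn₁ = ℕ.m≤m*n κn₂ εn₂ {{ℕ.>-nonZero 1≤εn₂}}

    g≤κn₁ = ℕ.≤-trans g≤κn₂ κn₂≤κn₁

    1≤εn₁ : 1 ℕ.≤ εn₁
    1≤εn₁ = εn≥1 κn₁ x₀₂ (ℕ.≤-trans 1≤κn₂ κn₂≤κn₁)

    half≰ : ¬ (ι 1 ≤ inv 2)
    half≰ p with ι-cancel {2} {1} (≤-trans (≤-reflexive (sym (*-identityʳ _))) (≤-trans (ι≥0 2 ⊛ p) (≤-reflexive (trans (*-comm _ _) (inv*ι 2)))))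
    ... | s≤s ()

    close-nat : ∀ a b → Bd (ι a - ι b) (inv 2) → a ≡ b
    close-nat a b (l , u) with ℕ.<-cmp a b
    ... | tri≈ _ p _ = p
    ... | tri< a<b _ _ = ⊥-elim (half≰ (lin (l ⊞ ι-mono a<b ⊞ ≤-reflexive (sym (ι-suc a))) (ring 4 λ a b i a′ → i :+ (:- i :+ (a′ :+ (a :+ con 1))) := con 1 :+ (a :- b :+ (b :+ a′)))))
    ... | tri> _ _ b<a = ⊥-elim (half≰ (lin (u ⊞ ι-mono b<a ⊞ ≤-reflexive (sym (ι-suc b))) (ring 4 λ a b i b′ → i :+ (a :- b :+ (b′ :+ (b :+ con 1))) := con 1 :+ (i :+ (a :+ b′)))))

    nat-sum : ∀ n {P : ℕ → Set} (P? : ∀ s → Dec (P s)) → Σ ℕ λ m → ∑ n (λ s → e s * 𝟙 (P? s)) ≡ ι m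
    nat-sum zero P? = 0 , refl
    nat-sum (suc n) P? with nat-sum n P? | coprime? (suc n) g | P? (suc n)
    ... | m , eq | no _ | _ = m , trans (cong₂ _+_ eq (*-zeroˡ _)) (+-identityʳ _)
    ... | m , eq | yes _ | no _ = m , trans (cong₂ _+_ eq (*-zeroʳ _)) (+-identityʳ _)
    ... | m , eq | yes _ | yes _ = suc m , trans (cong₂ _+_ eq (*-identityʳ _)) (sym (ι-suc m))

  module Contradiction (h : ℕ) (h≥ : threshold ℕ.≤ h) (1≤h : 1 ℕ.≤ h) (no-prime : ∀ p → Prime p → p ≈ 1 → q ℕ.* h ℕ.< p → ¬ (p ℕ.≤ q ℕ.* h ℕ.+ h))
    (x : ℕ) (x≡ : x ≡ q ℕ.* h) (X : ℕ) (4≤X : 4 ℕ.≤ X) (Rx≤X : R ℕ.* x ℕ.≤ X) (2x′<X : 2 ℕ.* (x ℕ.+ h) ℕ.< X) (D≤X : D ℕ.≤ X) (L : ℕ → ℚ) (diff : DiffBound X L) where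
    private
      open Estimates X L diff
      open Selberg g X 4≤X L diff using (mertens; M; gg≥0; invφ)
      open Windows g X 4≤X L diff
      open Density g X 4≤X L diff
      open CharacterMertens g X 4≤X L diff using (mertens-χ)
      open PrimePowers g X 4≤X L diff

      h≤x : h ℕ.≤ x
      h≤x = subst (h ℕ.≤_) (sym x≡) (ℕ.m≤n*m h q {{ℕ.>-nonZero 1≤q}})
      th≤x : threshold ℕ.≤ x
      th≤x = ℕ.≤-trans h≥ h≤x
      x<X : x ℕ.< X
      x<X = ℕ.≤-<-trans (ℕ.≤-trans (ℕ.m≤m+n x h) (ℕ.m≤n*m (x ℕ.+ h) 2)) 2x′<X
      1≤x = ℕ.≤-trans 1≤h h≤x

      lam : ℚ
      lam = ℓ R - ℓ 2
      W : ℚ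
      W = ι (suc (2 ℕ.* KN))
      2g = 2 ℕ.* g
      instance
        2g≢0 : NonZero 2g
        2g≢0 = ℕ.>-nonZero (ℕ.*-mono-≤ {1} {2} (s≤s z≤n) 1≤g)

      lam≥ : ι 2g * W ≤ lam
      lam≥ = ≤-trans (≤-reflexive (sym e1)) (≤-trans (ι≥0 r ⊛ ℓ2≥ 4≤X) (≤-reflexive (sym e2)))
        where
        e1 : ι r * inv 3 ≡ ι 2g * W
        e1 = trans (cong (λ w → ι w * inv 3) r-def) (trans (cong (_* inv 3) (trans (ι-* 3 (2g ℕ.* suc (2 ℕ.* KN))) (cong (ι 3 *_) (ι-* 2g (suc (2 ℕ.* KN)))))) (trans (ring 3 λ t a i → t :* a :* i := a :* (i :* t)) (trans (cong (ι 2g * W *_) (inv*ι 3)) (*-identityʳ _))))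
        e2 : lam ≡ ι r * ℓ 2
        e2 = trans (cong (λ w → ℓ w - ℓ 2) R-def) (trans (cong (_- ℓ 2) (trans (ℓ-power (suc r)) (cong (_* ℓ 2) (ι-suc r)))) (ring 2 λ r l → (r :+ con 1) :* l :- l := r :* l))

      upper-div : ∀ t → t * lam ≤ W → t ≤ inv 2g
      upper-div t p with ≤-total t (ι 0)
      ... | inj₁ t≤0 = ≤-trans t≤0 (inv≥0 2g)
      ... | inj₂ t≥0 = ι-cancelˡ 2g (≤-trans (cancel-pos {ι 2g * t} {ι 1} {W} (ι-mono (s≤s {0} {2 ℕ.* KN} z≤n)) (lin (t≥0 ⊛ lam≥ ⊞ p) (ring 4 λ g t W l → con 1 :* W :+ (t :* (g :* W) :+ t :* l) := g :* t :* W :+ (t :* l :+ W)))) (≤-reflexive (trans (sym (inv*ι 2g)) (*-comm _ _))))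

      Bd-div : ∀ t → Bd (t * lam) W → Bd t (inv 2g)
      Bd-div t (l , u) = lin (upper-div (- t) (lin l (ring 3 λ t l w → w :+ :- w := :- t :* l :+ t :* l))) (ring 2 λ t i → t :+ :- t := :- i :+ i) , upper-div t u

      KN≡ : ι KN ≡ ι 28 * gg + ι (16 ℕ.* Y) * (ι 24 * ι g)
      KN≡ = trans (cong ι KN-def) (trans (ι-+ (28 ℕ.* (g ℕ.* g)) (16 ℕ.* Y ℕ.* (24 ℕ.* g))) (cong₂ _+_ (trans (ι-* 28 (g ℕ.* g)) (cong (ι 28 *_) (ι-* g g))) (trans (ι-* (16 ℕ.* Y) (24 ℕ.* g)) (cong (ι (16 ℕ.* Y) *_) (ι-* 24 g)))))

      -- The two parts of the last summand are at most g R / κn₂ = 1/2 and 8 g R / Q ≤ 1/2.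
      error≤ : ∀ {κn} → κn₂ ℕ.≤ κn → ι 2 * ι KN + ι g * (ι R * (inv κn + ι 2 * inv Q) + ι 6 * inv Q) ≤ W
      error≤ {κn} κ≤ = lin (ι≥0 (g ℕ.* R) ⊛ inv-anti {κn₂} {κn} {{ℕ.>-nonZero 1≤κn₂}} κ≤ ⊞ *≥0 (ι≥0 8) (ι≥0 (g ℕ.* R)) ⊛ inv-anti {16 ℕ.* (g ℕ.* R)} {Q} {{ℕ.>-nonZero (ℕ.*-mono-≤ {1} {16} (s≤s z≤n) 1≤gR)}} 16gR≤Q
            ⊞ ≤-reflexive k2 ⊞ ι≥0 8 ⊛ ≤-reflexive k16 ⊞ *≥0 (*≥0 (ι≥0 6) (inv≥0 Q)) (ι≥0 g) ⊛ ι-mono 1≤R ⊞ +≥0 (inv≥0 κn) (*≥0 (ι≥0 8) (inv≥0 Q)) ⊛ ≤-reflexive (sym (ι-* g R))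
            ⊞ ≤-reflexive (trans (cong (_+ ι 1) (sym (ι-* 2 KN))) (sym (ι-suc (2 ℕ.* KN)))) ⊞ ≤-reflexive (ι*inv* 8 2 (s≤s z≤n)) ⊞ ≤-reflexive (trans (ring 1 λ i → i :+ i := i :* con 2) (inv*ι 2)))
          (ring 11 λ K g R k iQ W gR k2 j16 i16 i2 → W :+ (gR :* k :+ (con 8 :* gR :* iQ :+ (gR :* k2 :+ (con 8 :* (gR :* j16) :+ (con 6 :* iQ :* g :* con 1 :+ ((k :+ con 8 :* iQ) :* (g :* R) :+ (con 2 :* K :+ con 1 :+ (con 8 :* i16 :+ (i2 :+ i2)))))))))
            := con 2 :* K :+ g :* (R :* (k :+ con 2 :* iQ) :+ con 6 :* iQ) :+ (gR :* k2 :+ (con 8 :* gR :* j16 :+ (i2 :+ (con 8 :* i16 :+ (con 6 :* iQ :* g :* R :+ ((k :+ con 8 :* iQ) :* gR :+ (W :+ (i2 :+ con 1)))))))))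
        where
        k2 : ι (g ℕ.* R) * inv κn₂ ≡ inv 2
        k2 = trans (cong (λ w → ι (g ℕ.* R) * inv w) (trans κn₂-def (ℕ.*-comm 2 (g ℕ.* R)))) (ι*inv* (g ℕ.* R) 2 1≤gR)
        k16 : ι (g ℕ.* R) * inv (16 ℕ.* (g ℕ.* R)) ≡ inv 16
        k16 = trans (cong (λ w → ι (g ℕ.* R) * inv w) (ℕ.*-comm 16 (g ℕ.* R))) (ι*inv* (g ℕ.* R) 16 1≤gR)

      density′ : ∀ {Z κn B y} → κn₂ ℕ.≤ κn → y ℕ.< X → (S : Stretch₀ g X 4≤X L diff Z Q R (inv κn) B y) (c : ℕ → ℚ) (m K : ℚ) → K ≤ ι KN →
        (∀ n → Bd (c n) (ι 1)) → (∀ {a b} → a ≈ b → c a ≡ c b) → (∀ n → ¬ Coprime n g → c n ≡ ι 0) →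
        (∀ y → 1 ℕ.≤ y → y ℕ.< X → Bd (∑ y (λ k → c k * Λ k * inv k) - m * ℓ y) K) →
        Bd (β * ∑ g (λ s → c s * 𝟙 (Stretch₀.dense? S s)) - m) (inv 2g)
      density′ {κn = κn} κ≤ y<X S c m K K≤ c-Bd c-≈ c-0 mer = Bd-div _ (Bd-≤ (≤-trans (ι≥0 2 ⊛ K≤ ⊞ ≤-refl) (error≤ κ≤))
        (Consequence.density (inv≥0 κn) 1≤Q (ℕ.≤-trans (s≤s (s≤s z≤n)) 3≤R) y<X S c m K c-Bd c-≈ c-0 mer))

      -- `density` for the principal character gives β n = 1 within 1 / (2 g), with n the number of
      -- dense classes. Multiplied by φ ≤ g this is 2 n = φ within 1/2, hence exactly.
      half-dense : ∀ {Z κn B y} → κn₂ ℕ.≤ κn → y ℕ.< X → (S : Stretch₀ g X 4≤X L diff Z Q R (inv κn) B y) → ι 2 * ∑ g (λ s → e s * 𝟙 (Stretch₀.dense? S s)) ≡ ι φ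
      half-dense κ≤ y<X S = trans (cong (ι 2 *_) (proj₂ ns)) (trans (sym (ι-* 2 n)) (cong ι (close-nat (2 ℕ.* n) φ bd)))
        where
        open Stretch₀ S using (dense?)
        ns = nat-sum g dense?
        n = proj₁ ns
        b = density′ κ≤ y<X S e (ι 1) (ι 28 * gg) (lin (≤-reflexive (sym KN≡) ⊞ *≥0 (ι≥0 (16 ℕ.* Y)) (*≥0 (ι≥0 24) (ι≥0 g))) (ring 3 λ a b k → k :+ (a :+ b :+ con 0) := a :+ (k :+ b)))
              (λ k → Bd-≤ (e≤1 k) (Bd-self (e≥0 k))) (λ {a} {b} → e-≈ {a} {b}) (λ k ¬c → 𝟙-no (coprime? k g) ¬c) (λ y p r → Bd-≡ (cong (λ w → M y - w) (sym (*-identityˡ (ℓ y)))) (mertens y p r))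
        bd : Bd (ι (2 ℕ.* n) - ι φ) (inv 2)
        bd = Bd-≡ eq (Bd-≤ le (Bd-*ˡ (ι≥0 φ) b))
          where
          eq : ι φ * (β * ∑ g (λ s → e s * 𝟙 (dense? s)) - ι 1) ≡ ι (2 ℕ.* n) - ι φ
          eq = trans (cong (λ w → ι φ * (β * w - ι 1)) (proj₂ ns)) (trans (ring 3 λ f i n → f :* (con 2 :* i :* n :- con 1) := con 2 :* n :* (i :* f) :- f) (trans (cong (λ w → ι 2 * ι n * w - ι φ) (inv*ι φ)) (cong (_- ι φ) (trans (*-identityʳ _) (sym (ι-* 2 n))))))
          le : ι φ * inv 2g ≤ inv 2
          le = ≤-trans (*-mono (ι≥0 φ) (inv≥0 2g) φ≤g ≤-refl) (≤-reflexive (trans (cong (λ w → ι g * inv w) (ℕ.*-comm 2 g)) (ι*inv* g 2 1≤g)))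

      no-prime′ : ∀ p → Prime p → p ≈ 1 → x ℕ.< p → ¬ (p ℕ.≤ x ℕ.+ h)
      no-prime′ p pr p≈1 lt le = no-prime p pr p≈1 (subst (ℕ._< p) x≡ lt) (subst (λ w → p ℕ.≤ w ℕ.+ h) x≡ le)

      Z₁ : ℕ → Set
      Z₁ z = z ≡ 1

      abstract
        S₁ : Stretch₀ g X 4≤X L diff Z₁ Q R (inv κn₁) x₀₂ x
        S₁ = stretch g X 4≤X L diff q R Q κn₁ x₀₂ 2≤q 3≤R 2q<Q g≤κn₁ x h x≡ 1≤h (ℕ.≤-trans (ℕ.m≤m+n x₀₁ _) th≤x) 2x′<X Rx≤X Z₁ (λ z → z ℕ.≟ 1) (λ { refl → cop-1 })
          (λ { refl → prime-powers-sparse x h εn₁ 1≤x h≤x 1≤εn₁ (ℕ.<⇒≤ 2x′<X) (ℕ.≤-trans (ℕ.m≤n+m (2 ℕ.^ suc (expo εn₁)) x₀₁) th≤x) no-prime′ }) 1 refl ℕ.≤-refl 1≤g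

      module S₁ = Stretch₀ S₁

      -- The classes left empty by the first pass; they are the sparse set of the second.
      B : ℕ → Set
      B z = Coprime z g × ¬ S₁.Dense z

      B? : ∀ z → Dec (B z)
      B? z = coprime? z g ×-dec ¬? (S₁.dense? z)

      halfB : ι 2 * ∑ g (λ n → e n * 𝟙 (B? n)) ≡ ι φ
      halfB = trans (cong (ι 2 *_) (trans (∑-cong′ g term) (∑-- g _ _))) (trans (trans (ring 2 λ a b → con 2 :* (a :- b) := con 2 :* a :- con 2 :* b) (cong₂ (λ u v → ι 2 * u - v) (sym ι-φ) (half-dense κn₂≤κn₁ x<X S₁))) (ring 1 λ f → con 2 :* f :- f := f))
        where
        term : ∀ n → e n * 𝟙 (B? n) ≡ e n - e n * 𝟙 (S₁.dense? n)
        term n with coprime? n g | S₁.dense? n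
        ... | no _ | _ = ring 1 λ a → con 0 :* con 0 := con 0 :- con 0 :* a
        ... | yes _ | yes _ = ring 0 (con 1 :* con 0 := con 1 :- con 1 :* con 1)
        ... | yes _ | no _ = ring 0 (con 1 :* con 1 := con 1 :- con 1 :* con 0)

      abstract
        someB : Σ ℕ λ n → 1 ℕ.≤ n × n ℕ.≤ g × Coprime n g × B n
        someB = some B? B? halfB

      b₀ = proj₁ someB
      1≤b₀ = proj₁ (proj₂ someB)
      b₀≤g = proj₁ (proj₂ (proj₂ someB))
      cop-b₀ = proj₁ (proj₂ (proj₂ (proj₂ someB)))
      Bb₀ = proj₂ (proj₂ (proj₂ (proj₂ someB)))

      δ : ℕ
      δ = S₁.δ
      hh = h₁ ℕ.* δ
      x₁ = 2 ℕ.* Q ℕ.* δ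
      x₁≡ : x₁ ≡ q ℕ.* hh
      x₁≡ = trans (cong (ℕ._* δ) 2Q≡) (ℕ.*-assoc q h₁ δ)
      x₁′≡ : x₁ ℕ.+ hh ≡ (2 ℕ.* Q ℕ.+ h₁) ℕ.* δ
      x₁′≡ = sym (ℕ.*-distribʳ-+ δ (2 ℕ.* Q) h₁)
      2Q+h₁≤RQ : 2 ℕ.* Q ℕ.+ h₁ ℕ.≤ R ℕ.* Q
      2Q+h₁≤RQ = ℕ.≤-trans (ℕ.+-monoʳ-≤ (2 ℕ.* Q) h₁≤Q) (ℕ.≤-trans (ℕ.≤-reflexive (ℕ.+-comm (2 ℕ.* Q) Q)) (ℕ.*-monoˡ-≤ Q 3≤R))
      x₁′≤x : x₁ ℕ.+ hh ℕ.≤ x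
      x₁′≤x = ℕ.≤-trans (ℕ.≤-reflexive x₁′≡) (ℕ.≤-trans (ℕ.*-monoˡ-≤ δ 2Q+h₁≤RQ) S₁.RA≤x)
      x₁≤x : x₁ ℕ.≤ x
      x₁≤x = ℕ.≤-trans (ℕ.m≤m+n x₁ hh) x₁′≤x
      x₀₂≤x₁ : x₀₂ ℕ.≤ x₁
      x₀₂≤x₁ = ℕ.≤-trans S₁.B≤A (ℕ.*-monoˡ-≤ δ (ℕ.m≤n*m Q 2))

      cells : ∀ {z} → ¬ S₁.Dense z → ∀ n → n ℕ.≤ h₁ → mass z x₁ ((2 ℕ.* Q ℕ.+ n) ℕ.* δ) ≤ ι n * (inv κn₁ * ι δ)
      cells {z} ¬d zero _ = ≤-reflexive (trans (cong (λ w → mass z x₁ (w ℕ.* δ)) (ℕ.+-identityʳ (2 ℕ.* Q))) (ring 2 λ a b → a :- a := con 0 :* b))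
      cells {z} ¬d (suc n) n≤ = ≤-trans (≤-reflexive (trans (cong (λ w → mass z x₁ (w ℕ.* δ)) (ℕ.+-suc (2 ℕ.* Q) n)) (mass-+ z x₁ ((2 ℕ.* Q ℕ.+ n) ℕ.* δ) (suc (2 ℕ.* Q ℕ.+ n) ℕ.* δ))))
        (≤-trans (cells ¬d n (ℕ.≤-trans (ℕ.n≤1+n n) n≤) ⊞ proj₂ (S₁.empty-cell (2 ℕ.* Q ℕ.+ n) ¬d (ℕ.<-≤-trans (ℕ.+-monoʳ-< (2 ℕ.* Q) n≤) 2Q+h₁≤RQ) (ℕ.m≤m+n (2 ℕ.* Q) n))) (≤-reflexive (trans (ring 2 λ n k → n :* k :+ k := (n :+ con 1) :* k) (cong (_* (inv κn₁ * ι δ)) (sym (ι-suc n))))))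

      -- Each of the h₁ cells has mass at most δ / κn₁, and κn₁ ≥ εn₂.
      sparseB : ∀ {z} → B z → mass z x₁ (x₁ ℕ.+ hh) ≤ inv εn₂ * ι x₁
      sparseB {z} (_ , ¬d) = ≤-trans (≤-reflexive (cong (mass z x₁) x₁′≡)) (≤-trans (cells ¬d h₁ ℕ.≤-refl) (≤-trans (≤-reflexive (trans (ring 3 λ h k d → h :* (k :* d) := k :* (h :* d)) (cong (inv κn₁ *_) (sym (ι-* h₁ δ))))) (*-mono (inv≥0 κn₁) (ι≥0 x₁) (inv-anti {εn₂} {κn₁} {{ℕ.>-nonZero 1≤εn₂}} (ℕ.m≤n*m εn₂ κn₂ {{ℕ.>-nonZero 1≤κn₂}})) (ι-mono hh≤x₁))))
        where
        hh≤x₁ : hh ℕ.≤ x₁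
        hh≤x₁ = ℕ.*-monoˡ-≤ δ (ℕ.≤-trans h₁≤Q (ℕ.m≤n*m Q 2))

      abstract
        S₂ : Stretch₀ g X 4≤X L diff B Q R (inv κn₂) 1 x₁
        S₂ = stretch g X 4≤X L diff q R Q κn₂ 1 2≤q 3≤R 2q<Q g≤κn₂ x₁ hh x₁≡ (ℕ.*-mono-≤ 1≤h₁ S₁.1≤δ) x₀₂≤x₁ (ℕ.≤-<-trans (ℕ.*-monoʳ-≤ 2 (ℕ.≤-trans x₁′≤x (ℕ.m≤m+n x h))) 2x′<X) (ℕ.≤-trans (ℕ.*-monoʳ-≤ R x₁≤x) Rx≤X)
          B B? proj₁ sparseB b₀ Bb₀ 1≤b₀ b₀≤g

      module S₂ = Stretch₀ S₂

      halfD : ι 2 * ∑ g (λ n → e n * 𝟙 (S₂.dense? n)) ≡ ι φ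
      halfD = half-dense ℕ.≤-refl (ℕ.≤-<-trans x₁≤x x<X) S₂

      abstract
        someD : Σ ℕ λ n → 1 ℕ.≤ n × n ℕ.≤ g × Coprime n g × S₂.Dense n
        someD = some S₂.dense? S₂.dense? halfD

      d₀ = proj₁ someD

      open IndexTwo B? S₂.dense? halfB halfD (λ cs cs′ d Bz p r Bz′ p′ r′ h → S₂.closed cs cs′ d Bz p r Bz′ p′ r′ h) b₀ 1≤b₀ b₀≤g cop-b₀ Bb₀
        d₀ (proj₁ (proj₂ someD)) (proj₁ (proj₂ (proj₂ someD))) (proj₁ (proj₂ (proj₂ (proj₂ someD)))) (proj₂ (proj₂ (proj₂ (proj₂ someD))))

      small : Bd (β * ∑ g (λ s → χ s * 𝟙 (S₂.dense? s)) - ι 0) (inv 2g)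
      small = density′ ℕ.≤-refl (ℕ.≤-<-trans x₁≤x x<X) S₂ χ (ι 0) (ι (16 ℕ.* Y) * (ι 24 * ι g)) (lin (≤-reflexive (sym KN≡) ⊞ *≥0 (ι≥0 28) gg≥0) (ring 3 λ a b k → k :+ (a :+ b :+ con 0) := b :+ (k :+ a)))
        (χ-Bd character) (λ {a} {b} → χ-≈ {a} {b}) χ-noncop (λ y p r → Bd-≡ (ring 2 λ a l → a := a :- con 0 :* l) (mertens-χ character D≤X y p r))

      -- χ is constant on the dense classes, there are φ / 2 of them, and β = 2 / φ. So the quantity
      -- that `small` bounds by 1 / (2 g) is 1 or - 1.
      value : β * ∑ g (λ s → χ s * 𝟙 (S₂.dense? s)) - ι 0 ≡ χ d₀
      value = trans (cong (λ w → β * w - ι 0) (trans (∑-cong g term) (∑-*ˡ g (χ d₀) _))) (trans (ring 3 λ i c s → con 2 :* i :* (c :* s) :- con 0 := c :* (i :* (con 2 :* s))) (trans (cong (λ w → χ d₀ * (invφ * w)) halfD) (trans (cong (χ d₀ *_) (inv*ι φ)) (*-identityʳ _))))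
        where
        term : ∀ s → 1 ℕ.≤ s → s ℕ.≤ g → χ s * 𝟙 (S₂.dense? s) ≡ χ d₀ * (e s * 𝟙 (S₂.dense? s))
        term s p r = go (coprime? s g) (S₂.dense? s)
          where
          go : (c : Dec (Coprime s g)) (d : Dec (S₂.Dense s)) → χ s * 𝟙 d ≡ χ d₀ * (𝟙 c * 𝟙 d)
          go (no ¬c) d = trans (cong (_* 𝟙 d) (χ-noncop s ¬c)) (ring 2 λ a b → con 0 :* b := a :* (con 0 :* b))
          go (yes c) (no _) = ring 2 λ a b → a :* con 0 := b :* (con 1 :* con 0)
          go (yes c) (yes d) = trans (cong (_* ι 1) (χ-D s p r c d)) (ring 1 λ a → a :* con 1 := a :* (con 1 :* con 1))

      inv2g≤ : inv 2g ≤ inv 2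
      inv2g≤ = inv-anti {2} {2g} (ℕ.m≤m*n 2 g)

      final : (χ d₀ ≡ ι 1) ⊎ (χ d₀ ≡ - ι 1) → ⊥
      final (inj₁ h) = half≰ (≤-trans (≤-trans (≤-reflexive (sym (trans value h))) (proj₂ small)) inv2g≤)
      final (inj₂ h) = half≰ (lin (≤-trans (proj₁ small) (≤-reflexive (trans value h)) ⊞ inv2g≤) (ring 2 λ i j → j :+ (:- i :+ i) := con 1 :+ (:- con 1 :+ j)))

    absurd : ⊥
    absurd = final χ-d₀

  private
    module _ (h : ℕ) where
      x X : ℕ
      x = q ℕ.* h
      -- The sum of all lower bounds that `Contradiction` puts on `X`; only now, with `h` known, is
      -- an approximate logarithm taken.
      X = D ℕ.+ (4 ℕ.+ (R ℕ.* x ℕ.+ suc (2 ℕ.* (x ℕ.+ h))))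

      absurd′ : suc threshold ℕ.≤ h → (∀ p → Prime p → p ≈ 1 → q ℕ.* h ℕ.< p → ¬ (p ℕ.≤ q ℕ.* h ℕ.+ h)) → ⊥
      absurd′ h≥ none = Contradiction.absurd h (ℕ.<⇒≤ h≥) (ℕ.≤-trans (s≤s z≤n) h≥) none x refl X
        (ℕ.≤-trans (ℕ.m≤m+n 4 c) (ℕ.m≤n+m (4 ℕ.+ c) D))
        (ℕ.≤-trans (ℕ.≤-trans (ℕ.m≤m+n (R ℕ.* x) b) (ℕ.m≤n+m c 4)) (ℕ.m≤n+m (4 ℕ.+ c) D))
        (ℕ.≤-trans (ℕ.≤-trans (ℕ.m≤n+m b (R ℕ.* x)) (ℕ.m≤n+m c 4)) (ℕ.m≤n+m (4 ℕ.+ c) D))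
        (ℕ.m≤m+n D (4 ℕ.+ c)) (proj₁ (Existence.logarithm X)) (proj₂ (Existence.logarithm X))
        where
        b c : ℕ
        b = suc (2 ℕ.* (x ℕ.+ h))
        c = R ℕ.* x ℕ.+ b

  primes-in-windows : Σ ℕ λ h₀ → ∀ h → h₀ ℕ.≤ h → Σ ℕ λ p → Prime p × p ≈ 1 × q ℕ.* h ℕ.< p × p ℕ.≤ q ℕ.* h ℕ.+ h
  primes-in-windows = suc threshold , λ h h≥ → search h h≥
    where
    search : ∀ h → suc threshold ℕ.≤ h → Σ ℕ λ p → Prime p × p ≈ 1 × q ℕ.* h ℕ.< p × p ℕ.≤ q ℕ.* h ℕ.+ h
    search h h≥ with ℕ.anyUpTo? (λ p → prime? p ×-dec ((p ≈? 1) ×-dec (q ℕ.* h ℕ.<? p))) (suc (q ℕ.* h ℕ.+ h))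
    ... | yes (p , s≤s p≤ , pr , p≈1 , lt) = p , pr , p≈1 , lt , p≤
    ... | no none = ⊥-elim (absurd′ h h≥ (λ p pr p≈1 lt p≤ → none (p , s≤s p≤ , pr , p≈1 , lt)))

-- The upper bound by counting in windows.

module UpperBound where
  open import Data.Integer as ℤ using (ℤ; +_)
  import Data.Integer.Properties as ℤ
  open import Data.Integer.Tactic.RingSolver using (solve-∀)
  open import Data.List using (List; []; _∷_; _++_; map; filter; cartesianProduct)
  open import Data.List.Relation.Unary.All using (All; []; _∷_)
  open import Data.List.Relation.Unary.AllPairs using ([]; _∷_)
  open import Data.List.Relation.Unary.Unique.Propositional using (Unique)
  open import Defs
  open Field
  open Sums

  ∑∈ : ∀ {A : Set} → List A → (A → ℚ) → ℚ
  ∑∈ [] f = ι 0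
  ∑∈ (x ∷ xs) f = f x + ∑∈ xs f

  module _ {A : Set} where
    ∑∈-cong : ∀ (xs : List A) {f g : A → ℚ} → (∀ x → f x ≡ g x) → ∑∈ xs f ≡ ∑∈ xs g
    ∑∈-cong [] h = refl
    ∑∈-cong (x ∷ xs) h = cong₂ _+_ (h x) (∑∈-cong xs h)

    ∑∈-congᴬ : ∀ {xs : List A} {P : A → Set} {f g : A → ℚ} → All P xs → (∀ x → P x → f x ≡ g x) → ∑∈ xs f ≡ ∑∈ xs g
    ∑∈-congᴬ [] h = refl
    ∑∈-congᴬ (p ∷ ps) h = cong₂ _+_ (h _ p) (∑∈-congᴬ ps h)

    ∑∈-++ : ∀ (xs ys : List A) f → ∑∈ (xs ++ ys) f ≡ ∑∈ xs f + ∑∈ ys f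
    ∑∈-++ [] ys f = sym (+-identityˡ _)
    ∑∈-++ (x ∷ xs) ys f = trans (cong (λ w → f x + w) (∑∈-++ xs ys f)) (sym (+-assoc _ _ _))

    ∑∈-map : ∀ {B : Set} (h : B → A) xs f → ∑∈ (map h xs) f ≡ ∑∈ xs (λ x → f (h x))
    ∑∈-map h [] f = refl
    ∑∈-map h (x ∷ xs) f = cong (λ w → f (h x) + w) (∑∈-map h xs f)

    ∑∈-*ʳ : ∀ (xs : List A) f k → ∑∈ xs (λ x → f x * k) ≡ ∑∈ xs f * k
    ∑∈-*ʳ [] f k = sym (*-zeroˡ k)
    ∑∈-*ʳ (x ∷ xs) f k = trans (cong (λ w → f x * k + w) (∑∈-*ʳ xs f k)) (sym (*-distribʳ-+ k (f x) _))

    ∑∈-const : ∀ (xs : List A) k → ∑∈ xs (λ _ → k) ≡ ι (length xs) * k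
    ∑∈-const [] k = sym (*-zeroˡ k)
    ∑∈-const (x ∷ xs) k = trans (cong (λ w → k + w) (∑∈-const xs k)) (trans (ring 2 λ n k → k :+ n :* k := (n :+ con 1) :* k) (cong (_* k) (sym (ι-suc (length xs)))))

    ∑-∑∈ : ∀ n (xs : List A) (f : ℕ → A → ℚ) → ∑ n (λ i → ∑∈ xs (f i)) ≡ ∑∈ xs (λ x → ∑ n (λ i → f i x))
    ∑-∑∈ n [] f = ∑-0 n
    ∑-∑∈ n (x ∷ xs) f = trans (∑-+ n _ _) (cong (λ w → ∑ n (λ i → f i x) + w) (∑-∑∈ n xs f))

    ι-length-filter : ∀ {P : A → Set} (P? : ∀ x → Dec (P x)) xs → ι (length (filter P? xs)) ≡ ∑∈ xs (λ x → 𝟙 (P? x))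
    ι-length-filter P? [] = refl
    ι-length-filter P? (x ∷ xs) with P? x
    ... | yes _ = trans (ι-suc _) (trans (+-comm _ _) (cong (λ w → ι 1 + w) (ι-length-filter P? xs)))
    ... | no _ = trans (ι-length-filter P? xs) (sym (+-identityˡ _))

  ∑∈-cartesian : ∀ {A B : Set} (xs : List A) (ys : List B) (f : A × B → ℚ) → ∑∈ (cartesianProduct xs ys) f ≡ ∑∈ xs (λ x → ∑∈ ys (λ y → f (x , y)))
  ∑∈-cartesian [] ys f = refl
  ∑∈-cartesian (x ∷ xs) ys f = trans (∑∈-++ (map (x ,_) ys) (cartesianProduct xs ys) f) (cong₂ _+_ (∑∈-map (x ,_) ys f) (∑∈-cartesian xs ys f))

  ∑∈-unique : ∀ {xs} → Unique xs → ∑∈ xs (λ a → ∑∈ xs (λ b → 𝟙 (a ℕ.≟ b))) ≡ ι (length xs)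
  ∑∈-unique {xs} u = trans (go xs u) refl
    where
    none : ∀ a ys → All (a ≢_) ys → ∑∈ ys (λ b → 𝟙 (a ℕ.≟ b)) ≡ ι 0
    none a [] [] = refl
    none a (y ∷ ys) (p ∷ ps) = trans (cong₂ _+_ (𝟙-no (a ℕ.≟ y) p) (none a ys ps)) (+-identityˡ _)
    none′ : ∀ a ys → All (a ≢_) ys → ∑∈ ys (λ b → 𝟙 (b ℕ.≟ a)) ≡ ι 0
    none′ a [] [] = refl
    none′ a (y ∷ ys) (p ∷ ps) = trans (cong₂ _+_ (𝟙-no (y ℕ.≟ a) (λ e → p (sym e))) (none′ a ys ps)) (+-identityˡ _)
    split : ∀ (xs : List ℕ) (f g : ℕ → ℚ) → ∑∈ xs (λ a → f a + g a) ≡ ∑∈ xs f + ∑∈ xs g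
    split [] f g = sym (+-identityˡ _)
    split (x ∷ xs) f g = trans (cong (λ w → f x + g x + w) (split xs f g)) (ring 4 λ a b c d → a :+ b :+ (c :+ d) := a :+ c :+ (b :+ d))
    go : ∀ xs → Unique xs → ∑∈ xs (λ a → ∑∈ xs (λ b → 𝟙 (a ℕ.≟ b))) ≡ ι (length xs)
    go [] [] = refl
    go (x ∷ xs) (p ∷ ps) = trans (cong₂ _+_ (cong₂ _+_ (𝟙-yes (x ℕ.≟ x) refl) (none x xs p)) (trans (split xs (λ a → 𝟙 (a ℕ.≟ x)) _) (cong₂ _+_ (none′ x xs p) (go xs ps))))
      (trans (ring 1 λ n → con 1 :+ con 0 :+ (con 0 :+ n) := n :+ con 1) (sym (ι-suc (length xs))))

  -- Erdős–Turán: count the elements of A in all windows of length u, to first and second order.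
  module _ {g n : ℕ} (A : List ℕ) (adm : Admissible g n A) (u : ℕ) where
    private
      uniq = proj₁ adm
      range = proj₁ (proj₂ adm)
      m = length A
      N = n ℕ.+ u

      -- The number of elements of `A` in [t - u, t - 1].
      w : ℕ → ℚ
      w t = ∑∈ A (λ a → ∑ u (λ i → 𝟙 (t ℕ.≟ a ℕ.+ i)))

      hit : ∀ {a} i → 1 ℕ.≤ a × a ℕ.≤ n → 1 ℕ.≤ i → i ℕ.≤ u → (f : ℕ → ℚ) → ∑ N (λ t → 𝟙 (t ℕ.≟ a ℕ.+ i) * f t) ≡ f (a ℕ.+ i)
      hit {a} i (1≤a , a≤n) _ i≤u f = ∑-single N (a ℕ.+ i) (ℕ.≤-trans 1≤a (ℕ.m≤m+n a i)) (ℕ.+-mono-≤ a≤n i≤u)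

      pair : ∀ (f : ℕ → ℚ) → ∑ N (λ t → w t * f t) ≡ ∑∈ A (λ a → ∑ u (λ i → f (a ℕ.+ i)))
      pair f = trans (∑-cong′ N (λ t → trans (sym (∑∈-*ʳ A _ (f t))) (∑∈-cong A (λ a → sym (∑-*ʳ u (f t) _))))) (trans (∑-∑∈ N A _) (∑∈-congᴬ range (λ a ra → trans (∑-swap N u _) (∑-cong u (λ i p q → hit i ra p q f)))))

      first : ∑ N w ≡ ι m * ι u
      first = trans (∑-cong′ N (λ t → sym (*-identityʳ _))) (trans (pair (λ _ → ι 1)) (trans (∑∈-cong A (λ a → trans (∑-const u (ι 1)) (*-identityʳ _))) (∑∈-const A (ι u))))

      ρ : ℕ → ℕ → ℚ
      ρ i j = ∑∈ A (λ a → ∑∈ A (λ b → 𝟙 (a ℕ.+ i ℕ.≟ b ℕ.+ j)))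

      second : ∑ N (λ t → w t * w t) ≡ ∑ u (λ i → ∑ u (λ j → ρ i j))
      second = trans (pair w) (trans (sym (∑-∑∈ u A _)) (∑-cong′ u (λ i → trans (∑∈-cong A (λ a → sym (∑-∑∈ u A _))) (sym (∑-∑∈ u A _)))))

      ρ-diag : ∀ i → ρ i i ≡ ι m
      ρ-diag i = trans (∑∈-cong A (λ a → ∑∈-cong A (λ b → 𝟙-⇔ (a ℕ.+ i ℕ.≟ b ℕ.+ i) (a ℕ.≟ b) (ℕ.+-cancelʳ-≡ i a b) (λ { refl → refl })))) (∑∈-unique uniq)

      -- The pairs counted have a - b = j - i, a nonzero difference.
      ρ-off : ∀ i j → i ≢ j → ρ i j ≤ ι g
      ρ-off i j i≢j = ≤-trans (≤-reflexive (sym (trans (ι-length-filter _ (cartesianProduct A A)) (trans (∑∈-cartesian A A _) (∑∈-cong A (λ a → ∑∈-cong A (λ b → 𝟙-⇔ (d ℤ.≟ ((+ a) ℤ.- (+ b))) (a ℕ.+ i ℕ.≟ b ℕ.+ j) (to a b) (from a b)))))))) (ι-mono (proj₂ (proj₂ adm) d d≢0))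
        where
        d = (+ j) ℤ.- (+ i)
        d≢0 : ¬ d ≡ + 0
        d≢0 e = i≢j (sym (ℤ.+-injective (ℤ.i-j≡0⇒i≡j (+ j) (+ i) e)))
        to : ∀ a b → d ≡ (+ a) ℤ.- (+ b) → a ℕ.+ i ≡ b ℕ.+ j
        to a b e = ℤ.+-injective (trans (ℤ.pos-+ a i) (trans (lem (+ a) (+ b) (+ i) (+ j) e) (sym (ℤ.pos-+ b j))))
          where
          l1 : ∀ a b i → a ℤ.+ i ≡ (a ℤ.- b) ℤ.+ (b ℤ.+ i)
          l1 = solve-∀
          l2 : ∀ b i j → (j ℤ.- i) ℤ.+ (b ℤ.+ i) ≡ b ℤ.+ j
          l2 = solve-∀
          lem : ∀ a b i j → j ℤ.- i ≡ a ℤ.- b → a ℤ.+ i ≡ b ℤ.+ j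
          lem a b i j e = trans (l1 a b i) (trans (cong (ℤ._+ (b ℤ.+ i)) (sym e)) (l2 b i j))
        from : ∀ a b → a ℕ.+ i ≡ b ℕ.+ j → d ≡ (+ a) ℤ.- (+ b)
        from a b e = lem (+ a) (+ b) (+ i) (+ j) (trans (sym (ℤ.pos-+ a i)) (trans (cong +_ e) (ℤ.pos-+ b j)))
          where
          l1 : ∀ b i j → j ℤ.- i ≡ (b ℤ.+ j) ℤ.- b ℤ.- i
          l1 = solve-∀
          l2 : ∀ a b i → (a ℤ.+ i) ℤ.- b ℤ.- i ≡ a ℤ.- b
          l2 = solve-∀
          lem : ∀ a b i j → a ℤ.+ i ≡ b ℤ.+ j → j ℤ.- i ≡ a ℤ.- b
          lem a b i j e = trans (l1 b i j) (trans (cong (λ z → z ℤ.- b ℤ.- i) (sym e)) (l2 a b i))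

      second≤ : ∑ N (λ t → w t * w t) ≤ ι u * (ι m + ι u * ι g)
      second≤ = ≤-trans (≤-reflexive second) (≤-trans (∑-mono u {λ i → ∑ u (λ j → ρ i j)} {λ _ → ι m + ι u * ι g} row) (≤-reflexive (∑-const u _)))
        where
        row : ∀ i → 1 ℕ.≤ i → i ℕ.≤ u → ∑ u (λ j → ρ i j) ≤ ι m + ι u * ι g
        row i p q = ≤-trans (∑-mono u {λ j → ρ i j} {λ j → 𝟙 (j ℕ.≟ i) * ι m + ι g} (λ j _ _ → each j)) (≤-reflexive (trans (∑-+ u _ _) (cong₂ _+_ (∑-single u i {λ _ → ι m} p q) (∑-const u (ι g)))))
          where
          each : ∀ j → ρ i j ≤ 𝟙 (j ℕ.≟ i) * ι m + ι g
          each j with j ℕ.≟ i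
          ... | yes refl = lin (≤-reflexive (ρ-diag i) ⊞ ι≥0 g) (ring 3 λ r m g → con 1 :* m :+ g :+ (r :+ con 0) := r :+ (m :+ g))
          ... | no j≢i = ≤-trans (ρ-off i j (λ e → j≢i (sym e))) (≤-reflexive (ring 2 λ m g → g := con 0 :* m :+ g))

      -- Cauchy-Schwarz as nonnegativity of a variance: the squares of N w(t) - m u are summed over
      -- t.
      cauchy : (ι m * ι u) * (ι m * ι u) ≤ ι N * ∑ N (λ t → w t * w t)
      cauchy with N in N≡
      ... | zero = ≤-reflexive (trans (cong (λ z → z * z) (trans (sym first) (trans (cong (λ k → ∑ k w) N≡) refl))) (ring 0 (con 0 :* con 0 := con 0 :* con 0)))
      ... | N′@(suc _) = ι-cancelˡ N′ (lin (∑≥0 N′ {λ t → (ι N′ * w t - ι m * ι u) * (ι N′ * w t - ι m * ι u)} (λ t _ _ → sq≥0 _) ⊞ ≤-reflexive expand)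
          (ring 4 λ N a W S → N :* (N :* W) :+ (con 0 :+ S) := N :* (a :* a) :+ (S :+ (N :* N :* W :- N :* (a :* a)))))
        where
        a = ι m * ι u
        first′ : ∑ N′ w ≡ a
        first′ = trans (cong (λ k → ∑ k w) (sym N≡)) first
        expand : ∑ N′ (λ t → (ι N′ * w t - a) * (ι N′ * w t - a)) ≡ ι N′ * ι N′ * ∑ N′ (λ t → w t * w t) - ι N′ * (a * a)
        expand = trans (∑-cong′ N′ (λ t → ring 3 λ N w a → (N :* w :- a) :* (N :* w :- a) := N :* N :* (w :* w) :+ (a :* a :- con 2 :* N :* a :* w)))
          (trans (∑-+ N′ _ _) (trans (cong₂ _+_ (∑-*ˡ N′ (ι N′ * ι N′) _) (trans (∑-- N′ _ _) (cong₂ _-_ (∑-const N′ (a * a)) (trans (∑-*ˡ N′ (ι 2 * ι N′ * a) w) (cong (ι 2 * ι N′ * a *_) first′)))))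
            (ring 3 λ N W a → N :* N :* W :+ (N :* (a :* a) :- con 2 :* N :* a :* a) := N :* N :* W :- N :* (a :* a))))

    erdős-turán : .{{_ : NonZero u}} → ι m * ι m * ι u ≤ (ι n + ι u) * (ι m + ι u * ι g)
    erdős-turán = ι-cancelˡ u (lin (cauchy ⊞ ι≥0 N ⊛ second≤ ⊞ *≥0 (ι≥0 u) (+≥0 (ι≥0 m) (*≥0 (ι≥0 u) (ι≥0 g))) ⊛ ≤-reflexive (ι-+ n u))
      (ring 6 λ m u n g N W → u :* ((n :+ u) :* (m :+ u :* g)) :+ (m :* u :* (m :* u) :+ (N :* W :+ u :* (m :+ u :* g) :* N)) := u :* (m :* m :* u) :+ (N :* W :+ (N :* (u :* (m :+ u :* g)) :+ u :* (m :+ u :* g) :* (n :+ u)))))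

  -- Windows of length u = n ÷ s turn `erdős-turán` into (s - 1) m² ≤ (s + 1) g n; with s = (k + 1)²
  -- + 2 the ratio (s + 1) / (s - 1) is at most ((k + 2) / (k + 1))². The linear term (2 s + 1) m is
  -- absorbed by m² / s when m ≥ t, and smaller sets satisfy the bound for large n.
  upper-bound : ∀ g k .{{_ : NonZero g}} → Σ ℕ λ N → ∀ n A → N ℕ.≤ n → Admissible g n A → ι (suc k) * ι (suc k) * (ι (length A) * ι (length A)) ≤ ι (suc (suc k)) * ι (suc (suc k)) * (ι g * ι n)
  upper-bound g k = N₀ , bound
    where
    s t N₀ : ℕ
    s = suc k ℕ.* suc k ℕ.+ 2
    t = (2 ℕ.* s ℕ.+ 1) ℕ.* s
    N₀ = s ℕ.+ (suc k ℕ.* suc k) ℕ.* (t ℕ.* t)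
    bound : ∀ n A → N₀ ℕ.≤ n → Admissible g n A → ι (suc k) * ι (suc k) * (ι (length A) * ι (length A)) ≤ ι (suc (suc k)) * ι (suc (suc k)) * (ι g * ι n)
    bound n A N₀≤n adm with ℕ.≤-total (length A) t
    ... | inj₁ m≤t = ≤-trans (*≥0 (ι≥0 (suc k)) (ι≥0 (suc k)) ⊛ *-mono (ι≥0 (length A)) (ι≥0 t) (ι-mono m≤t) (ι-mono m≤t)) (≤-trans small big)
      where
      small : ι (suc k) * ι (suc k) * (ι t * ι t) ≤ ι n
      small = ≤-trans (≤-reflexive (sym (trans (ι-* (suc k ℕ.* suc k) (t ℕ.* t)) (cong₂ _*_ (ι-* (suc k) (suc k)) (ι-* t t))))) (ι-mono (ℕ.≤-trans (ℕ.m≤n+m _ s) N₀≤n))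
      big : ι n ≤ ι (suc (suc k)) * ι (suc (suc k)) * (ι g * ι n)
      big = ≤-trans (≤-trans (≤-reflexive (trans (sym (*-identityˡ _)) (cong (ι 1 *_) (sym (*-identityˡ _))))) (*-mono 0≤1 (*≥0 (ι≥0 g) (ι≥0 n)) (≤-trans (≤-reflexive (sym (*-identityˡ (ι 1)))) (*-mono 0≤1 (ι≥0 (suc (suc k))) (ι-mono (s≤s z≤n)) (ι-mono (s≤s z≤n)))) (*-mono 0≤1 (ι≥0 n) (ι-mono (ℕ.>-nonZero⁻¹ g)) ≤-refl))) ≤-refl
    ... | inj₂ t≤m = ι-cancelˡ s′ (lin (kk≥0 ⊛ main ⊞ gn≥0 ⊛ consts) (ring 5 λ K K′ M G S → S :* (K′ :* G) :+ (K :* (S :* M) :+ G :* (K :* (S :+ con 2))) := S :* (K :* M) :+ (K :* ((S :+ con 2) :* G) :+ G :* (K′ :* S))))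
      where
      m = length A
      u = n ÷ s
      s′ = suc k ℕ.* suc k ℕ.+ 1
      instance
        s′≢0 : NonZero s′
        s′≢0 = ℕ.>-nonZero (ℕ.m≤n+m 1 (suc k ℕ.* suc k))
        s≢0 : NonZero s
        s≢0 = ℕ.>-nonZero (ℕ.≤-trans (s≤s z≤n) (ℕ.m≤n+m 2 (suc k ℕ.* suc k)))
      1≤s : 1 ℕ.≤ s
      1≤s = ℕ.>-nonZero⁻¹ s
      1≤u : 1 ℕ.≤ u
      1≤u = 1≤÷ 1≤s (ℕ.≤-trans (ℕ.m≤m+n s _) N₀≤n)
      instance
        u≢0 : NonZero u
        u≢0 = ℕ.>-nonZero 1≤u
      sq S Mm K K′ : ℚ
      sq = ι s
      S = ι s′
      Mm = ι m * ι m
      K = ι (suc k) * ι (suc k)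
      K′ = ι (suc (suc k)) * ι (suc (suc k))
      kk≥0 : ι 0 ≤ K
      kk≥0 = *≥0 (ι≥0 (suc k)) (ι≥0 (suc k))
      gn≥0 : ι 0 ≤ ι g * ι n
      gn≥0 = *≥0 (ι≥0 g) (ι≥0 n)
      S≡ : sq ≡ S + ι 1
      S≡ = trans (cong ι (trans (sym (ℕ.+-assoc (suc k ℕ.* suc k) 1 1)) (ℕ.+-comm s′ 1))) (ι-suc s′)
      S≡K : S ≡ K + ι 1
      S≡K = trans (ι-+ (suc k ℕ.* suc k) 1) (cong (_+ ι 1) (ι-* (suc k) (suc k)))
      su≤n : sq * ι u ≤ ι n
      su≤n = ≤-trans (≤-reflexive (sym (ι-* s u))) (ι-mono (÷-* n s))
      n≤2su : ι n ≤ ι 2 * sq * ι u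
      n≤2su = ≤-trans (ι-mono (ℕ.<⇒≤ (÷-< n s 1≤s))) (≤-trans (≤-reflexive (trans (ι-* s (suc u)) (cong (sq *_) (ι-suc u)))) (lin (ι≥0 s ⊛ ι-mono 1≤u) (ring 2 λ s u → con 2 :* s :* u :+ s :* con 1 := s :* (u :+ con 1) :+ s :* u)))
      tm : (ι 2 * sq + ι 1) * sq ≤ ι m
      tm = ≤-trans (≤-reflexive (sym (trans (ι-* (2 ℕ.* s ℕ.+ 1) s) (cong (_* sq) (trans (ι-+ (2 ℕ.* s) 1) (cong (_+ ι 1) (ι-* 2 s))))))) (ι-mono t≤m)
      -- u cancels: m² ≤ g n + g u + (2 s + 1) m
      basic : Mm ≤ ι g * ι n + ι g * ι u + (ι 2 * sq + ι 1) * ι m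
      basic = ι-cancelˡ u (lin (erdős-turán A adm u ⊞ ι≥0 m ⊛ n≤2su) (ring 5 λ u m n g s → u :* (g :* n :+ g :* u :+ (con 2 :* s :+ con 1) :* m) :+ (m :* m :* u :+ m :* n) := u :* (m :* m) :+ ((n :+ u) :* (m :+ u :* g) :+ m :* (con 2 :* s :* u))))
      main : S * Mm ≤ (S + ι 2) * (ι g * ι n)
      main = lin (ι≥0 s ⊛ basic ⊞ ι≥0 g ⊛ su≤n ⊞ ι≥0 m ⊛ tm ⊞ +≥0 gn≥0 (≤-refl {ι 0}) ⊛ ≤-reflexive S≡ ⊞ *≥0 (ι≥0 m) (ι≥0 m) ⊛ ≤-reflexive (sym S≡))
        (ring 6 λ s S m g n u → (S :+ con 2) :* (g :* n) :+ (s :* (m :* m) :+ (g :* (s :* u) :+ (m :* ((con 2 :* s :+ con 1) :* s) :+ ((g :* n :+ con 0) :* s :+ m :* m :* (S :+ con 1))))) := S :* (m :* m) :+ (s :* (g :* n :+ g :* u :+ (con 2 :* s :+ con 1) :* m) :+ (g :* n :+ (m :* m :+ ((g :* n :+ con 0) :* (S :+ con 1) :+ m :* m :* s)))))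
      consts : K * (S + ι 2) ≤ K′ * S
      consts = subst₂ (λ K′ S → K * (S + ι 2) ≤ K′ * S) (cong (λ z → z * z) (sym (ι-suc (suc k)))) (sym S≡K)
        (lin (kk≥0 ⊛ ι-mono {1} {suc k} (s≤s z≤n) ⊞ *≥0 kk≥0 (ι≥0 (suc k)) ⊞ ι≥0 2 ⊛ ι≥0 (suc k) ⊞ 0≤1)
          (ring 1 λ a → (a :+ con 1) :* (a :+ con 1) :* (a :* a :+ con 1) :+ (a :* a :* con 1 :+ (con 0 :+ (con 2 :* con 0 :+ con 0))) := a :* a :* (a :* a :+ con 1 :+ con 2) :+ (a :* a :* a :+ (a :* a :* a :+ (con 2 :* a :+ con 1)))))

-- Congruence as divisibility of integer differences.

module Congruence (m : ℕ) {{m≢0 : NonZero m}} where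
  open import Data.Integer as ℤ using (ℤ; +_)
  open import Data.Integer.Divisibility.Signed using (_∣_; divides; ∣⇒∣ᵤ)
  import Data.Integer.Properties as ℤ
  open import Data.Integer.Tactic.RingSolver using (solve-∀)
  import Data.Nat.Divisibility as ℕ
  open import Data.Nat.DivMod using (_%_; _/_; m≡m%n+[m/n]*n; %-remove-+ʳ)
  open import Data.Sum using ([_,_]′)

  %≡⇒∣ : ∀ a b → a % m ≡ b % m → + m ∣ (+ a ℤ.- + b)
  %≡⇒∣ a b h = divides (+ (a / m) ℤ.- + (b / m)) (trans (cong₂ ℤ._-_ (e a) (trans (e b) (cong (λ w → + w ℤ.+ + (b / m) ℤ.* + m) (sym h)))) (lem (+ (a % m)) (+ (a / m)) (+ (b / m)) (+ m)))
    where
    e : ∀ a → + a ≡ + (a % m) ℤ.+ + (a / m) ℤ.* + m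
    e a = trans (cong +_ (m≡m%n+[m/n]*n a m)) (trans (ℤ.pos-+ (a % m) (a / m ℕ.* m)) (cong (λ w → + (a % m) ℤ.+ w) (ℤ.pos-* (a / m) m)))
    lem : ∀ r x y p → (r ℤ.+ x ℤ.* p) ℤ.- (r ℤ.+ y ℤ.* p) ≡ (x ℤ.- y) ℤ.* p
    lem = solve-∀

  ∣-⇒%≡ : ∀ a b → + m ∣ (+ a ℤ.- + b) → a % m ≡ b % m
  ∣-⇒%≡ a b h = [ (λ b≤a → half b≤a (∣⇒∣ᵤ h)) , (λ a≤b → sym (half a≤b (subst (m ℕ.∣_) (ℤ.∣i-j∣≡∣j-i∣ (+ a) (+ b)) (∣⇒∣ᵤ h)))) ]′ (ℕ.≤-total b a)
    where
    half : ∀ {a b} → b ℕ.≤ a → m ℕ.∣ ℤ.∣ + a ℤ.- + b ∣ → a % m ≡ b % m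
    half {a} {b} b≤a d = trans (cong (_% m) (sym (ℕ.m+[n∸m]≡n b≤a))) (%-remove-+ʳ b (subst (m ℕ.∣_) (cong ℤ.∣_∣ (trans (ℤ.m-n≡m⊖n a b) (ℤ.⊖-≥ b≤a))) d))

-- Existence of primitive roots.

module PrimitiveRoot (p : ℕ) {{p≢0 : NonZero p}} (p-prime : Prime p) where
  open import Data.Nat.Primality using (prime⇒nonZero; euclidsLemma)

  open import Data.Fin using (Fin; toℕ; fromℕ<)
  open import Data.Fin.Properties using (pigeonhole; toℕ<n; toℕ-fromℕ<)
  open import Data.Integer as ℤ using (ℤ; +_)
  import Data.Integer.Properties as ℤ
  import Data.Integer.Divisibility.Signed as ℤ∣
  open import Data.Integer.Tactic.RingSolver using (solve-∀)
  open import Data.List using ([]; _∷_; applyUpTo)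
  open import Data.List.Properties using (length-applyUpTo)
  open import Data.List.Relation.Unary.All as All using (All; []; _∷_)
  import Data.List.Relation.Unary.All.Properties as All
  open import Data.List.Relation.Unary.AllPairs using (AllPairs; []; _∷_)
  import Data.List.Relation.Unary.AllPairs.Properties as AllPairs
  open import Data.Nat.Coprimality as Coprimality using (Coprime; coprime-divisor; prime⇒coprime; coprime-/gcd)
  open import Data.Nat.DivMod using (_%_; _/_; m≡m%n+[m/n]*n; m%n<n; m/n*n≡m)
  open import Data.Nat.Divisibility using (_∣_; divides; ∣-trans; *-cancelˡ-∣; *-monoˡ-∣; *-monoʳ-∣; m%n≡0⇒n∣m; m∣m*n; ∣⇒≤; ∣1⇒≡1; _∣?_)
  open import Data.Nat.GCD using (gcd; gcd[m,n]∣m; gcd[m,n]∣n; gcd[m,n]≢0)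
  open import Data.Nat.Induction using (<-wellFounded)
  open import Induction.WellFounded using (Acc; acc)
  open import Relation.Nullary.Decidable using (¬?; _×-dec_)
  open Factors using (prime-divisor; prime>1; prime∣prime)
  open Congruence p
  open Residues p

  ^-cong≈ : ∀ {x y} k → x ≈ y → x ℕ.^ k ≈ y ℕ.^ k
  ^-cong≈ zero h = refl
  ^-cong≈ {x} {y} (suc k) h = *-cong≈ {x} {y} {x ℕ.^ k} {y ℕ.^ k} h (^-cong≈ {x} {y} k h)

  ^-1≈ : ∀ {x} k → x ≈ 1 → x ℕ.^ k ≈ 1
  ^-1≈ {x} k h = trans (^-cong≈ {x} {1} k h) (≡⇒≈ {1 ℕ.^ k} {1} (ℕ.^-zeroˡ k))

  ^-cop : ∀ {x} k → Coprime x p → Coprime (x ℕ.^ k) p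
  ^-cop zero c = cop-1
  ^-cop (suc k) c = cop-* c (^-cop k c)

  -- Minimality is expressed by divisibility, the form in which orders are combined.
  HasOrder : ℕ → ℕ → Set
  HasOrder x m = 1 ℕ.≤ m × x ℕ.^ m ≈ 1 × (∀ k → x ℕ.^ k ≈ 1 → m ∣ k)

  order-least : ∀ x K → Acc ℕ._<_ K → 1 ℕ.≤ K → x ℕ.^ K ≈ 1 → Σ ℕ λ m → m ℕ.≤ K × HasOrder x m
  order-least x (suc K) (acc rs) 1≤K xK with ℕ.anyUpTo? (λ j → x ℕ.^ suc j ≈? 1) K
  ... | yes (j , j<K , xj) with order-least x (suc j) (rs (s≤s j<K)) (s≤s z≤n) xj
  ...   | m , m≤ , o = m , ℕ.≤-trans m≤ (ℕ.≤-trans j<K (ℕ.n≤1+n K)) , o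
  order-least x (suc K) (acc rs) 1≤K xK | no none = suc K , ℕ.≤-refl , 1≤K , xK , λ k xk → m%n≡0⇒n∣m k (suc K) (rem k xk)
    where
    rem : ∀ k → x ℕ.^ k ≈ 1 → k % suc K ≡ 0
    rem k xk with k % suc K in eq
    ... | zero = refl
    ... | suc j = ⊥-elim (none (j , ℕ.≤-pred (subst (ℕ._< suc K) eq (m%n<n k (suc K))) , trans (sym xj) xk))
      where
      q = k / suc K
      k≡ : k ≡ suc j ℕ.+ suc K ℕ.* q
      k≡ = trans (m≡m%n+[m/n]*n k (suc K)) (cong₂ ℕ._+_ eq (ℕ.*-comm q (suc K)))
      xj : x ℕ.^ k ≈ x ℕ.^ suc j
      xj = trans (≡⇒≈ (trans (cong (x ℕ.^_) k≡) (trans (ℕ.^-distribˡ-+-* x (suc j) (suc K ℕ.* q)) (cong (x ℕ.^ suc j ℕ.*_) (sym (ℕ.^-*-assoc x (suc K) q))))))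
        (trans (*-cong≈ {x ℕ.^ suc j} {x ℕ.^ suc j} {(x ℕ.^ suc K) ℕ.^ q} {1} refl (^-1≈ {x ℕ.^ suc K} q xK)) (≡⇒≈ (ℕ.*-identityʳ (x ℕ.^ suc j))))

  private
    1<p : 1 ℕ.< p
    1<p = prime>1 p-prime

  unit : ∀ {x} → 1 ℕ.≤ x → x ℕ.< p → Coprime x p
  unit 1≤x x<p = Coprimality.sym (prime⇒coprime p-prime {{ℕ.>-nonZero 1≤x}} x<p)

  cop-%≢0 : ∀ {x} → Coprime x p → NonZero (x % p)
  cop-%≢0 {x} c = ℕ.≢-nonZero λ e → ℕ.<⇒≢ 1<p (sym (c (m%n≡0⇒n∣m x p e , divides 1 (sym (ℕ.*-identityˡ p)))))

  abstract
    -- The p powers with exponents 0, ..., p - 1 take only p - 1 nonzero residues, so two coincide.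
    order : ∀ {x} → Coprime x p → Σ ℕ λ m → m ℕ.≤ ℕ.pred p × HasOrder x m
    order {x} c = go (pigeonhole (ℕ.n<1+n (ℕ.pred p)) f)
      where
      bound : ∀ i → ℕ.pred (x ℕ.^ i % p) ℕ.< ℕ.pred p
      bound i = ℕ.pred-mono-< {{cop-%≢0 (^-cop i c)}} (m%n<n (x ℕ.^ i) p)
      f : Fin (suc (ℕ.pred p)) → Fin (ℕ.pred p)
      f i = fromℕ< (bound (toℕ i))
      f-≈ : ∀ i j → f i ≡ f j → x ℕ.^ toℕ i ≈ x ℕ.^ toℕ j
      f-≈ i j h = ℕ.pred-injective {{cop-%≢0 (^-cop (toℕ i) c)}} {{cop-%≢0 (^-cop (toℕ j) c)}} (trans (sym (toℕ-fromℕ< (bound (toℕ i)))) (trans (cong toℕ h) (toℕ-fromℕ< (bound (toℕ j)))))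
      go : (Σ (Fin (suc (ℕ.pred p))) λ i → Σ (Fin (suc (ℕ.pred p))) λ j → toℕ i ℕ.< toℕ j × f i ≡ f j) → Σ ℕ λ m → m ℕ.≤ ℕ.pred p × HasOrder x m
      go (i , j , i<j , eq) = proj₁ o , ℕ.≤-trans (proj₁ (proj₂ o)) (ℕ.≤-trans (ℕ.m∸n≤m (toℕ j) (toℕ i)) (ℕ.≤-pred (toℕ<n j))) , proj₂ (proj₂ o)
        where
        K : ℕ
        K = toℕ j ℕ.∸ toℕ i
        xK : x ℕ.^ K ≈ 1
        xK = sym (*-cancel≈ {x ℕ.^ toℕ i} {1} {x ℕ.^ K} (^-cop (toℕ i) c) (trans (≡⇒≈ (ℕ.*-identityʳ (x ℕ.^ toℕ i))) (trans (f-≈ i j eq) (≡⇒≈ (trans (cong (x ℕ.^_) (sym (ℕ.m+[n∸m]≡n (ℕ.<⇒≤ i<j)))) (ℕ.^-distribˡ-+-* x (toℕ i) K))))))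
        o : Σ ℕ λ m → m ℕ.≤ K × HasOrder x m
        o = order-least x K (<-wellFounded K) (ℕ.m<n⇒0<n∸m i<j) xK

  order≤ : ∀ {x m} → HasOrder x m → m ℕ.≤ ℕ.pred p
  order≤ {x} {suc m} (_ , h , least) = ℕ.≤-trans (∣⇒≤ {{ℕ.>-nonZero (proj₁ (proj₂ (proj₂ o)))}} (least _ (proj₁ (proj₂ (proj₂ (proj₂ o)))))) (proj₁ (proj₂ o))
    where
    o = order {x} (cop-*⁻ˡ (x ℕ.^ m) (≈-cop {1} {x ℕ.^ suc m} (sym h) cop-1))

  order-^ : ∀ {x} d m → 1 ℕ.≤ d → 1 ℕ.≤ m → HasOrder x (d ℕ.* m) → HasOrder (x ℕ.^ d) m
  order-^ {x} d m 1≤d 1≤m (_ , h , least) = 1≤m , trans (≡⇒≈ (ℕ.^-*-assoc x d m)) h , λ k e → *-cancelˡ-∣ d {{ℕ.>-nonZero 1≤d}} (least (d ℕ.* k) (trans (≡⇒≈ (sym (ℕ.^-*-assoc x d k))) e))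

  ^-distrib-* : ∀ x y k → (x ℕ.* y) ℕ.^ k ≡ x ℕ.^ k ℕ.* y ℕ.^ k
  ^-distrib-* x y zero = refl
  ^-distrib-* x y (suc k) = trans (cong (x ℕ.* y ℕ.*_) (^-distrib-* x y k)) (ℕ.[m*n]*[o*p]≡[m*o]*[n*p] x y (x ℕ.^ k) (y ℕ.^ k))

  coprime-*-∣ : ∀ {m n k} → Coprime m n → m ∣ k → n ∣ k → m ℕ.* n ∣ k
  coprime-*-∣ {m} {n} c (divides q refl) n∣k = subst (_∣ q ℕ.* m) (ℕ.*-comm n m) (*-monoˡ-∣ m (coprime-divisor {n} {m} {q} (Coprimality.sym c) (subst (n ∣_) (ℕ.*-comm q m) n∣k)))

  -- If (x y)^k ≈ 1, raising to the power n removes y and leaves x^(n k) ≈ 1; so m ∣ n k, and m ∣ k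
  -- by coprimality. The other factor is symmetric.
  order-* : ∀ {x y m n} → Coprime m n → HasOrder x m → HasOrder y n → HasOrder (x ℕ.* y) (m ℕ.* n)
  order-* {x} {y} {m} {n} c (1≤m , xm , lx) (1≤n , yn , ly) = ℕ.*-mono-≤ 1≤m 1≤n , trans (≡⇒≈ (^-distrib-* x y (m ℕ.* n))) (*-cong≈ {x ℕ.^ (m ℕ.* n)} {1} {y ℕ.^ (m ℕ.* n)} {1} (trans (≡⇒≈ (sym (ℕ.^-*-assoc x m n))) (^-1≈ {x ℕ.^ m} n xm)) (trans (≡⇒≈ (trans (cong (y ℕ.^_) (ℕ.*-comm m n)) (sym (ℕ.^-*-assoc y n m)))) (^-1≈ {y ℕ.^ n} m yn)))
    , λ k e → coprime-*-∣ c (half {x} {y} {m} {n} c xm lx yn k e) (half {y} {x} {n} {m} (Coprimality.sym c) yn ly xm k (trans (≡⇒≈ (cong (ℕ._^ k) (ℕ.*-comm y x))) e))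
    where
    half : ∀ {x y m n} → Coprime m n → x ℕ.^ m ≈ 1 → (∀ k → x ℕ.^ k ≈ 1 → m ∣ k) → y ℕ.^ n ≈ 1 → ∀ k → (x ℕ.* y) ℕ.^ k ≈ 1 → m ∣ k
    half {x} {y} {m} {n} c xm lx yn k e = coprime-divisor {m} {n} {k} c (lx (n ℕ.* k) (trans (sym both) (trans (≡⇒≈ (trans (cong ((x ℕ.* y) ℕ.^_) (ℕ.*-comm n k)) (sym (ℕ.^-*-assoc (x ℕ.* y) k n)))) (^-1≈ {(x ℕ.* y) ℕ.^ k} n e))))
      where
      both : (x ℕ.* y) ℕ.^ (n ℕ.* k) ≈ x ℕ.^ (n ℕ.* k)
      both = trans (≡⇒≈ (^-distrib-* x y (n ℕ.* k))) (trans (*-cong≈ {x ℕ.^ (n ℕ.* k)} {x ℕ.^ (n ℕ.* k)} {y ℕ.^ (n ℕ.* k)} {1} refl (trans (≡⇒≈ (sym (ℕ.^-*-assoc y n k))) (^-1≈ {y ℕ.^ n} k yn))) (≡⇒≈ (ℕ.*-identityʳ (x ℕ.^ (n ℕ.* k)))))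

  private
    valuation : ∀ r → 1 ℕ.< r → ∀ a → Acc ℕ._<_ a → 1 ℕ.≤ a → Σ ℕ λ f → Σ ℕ λ a′ → a ≡ r ℕ.^ f ℕ.* a′ × ¬ (r ∣ a′)
    valuation r 1<r a (acc rs) 1≤a with r ∣? a
    ... | no r∤a = 0 , a , sym (ℕ.*-identityˡ a) , r∤a
    ... | yes (divides b refl) with valuation r 1<r b (rs (ℕ.m<m*n b r {{b≢0}} 1<r)) (ℕ.>-nonZero⁻¹ b {{b≢0}})
      where
      b≢0 : NonZero b
      b≢0 = ℕ.m*n≢0⇒m≢0 b {r} {{ℕ.>-nonZero 1≤a}}
    ...   | f , a′ , eq , r∤a′ = suc f , a′ , trans (ℕ.*-comm b r) (trans (cong (r ℕ.*_) eq) (sym (ℕ.*-assoc r (r ℕ.^ f) a′))) , r∤a′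

    prime-∤-coprime : ∀ {r a} → Prime r → ¬ (r ∣ a) → Coprime r a
    prime-∤-coprime {r} {a} pr r∤a {i} (i∣r , i∣a) with i ℕ.≟ 0 | i ℕ.≟ 1
    ... | _ | yes e = e
    ... | yes refl | no _ = ⊥-elim (r∤a (subst (_∣ a) (sym (0∣ i∣r)) i∣a))
      where
      0∣ : ∀ {n} → 0 ∣ n → n ≡ 0
      0∣ (divides q refl) = ℕ.*-zeroʳ q
    ... | no i≢0 | no i≢1 with prime-divisor (ℕ.≤∧≢⇒< (ℕ.n≢0⇒n>0 i≢0) (λ e → i≢1 (sym e)))
    ...   | s , ps , s∣i = ⊥-elim (r∤a (subst (_∣ a) (prime∣prime ps pr (∣-trans s∣i i∣r)) (∣-trans s∣i i∣a)))

    coprime-^ : ∀ {r a} f → Coprime r a → Coprime (r ℕ.^ f) a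
    coprime-^ zero c = Coprimality.1-coprimeTo _
    coprime-^ {r} {a} (suc f) c {i} (i∣ , i∣a) = coprime-^ f c (coprime-divisor {i} {r} (λ { (j∣i , j∣r) → c (j∣r , ∣-trans j∣i i∣a) }) i∣ , i∣a)

    reduced : ∀ a b → 1 ℕ.≤ a → Σ ℕ λ d → Σ ℕ λ a″ → Σ ℕ λ b″ → a ≡ a″ ℕ.* d × b ≡ b″ ℕ.* d × Coprime a″ b″
    reduced a b 1≤a = gcd a b , a / gcd a b , b / gcd a b , sym (m/n*n≡m (gcd[m,n]∣m a b)) , sym (m/n*n≡m (gcd[m,n]∣n a b)) , coprime-/gcd a b
      where
      instance
        d≢0 : NonZero (gcd a b)
        d≢0 = ℕ.≢-nonZero (gcd[m,n]≢0 a b (inj₁ (λ e → ℕ.<⇒≢ 1≤a (sym e))))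

    -- After division by the gcd, the cofactor of `b` is at least 2 and prime to that of `a`; a
    -- prime dividing it occurs in `b` to a higher power than in `a`.
    excess-prime : ∀ a b → 1 ℕ.≤ a → 1 ℕ.≤ b → ¬ (b ∣ a) → Σ ℕ λ r → Σ ℕ λ f → Σ ℕ λ a′ → Prime r × a ≡ r ℕ.^ f ℕ.* a′ × ¬ (r ∣ a′) × r ℕ.^ suc f ∣ b
    excess-prime a b 1≤a 1≤b b∤a = go (reduced a b 1≤a)
      where
      go : (Σ ℕ λ d → Σ ℕ λ a″ → Σ ℕ λ b″ → a ≡ a″ ℕ.* d × b ≡ b″ ℕ.* d × Coprime a″ b″) → Σ ℕ λ r → Σ ℕ λ f → Σ ℕ λ a′ → Prime r × a ≡ r ℕ.^ f ℕ.* a′ × ¬ (r ∣ a′) × r ℕ.^ suc f ∣ b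
      go (d , a″ , zero , a≡″ , b≡″ , c) = ⊥-elim (ℕ.<⇒≢ 1≤b (sym b≡″))
      go (d , a″ , suc zero , a≡″ , b≡″ , c) = ⊥-elim (b∤a (divides a″ (trans a≡″ (cong (a″ ℕ.*_) (sym (trans b≡″ (ℕ.*-identityˡ d)))))))
      go (d , a″ , b″@(suc (suc _)) , a≡″ , b≡″ , c) = r , f , a′ , r-prime , a≡ , r∤a′ , subst (r ℕ.^ suc f ∣_) (sym b≡″) (∣-trans (*-monoʳ-∣ r rf∣d) (*-monoˡ-∣ d r∣b″))
        where
        pd = prime-divisor {b″} (s≤s (s≤s z≤n))
        r = proj₁ pd
        r-prime = proj₁ (proj₂ pd)
        r∣b″ = proj₂ (proj₂ pd)
        v = valuation r (prime>1 r-prime) a (<-wellFounded a) 1≤a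
        f = proj₁ v
        a′ = proj₁ (proj₂ v)
        a≡ = proj₁ (proj₂ (proj₂ v))
        r∤a′ = proj₂ (proj₂ (proj₂ v))
        r∤a″ : ¬ (r ∣ a″)
        r∤a″ h = ℕ.<⇒≢ (prime>1 r-prime) (sym (c (h , r∣b″)))
        rf∣d : r ℕ.^ f ∣ d
        rf∣d = coprime-divisor {r ℕ.^ f} {a″} {d} (coprime-^ f (prime-∤-coprime r-prime r∤a″)) (subst (r ℕ.^ f ∣_) (trans (sym a≡) a≡″) (m∣m*n a′))

    -- The part r^f of the order of `x` is exchanged for r^(f + 1): x^(r^f) has order a′, a power of
    -- `y` has order r^(f + 1), and these orders are coprime.
    improve : ∀ {x a y} → HasOrder x a → Coprime y p → ¬ (y ℕ.^ a ≈ 1) → Σ ℕ λ x′ → Σ ℕ λ a′ → a ℕ.< a′ × HasOrder x′ a′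
    improve {x} {a} {y} ox cy y≉ = go (excess-prime a b 1≤a 1≤b b∤a)
      where
      1≤a = proj₁ ox
      b = proj₁ (order cy)
      oy = proj₂ (proj₂ (order cy))
      1≤b = proj₁ oy
      b∤a : ¬ (b ∣ a)
      b∤a (divides q eq) = y≉ (trans (≡⇒≈ (trans (cong (y ℕ.^_) (trans eq (ℕ.*-comm q b))) (sym (ℕ.^-*-assoc y b q)))) (^-1≈ {y ℕ.^ b} q (proj₁ (proj₂ oy))))
      go : (Σ ℕ λ r → Σ ℕ λ f → Σ ℕ λ a′ → Prime r × a ≡ r ℕ.^ f ℕ.* a′ × ¬ (r ∣ a′) × r ℕ.^ suc f ∣ b) → Σ ℕ λ x′ → Σ ℕ λ a′ → a ℕ.< a′ × HasOrder x′ a′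
      go (r , f , a′ , pr , a≡ , r∤a′ , divides c b≡) = x ℕ.^ (r ℕ.^ f) ℕ.* y ℕ.^ c , a′ ℕ.* r ℕ.^ suc f , a< ,
        order-* {x ℕ.^ (r ℕ.^ f)} {y ℕ.^ c} {a′} {r ℕ.^ suc f} (Coprimality.sym (coprime-^ (suc f) (prime-∤-coprime pr r∤a′))) (order-^ {x} (r ℕ.^ f) a′ (r^≥1 f) 1≤a′ (subst (HasOrder x) a≡ ox)) (order-^ {y} c (r ℕ.^ suc f) 1≤c (r^≥1 (suc f)) (subst (HasOrder y) b≡ oy))
        where
        r^≥1 : ∀ f → 1 ℕ.≤ r ℕ.^ f
        r^≥1 f = ℕ.m^n>0 r {{prime⇒nonZero pr}} f
        1≤a′ : 1 ℕ.≤ a′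
        1≤a′ = ℕ.>-nonZero⁻¹ a′ {{ℕ.m*n≢0⇒n≢0 (r ℕ.^ f) {{ℕ.>-nonZero (subst (1 ℕ.≤_) a≡ 1≤a)}}}}
        1≤c : 1 ℕ.≤ c
        1≤c = ℕ.>-nonZero⁻¹ c {{ℕ.m*n≢0⇒m≢0 c {{ℕ.>-nonZero (subst (1 ℕ.≤_) b≡ 1≤b)}}}}
        a< : a ℕ.< a′ ℕ.* r ℕ.^ suc f
        a< = subst₂ ℕ._<_ refl (trans (cong (ℕ._* r) a≡) (trans (cong (ℕ._* r) (ℕ.*-comm (r ℕ.^ f) a′)) (trans (ℕ.*-assoc a′ (r ℕ.^ f) r) (cong (a′ ℕ.*_) (ℕ.*-comm (r ℕ.^ f) r))))) (ℕ.m<m*n a r {{ℕ.>-nonZero 1≤a}} (prime>1 pr))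

  -- Monic polynomial functions, described by their divided differences.
  MonicDeg : ℕ → (ℤ → ℤ) → Set
  MonicDeg zero F = ∀ x → F x ≡ + 1
  MonicDeg (suc n) F = ∀ c → Σ (ℤ → ℤ) λ Q → MonicDeg n Q × (∀ x → F x ℤ.- F c ≡ (x ℤ.- c) ℤ.* Q x)

  monic-x* : ∀ n {G} k → MonicDeg n G → MonicDeg (suc n) (λ x → x ℤ.* G x ℤ.+ k)
  monic-x* zero {G} k h c = (λ _ → + 1) , (λ _ → refl) , λ x → trans (cong₂ (λ u v → (x ℤ.* u ℤ.+ k) ℤ.- (c ℤ.* v ℤ.+ k)) (h x) (h c)) (lem x c k)
    where
    lem : ∀ x c k → (x ℤ.* + 1 ℤ.+ k) ℤ.- (c ℤ.* + 1 ℤ.+ k) ≡ (x ℤ.- c) ℤ.* + 1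
    lem = solve-∀
  monic-x* (suc n) {G} k h c = (λ x → x ℤ.* proj₁ (h c) x ℤ.+ G c) , monic-x* n (G c) (proj₁ (proj₂ (h c))) , λ x → trans (lem x c k (G x) (G c)) (trans (cong (λ w → x ℤ.* w ℤ.+ (x ℤ.- c) ℤ.* G c) (proj₂ (proj₂ (h c)) x)) (lem′ x c (proj₁ (h c) x) (G c)))
    where
    lem : ∀ x c k u v → (x ℤ.* u ℤ.+ k) ℤ.- (c ℤ.* v ℤ.+ k) ≡ x ℤ.* (u ℤ.- v) ℤ.+ (x ℤ.- c) ℤ.* v
    lem = solve-∀
    lem′ : ∀ x c q v → x ℤ.* ((x ℤ.- c) ℤ.* q) ℤ.+ (x ℤ.- c) ℤ.* v ≡ (x ℤ.- c) ℤ.* (x ℤ.* q ℤ.+ v)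
    lem′ = solve-∀

  -- The summand + 0 gives every step the shape covered by `monic-x*`.
  pow : ℕ → ℤ → ℤ
  pow zero x = + 1
  pow (suc n) x = x ℤ.* pow n x ℤ.+ + 0

  monic-pow : ∀ n → MonicDeg n (pow n)
  monic-pow zero x = refl
  monic-pow (suc n) = monic-x* n (+ 0) (monic-pow n)

  pow-+ : ∀ n x → pow n (+ x) ≡ + (x ℕ.^ n)
  pow-+ zero x = refl
  pow-+ (suc n) x = trans (ℤ.+-identityʳ _) (trans (cong (λ w → + x ℤ.* w) (pow-+ n x)) (sym (ℤ.pos-* x (x ℕ.^ n))))

  Incongruent : ℤ → ℤ → Set
  Incongruent x y = ¬ (+ p ℤ∣.∣ (y ℤ.- x))

  euclid : ∀ i j → + p ℤ∣.∣ i ℤ.* j → (+ p ℤ∣.∣ i) ⊎ (+ p ℤ∣.∣ j)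
  euclid i j h with euclidsLemma ℤ.∣ i ∣ ℤ.∣ j ∣ p-prime (subst (p ∣_) (ℤ.abs-* i j) (ℤ∣.∣⇒∣ᵤ h))
  ... | inj₁ l = inj₁ (ℤ∣.∣ᵤ⇒∣ l)
  ... | inj₂ r = inj₂ (ℤ∣.∣ᵤ⇒∣ r)

  -- At a root c, F(x) - F(c) = (x - c) Q(x) makes every root incongruent to c a root of `Q`, whose
  -- degree is one less.
  roots≤degree : ∀ n {F} xs → MonicDeg n F → AllPairs Incongruent xs → All (λ x → + p ℤ∣.∣ F x) xs → length xs ℕ.≤ n
  roots≤degree n [] h _ _ = z≤n
  roots≤degree zero (c ∷ xs) h _ (r ∷ _) = ⊥-elim (ℕ.<⇒≢ 1<p (sym (∣1⇒≡1 (ℤ∣.∣⇒∣ᵤ (subst (+ p ℤ∣.∣_) (h c) r)))))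
  roots≤degree (suc n) {F} (c ∷ xs) h (i ∷ is) (r ∷ rs) = s≤s (roots≤degree n xs (proj₁ (proj₂ (h c))) is (All.map root (All.zip (i , rs))))
    where
    root : ∀ {x} → Incongruent c x × (+ p ℤ∣.∣ F x) → + p ℤ∣.∣ proj₁ (h c) x
    root {x} (inc , rx) with euclid (x ℤ.- c) (proj₁ (h c) x) (subst (+ p ℤ∣.∣_) (proj₂ (proj₂ (h c)) x) (ℤ∣.∣m∣n⇒∣m-n rx r))
    ... | inj₁ l = ⊥-elim (inc l)
    ... | inj₂ q = q

  private
    -- The p - 1 units are incongruent roots of x^(a + 1) - 1.
    all-roots : ∀ a → (∀ y → 1 ℕ.≤ y → y ℕ.< p → y ℕ.^ suc a ≈ 1) → ℕ.pred p ℕ.≤ suc a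
    all-roots a h = subst (ℕ._≤ suc a) (length-applyUpTo (λ i → + suc i) (ℕ.pred p)) (roots≤degree (suc a) (applyUpTo (λ i → + suc i) (ℕ.pred p)) (monic-x* a (ℤ.- + 1) (monic-pow a))
      (AllPairs.applyUpTo⁺₁ (λ i → + suc i) (ℕ.pred p) inc) (All.applyUpTo⁺₁ {P = λ x → + p ℤ∣.∣ (x ℤ.* pow a x ℤ.+ (ℤ.- + 1))} (λ i → + suc i) (ℕ.pred p) root))
      where
      root : ∀ {i} → i ℕ.< ℕ.pred p → + p ℤ∣.∣ (+ suc i ℤ.* pow a (+ suc i) ℤ.+ (ℤ.- + 1))
      root {i} i< = subst (λ w → + p ℤ∣.∣ (w ℤ.+ (ℤ.- + 1))) (trans (ℤ.pos-* (suc i) (suc i ℕ.^ a)) (cong (λ w → + suc i ℤ.* w) (sym (pow-+ a (suc i))))) (%≡⇒∣ (suc i ℕ.^ suc a) 1 (h (suc i) (s≤s z≤n) (subst (suc i ℕ.<_) (ℕ.suc-pred p) (s≤s i<))))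
      inc : ∀ {i j} → i ℕ.< j → j ℕ.< ℕ.pred p → Incongruent (+ suc i) (+ suc j)
      inc {i} {j} i<j j< h = ℕ.<⇒≱ (ℕ.≤-<-trans (ℕ.m∸n≤m j i) (ℕ.<-≤-trans j< (ℕ.pred[n]≤n {p}))) (∣⇒≤ {{ℕ.>-nonZero (ℕ.m<n⇒0<n∸m i<j)}} (subst (p ∣_) eq (ℤ∣.∣⇒∣ᵤ h)))
        where
        eq : ℤ.∣ + suc j ℤ.- + suc i ∣ ≡ j ℕ.∸ i
        eq = cong ℤ.∣_∣ (trans (ℤ.m-n≡m⊖n (suc j) (suc i)) (ℤ.⊖-≥ (s≤s (ℕ.<⇒≤ i<j))))

    abstract
      progress : ∀ x a → HasOrder x a → (Σ ℕ λ x′ → Σ ℕ λ a′ → a ℕ.< a′ × HasOrder x′ a′) ⊎ (a ≡ ℕ.pred p)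
      progress x zero (() , _)
      progress x (suc a) o with ℕ.anyUpTo? (λ y → (1 ℕ.≤? y) ×-dec ¬? (y ℕ.^ suc a ≈? 1)) p
      ... | yes (y , y<p , 1≤y , y≉) = inj₁ (improve {x} {suc a} {y} o (unit 1≤y y<p) y≉)
      ... | no none = inj₂ (ℕ.≤-antisym (order≤ {x} {suc a} o) (all-roots a all))
        where
        all : ∀ y → 1 ℕ.≤ y → y ℕ.< p → y ℕ.^ suc a ≈ 1
        all y 1≤y y<p with y ℕ.^ suc a ≈? 1
        ... | yes h = h
        ... | no h = ⊥-elim (none (y , y<p , 1≤y , h))

    climb : ∀ fuel x a → HasOrder x a → ℕ.pred p ℕ.≤ a ℕ.+ fuel → Σ ℕ λ x → HasOrder x (ℕ.pred p)
    climb fuel x a o le with progress x a o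
    ... | inj₂ refl = x , o
    climb zero x a o le | inj₁ (x′ , a′ , a< , o′) = ⊥-elim (ℕ.<⇒≱ a< (ℕ.≤-trans (order≤ {x′} {a′} o′) (ℕ.≤-trans le (ℕ.≤-reflexive (ℕ.+-identityʳ a)))))
    climb (suc fuel) x a o le | inj₁ (x′ , a′ , a< , o′) = climb fuel x′ a′ o′ (ℕ.≤-trans le (ℕ.≤-trans (ℕ.≤-reflexive (ℕ.+-suc a fuel)) (ℕ.+-monoˡ-≤ fuel a<)))

  abstract
    primitive-root : Σ ℕ λ x → HasOrder x (ℕ.pred p)
    primitive-root = climb (ℕ.pred p) 1 1 (ℕ.≤-refl , refl , λ k _ → divides k (sym (ℕ.*-identityʳ k))) (ℕ.n≤1+n (ℕ.pred p))

-- Ruzsa's construction.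

module Ruzsa (g u p : ℕ) (p≡ : p ≡ suc (g ℕ.* suc u)) {{p≢0 : NonZero p}} (p-prime : Prime p) where
  open import Data.Fin using (Fin; zero; suc; toℕ; fromℕ<)
  open import Data.Fin.Properties using (toℕ-fromℕ<; injective⇒≤)
  open import Data.Integer as ℤ using (ℤ; +_)
  open import Data.Integer.Divisibility.Signed using (∣m∣n⇒∣m+n; ∣m∣n⇒∣m-n) renaming (_∣_ to _ℤ∣_)
  import Data.Integer.Properties as ℤ
  open import Data.Integer.Tactic.RingSolver using (solve-∀)
  import Data.Nat.Tactic.RingSolver as ℕSolver
  open import Data.List using (List; _∷_; lookup; filter; cartesianProduct; applyUpTo)
  open import Data.List.Membership.Propositional using (_∈_)
  open import Data.List.Membership.Propositional.Properties using (∈-lookup; ∈-filter⁻; ∈-cartesianProduct⁻; ∈-applyUpTo⁻)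
  open import Data.List.Relation.Unary.All as All using (All; _∷_)
  import Data.List.Relation.Unary.All.Properties as All
  open import Data.List.Relation.Unary.AllPairs using (_∷_)
  open import Data.List.Relation.Unary.Unique.Propositional using (Unique)
  import Data.List.Relation.Unary.Unique.Propositional.Properties as Unique
  open import Data.List.Properties using (length-applyUpTo)
  open import Data.Nat.DivMod using (_%_; _/_; m≡m%n+[m/n]*n; m%n<n; m<n⇒m%n≡m; [m+kn]%n≡m%n; m<n*o⇒m/o<n)
  open import Data.Nat.Coprimality using (Coprime)
  open import Data.Nat.Divisibility using (∣⇒≤)
  open import Defs
  open Residues p hiding (e)
  open PrimitiveRoot p p-prime

  Unique-lookup : ∀ {A : Set} {xs : List A} → Unique xs → ∀ i j → lookup xs i ≡ lookup xs j → i ≡ j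
  Unique-lookup (_ ∷ _) zero zero _ = refl
  Unique-lookup (x∉ ∷ _) zero (suc j) e = ⊥-elim (All.lookup x∉ (∈-lookup j) e)
  Unique-lookup (x∉ ∷ _) (suc i) zero e = ⊥-elim (All.lookup x∉ (∈-lookup i) (sym e))
  Unique-lookup (_ ∷ us) (suc i) (suc j) e = cong suc (Unique-lookup us i j e)

  -- This bounds the number of representations of a difference: each receives a label in `Fin g`
  -- that determines it.
  length≤keys : ∀ {A : Set} {P : A → Set} {k} {xs : List A} → Unique xs → (∀ {x} → x ∈ xs → P x) → (key : ∀ x → P x → Fin k) → (∀ {x y} px py → key x px ≡ key y py → x ≡ y) → length xs ℕ.≤ k
  length≤keys {xs = xs} us P key inj = injective⇒≤ {f = λ i → key (lookup xs i) (P (∈-lookup i))} (λ {i} {j} e → Unique-lookup us i j (inj (P (∈-lookup i)) (P (∈-lookup j)) e))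

  v n γ : ℕ
  v = suc u
  n = g ℕ.* v
  γ = proj₁ primitive-root

  private
    pred-p : ℕ.pred p ≡ n
    pred-p = cong ℕ.pred p≡

    γ-order : HasOrder γ n
    γ-order = subst (HasOrder γ) pred-p (proj₂ primitive-root)

    γⁿ≈1 : γ ℕ.^ n ≈ 1
    γⁿ≈1 = proj₁ (proj₂ γ-order)

    instance
      n≢0 : NonZero n
      n≢0 = ℕ.>-nonZero (proj₁ γ-order)

    γ-cop : Coprime γ p
    γ-cop = cop-*⁻ˡ (γ ℕ.^ ℕ.pred n) (≈-cop {1} {γ ℕ.^ suc (ℕ.pred n)} (sym (trans (≡⇒≈ (cong (γ ℕ.^_) (ℕ.suc-pred n))) γⁿ≈1)) cop-1)

    γ-small : ∀ s → s ℕ.< n → γ ℕ.^ s ≈ 1 → s ≡ 0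
    γ-small zero _ _ = refl
    γ-small (suc s) s<n h = ⊥-elim (ℕ.<⇒≱ s<n (∣⇒≤ (proj₂ (proj₂ γ-order) (suc s) h)))

    γ-injective≤ : ∀ {i j} → i ℕ.≤ j → j ℕ.< n → γ ℕ.^ i ≈ γ ℕ.^ j → i ≡ j
    γ-injective≤ {i} {j} i≤j j<n h = ℕ.≤-antisym i≤j (ℕ.m∸n≡0⇒m≤n (γ-small (j ℕ.∸ i) (ℕ.≤-<-trans (ℕ.m∸n≤m j i) j<n) (sym (*-cancel≈ {γ ℕ.^ i} {1} {γ ℕ.^ (j ℕ.∸ i)} (^-cop i γ-cop)
      (trans (≡⇒≈ (ℕ.*-identityʳ (γ ℕ.^ i))) (trans h (≡⇒≈ (trans (cong (γ ℕ.^_) (sym (ℕ.m+[n∸m]≡n i≤j))) (ℕ.^-distribˡ-+-* γ i (j ℕ.∸ i))))))))))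

    γ-injective : ∀ {i j} → i ℕ.< n → j ℕ.< n → γ ℕ.^ i ≈ γ ℕ.^ j → i ≡ j
    γ-injective {i} {j} i<n j<n h with ℕ.≤-total i j
    ... | inj₁ i≤j = γ-injective≤ i≤j j<n h
    ... | inj₂ j≤i = sym (γ-injective≤ j≤i i<n (sym h))

  -- z i is the residue mod pv with z i ≡ γ^i (mod p) and z i ≡ i (mod v).
  c t z : ℕ → ℕ
  c i = γ ℕ.^ i % p
  t i = (i ℕ.+ u ℕ.* c i) % v
  z i = c i ℕ.+ t i ℕ.* p

  z≈γ^ : ∀ i → z i ≈ γ ℕ.^ i
  z≈γ^ i = trans ([m+kn]%n≡m%n (c i) (t i) p) (m<n⇒m%n≡m (m%n<n (γ ℕ.^ i) p))

  -- p ≡ 1 and u ≡ - 1 (mod v), so `t i` ≡ i - c i is the correction that `c i` needs modulo v.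
  z%v : ∀ i → z i % v ≡ i % v
  z%v i = trans (sym ([m+kn]%n≡m%n (z i) q v)) (trans (cong (_% v) e) ([m+kn]%n≡m%n i (c i ℕ.+ g ℕ.* t i) v))
    where
    q = (i ℕ.+ u ℕ.* c i) / v
    lem : ∀ c t g u q → c ℕ.+ t ℕ.* suc (g ℕ.* suc u) ℕ.+ q ℕ.* suc u ≡ (t ℕ.+ q ℕ.* suc u) ℕ.+ (c ℕ.+ t ℕ.* g ℕ.* suc u)
    lem = ℕSolver.solve-∀
    lem′ : ∀ c t g u i → i ℕ.+ u ℕ.* c ℕ.+ (c ℕ.+ t ℕ.* g ℕ.* suc u) ≡ i ℕ.+ (c ℕ.+ g ℕ.* t) ℕ.* suc u
    lem′ = ℕSolver.solve-∀
    e : z i ℕ.+ q ℕ.* v ≡ i ℕ.+ (c i ℕ.+ g ℕ.* t i) ℕ.* v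
    e = trans (cong (λ w → c i ℕ.+ t i ℕ.* w ℕ.+ q ℕ.* v) p≡) (trans (lem (c i) (t i) g u q) (trans (cong (ℕ._+ (c i ℕ.+ t i ℕ.* g ℕ.* v)) (sym (m≡m%n+[m/n]*n (i ℕ.+ u ℕ.* c i) v))) (lem′ (c i) (t i) g u i)))

  z≥1 : ∀ i → 1 ℕ.≤ z i
  z≥1 i = ℕ.≤-trans (ℕ.>-nonZero⁻¹ (c i) {{cop-%≢0 (^-cop i γ-cop)}}) (ℕ.m≤m+n (c i) _)

  z≤pv : ∀ i → z i ℕ.≤ v ℕ.* p
  z≤pv i = ℕ.≤-trans (ℕ.+-monoˡ-≤ (t i ℕ.* p) (ℕ.<⇒≤ (m%n<n (γ ℕ.^ i) p))) (ℕ.*-monoˡ-≤ p (m%n<n (i ℕ.+ u ℕ.* c i) v))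

  z-injective : ∀ {i j} → i ℕ.< n → j ℕ.< n → z i ≡ z j → i ≡ j
  z-injective {i} {j} i<n j<n h = γ-injective i<n j<n (trans (sym (z≈γ^ i)) (trans (≡⇒≈ h) (z≈γ^ j)))

  -- s i j is the residue of i - j mod n.
  s : ℕ → ℕ → ℕ
  s i j = (i ℕ.+ (n ℕ.∸ j)) % n

  private
    s-eq : ∀ i j → j ℕ.< n → i ℕ.+ n ≡ s i j ℕ.+ j ℕ.+ (i ℕ.+ (n ℕ.∸ j)) / n ℕ.* n
    s-eq i j j<n = trans (cong (i ℕ.+_) (sym (ℕ.m∸n+n≡m (ℕ.<⇒≤ j<n)))) (trans (sym (ℕ.+-assoc i (n ℕ.∸ j) j)) (trans (cong (ℕ._+ j) (m≡m%n+[m/n]*n (i ℕ.+ (n ℕ.∸ j)) n)) (lem (s i j) ((i ℕ.+ (n ℕ.∸ j)) / n ℕ.* n) j)))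
      where
      lem : ∀ a b c → a ℕ.+ b ℕ.+ c ≡ a ℕ.+ c ℕ.+ b
      lem = ℕSolver.solve-∀

    γ-s : ∀ i j → j ℕ.< n → γ ℕ.^ i ≈ γ ℕ.^ s i j ℕ.* γ ℕ.^ j
    γ-s i j j<n = trans (sym (drop i 1)) (trans (≡⇒≈ (cong (γ ℕ.^_) (trans (cong (i ℕ.+_) (ℕ.*-identityˡ n)) (s-eq i j j<n)))) (trans (drop (s i j ℕ.+ j) ((i ℕ.+ (n ℕ.∸ j)) / n)) (≡⇒≈ (ℕ.^-distribˡ-+-* γ (s i j) j))))
      where
      drop : ∀ a k → γ ℕ.^ (a ℕ.+ k ℕ.* n) ≈ γ ℕ.^ a
      drop a k = trans (≡⇒≈ (trans (ℕ.^-distribˡ-+-* γ a (k ℕ.* n)) (cong (γ ℕ.^ a ℕ.*_) (trans (cong (γ ℕ.^_) (ℕ.*-comm k n)) (sym (ℕ.^-*-assoc γ n k)))))) (trans (*-cong≈ {γ ℕ.^ a} {γ ℕ.^ a} {(γ ℕ.^ n) ℕ.^ k} {1} refl (^-1≈ {γ ℕ.^ n} k γⁿ≈1)) (≡⇒≈ (ℕ.*-identityʳ (γ ℕ.^ a))))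

    s%v : ∀ i j → j ℕ.< n → (s i j ℕ.+ j) % v ≡ i % v
    s%v i j j<n = sym (trans (sym ([m+kn]%n≡m%n i g v)) (trans (cong (_% v) (s-eq i j j<n)) (trans (cong (λ w → (s i j ℕ.+ j ℕ.+ w) % v) (sym (ℕ.*-assoc ((i ℕ.+ (n ℕ.∸ j)) / n) g v))) ([m+kn]%n≡m%n (s i j ℕ.+ j) ((i ℕ.+ (n ℕ.∸ j)) / n ℕ.* g) v))))

    s<n : ∀ i j → s i j ℕ.< n
    s<n i j = m%n<n (i ℕ.+ (n ℕ.∸ j)) n

    open Congruence v renaming (%≡⇒∣ to v⇒; ∣-⇒%≡ to v⇐)
    open Congruence p renaming (%≡⇒∣ to p⇒; ∣-⇒%≡ to p⇐)

    -- Modulo v, both i - j and i′ - j′ are the common difference of the `z`; thus the two values of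
    -- `s` have equal residues and, by assumption, equal quotients.
    same-s : ∀ {i j i′ j′} → j ℕ.< n → j′ ℕ.< n → + z i ℤ.- + z j ≡ + z i′ ℤ.- + z j′ → s i j / v ≡ s i′ j′ / v → s i j ≡ s i′ j′
    same-s {i} {j} {i′} {j′} j<n j′<n h eq = trans (m≡m%n+[m/n]*n (s i j) v) (trans (cong₂ (λ a b → a ℕ.+ b ℕ.* v) (v⇐ (s i j) (s i′ j′) d) eq) (sym (m≡m%n+[m/n]*n (s i′ j′) v)))
      where
      lem : ∀ s j i zi zj s′ j′ i′ zi′ zj′ → zi ℤ.- zj ≡ zi′ ℤ.- zj′ →
        ((s ℤ.+ j) ℤ.- i) ℤ.- ((s′ ℤ.+ j′) ℤ.- i′) ℤ.- ((zi ℤ.- i) ℤ.- (zj ℤ.- j)) ℤ.+ ((zi′ ℤ.- i′) ℤ.- (zj′ ℤ.- j′)) ≡ s ℤ.- s′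
      lem s j i zi zj s′ j′ i′ zi′ zj′ h = trans (l1 s j i zi zj s′ j′ i′ zi′ zj′) (trans (cong (λ w → s ℤ.- s′ ℤ.- w ℤ.+ (zi′ ℤ.- zj′)) h) (l2 (s ℤ.- s′) (zi′ ℤ.- zj′)))
        where
        l1 : ∀ s j i zi zj s′ j′ i′ zi′ zj′ → ((s ℤ.+ j) ℤ.- i) ℤ.- ((s′ ℤ.+ j′) ℤ.- i′) ℤ.- ((zi ℤ.- i) ℤ.- (zj ℤ.- j)) ℤ.+ ((zi′ ℤ.- i′) ℤ.- (zj′ ℤ.- j′)) ≡ s ℤ.- s′ ℤ.- (zi ℤ.- zj) ℤ.+ (zi′ ℤ.- zj′)
        l1 = solve-∀
        l2 : ∀ a b → a ℤ.- b ℤ.+ b ≡ a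
        l2 = solve-∀
      fact : ∀ i j → j ℕ.< n → + v ℤ∣ ((+ s i j ℤ.+ + j) ℤ.- + i)
      fact i j j<n = subst (λ w → + v ℤ∣ (w ℤ.- + i)) (ℤ.pos-+ (s i j) j) (v⇒ (s i j ℕ.+ j) i (s%v i j j<n))
      zfact : ∀ i → + v ℤ∣ (+ z i ℤ.- + i)
      zfact i = v⇒ (z i) i (z%v i)
      d : + v ℤ∣ (+ s i j ℤ.- + s i′ j′)
      d = subst (+ v ℤ∣_) (lem (+ s i j) (+ j) (+ i) (+ z i) (+ z j) (+ s i′ j′) (+ j′) (+ i′) (+ z i′) (+ z j′) h)
        (∣m∣n⇒∣m+n (∣m∣n⇒∣m-n (∣m∣n⇒∣m-n (fact i j j<n) (fact i′ j′ j′<n)) (∣m∣n⇒∣m-n (zfact i) (zfact j))) (∣m∣n⇒∣m-n (zfact i′) (zfact j′)))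

    -- With γ^i = γ^s γ^j and γ^i′ = γ^s γ^j′, equal differences give (γ^s - 1)(γ^j - γ^j′) ≡ 0 (mod p).
    coincide : ∀ {i j i′ j′} → i ℕ.< n → j ℕ.< n → i′ ℕ.< n → j′ ℕ.< n → ¬ (i ≡ j) → + z i ℤ.- + z j ≡ + z i′ ℤ.- + z j′ → s i j ≡ s i′ j′ → i ≡ i′ × j ≡ j′
    coincide {i} {j} {i′} {j′} i<n j<n i′<n j′<n i≢j h eq = go (euclid (+ S ℤ.- + 1) (+ J ℤ.- + J′) prod)
      where
      S I J I′ J′ : ℕ
      S = γ ℕ.^ s i j
      I = γ ℕ.^ i
      J = γ ℕ.^ j
      I′ = γ ℕ.^ i′
      J′ = γ ℕ.^ j′
      fact : + p ℤ∣ (+ I ℤ.- + S ℤ.* + J)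
      fact = subst (λ w → + p ℤ∣ (+ I ℤ.- w)) (ℤ.pos-* S J) (p⇒ I (S ℕ.* J) (γ-s i j j<n))
      fact′ : + p ℤ∣ (+ I′ ℤ.- + S ℤ.* + J′)
      fact′ = subst (λ w → + p ℤ∣ (+ I′ ℤ.- w)) (trans (cong (λ w → + (γ ℕ.^ w ℕ.* J′)) (sym eq)) (ℤ.pos-* S J′)) (p⇒ I′ (γ ℕ.^ s i′ j′ ℕ.* J′) (γ-s i′ j′ j′<n))
      zfact : ∀ i → + p ℤ∣ (+ z i ℤ.- + (γ ℕ.^ i))
      zfact i = p⇒ (z i) (γ ℕ.^ i) (z≈γ^ i)
      lem : ∀ S I J I′ J′ zi zj zi′ zj′ → zi ℤ.- zj ≡ zi′ ℤ.- zj′ →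
        (((I′ ℤ.- S ℤ.* J′) ℤ.- (I ℤ.- S ℤ.* J)) ℤ.+ ((zi′ ℤ.- I′) ℤ.- (zj′ ℤ.- J′))) ℤ.- ((zi ℤ.- I) ℤ.- (zj ℤ.- J)) ≡ (S ℤ.- + 1) ℤ.* (J ℤ.- J′)
      lem S I J I′ J′ zi zj zi′ zj′ h = trans (l1 S I J I′ J′ zi zj zi′ zj′) (trans (cong (λ w → (S ℤ.- + 1) ℤ.* (J ℤ.- J′) ℤ.+ (zi′ ℤ.- zj′) ℤ.- w) h) (l2 ((S ℤ.- + 1) ℤ.* (J ℤ.- J′)) (zi′ ℤ.- zj′)))
        where
        l1 : ∀ S I J I′ J′ zi zj zi′ zj′ → (((I′ ℤ.- S ℤ.* J′) ℤ.- (I ℤ.- S ℤ.* J)) ℤ.+ ((zi′ ℤ.- I′) ℤ.- (zj′ ℤ.- J′))) ℤ.- ((zi ℤ.- I) ℤ.- (zj ℤ.- J)) ≡ (S ℤ.- + 1) ℤ.* (J ℤ.- J′) ℤ.+ (zi′ ℤ.- zj′) ℤ.- (zi ℤ.- zj)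
        l1 = solve-∀
        l2 : ∀ a b → a ℤ.+ b ℤ.- b ≡ a
        l2 = solve-∀
      prod : + p ℤ∣ ((+ S ℤ.- + 1) ℤ.* (+ J ℤ.- + J′))
      prod = subst (+ p ℤ∣_) (lem (+ S) (+ I) (+ J) (+ I′) (+ J′) (+ z i) (+ z j) (+ z i′) (+ z j′) h)
        (∣m∣n⇒∣m-n (∣m∣n⇒∣m+n (∣m∣n⇒∣m-n fact′ fact) (∣m∣n⇒∣m-n (zfact i′) (zfact j′))) (∣m∣n⇒∣m-n (zfact i) (zfact j)))
      go : (+ p ℤ∣ (+ S ℤ.- + 1)) ⊎ (+ p ℤ∣ (+ J ℤ.- + J′)) → i ≡ i′ × j ≡ j′
      go (inj₁ S≡1) = ⊥-elim (i≢j (γ-injective i<n j<n (trans (γ-s i j j<n) (trans (*-cong≈ {S} {1} {J} {J} (p⇐ S 1 S≡1) refl) (≡⇒≈ (ℕ.*-identityˡ J))))))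
      go (inj₂ J≡J′) = γ-injective i<n i′<n (trans (γ-s i j j<n) (trans (≡⇒≈ (cong₂ (λ a b → γ ℕ.^ a ℕ.* γ ℕ.^ b) eq j≡j′)) (sym (γ-s i′ j′ j′<n)))) , j≡j′
        where
        j≡j′ : j ≡ j′
        j≡j′ = γ-injective j<n j′<n (p⇐ J J′ J≡J′)

  ruzsa-set : List ℕ
  ruzsa-set = applyUpTo z n

  private
    ruzsa-unique : Unique ruzsa-set
    ruzsa-unique = Unique.applyUpTo⁺₁ z n (λ i<j j<n e → ℕ.<⇒≢ i<j (z-injective (ℕ.<-trans i<j j<n) j<n e))

    Represents : ℤ → ℕ × ℕ → Set
    Represents d (a , b) = Σ ℕ λ i → Σ ℕ λ j → i ℕ.< n × j ℕ.< n × a ≡ z i × b ≡ z j × d ≡ + a ℤ.- + b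

    represents : ∀ d {x} → x ∈ filter (λ x → d ℤ.≟ (+ proj₁ x ℤ.- + proj₂ x)) (cartesianProduct ruzsa-set ruzsa-set) → Represents d x
    represents d x∈ with ∈-filter⁻ (λ x → d ℤ.≟ (+ proj₁ x ℤ.- + proj₂ x)) {xs = cartesianProduct ruzsa-set ruzsa-set} x∈
    ... | x∈′ , d≡ with ∈-cartesianProduct⁻ ruzsa-set ruzsa-set x∈′
    ... | a∈ , b∈ with ∈-applyUpTo⁻ z a∈ | ∈-applyUpTo⁻ z b∈
    ... | i , i<n , a≡ | j , j<n , b≡ = i , j , i<n , j<n , a≡ , b≡ , d≡

    key : ∀ d x → Represents d x → Fin g
    key d x (i , j , _) = fromℕ< (m<n*o⇒m/o<n {s i j} {g} {v} (s<n i j))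

    key-injective : ∀ {d} → ¬ (d ≡ + 0) → ∀ {x y} (px : Represents d x) (py : Represents d y) → key d x px ≡ key d y py → x ≡ y
    key-injective {d} d≢0 (i , j , i<n , j<n , refl , refl , d≡) (i′ , j′ , i′<n , j′<n , refl , refl , d≡′) e = cong₂ (λ a b → z a , z b) (proj₁ both) (proj₂ both)
      where
      h = trans (sym d≡) d≡′
      both : i ≡ i′ × j ≡ j′
      both = coincide i<n j<n i′<n j′<n (λ { refl → d≢0 (trans d≡ (ℤ.+-inverseʳ (+ z i))) }) h
        (same-s {i} {j} {i′} {j′} j<n j′<n h (trans (sym (toℕ-fromℕ< (m<n*o⇒m/o<n {s i j} {g} {v} (s<n i j)))) (trans (cong toℕ e) (toℕ-fromℕ< (m<n*o⇒m/o<n {s i′ j′} {g} {v} (s<n i′ j′))))))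

  ruzsa-admissible : ∀ {N} → v ℕ.* p ℕ.≤ N → Admissible g N ruzsa-set
  ruzsa-admissible vp≤N = ruzsa-unique , All.applyUpTo⁺₁ z n (λ {i} _ → z≥1 i , ℕ.≤-trans (z≤pv i) vp≤N) , λ d d≢0 → length≤keys {P = Represents d} (Unique.filter⁺ (λ x → d ℤ.≟ (+ proj₁ x ℤ.- + proj₂ x)) (Unique.cartesianProduct⁺ ruzsa-unique ruzsa-unique)) (represents d) (key d) (key-injective d≢0)

  ruzsa-length : length ruzsa-set ≡ n
  ruzsa-length = length-applyUpTo z n

-- The lower bound from primes in windows.

module LowerBound where
  open import Data.Integer as ℤ using (ℤ; +_)
  import Data.Integer.Properties as ℤ
  open import Data.Integer.Divisibility.Signed using (∣⇒∣ᵤ)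
  open import Data.Nat.Divisibility using (_∣_; divides)
  open import Data.Nat.DivMod using (_%_)
  open import Data.Nat.Primality using (prime⇒nonZero)
  open import Data.Nat.Tactic.RingSolver using (solve-∀)
  open import Defs
  open Factors using (prime>1)

  sq-mono : ∀ {a b} → a ℕ.≤ b → a ℕ.* a ℕ.≤ b ℕ.* b
  sq-mono a≤b = ℕ.*-mono-≤ a≤b a≤b

  floor-sqrt : ∀ Q .{{_ : NonZero Q}} M → Σ ℕ λ h → Q ℕ.* h ℕ.* (Q ℕ.* h) ℕ.≤ M × M ℕ.< Q ℕ.* suc h ℕ.* (Q ℕ.* suc h)
  floor-sqrt Q zero = 0 , ℕ.≤-reflexive (cong (λ w → w ℕ.* w) (ℕ.*-zeroʳ Q)) , ℕ.*-mono-≤ Q1≥1 Q1≥1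
    where
    Q1≥1 : 1 ℕ.≤ Q ℕ.* 1
    Q1≥1 = ℕ.*-mono-≤ (ℕ.>-nonZero⁻¹ Q) (ℕ.≤-refl {1})
  floor-sqrt Q (suc M) with floor-sqrt Q M
  ... | h , lo , hi with Q ℕ.* suc h ℕ.* (Q ℕ.* suc h) ℕ.≤? suc M
  ...   | yes p = suc h , p , ℕ.≤-<-trans hi (ℕ.*-mono-< lt lt)
    where
    lt : Q ℕ.* suc h ℕ.< Q ℕ.* suc (suc h)
    lt = ℕ.*-monoʳ-< Q (ℕ.n<1+n (suc h))
  ...   | no ¬p = h , ℕ.≤-trans lo (ℕ.n≤1+n M) , ℕ.≰⇒> ¬p

  ≡1-mod : ∀ g .{{_ : NonZero g}} {p} → Prime p → p % g ≡ 1 % g → Σ ℕ λ u → p ≡ suc (g ℕ.* suc u)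
  ≡1-mod g@(suc _) {p} pr h = go (subst (g ∣_) eq (∣⇒∣ᵤ (Congruence.%≡⇒∣ g p 1 h)))
    where
    eq : ℤ.∣ + p ℤ.- + 1 ∣ ≡ p ℕ.∸ 1
    eq = cong ℤ.∣_∣ (trans (ℤ.m-n≡m⊖n p 1) (ℤ.⊖-≥ (ℕ.<⇒≤ (prime>1 pr))))
    go : g ∣ (p ℕ.∸ 1) → Σ ℕ λ u → p ≡ suc (g ℕ.* suc u)
    go (divides zero e) = ⊥-elim (ℕ.<⇒≢ (ℕ.m<n⇒0<n∸m (prime>1 pr)) (sym e))
    go (divides (suc u) e) = u , trans (sym (ℕ.m+[n∸m]≡n (ℕ.<⇒≤ (prime>1 pr)))) (cong suc (trans e (ℕ.*-comm (suc u) g)))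

  -- p² ≤ g n and p - 1 = g v give v p ≤ n, so the construction fits into [n]; it has p - 1
  -- elements.
  prime-set : ∀ g .{{_ : NonZero g}} {p n m} → Prime p → p % g ≡ 1 % g → p ℕ.* p ℕ.≤ g ℕ.* n → (∀ A → Admissible g n A → length A ℕ.≤ m) → p ℕ.≤ suc m
  prime-set g {p} {n} {m} pr h p²≤ max = subst (ℕ._≤ suc m) (sym p≡) (s≤s (subst (ℕ._≤ m) R.ruzsa-length (max R.ruzsa-set (R.ruzsa-admissible vp≤n))))
    where
    u = proj₁ (≡1-mod g pr h)
    p≡ = proj₂ (≡1-mod g pr h)
    module R = Ruzsa g u p p≡ {{prime⇒nonZero pr}} pr
    vp≤n : suc u ℕ.* p ℕ.≤ n
    vp≤n = ℕ.*-cancelˡ-≤ g (ℕ.≤-trans (ℕ.≤-reflexive (sym (ℕ.*-assoc g (suc u) p))) (ℕ.≤-trans (ℕ.*-monoˡ-≤ p (ℕ.≤-trans (ℕ.n≤1+n _) (ℕ.≤-reflexive (sym p≡)))) p²≤))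

  module _ (g k : ℕ) .{{_ : NonZero g}} where
    private
      q Q : ℕ
      q = 2 ℕ.* suc k
      Q = suc q

      2≤q : 2 ℕ.≤ q
      2≤q = ℕ.*-monoʳ-≤ 2 (s≤s (z≤n {k}))

      abstract
        windows : Σ ℕ λ h₀ → ∀ h → h₀ ℕ.≤ h → Σ ℕ λ p → Prime p × p % g ≡ 1 % g × q ℕ.* h ℕ.< p × p ℕ.≤ q ℕ.* h ℕ.+ h
        windows = PrimesAP.primes-in-windows g {{ℕ.≢-nonZero (ℕ.≢-nonZero⁻¹ g)}} q 2≤q

      H : ℕ
      H = proj₁ windows ℕ.+ 2 ℕ.* k

      -- k Q = 2 k² + 3 k falls short of (k + 1) q = 2 k² + 4 k + 2 by k + 2, and for h ≥ 2 k the
      -- gain (k + 2) h covers the step from h to h + 1.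
      margin : ∀ h → 2 ℕ.* k ℕ.≤ h → k ℕ.* (Q ℕ.* suc h) ℕ.≤ suc k ℕ.* (q ℕ.* h)
      margin h 2k≤h with ℕ.m≤n⇒∃[o]m+o≡n 2k≤h
      ... | o , refl = ℕ.≤-trans (ℕ.m≤m+n _ (k ℕ.+ (k ℕ.+ 2) ℕ.* o)) (ℕ.≤-reflexive (lem k o))
        where
        lem : ∀ k o → k ℕ.* (suc (2 ℕ.* suc k) ℕ.* suc (2 ℕ.* k ℕ.+ o)) ℕ.+ (k ℕ.+ (k ℕ.+ 2) ℕ.* o) ≡ suc k ℕ.* (2 ℕ.* suc k ℕ.* (2 ℕ.* k ℕ.+ o))
        lem = solve-∀

      N₀ : ℕ
      N₀ = Q ℕ.* H ℕ.* (Q ℕ.* H)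

      -- With Q h ≤ √(g n) < Q (h + 1), a prime in (q h, Q h] gives m ≥ p - 1 ≥ q h, and q / Q is
      -- close to 1.
      bound : ∀ n m → N₀ ℕ.≤ n → (∀ A → Admissible g n A → length A ℕ.≤ m) → k ℕ.* k ℕ.* (g ℕ.* n) ℕ.≤ suc k ℕ.* suc k ℕ.* (m ℕ.* m)
      bound n m n≥ max = ℕ.≤-trans (ℕ.*-monoʳ-≤ (k ℕ.* k) (ℕ.<⇒≤ hi)) (ℕ.≤-trans (ℕ.≤-reflexive (ℕ.[m*n]*[o*p]≡[m*o]*[n*p] k k (Q ℕ.* suc h) (Q ℕ.* suc h)))
          (ℕ.≤-trans (sq-mono (ℕ.≤-trans (margin h (ℕ.≤-trans (ℕ.m≤n+m _ (proj₁ windows)) H≤h)) (ℕ.*-monoʳ-≤ (suc k) qh≤m))) (ℕ.≤-reflexive (ℕ.[m*n]*[o*p]≡[m*o]*[n*p] (suc k) m (suc k) m))))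
        where
        root = floor-sqrt Q (g ℕ.* n)
        h = proj₁ root
        lo = proj₁ (proj₂ root)
        hi = proj₂ (proj₂ root)
        H≤h : H ℕ.≤ h
        H≤h = ℕ.≮⇒≥ λ h<H → ℕ.<⇒≱ hi (ℕ.≤-trans (sq-mono (ℕ.*-monoʳ-≤ Q h<H)) (ℕ.≤-trans n≥ (ℕ.m≤n*m n g)))
        win = proj₂ windows h (ℕ.≤-trans (ℕ.m≤m+n _ _) H≤h)
        p = proj₁ win
        p≤ : p ℕ.≤ Q ℕ.* h
        p≤ = ℕ.≤-trans (proj₂ (proj₂ (proj₂ (proj₂ win)))) (ℕ.≤-reflexive (ℕ.+-comm (q ℕ.* h) h))
        qh≤m : q ℕ.* h ℕ.≤ m
        qh≤m = ℕ.≤-pred (ℕ.≤-trans (proj₁ (proj₂ (proj₂ (proj₂ win)))) (prime-set g (proj₁ (proj₂ win)) (proj₁ (proj₂ (proj₂ win))) (ℕ.≤-trans (sq-mono p≤) lo) max))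

    lower-bound : Σ ℕ λ N → ∀ n m → N ℕ.≤ n → (∀ A → Admissible g n A → length A ℕ.≤ m) → k ℕ.* k ℕ.* (g ℕ.* n) ℕ.≤ suc k ℕ.* suc k ℕ.* (m ℕ.* m)
    lower-bound = N₀ , bound

-- Both bounds combined.

open import Defs
open import Data.Nat using (ℕ; suc; _≤_; _*_; _^_; NonZero)
open import Data.Product using (Σ; _×_)

-- For arbitrary k, the ratio m / √(g n) lies between k / (k + 1) and (k + 2) / (k + 1) once n is
-- large; squaring and clearing denominators states the limit within ℕ.
theorem3 : (g : ℕ) → .{{_ : NonZero g}} →
    (k : ℕ) → Σ ℕ (λ N → (n m : ℕ) → N ≤ n → IsAlpha g n m →
      (k ^ 2) * (g * n) ≤ (suc k ^ 2) * (m ^ 2)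
      × (suc k ^ 2) * (m ^ 2) ≤ (suc (suc k) ^ 2) * (g * n))
theorem3 g k = Nₗ ℕ.+ Nᵤ , λ n m N≤n α → lower n m N≤n α , upper n m N≤n α
  where
  open Field using (ι; ι-*; ι-cancel)

  abstract
    lo : Σ ℕ λ N → ∀ n m → N ≤ n → (∀ A → Admissible g n A → length A ≤ m) → k * k * (g * n) ≤ suc k * suc k * (m * m)
    lo = LowerBound.lower-bound g k

    hi : Σ ℕ λ N → ∀ n A → N ≤ n → Admissible g n A → suc k * suc k * (length A * length A) ≤ suc (suc k) * suc (suc k) * (g * n)
    hi = proj₁ (UpperBound.upper-bound g k) , λ n A N≤n adm → ι-cancel (subst₂ Field._≤_ (sym (cast (suc k) (suc k) (length A) (length A))) (sym (cast (suc (suc k)) (suc (suc k)) g n)) (proj₂ (UpperBound.upper-bound g k) n A N≤n adm))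
      where
      cast : ∀ a b c d → ι (a * b * (c * d)) ≡ ι a Field.* ι b Field.* (ι c Field.* ι d)
      cast a b c d = trans (ι-* (a * b) (c * d)) (cong₂ Field._*_ (ι-* a b) (ι-* c d))

  Nₗ Nᵤ : ℕ
  Nₗ = proj₁ lo
  Nᵤ = proj₁ hi

  square : ∀ a → a ^ 2 ≡ a * a
  square a = cong (a *_) (ℕ.*-identityʳ a)

  lower : ∀ n m → Nₗ ℕ.+ Nᵤ ≤ n → IsAlpha g n m → (k ^ 2) * (g * n) ≤ (suc k ^ 2) * (m ^ 2)
  lower n m N≤n (_ , max) = subst₂ _≤_ (cong (_* (g * n)) (sym (square k))) (sym (cong₂ _*_ (square (suc k)) (square m))) (proj₂ lo n m (ℕ.≤-trans (ℕ.m≤m+n Nₗ Nᵤ) N≤n) max)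

  upper : ∀ n m → Nₗ ℕ.+ Nᵤ ≤ n → IsAlpha g n m → (suc k ^ 2) * (m ^ 2) ≤ (suc (suc k) ^ 2) * (g * n)
  upper n _ N≤n ((A , adm , refl) , _) = subst₂ _≤_ (sym (cong₂ _*_ (square (suc k)) (square (length A)))) (cong (_* (g * n)) (sym (square (suc (suc k))))) (proj₂ hi n A (ℕ.≤-trans (ℕ.m≤n+m Nᵤ Nₗ) N≤n) adm)
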